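{- Let $p$ be a prime and $q=p^h$ with $h\in\mathbb{N}$. Let $f\in\mathbb{Z}_q[x_1,\dots,x_n]$ be a nonzero polynomial, let $m\in\mathbb{N}$, and let $V:=\{X\in T_q^n: f(X)\equiv0\pmod{p^m}\}$. Let $f=\sum_{i=0}^\infty p^if_i$ be the Teichm\"uller expansion of $f$ and let $d\in\mathbb{N}$. If $\deg(f_i)\leq dp^{h\lfloor i/h\rfloor}$ for all $i\in[0,m-1]$, then $$\mathrm{ord}_q(|V|)\geq\left\lceil\frac{n-\frac{p^m-1}{p-1}d}{p^{m-1}d}\right\rceil^*.$$
   Context: $\mathbb{N}$ = positive integers, $[a,b]=\{x\in\mathbb{Z}:a\le x\le b\}$, $\lfloor x\rfloor$ is the floor. $\mathbb{Z}_q$ is the ring of integers of the unramified extension of $\mathbb{Q}_p$ of degree $h$ (residue field $\mathbb{F}_q$). $T_q\subset\mathbb{Z}_q$ is the set of Teichm\"uller representatives of $\mathbb{F}_q$ (i.e. $0$ together with the $(q-1)$-th roots of unity), and $T_q^n$ is called the Teichm\"uller box. A polynomial in $\mathbb{Z}_q[x_1,\dots,x_n]$ is a Teichm\"uller polynomial if all its coefficients lie in $T_q$; every $f$ has a unique Teichm\"uller expansion $f=\sum_{i\ge0}p^if_i$ with each $f_i$ a Teichm\"uller polynomial (obtained by expanding each coefficient as $\sum_i a_ip^i$, $a_i\in T_q$). $\deg$ is total degree. $\mathrm{ord}_q$ is the $q$-adic valuation normalized by $\mathrm{ord}_q(q)=1$. For $t\in\mathbb{R}$, $\lceil t\rceil^*$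 is the least nonnegative integer $\geq t$. -}

module Defs where

open import Data.Nat using (ℕ; zero; suc; _+_; _*_; _∸_; _^_; _≤_; _<_; _≟_)
open import Data.Nat.DivMod using (_%_; _/_)
open import Data.Fin using (Fin; toℕ)
open import Data.Vec as V using (Vec; []; _∷_)
open import Data.Vec.Properties using (≡-dec)
open import Data.List as L using (List)
open import Data.List.Relation.Unary.All using (All)
open import Data.List.Relation.Unary.Any using (Any)
open import Data.List.Relation.Unary.Unique.Propositional using (Unique)
open import Data.Product using (Σ; _×_; _,_; proj₁; ∃)
open import Relation.Binary.PropositionalEquality using (_≡_; _≢_)

modN : ℕ → ℕ → ℕ
modN x zero    = x
modN x (suc k) = x % suc k

divN : ℕ → ℕ → ℕ
divN x zero    = 0
divN x (suc k) = x / suc k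

ceilDiv : ℕ → ℕ → ℕ
ceilDiv a b = divN (a + b ∸ 1) b

-- The ring (ℤ/Mℤ)[t]/(G), G = t^h + g_{h-1} t^{h-1} + … + g_0 monic.
-- Elements are coefficient vectors (c_0,…,c_{h-1}), kept canonical
-- (every entry < M) by the operations below.

Elt : ℕ → Set
Elt h = Vec ℕ h

module Ring (M : ℕ) {h : ℕ} (g : Vec ℕ h) where

  norm : Elt h → Elt h
  norm = V.map (λ x → modN x M)

  _⊕_ : Elt h → Elt h → Elt h
  a ⊕ b = norm (V.zipWith _+_ a b)

  scale : ℕ → Elt h → Elt h
  scale c a = norm (V.map (c *_) a)

  zeroE : Elt h
  zeroE = V.replicate h 0

  -- coefficients of -g (mod M): t^h ≡ Σ negg_j t^j
  negg : Elt h
  negg = V.map (λ x → M ∸ modN x M) g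

  private
    oneE′ : ∀ {k} → Elt k
    oneE′ {zero}  = []
    oneE′ {suc k} = modN 1 M ∷ V.replicate k 0

    mulT′ : ∀ {k} → Elt k → Elt k → Elt k
    mulT′ {zero}  ng v = []
    mulT′ {suc k} ng v =
      V.map (λ x → modN x M) (V.zipWith _+_ (0 ∷ V.init v) (V.map (V.last v *_) ng))

  oneE : Elt h
  oneE = oneE′

  mulT : Elt h → Elt h
  mulT = mulT′ negg

  tpow : ℕ → Elt h
  tpow zero    = oneE
  tpow (suc k) = mulT (tpow k)

  sumE : List (Elt h) → Elt h
  sumE = L.foldr _⊕_ zeroE

  _⊗_ : Elt h → Elt h → Elt h
  a ⊗ b = sumE (L.concatMap (λ i → L.map (λ j →
            scale (V.lookup a i * V.lookup b j) (tpow (toℕ i + toℕ j)))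
            (L.allFin h)) (L.allFin h))

  powE : Elt h → ℕ → Elt h
  powE a zero    = oneE
  powE a (suc k) = a ⊗ powE a k

  allVecs : (k : ℕ) → List (Vec ℕ k)
  allVecs zero    = [] L.∷ L.[]
  allVecs (suc k) = L.concatMap (λ c → L.map (c ∷_) (allVecs k)) (L.upTo M)

  allElts : List (Elt h)
  allElts = allVecs h

  Canonical : Elt h → Set
  Canonical a = V.All (_< M) a
    where import Data.Vec.Relation.Unary.All as V

  IsField : Set
  IsField = ∀ (a : Elt h) → Canonical a → a ≢ zeroE → ∃ λ b → a ⊗ b ≡ oneE

  IsTeich : ℕ → Elt h → Set
  IsTeich q x = Canonical x × powE x q ≡ x

  teichList : ℕ → List (Elt h)
  teichList q = L.filter (λ x → ≡-dec _≟_ (powE x q) x) allElts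

  box : ℕ → (n : ℕ) → List (Vec (Elt h) n)
  box q zero    = [] L.∷ L.[]
  box q (suc n) = L.concatMap (λ x → L.map (x ∷_) (box q n)) (teichList q)

-- Polynomials over ℤ_q in n variables, given by their Teichmüller digits.
-- A term (e , a) is the monomial x^e with coefficient Σ_{i≥0} p^i a(i),
-- a(i) ∈ T_q.  Teichmüller representatives are stored by their (injective)
-- image in ℤ_q / p^m ℤ_q ≅ (ℤ/p^mℤ)[t]/(G).

TPoly : ℕ → ℕ → Set
TPoly n h = List (Vec ℕ n × (ℕ → Elt h))

module Setup (p h m : ℕ) (g : Vec ℕ h) where
  q : ℕ
  q = p ^ h

  open Ring (p ^ m) g public

  WellFormed : ∀ {n} → TPoly n h → Set
  WellFormed f = Unique (L.map proj₁ f)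
               × All (λ t → ∀ i → IsTeich q (Data.Product.proj₂ t i)) f

  NonZeroPoly : ∀ {n} → TPoly n h → Set
  NonZeroPoly f = Any (λ t → ∃ λ i → Data.Product.proj₂ t i ≢ zeroE) f

  DegLe : ∀ {n} → TPoly n h → ℕ → ℕ → Set
  DegLe f i D = All (λ t → Data.Product.proj₂ t i ≢ zeroE → V.sum (proj₁ t) ≤ D) f

  coeffMod : (ℕ → Elt h) → Elt h
  coeffMod a = sumE (L.map (λ i → scale (p ^ i) (a i)) (L.upTo m))

  monomial : ∀ {n} → Vec ℕ n → Vec (Elt h) n → Elt h
  monomial e X = L.foldr _⊗_ oneE (V.toList (V.zipWith powE X e))

  evalMod : ∀ {n} → TPoly n h → Vec (Elt h) n → Elt h
  evalMod f X = sumE (L.map (λ t → coeffMod (Data.Product.proj₂ t) ⊗ monomial (proj₁ t) X) f)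

  countV : ∀ {n} → TPoly n h → ℕ
  countV {n} f = L.length (L.filter (λ X → ≡-dec _≟_ (evalMod f X) zeroE) (box q n))

FieldModulus : (p : ℕ) {h : ℕ} → Vec ℕ h → Set
FieldModulus p g = Ring.IsField p g

bound : ℕ → ℕ → ℕ → ℕ → ℕ
bound p n m d = ceilDiv (n ∸ divN (p ^ m ∸ 1) (p ∸ 1) * d) (p ^ (m ∸ 1) * d)

{-# OPTIONS --safe #-}

-- Let O = ℤ_q / p^N with N large, let T be its Teichmüller set, and let B = O[O/p^m], with basis elements [x].  For t in T
-- we have [t] = 1 + (q−1)⁻¹ Σ_{1≤r≤q−1} t^r E_r, where T^* acts on E_r ∈ B through u ↦ u^r.  Hence Σ_X [f(X)] expands into
-- products of elements Ψ^i E_r, Ψ[x] = [px], times power sums over T, which vanish unless q−1 divides every exponent.  The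
-- coefficient of [0] is the number of zeros, so it suffices to see that these products are divisible by a high power of p.
--
-- As an O-algebra B is generated by y_j = E_{p^j}, j < h.  In each of the h Frobenius twists l give y_j the residue of
-- p^(j+l) modulo q−1 as weight, and let a factor p be worth (q−1)p^(m−1) in one twist of choice.  Any eigenvector has in
-- every twist at least the weight forced by its eigenvalue.  Therefore Ψ, which is the Frobenius modulo p, multiplies
-- weights by p while rotating the twists, and Ψ^m y_j = 0 rewrites y_j^(p^m) without loss of weight into terms divisible
-- by p.  A monomial with all exponents below p^m has weight at most (q−1)(p^m−1)/(p−1) in each twist; the rest of the
-- weight is made up of factors p.  Counting them twist by twist gives h times a ceiling, i.e. a bound for ord_q.  Since
-- only Ψ^h is sure to raise the weight in all twists, by the factor q, the degree of f_i may grow like q^⌊i/h⌋.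
module Submission where

-- For m = 1 an additive character sends `E r` essentially to a Gauss sum, and the weights refine
-- Stickelberger's digit sums by keeping the h conjugates apart. One averaged weight would be
-- rounded up only once and bound the p-adic valuation of the count. With a vector of weights every
-- twist claims its own rounded-up number of factors p, and no factor is claimed twice. The obstacle
-- is that Ψ lifts Frobenius only modulo p. The difference of E_r^p and Ψ E_(pr) is an eigenvector
-- divisible by p, of which only the residue weight is known. The weight lost is Q times a carry of
-- multiplication by p modulo q - 1. Exactly one carry occurs in a cycle of h twists, so the one
-- factor p pays for it. Over m steps a carry can be magnified by p^(m-1), which fixes the value of
-- a factor p. That the y_j generate B is seen on I/(I^2 + pB), I the augmentation ideal: there x ↦
-- [x] - 1 is additive, and t ↦ t^r is additive modulo p only for r a power of p. Since p^N = 0, all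
-- approximations stop after finitely many rounds.

module Arithmetic where

  open import Defs using (divN; ceilDiv)
  open import Data.Nat
  open import Data.Nat.Properties
  open import Data.Nat.DivMod
  open import Data.Nat.Divisibility
  open import Data.Nat.Primality using (Prime; euclidsLemma; prime⇒nonTrivial; prime⇒nonZero)
  open import Data.Nat.Combinatorics using (_C_; nCk+nC[k+1]≡[n+1]C[k+1]; nC1≡n; k>n⇒nCk≡0)
  open import Data.Nat.Tactic.RingSolver using (solve-∀)
  open import Data.Product using (∃; _×_; _,_; proj₁; proj₂)
  open import Data.Sum using (inj₁; inj₂)
  open import Relation.Nullary using (¬_; yes; no; contradiction)
  open import Relation.Binary.PropositionalEquality

  -- Finite sums, periodic sequences and binomial coefficients modulo p.

  module Nats where

    sumN : ℕ → (ℕ → ℕ) → ℕ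
    sumN zero    f = 0
    sumN (suc n) f = sumN n f + f n

    sumN-cong : ∀ n {f g} → (∀ i → i < n → f i ≡ g i) → sumN n f ≡ sumN n g
    sumN-cong zero    eq = refl
    sumN-cong (suc n) eq = cong₂ _+_ (sumN-cong n (λ i i<n → eq i (m<n⇒m<1+n i<n))) (eq n ≤-refl)

    sumN-+ : ∀ n f g → sumN n (λ i → f i + g i) ≡ sumN n f + sumN n g
    sumN-+ zero    f g = refl
    sumN-+ (suc n) f g rewrite sumN-+ n f g = lem (sumN n f) (sumN n g) (f n) (g n)
      where
      lem : ∀ a b c d → a + b + (c + d) ≡ a + c + (b + d)
      lem = solve-∀

    sumN-* : ∀ n c f → sumN n (λ i → c * f i) ≡ c * sumN n f
    sumN-* zero    c f = sym (*-zeroʳ c)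
    sumN-* (suc n) c f rewrite sumN-* n c f = sym (*-distribˡ-+ c (sumN n f) (f n))

    sumN-mono : ∀ n {f g} → (∀ i → i < n → f i ≤ g i) → sumN n f ≤ sumN n g
    sumN-mono zero    le = z≤n
    sumN-mono (suc n) le = +-mono-≤ (sumN-mono n (λ i i<n → le i (m<n⇒m<1+n i<n))) (le n ≤-refl)

    sumN-const : ∀ n c → sumN n (λ _ → c) ≡ n * c
    sumN-const zero    c = refl
    sumN-const (suc n) c = trans (cong (_+ c) (sumN-const n c)) (+-comm (n * c) c)

    sumN-front : ∀ n f → sumN (suc n) f ≡ f 0 + sumN n (λ i → f (suc i))
    sumN-front zero    f = sym (+-identityʳ (f 0))
    sumN-front (suc n) f = trans (cong (_+ f (suc n)) (sumN-front n f)) (+-assoc (f 0) _ _)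

    sumN-term : ∀ n f {i} → i < n → f i ≤ sumN n f
    sumN-term (suc n) f {i} i<n with i ≟ n
    ... | yes refl = m≤n+m (f n) (sumN n f)
    ... | no i≢n   = ≤-trans (sumN-term n f (≤∧≢⇒< (s≤s⁻¹ i<n) i≢n)) (m≤m+n _ (f n))

    sumN-0 : ∀ n {f} → (∀ i → i < n → f i ≡ 0) → sumN n f ≡ 0
    sumN-0 n e = trans (sumN-cong n e) (trans (sumN-const n 0) (*-zeroʳ n))

    sumN-single : ∀ n {f j} → j < n → (∀ i → i < n → ¬ i ≡ j → f i ≡ 0) → sumN n f ≡ f j
    sumN-single (suc n) {f} {j} j<n e with j ≟ n
    ... | yes refl = cong (_+ f j) (sumN-0 n (λ i i<n → e i (m<n⇒m<1+n i<n) (<⇒≢ i<n)))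
    ... | no j≢n = trans (cong₂ _+_ (sumN-single n (≤∧≢⇒< (s≤s⁻¹ j<n) j≢n) (λ i i<n → e i (m<n⇒m<1+n i<n)))
        (e n ≤-refl (λ n≡j → j≢n (sym n≡j)))) (+-identityʳ _)

    spike : ℕ → ℕ → ℕ → ℕ
    spike j n i with i ≟ j
    ... | yes _ = n
    ... | no _  = 0

    spike-≡ : ∀ j n → spike j n j ≡ n
    spike-≡ j n with j ≟ j
    ... | yes _ = refl
    ... | no ne = contradiction refl ne

    spike-≢ : ∀ {i j} n → ¬ i ≡ j → spike j n i ≡ 0
    spike-≢ {i} {j} n ne with i ≟ j
    ... | yes e = contradiction e ne
    ... | no _  = refl

    Periodic : ℕ → (ℕ → ℕ) → Set
    Periodic h f = ∀ l → f (h + l) ≡ f l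

    sumN-shift : ∀ h f → Periodic h f → sumN h (λ l → f (suc l)) ≡ sumN h f
    sumN-shift h f per = +-cancelˡ-≡ (f 0) _ _ (begin
      f 0 + sumN h (λ l → f (suc l)) ≡⟨ sumN-front h f ⟨
      sumN h f + f h                 ≡⟨ cong (λ x → sumN h f + f x) (+-identityʳ h) ⟨
      sumN h f + f (h + 0)           ≡⟨ cong (sumN h f +_) (per 0) ⟩
      sumN h f + f 0                 ≡⟨ +-comm _ (f 0) ⟩
      f 0 + sumN h f                 ∎)
      where open ≡-Reasoning

    Periodic-+ : ∀ {h f} k → Periodic h f → Periodic h (λ l → f (l + k))
    Periodic-+ {h} {f} k per l = trans (cong f (+-assoc h l k)) (per (l + k))

    sumN-shift+ : ∀ h f k → Periodic h f → sumN h (λ l → f (l + k)) ≡ sumN h f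
    sumN-shift+ h f zero    per = sumN-cong h (λ i _ → cong f (+-identityʳ i))
    sumN-shift+ h f (suc k) per = trans
      (trans (sumN-cong h (λ i _ → cong f (+-suc i k)))
             (sumN-shift h (λ l → f (l + k)) (Periodic-+ {h} {f} k per)))
      (sumN-shift+ h f k per)

    ∣-cancel-coprime-power : ∀ {p} → Prime p → ∀ v j c → p ^ v ∣ j * c → ¬ p ∣ c → p ^ v ∣ j
    ∣-cancel-coprime-power pp zero    j c d nc = 1∣ j
    ∣-cancel-coprime-power {p} pp (suc v) j c d nc with euclidsLemma j c pp (∣-trans (m∣m*n (p ^ v)) d)
    ... | inj₂ p∣c = contradiction p∣c nc
    ... | inj₁ (divides j′ refl) = subst (_∣ j′ * p) (*-comm (p ^ v) p)
            (*-monoˡ-∣ p (∣-cancel-coprime-power pp v j′ c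
              (*-cancelˡ-∣ p {{prime⇒nonZero pp}} (subst (p ^ suc v ∣_) (lem j′ p c) d)) nc))
      where
      lem : ∀ a b c → a * b * c ≡ b * (a * c)
      lem = solve-∀

    nC0≡1 : ∀ n → n C 0 ≡ 1
    nC0≡1 zero    = refl
    nC0≡1 (suc n) = refl

    absorption : ∀ n k → (suc n C suc k) * suc k ≡ suc n * (n C k)
    absorption n zero = trans (cong (_* 1) (nC1≡n (suc n))) (cong (suc n *_) (sym (nC0≡1 n)))
    absorption zero (suc k) = begin
      (1 C suc (suc k)) * suc (suc k) ≡⟨ cong (_* suc (suc k)) (k>n⇒nCk≡0 {1} {suc (suc k)} (s≤s (s≤s z≤n))) ⟩
      0                               ≡⟨ k>n⇒nCk≡0 {0} {suc k} (s≤s z≤n) ⟨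
      0 C suc k                       ≡⟨ *-identityˡ (0 C suc k) ⟨
      1 * (0 C suc k)                 ∎
      where open ≡-Reasoning
    absorption (suc n) (suc k) = begin
      (suc (suc n) C suc (suc k)) * suc (suc k)
        ≡⟨ cong (_* suc (suc k)) (nCk+nC[k+1]≡[n+1]C[k+1] (suc n) (suc k)) ⟨
      (a + b) * suc (suc k)
        ≡⟨ lem a b (suc k) ⟩
      a + a * suc k + b * suc (suc k)
        ≡⟨ cong₂ (λ x y → a + x + y) (absorption n k) (absorption n (suc k)) ⟩
      a + suc n * (n C k) + suc n * (n C suc k)
        ≡⟨ lem₂ a (suc n) (n C k) (n C suc k) ⟩
      a + suc n * (n C k + n C suc k)
        ≡⟨ cong (λ x → a + suc n * x) (nCk+nC[k+1]≡[n+1]C[k+1] n k) ⟩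
      suc (suc n) * a ∎
      where
      open ≡-Reasoning
      a = suc n C suc k
      b = suc n C suc (suc k)
      lem : ∀ a b k → (a + b) * suc k ≡ a + a * k + b * suc k
      lem = solve-∀
      lem₂ : ∀ a n x y → a + n * x + n * y ≡ a + n * (x + y)
      lem₂ = solve-∀

    p∣pCk : ∀ {p} → Prime p → ∀ k → suc k < p → p ∣ (p C suc k)
    p∣pCk {suc p} pp k k<p with euclidsLemma (suc p C suc k) (suc k) pp
          (divides (p C k) (trans (absorption p k) (*-comm (suc p) (p C k))))
    ... | inj₁ d = d
    ... | inj₂ d = contradiction (∣⇒≤ d) (<⇒≱ k<p)

    -- Among the binomials of N − 1 = p^v r − 1, those below p^v are ±1 modulo p.
    private
      below : ∀ {p} → Prime p → ∀ v N → p ^ v ∣ suc N → ∀ j → j < p ^ v → ¬ p ∣ (N C j)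
      below {p} pp v N d zero j< p∣ = contradiction (∣1⇒≡1 (subst (p ∣_) (nC0≡1 N) p∣))
        (nonTrivial⇒≢1 {{prime⇒nonTrivial pp}})
      below {p} pp v N d (suc j) j< p∣ with p ∣? (suc N C suc j)
      ... | no nd = >⇒∤ j< (∣-cancel-coprime-power pp v (suc j) (suc N C suc j)
             (subst (p ^ v ∣_) (trans (sym (absorption N j)) (*-comm (suc N C suc j) (suc j)))
               (∣m⇒∣m*n (N C j) d)) nd)
      ... | yes d′ = below pp v N d j (<-trans (n<1+n j) j<)
             (∣m+n∣m⇒∣n (subst (p ∣_) (trans (sym (nCk+nC[k+1]≡[n+1]C[k+1] N j)) (+-comm (N C j) (N C suc j))) d′) p∣)

    private
      p∤C′ : ∀ {p} → Prime p → ∀ v r N k → p ^ v ≡ suc k → suc N ≡ suc k * r → ¬ p ∣ r → ¬ p ∣ (suc N C suc k)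
      p∤C′ {p} pp v r N k eqv eqN nr p∣ with euclidsLemma r (N C k) pp (subst (p ∣_) eq p∣)
        where
        lem : ∀ k r c → suc k * r * c ≡ r * c * suc k
        lem = solve-∀
        eq : suc N C suc k ≡ r * (N C k)
        eq = *-cancelʳ-≡ _ _ (suc k) (trans (absorption N k) (trans (cong (_* (N C k)) eqN) (lem k r (N C k))))
      ... | inj₁ d = nr d
      ... | inj₂ d = below pp v N (subst₂ _∣_ (sym eqv) (sym eqN) (m∣m*n r)) k (subst (k <_) (sym eqv) ≤-refl) d

    -- Absorption turns the binomial into r times C(p^v r - 1, p^v - 1), and the second factor is
    -- prime to p by `below`. This makes the coefficient isolated in `Aug-E-composite` a unit.
    p∤C : ∀ {p} → Prime p → ∀ v r → ¬ p ∣ r → ¬ p ∣ ((p ^ v * r) C (p ^ v))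
    p∤C {p} pp v zero    nr = contradiction (p ∣0) nr
    p∤C {p} pp v (suc r) nr with p ^ v in eqv | m^n>0 p {{prime⇒nonZero pp}} v
    ... | suc k | _ = p∤C′ pp v (suc r) _ k eqv refl nr

    p-part : ∀ {p} → Prime p → ∀ f n → n < f → 1 ≤ n → ∃ λ v → ∃ λ r → n ≡ p ^ v * r × ¬ p ∣ r
    p-part {p} pp (suc f) n n<f 1≤n with p ∣? n
    ... | no nd = 0 , n , sym (*-identityˡ n) , nd
    ... | yes (divides zero refl) = contradiction 1≤n (λ ())
    ... | yes (divides (suc c) refl) with p-part pp f (suc c)
              (<-≤-trans (m<m*n (suc c) p (nonTrivial⇒n>1 p {{prime⇒nonTrivial pp}})) (s≤s⁻¹ n<f)) (s≤s z≤n)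
    ... | v , r , eq , nr = suc v , r , trans (cong (_* p) eq) (lem (p ^ v) r p) , nr
      where
      lem : ∀ a b c → a * b * c ≡ c * a * b
      lem = solve-∀

  -- Exponents modulo q - 1 and the carries of multiplication by p.

  module Residues (Q′ : ℕ) where
    open Nats

    Q : ℕ
    Q = suc Q′

    infix 4 _∼_
    _∼_ : ℕ → ℕ → Set
    x ∼ y = x % Q ≡ y % Q

    ∼-+ : ∀ {a b c d} → a ∼ b → c ∼ d → a + c ∼ b + d
    ∼-+ {a} {b} {c} {d} ab cd = trans (%-distribˡ-+ a c Q) (trans (cong₂ (λ x y → (x + y) % Q) ab cd) (sym (%-distribˡ-+ b d Q)))

    ∼-* : ∀ {a b c d} → a ∼ b → c ∼ d → a * c ∼ b * d
    ∼-* {a} {b} {c} {d} ab cd = trans (%-distribˡ-* a c Q) (trans (cong₂ (λ x y → (x * y) % Q) ab cd) (sym (%-distribˡ-* b d Q)))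

    +Q∼ : ∀ x k → x + Q * k ∼ x
    +Q∼ x k = trans (cong (λ z → (x + z) % Q) (*-comm Q k)) ([m+kn]%n≡m%n x k Q)

    ∼-pred : ∀ {a b} → suc a ∼ suc b → a ∼ b
    ∼-pred {a} {b} e = trans (sym (l a)) (trans (∼-+ {suc a} {suc b} {Q′} {Q′} e refl) (l b))
      where
      l : ∀ a → suc a + Q′ ∼ a
      l a = trans (cong (_% Q) (sym (+-suc a Q′))) ([m+n]%n≡m%n a Q)

    ∼-diff : ∀ {x y} → x ≤ y → y ∼ x → ∃ λ c → y ≡ x + Q * c
    ∼-diff {x} {y} x≤y e = y / Q ∸ x / Q , (begin
      y                                         ≡⟨ m≡m%n+[m/n]*n y Q ⟩
      y % Q + y / Q * Q                         ≡⟨ cong₂ (λ a b → a + b * Q) e (sym (m+[n∸m]≡n (/-monoˡ-≤ Q x≤y))) ⟩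
      x % Q + (x / Q + (y / Q ∸ x / Q)) * Q     ≡⟨ lem (x % Q) (x / Q) (y / Q ∸ x / Q) Q ⟩
      x % Q + x / Q * Q + Q * (y / Q ∸ x / Q)   ≡⟨ cong (_+ Q * (y / Q ∸ x / Q)) (m≡m%n+[m/n]*n x Q) ⟨
      x + Q * (y / Q ∸ x / Q)                   ∎)
      where
      open ≡-Reasoning
      lem : ∀ a b c q → a + (b + c) * q ≡ a + b * q + q * c
      lem = solve-∀

    -- Representatives modulo Q are taken in [1, Q], so that positive exponents stay positive.
    res : ℕ → ℕ
    res x = suc ((x ∸ 1) % Q)

    1≤res : ∀ x → 1 ≤ res x
    1≤res x = s≤s z≤n

    res∼ : ∀ {x} → 1 ≤ x → res x ∼ x
    res∼ {suc x} _ = ∼-+ {1} {1} refl (m%n%n≡m%n x Q)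

    res-cong : ∀ {x y} → 1 ≤ x → 1 ≤ y → x ∼ y → res x ≡ res y
    res-cong {suc x} {suc y} _ _ e = cong suc (∼-pred {x} {y} e)

    res-least : ∀ {x y} → 1 ≤ x → 1 ≤ y → y ∼ x → res x ≤ y
    res-least {suc x} {suc y} _ _ e = s≤s (subst (_≤ y) (∼-pred {y} {x} e) (m%n≤m y Q))

    res-id : ∀ {x} → 1 ≤ x → x ≤ Q → res x ≡ x
    res-id {suc x} _ x≤Q = cong suc (m<n⇒m%n≡m x≤Q)

    -- A positive exponent congruent to - r, so that 0 ^ neg r vanishes in a ring.
    neg : ℕ → ℕ
    neg r = Q′ * r + Q

    1≤neg : ∀ r → 1 ≤ neg r
    1≤neg r = ≤-trans (s≤s z≤n) (m≤n+m Q (Q′ * r))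

    neg+ : ∀ r → neg r + r ≡ Q * suc r
    neg+ r = lem Q′ r
      where
      lem : ∀ a r → a * r + suc a + r ≡ suc a * suc r
      lem = solve-∀

    ∼-neg : ∀ {r n} → Q ∣ neg r + n → n ∼ r
    ∼-neg {r} {n} d = begin
      n % Q                     ≡⟨ +Q∼ n (suc r) ⟨
      (n + Q * suc r) % Q       ≡⟨ cong (λ z → (n + z) % Q) (neg+ r) ⟨
      (n + (neg r + r)) % Q     ≡⟨ cong (_% Q) (lem n (neg r) r) ⟩
      (neg r + n + r) % Q       ≡⟨ %-remove-+ˡ r d ⟩
      r % Q                     ∎
      where
      open ≡-Reasoning
      lem : ∀ a b c → a + (b + c) ≡ b + a + c
      lem = solve-∀

    neg-∼ : ∀ {r n} → n ∼ r → Q ∣ neg r + n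
    neg-∼ {r} {n} e = m%n≡0⇒n∣m _ Q (trans (∼-+ {neg r} {neg r} {n} {r} refl e)
      (n∣m⇒m%n≡0 _ Q (subst (Q ∣_) (sym (neg+ r)) (m∣m*n (suc r)))))

    module Powers (p h : ℕ) (pp : Prime p) (q≡ : p ^ h ≡ suc Q) where

      private
        instance
          p≢0 : NonZero p
          p≢0 = prime⇒nonZero pp

      2≤p : 2 ≤ p
      2≤p = nonTrivial⇒n>1 p {{prime⇒nonTrivial pp}}

      1≤p^ : ∀ k → 1 ≤ p ^ k
      1≤p^ k = m^n>0 p k

      p^h+∼ : ∀ k → p ^ (h + k) ∼ p ^ k
      p^h+∼ k = begin
        p ^ (h + k) % Q        ≡⟨ cong (_% Q) (^-distribˡ-+-* p h k) ⟩
        (p ^ h * p ^ k) % Q    ≡⟨ cong (λ z → (z * p ^ k) % Q) q≡ ⟩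
        (p ^ k + Q * p ^ k) % Q ≡⟨ +Q∼ (p ^ k) (p ^ k) ⟩
        p ^ k % Q              ∎
        where open ≡-Reasoning

      -- Equals p^(k mod h). The weight of the generator y_j in the twist l is `rep (j + l)`.
      rep : ℕ → ℕ
      rep k = res (p ^ k)

      rep-periodic : Periodic h rep
      rep-periodic k = res-cong (1≤p^ (h + k)) (1≤p^ k) (p^h+∼ k)

      rep-small : ∀ k → k < h → rep k ≡ p ^ k
      rep-small k k<h = res-id (1≤p^ k) (s≤s⁻¹ (subst (p ^ k <_) q≡ (^-monoʳ-< p 2≤p k<h)))

      private
        geometric : ∀ n → p * sumN n (p ^_) + 1 ≡ sumN n (p ^_) + p ^ n
        geometric zero    = cong (_+ 1) (*-zeroʳ p)
        geometric (suc n) = begin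
          p * (sumN n (p ^_) + p ^ n) + 1     ≡⟨ lem p (sumN n (p ^_)) (p ^ n) ⟩
          p * sumN n (p ^_) + 1 + p * p ^ n   ≡⟨ cong (_+ p * p ^ n) (geometric n) ⟩
          sumN n (p ^_) + p ^ n + p * p ^ n   ∎
          where
          open ≡-Reasoning
          lem : ∀ p s t → p * (s + t) + 1 ≡ p * s + 1 + p * t
          lem = solve-∀

      sum-rep : ∀ k → sumN h (λ l → rep (l + k)) ≡ sumN h rep
      sum-rep k = sumN-shift+ h rep k rep-periodic

      p*sum-rep : p * sumN h rep ≡ sumN h rep + Q
      p*sum-rep = suc-injective (begin
        suc (p * sumN h rep)      ≡⟨ +-comm 1 _ ⟩
        p * sumN h rep + 1        ≡⟨ cong (λ z → p * z + 1) e ⟩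
        p * sumN h (p ^_) + 1      ≡⟨ geometric h ⟩
        sumN h (p ^_) + p ^ h      ≡⟨ cong₂ _+_ (sym e) q≡ ⟩
        sumN h rep + suc Q        ≡⟨ +-suc _ Q ⟩
        suc (sumN h rep + Q)      ∎)
        where
        open ≡-Reasoning
        e = sumN-cong h rep-small

      private
        carry-spec : ∀ k → ∃ λ c → p * rep k ≡ rep (suc k) + Q * c
        carry-spec k = ∼-diff (res-least (1≤p^ (suc k)) (*-mono-≤ {1} {p} {1} (≤-trans (s≤s z≤n) 2≤p) (1≤res (p ^ k))) e′) e
          where
          e′ : p * rep k ∼ p ^ suc k
          e′ = ∼-* {p} {p} refl (res∼ (1≤p^ k))
          e : p * rep k ∼ rep (suc k)
          e = trans e′ (sym (res∼ (1≤p^ (suc k))))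

      -- It is 1 for k congruent to h - 1 modulo h, where p · p^(h-1) = q wraps around to 1, and 0
      -- otherwise. Times Q it is the weight lost when a p-th power is replaced by its Frobenius
      -- image.
      carry : ℕ → ℕ
      carry k = proj₁ (carry-spec k)

      carry-eq : ∀ k → p * rep k ≡ rep (suc k) + Q * carry k
      carry-eq k = proj₂ (carry-spec k)

      carry-periodic : Periodic h carry
      carry-periodic k = *-cancelˡ-≡ _ _ Q (+-cancelˡ-≡ (rep (suc k)) _ _ (begin
        rep (suc k) + Q * carry (h + k)        ≡⟨ cong (_+ Q * carry (h + k)) (rep-periodic (suc k)) ⟨
        rep (h + suc k) + Q * carry (h + k)    ≡⟨ cong (λ z → rep z + Q * carry (h + k)) (+-suc h k) ⟩
        rep (suc (h + k)) + Q * carry (h + k)  ≡⟨ carry-eq (h + k) ⟨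
        p * rep (h + k)                        ≡⟨ cong (p *_) (rep-periodic k) ⟩
        p * rep k                              ≡⟨ carry-eq k ⟩
        rep (suc k) + Q * carry k              ∎))
        where open ≡-Reasoning

      -- A shift does not change the sum of `rep` over a period, so the sum of p · rep exceeds it by
      -- Q times the number of carries, and `p*sum-rep` gives the excess Q. Hence a Frobenius step
      -- loses weight in one twist only, and a single factor p can repay it.
      sum-carry : sumN h carry ≡ 1
      sum-carry = *-cancelˡ-≡ _ _ Q (+-cancelˡ-≡ (sumN h rep) _ _ (begin
        sumN h rep + Q * sumN h carry                       ≡⟨ cong₂ _+_ (sym (sumN-shift h rep rep-periodic)) (sym (sumN-* h Q carry)) ⟩
        sumN h (λ l → rep (suc l)) + sumN h (λ l → Q * carry l) ≡⟨ sumN-+ h _ _ ⟨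
        sumN h (λ l → rep (suc l) + Q * carry l)            ≡⟨ sumN-cong h (λ l _ → sym (carry-eq l)) ⟩
        sumN h (λ l → p * rep l)                            ≡⟨ sumN-* h p rep ⟩
        p * sumN h rep                                      ≡⟨ p*sum-rep ⟩
        sumN h rep + Q                                      ≡⟨ cong (sumN h rep +_) (*-identityʳ Q) ⟨
        sumN h rep + Q * 1                                  ∎))
        where open ≡-Reasoning

      carries : ℕ → ℕ → ℕ
      carries zero    k = 0
      carries (suc i) k = carry k + carries i (suc k)

      carries-periodic : ∀ i → Periodic h (carries i)
      carries-periodic zero    k = refl
      carries-periodic (suc i) k = cong₂ _+_ (carry-periodic k) (trans (cong (carries i) (sym (+-suc h k))) (carries-periodic i (suc k)))

      sum-carries : ∀ i → sumN h (carries i) ≡ i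
      sum-carries zero    = trans (sumN-const h 0) (*-zeroʳ h)
      sum-carries (suc i) = trans (sumN-+ h carry _) (cong₂ _+_ sum-carry
        (trans (sumN-shift h (carries i) (carries-periodic i)) (sum-carries i)))

      -- Unfolding `carry-eq` gives rep (i + k) plus Q times the sum of p^(i-1-s) carry (k + s) over
      -- s < i; each power is then rounded up to p^(i-1). With i = m this is the origin of the value
      -- Q p^(m-1) of a factor p.
      carries-bound : ∀ i k → p ^ i * rep k ≤ Q * p ^ pred i * carries i k + rep (i + k)
      carries-bound zero    k = ≤-trans (≤-reflexive (*-identityˡ (rep k))) (m≤n+m (rep k) _)
      carries-bound (suc i) k = begin
        p * p ^ i * rep k                     ≡⟨ lem p (p ^ i) (rep k) ⟩
        p ^ i * (p * rep k)                   ≡⟨ cong (p ^ i *_) (carry-eq k) ⟩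
        p ^ i * (rep (suc k) + Q * carry k)   ≡⟨ lem₂ (p ^ i) (rep (suc k)) Q (carry k) ⟩
        p ^ i * rep (suc k) + Q * p ^ i * carry k
          ≤⟨ +-monoˡ-≤ _ (carries-bound i (suc k)) ⟩
        Q * p ^ pred i * carries i (suc k) + rep (i + suc k) + Q * p ^ i * carry k
          ≤⟨ +-monoˡ-≤ _ (+-monoˡ-≤ _ (*-monoˡ-≤ (carries i (suc k)) (*-monoʳ-≤ Q (^-monoʳ-≤ p (pred[n]≤n {i}))))) ⟩
        Q * p ^ i * carries i (suc k) + rep (i + suc k) + Q * p ^ i * carry k
          ≡⟨ cong (λ z → Q * p ^ i * carries i (suc k) + rep z + Q * p ^ i * carry k) (+-suc i k) ⟩
        Q * p ^ i * carries i (suc k) + rep (suc (i + k)) + Q * p ^ i * carry k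
          ≡⟨ lem₃ (Q * p ^ i) (carries i (suc k)) (rep (suc (i + k))) (carry k) ⟩
        Q * p ^ i * (carry k + carries i (suc k)) + rep (suc (i + k)) ∎
        where
        open ≤-Reasoning
        lem : ∀ a b c → a * b * c ≡ b * (a * c)
        lem = solve-∀
        lem₂ : ∀ a b c d → a * (b + c * d) ≡ a * b + c * a * d
        lem₂ = solve-∀
        lem₃ : ∀ a b c d → a * b + c + a * d ≡ a * (d + b) + c
        lem₃ = solve-∀

  -- Ceilings and repunits.

  module Ceilings where

    private
      a+b∸1 : ∀ a k → a + suc k ∸ 1 ≡ a + k
      a+b∸1 a k = cong (_∸ 1) (+-suc a k)

    ceilDiv-upper : ∀ a b → 1 ≤ b → a ≤ b * ceilDiv a b
    ceilDiv-upper a (suc k) _ = +-cancelʳ-≤ k _ _ (begin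
      a + k                                                  ≡⟨ m≡m%n+[m/n]*n (a + k) (suc k) ⟩
      (a + k) % suc k + (a + k) / suc k * suc k              ≤⟨ +-monoˡ-≤ _ (s≤s⁻¹ (m%n<n (a + k) (suc k))) ⟩
      k + (a + k) / suc k * suc k                            ≡⟨ +-comm k _ ⟩
      (a + k) / suc k * suc k + k                            ≡⟨ cong (_+ k) (trans (*-comm _ (suc k)) (cong (λ z → suc k * (z / suc k)) (sym (a+b∸1 a k)))) ⟩
      suc k * ceilDiv a (suc k) + k                          ∎)
      where open ≤-Reasoning

    ceilDiv-least : ∀ a b x → 1 ≤ b → a ≤ b * x → ceilDiv a b ≤ x
    ceilDiv-least a (suc k) x _ le = s≤s⁻¹ (m<n*o⇒m/o<n {a + suc k ∸ 1} {suc x} {suc k} (begin-strict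
      a + suc k ∸ 1        ≡⟨ a+b∸1 a k ⟩
      a + k                ≤⟨ +-monoˡ-≤ k le ⟩
      suc k * x + k        <⟨ +-monoʳ-< (suc k * x) (n<1+n k) ⟩
      suc k * x + suc k    ≡⟨ +-comm _ (suc k) ⟩
      suc k + suc k * x    ≡⟨ cong (suc k +_) (*-comm (suc k) x) ⟩
      suc x * suc k        ∎))
      where open ≤-Reasoning

    -- As c ≥ 1, a unit more in the numerator raises the ceiling by at most one. It is used with z
    -- variables of exponent 0, each of which yields a whole factor q, and s variables whose weight
    -- has to be converted into factors p.
    ceilDiv-step : ∀ s z E c → 1 ≤ c → ceilDiv (s + z ∸ E) c ≤ z + ceilDiv (s ∸ E) c
    ceilDiv-step s z E c 1≤c = ceilDiv-least (s + z ∸ E) c (z + ceilDiv (s ∸ E) c) 1≤c (begin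
      s + z ∸ E                       ≤⟨ m≤n+o⇒m∸n≤o (s + z) E (≤-trans (+-monoˡ-≤ z (m≤n+m∸n s E)) (≤-reflexive (trans (+-assoc E _ z) (cong (E +_) (+-comm _ z))))) ⟩
      z + (s ∸ E)                     ≤⟨ +-mono-≤ (m≤n*m z c {{>-nonZero 1≤c}}) (ceilDiv-upper (s ∸ E) c 1≤c) ⟩
      c * z + c * ceilDiv (s ∸ E) c   ≡⟨ *-distribˡ-+ c z _ ⟨
      c * (z + ceilDiv (s ∸ E) c)     ∎)
      where open ≤-Reasoning

    repunit : ℕ → ℕ → ℕ
    repunit p m = divN (p ^ m ∸ 1) (p ∸ 1)

    repunit-eq : ∀ p m → 2 ≤ p → repunit p m * (p ∸ 1) ≡ p ^ m ∸ 1
    repunit-eq (suc zero)    m (s≤s ())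
    repunit-eq (suc (suc k)) m _ = m/n*n≡m (divides-pred m)
      where
      divides-pred : ∀ m → suc k ∣ suc (suc k) ^ m ∸ 1
      divides-pred zero    = suc k ∣0
      divides-pred (suc m) = subst (suc k ∣_) (sym eq) (∣m∣n⇒∣m+n (divides-pred m) (m∣m*n (suc (suc k) ^ m)))
        where
        eq : suc (suc k) ^ suc m ∸ 1 ≡ (suc (suc k) ^ m ∸ 1) + suc k * suc (suc k) ^ m
        eq = +-∸-comm (suc k * suc (suc k) ^ m) (m^n>0 (suc (suc k)) m)

    divN-spec : ∀ i h → 1 ≤ h → ∃ λ b → i ≡ b + divN i h * h
    divN-spec i (suc h) _ = i % suc h , m≡m%n+[m/n]*n i (suc h)

open Arithmetic

-- Normalisation of ring identities with integer coefficients.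

module IntegerSolver where

  open import Level using (0ℓ)
  open import Algebra.Bundles using (CommutativeRing; RawRing)
  import Algebra.Solver.Ring
  import Algebra.Solver.Ring.AlmostCommutativeRing as ACR
  import Algebra.Properties.Ring
  import Algebra.Properties.Semiring.Mult.TCOptimised
  import Relation.Binary.Reasoning.Setoid
  import Data.Integer.Properties as ℤ
  open import Data.Integer as ℤ using (ℤ; +_; -[1+_]; _⊖_)
  open import Data.Nat as ℕ using (ℕ; zero; suc)
  open import Data.Maybe using (Maybe; just; nothing)
  open import Relation.Nullary using (yes; no)
  open import Relation.Binary.PropositionalEquality as ≡ using (_≡_)

  -- Normalisation compares coefficients. In ℤ this is decidable and negatives exist, whereas the
  -- equality of the rings treated below, in particular of the group algebra, comes with no decision
  -- procedure.
  module IntSolver (R : CommutativeRing 0ℓ 0ℓ) where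
    open CommutativeRing R
    open Algebra.Properties.Ring ring using (-‿distribˡ-*; -‿distribʳ-*; -0#≈0#; -‿involutive; -‿+-comm)
    open Algebra.Properties.Semiring.Mult.TCOptimised semiring
      using (×-homo-+; ×1-homo-*; 1+×) renaming (_×_ to _·_)

    private
      ⟦_⟧ : ℤ → Carrier
      ⟦ + n ⟧      = n · 1#
      ⟦ -[1+ n ] ⟧ = - (suc n · 1#)

      open Relation.Binary.Reasoning.Setoid setoid

      cancel : ∀ a b → (1# + a) - (1# + b) ≈ a - b
      cancel a b = begin
        1# + a - (1# + b)       ≈⟨ +-cong (+-comm 1# a) (sym (-‿+-comm 1# b)) ⟩
        a + 1# + (- 1# + - b)   ≈⟨ +-assoc a 1# _ ⟩
        a + (1# + (- 1# + - b)) ≈⟨ +-congˡ (+-assoc 1# (- 1#) (- b)) ⟨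
        a + (1# + - 1# + - b)   ≈⟨ +-congˡ (trans (+-congʳ (-‿inverseʳ 1#)) (+-identityˡ _)) ⟩
        a - b                   ∎

      ⊖-homo : ∀ m n → ⟦ m ⊖ n ⟧ ≈ m · 1# - n · 1#
      ⊖-homo m zero = sym (trans (+-congˡ -0#≈0#) (+-identityʳ _))
      ⊖-homo zero (suc n) = sym (+-identityˡ _)
      ⊖-homo (suc m) (suc n) = begin
        ⟦ suc m ⊖ suc n ⟧         ≡⟨ ≡.cong ⟦_⟧ (ℤ.[1+m]⊖[1+n]≡m⊖n m n) ⟩
        ⟦ m ⊖ n ⟧                 ≈⟨ ⊖-homo m n ⟩
        m · 1# - n · 1#           ≈⟨ cancel _ _ ⟨
        1# + m · 1# - (1# + n · 1#) ≈⟨ +-cong (sym (1+× m 1#)) (-‿cong (sym (1+× n 1#))) ⟩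
        suc m · 1# - suc n · 1#   ∎

      +-homo : ∀ x y → ⟦ x ℤ.+ y ⟧ ≈ ⟦ x ⟧ + ⟦ y ⟧
      +-homo (+ m)      (+ n)      = ×-homo-+ 1# m n
      +-homo (+ m)      -[1+ n ]   = ⊖-homo m (suc n)
      +-homo -[1+ m ]   (+ n)      = trans (⊖-homo n (suc m)) (+-comm _ _)
      +-homo -[1+ m ]   -[1+ n ]   = begin
        - (suc (suc (m ℕ.+ n)) · 1#)   ≡⟨ ≡.cong (λ k → - (suc k · 1#)) (≡.sym (ℕ+-suc m n)) ⟩
        - ((suc m ℕ.+ suc n) · 1#)     ≈⟨ -‿cong (×-homo-+ 1# (suc m) (suc n)) ⟩
        - (suc m · 1# + suc n · 1#)    ≈⟨ -‿+-comm _ _ ⟨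
        - (suc m · 1#) - suc n · 1#    ∎
        where
        ℕ+-suc : ∀ m n → m ℕ.+ suc n ≡ suc (m ℕ.+ n)
        ℕ+-suc zero    n = ≡.refl
        ℕ+-suc (suc m) n = ≡.cong suc (ℕ+-suc m n)

      neg-homo : ∀ x → ⟦ ℤ.- x ⟧ ≈ - ⟦ x ⟧
      neg-homo (+ zero)  = sym -0#≈0#
      neg-homo (+ suc n) = refl
      neg-homo -[1+ n ]  = sym (-‿involutive _)

      +*-homo : ∀ m y → ⟦ + m ℤ.* y ⟧ ≈ m · 1# * ⟦ y ⟧
      +*-homo m (+ n) = trans (reflexive (≡.cong ⟦_⟧ (≡.sym (ℤ.pos-* m n)))) (×1-homo-* m n)
      +*-homo m -[1+ n ] = begin
        ⟦ + m ℤ.* -[1+ n ] ⟧         ≡⟨ ≡.cong ⟦_⟧ (ℤ.neg-distribʳ-* (+ m) (+ suc n)) ⟨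
        ⟦ ℤ.- (+ m ℤ.* + suc n) ⟧    ≈⟨ neg-homo (+ m ℤ.* + suc n) ⟩
        - ⟦ + m ℤ.* + suc n ⟧        ≈⟨ -‿cong (+*-homo m (+ suc n)) ⟩
        - (m · 1# * suc n · 1#)      ≈⟨ -‿distribʳ-* _ _ ⟩
        m · 1# * - (suc n · 1#)      ∎

      *-homo : ∀ x y → ⟦ x ℤ.* y ⟧ ≈ ⟦ x ⟧ * ⟦ y ⟧
      *-homo (+ m)    y = +*-homo m y
      *-homo -[1+ m ] y = begin
        ⟦ -[1+ m ] ℤ.* y ⟧         ≡⟨ ≡.cong ⟦_⟧ (ℤ.neg-distribˡ-* (+ suc m) y) ⟨
        ⟦ ℤ.- (+ suc m ℤ.* y) ⟧    ≈⟨ neg-homo (+ suc m ℤ.* y) ⟩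
        - ⟦ + suc m ℤ.* y ⟧        ≈⟨ -‿cong (+*-homo (suc m) y) ⟩
        - (suc m · 1# * ⟦ y ⟧)     ≈⟨ -‿distribˡ-* _ _ ⟩
        - (suc m · 1#) * ⟦ y ⟧     ∎

      ℤ-rawRing : RawRing 0ℓ 0ℓ
      ℤ-rawRing = record
        { Carrier = ℤ ; _≈_ = _≡_ ; _+_ = ℤ._+_ ; _*_ = ℤ._*_ ; -_ = ℤ.-_ ; 0# = + 0 ; 1# = + 1 }

      acr : ACR.AlmostCommutativeRing 0ℓ 0ℓ
      acr = ACR.fromCommutativeRing R

      morphism : ℤ-rawRing ACR.-Raw-AlmostCommutative⟶ acr
      morphism = record
        { ⟦_⟧ = ⟦_⟧ ; +-homo = +-homo ; *-homo = *-homo ; -‿homo = neg-homo ; 0-homo = refl ; 1-homo = refl }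

      ≟ : ∀ x y → Maybe (⟦ x ⟧ ≈ ⟦ y ⟧)
      ≟ x y with x ℤ.≟ y
      ... | yes e = just (reflexive (≡.cong ⟦_⟧ e))
      ... | no _  = nothing

    open Algebra.Solver.Ring ℤ-rawRing acr morphism ≟ public
      using (solve; _:+_; _:*_; _:-_; :-_; con; _:=_)

open IntegerSolver

-- Commutative rings: sums, units, roots of polynomials, congruences modulo powers of p.

module RingTheory where

  open import Level using (0ℓ)
  open import Algebra.Bundles using (CommutativeRing)
  open import Data.Fin using (toℕ)
  open import Data.Nat as ℕ using (ℕ; zero; suc; s≤s)
  import Data.Nat.Properties as ℕ
  open import Data.Nat.Divisibility using (_∣_; divides)
  open import Data.Nat.Primality using (Prime; prime⇒nonTrivial; prime⇒irreducible)
  open import Data.Nat.Combinatorics using (_C_; nCn≡1)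
  open import Data.Nat.Coprimality using (coprime-Bézout; Coprime)
  open import Data.Nat.GCD using (module Bézout)
  open import Data.List using (List; []; _∷_; _++_; map; upTo; applyUpTo; length; concatMap; filter)
  open import Data.List.Membership.Propositional using (_∈_)
  open import Data.List.Membership.Propositional.Properties using (∈-upTo⁻)
  open import Data.List.Relation.Unary.Any using (here; there)
  open import Data.List.Relation.Unary.All as All using (All; []; _∷_)
  open import Data.List.Relation.Unary.AllPairs using (AllPairs; []; _∷_)
  open import Data.List.Relation.Unary.Unique.Propositional using (Unique)
  open import Data.List.Relation.Binary.Pointwise using (Pointwise; []; _∷_)
  open import Data.List.Relation.Binary.Permutation.Propositional as ↭ using (_↭_)
  open import Data.Vec as V using (Vec; []; _∷_)
  import Data.Vec.Relation.Unary.All as VAll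
  open import Data.Product using (∃; _×_; _,_; proj₁; proj₂)
  open import Data.Sum using (_⊎_; inj₁; inj₂)
  open import Relation.Nullary using (Dec; ¬_; yes; no; contradiction)
  open import Relation.Binary.PropositionalEquality as ≡ using (_≡_)
  import Data.Integer as ℤ
  import Algebra.Properties.Semiring.Exp
  import Algebra.Properties.Semiring.Mult
  import Algebra.Properties.CommutativeSemiring.Exp
  import Algebra.Properties.CommutativeSemiring.Binomial
  import Algebra.Properties.Semiring.Sum
  import Algebra.Properties.Ring
  import Relation.Binary.Reasoning.Setoid

  module RingFacts (R : CommutativeRing 0ℓ 0ℓ) where
    open CommutativeRing R public
    open Algebra.Properties.Semiring.Exp semiring public
      using (_^_; ^-congˡ; ^-congʳ; ^-homo-*; ^-assocʳ)
    open Algebra.Properties.CommutativeSemiring.Exp commutativeSemiring public using (^-distrib-*)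
    open Algebra.Properties.Semiring.Mult semiring public
      using (×1-homo-*; ×-assoc-*; ×-congʳ)
      renaming (_×_ to infixr 8 _·_)
    open Algebra.Properties.Ring ring public using (-‿distribˡ-*; -‿distribʳ-*; -0#≈0#; +-cancelˡ)
    module ≈R = Relation.Binary.Reasoning.Setoid setoid

    open IntSolver R public

    nat : ℕ → Carrier
    nat n = n · 1#

    nat-* : ∀ m n → nat (m ℕ.* n) ≈ nat m * nat n
    nat-* = ×1-homo-*

    nat-1 : nat 1 ≈ 1#
    nat-1 = +-identityʳ 1#

    nat-^ : ∀ m n → nat (m ℕ.^ n) ≈ nat m ^ n
    nat-^ m zero    = nat-1
    nat-^ m (suc n) = trans (nat-* m (m ℕ.^ n)) (*-congˡ (nat-^ m n))

    nat-cong : ∀ {m n} → m ≡ n → nat m ≈ nat n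
    nat-cong ≡.refl = refl

    ×≈nat* : ∀ n x → n · x ≈ nat n * x
    ×≈nat* n x = sym (trans (×-assoc-* n 1# x) (×-congʳ n (*-identityˡ x)))

    1^ : ∀ n → 1# ^ n ≈ 1#
    1^ zero    = refl
    1^ (suc n) = trans (*-identityˡ _) (1^ n)

    0^ : ∀ {n} → 1 ℕ.≤ n → 0# ^ n ≈ 0#
    0^ {suc n} _ = zeroˡ _

    ΣL : {A : Set} → List A → (A → Carrier) → Carrier
    ΣL []       f = 0#
    ΣL (x ∷ xs) f = f x + ΣL xs f

    module _ {A : Set} where

      Σ-cong∈ : ∀ (xs : List A) {f g} → (∀ {x} → x ∈ xs → f x ≈ g x) → ΣL xs f ≈ ΣL xs g
      Σ-cong∈ []       eq = refl
      Σ-cong∈ (x ∷ xs) eq = +-cong (eq (here ≡.refl)) (Σ-cong∈ xs (λ i → eq (there i)))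

      Σ-cong : ∀ (xs : List A) {f g} → (∀ x → f x ≈ g x) → ΣL xs f ≈ ΣL xs g
      Σ-cong xs eq = Σ-cong∈ xs (λ {x} _ → eq x)

      Σ-+ : ∀ (xs : List A) f g → ΣL xs (λ x → f x + g x) ≈ ΣL xs f + ΣL xs g
      Σ-+ []       f g = sym (+-identityˡ 0#)
      Σ-+ (x ∷ xs) f g = trans (+-congˡ (Σ-+ xs f g)) (lem (f x) (g x) (ΣL xs f) (ΣL xs g))
        where
        lem : ∀ a b c d → a + b + (c + d) ≈ a + c + (b + d)
        lem = solve 4 (λ a b c d → a :+ b :+ (c :+ d) := a :+ c :+ (b :+ d)) refl

      Σ-*ˡ : ∀ (xs : List A) c f → ΣL xs (λ x → c * f x) ≈ c * ΣL xs f
      Σ-*ˡ []       c f = sym (zeroʳ c)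
      Σ-*ˡ (x ∷ xs) c f = trans (+-congˡ (Σ-*ˡ xs c f)) (sym (distribˡ c (f x) (ΣL xs f)))

      Σ-*ʳ : ∀ (xs : List A) c f → ΣL xs (λ x → f x * c) ≈ ΣL xs f * c
      Σ-*ʳ xs c f = trans (Σ-cong xs (λ x → *-comm (f x) c)) (trans (Σ-*ˡ xs c f) (*-comm c _))

      Σ-neg : ∀ (xs : List A) f → ΣL xs (λ x → - f x) ≈ - ΣL xs f
      Σ-neg []       f = sym -0#≈0#
      Σ-neg (x ∷ xs) f = trans (+-congˡ (Σ-neg xs f)) (lem (f x) (ΣL xs f))
        where
        lem : ∀ a b → - a + - b ≈ - (a + b)
        lem = solve 2 (λ a b → :- a :+ :- b := :- (a :+ b)) refl

      Σ-- : ∀ (xs : List A) f g → ΣL xs (λ x → f x - g x) ≈ ΣL xs f - ΣL xs g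
      Σ-- xs f g = trans (Σ-+ xs f (λ x → - g x)) (+-congˡ (Σ-neg xs g))

      Σ-0 : ∀ (xs : List A) {f} → (∀ {x} → x ∈ xs → f x ≈ 0#) → ΣL xs f ≈ 0#
      Σ-0 []       eq = refl
      Σ-0 (x ∷ xs) eq = trans (+-cong (eq (here ≡.refl)) (Σ-0 xs (λ i → eq (there i)))) (+-identityˡ 0#)

      Σ-++ : ∀ (xs ys : List A) f → ΣL (xs ++ ys) f ≈ ΣL xs f + ΣL ys f
      Σ-++ []       ys f = sym (+-identityˡ _)
      Σ-++ (x ∷ xs) ys f = trans (+-congˡ (Σ-++ xs ys f)) (sym (+-assoc _ _ _))

      Σ-const : ∀ (xs : List A) → ΣL xs (λ _ → 1#) ≈ nat (length xs)
      Σ-const []       = refl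
      Σ-const (x ∷ xs) = +-congˡ (Σ-const xs)

      Σ-↭ : ∀ {xs ys : List A} f → xs ↭ ys → ΣL xs f ≈ ΣL ys f
      Σ-↭ f ↭.refl         = refl
      Σ-↭ f (↭.prep x p)   = +-congˡ (Σ-↭ f p)
      Σ-↭ f (↭.swap x y p) = trans (+-congˡ (+-congˡ (Σ-↭ f p))) (lem (f x) (f y) _)
        where
        lem : ∀ a b c → a + (b + c) ≈ b + (a + c)
        lem = solve 3 (λ a b c → a :+ (b :+ c) := b :+ (a :+ c)) refl
      Σ-↭ f (↭.trans p q)  = trans (Σ-↭ f p) (Σ-↭ f q)

      Σ-pointwise : ∀ {B : Set} {xs : List A} {ys : List B} {f g} → Pointwise (λ x y → f x ≈ g y) xs ys → ΣL xs f ≈ ΣL ys g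
      Σ-pointwise []       = refl
      Σ-pointwise (e ∷ es) = +-cong e (Σ-pointwise es)

      Σ-map : ∀ {B : Set} (k : B → A) (xs : List B) f → ΣL (map k xs) f ≈ ΣL xs (λ x → f (k x))
      Σ-map k []       f = refl
      Σ-map k (x ∷ xs) f = +-congˡ (Σ-map k xs f)

      Σ-concatMap : ∀ {B : Set} (k : B → List A) (xs : List B) f → ΣL (concatMap k xs) f ≈ ΣL xs (λ x → ΣL (k x) f)
      Σ-concatMap k []       f = refl
      Σ-concatMap k (x ∷ xs) f = trans (Σ-++ (k x) (concatMap k xs) f) (+-congˡ (Σ-concatMap k xs f))

    Σ-swap : ∀ {A B : Set} (xs : List A) (ys : List B) (f : A → B → Carrier) →
      ΣL xs (λ x → ΣL ys (f x)) ≈ ΣL ys (λ y → ΣL xs (λ x → f x y))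
    Σ-swap []       ys f = sym (Σ-0 ys (λ _ → refl))
    Σ-swap (x ∷ xs) ys f = trans (+-congˡ (Σ-swap xs ys f)) (sym (Σ-+ ys (f x) _))

    Σ-product : ∀ {A B : Set} (xs : List A) (ys : List B) (f : A → Carrier) (g : B → Carrier) →
      ΣL xs f * ΣL ys g ≈ ΣL xs (λ x → ΣL ys (λ y → f x * g y))
    Σ-product xs ys f g = sym (trans (Σ-cong xs (λ x → Σ-*ˡ ys (f x) g)) (Σ-*ʳ xs (ΣL ys g) f))

    ΣBox : {A : Set} → List A → ∀ n → (Vec A n → Carrier) → Carrier
    ΣBox xs zero    G = G []
    ΣBox xs (suc n) G = ΣL xs (λ x → ΣBox xs n (λ X → G (x ∷ X)))

    module _ {A : Set} (xs : List A) where

      ΣBox-cong : ∀ n {G H : Vec A n → Carrier} → (∀ X → VAll.All (_∈ xs) X → G X ≈ H X) → ΣBox xs n G ≈ ΣBox xs n H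
      ΣBox-cong zero    eq = eq [] VAll.[]
      ΣBox-cong (suc n) eq = Σ-cong∈ xs (λ i → ΣBox-cong n (λ X a → eq _ (i VAll.∷ a)))

      ΣBox-+ : ∀ n (G H : Vec A n → Carrier) → ΣBox xs n (λ X → G X + H X) ≈ ΣBox xs n G + ΣBox xs n H
      ΣBox-+ zero    G H = refl
      ΣBox-+ (suc n) G H = trans (Σ-cong xs (λ x → ΣBox-+ n (λ X → G (x ∷ X)) (λ X → H (x ∷ X)))) (Σ-+ xs _ _)

      ΣBox-0 : ∀ n → ΣBox xs n (λ _ → 0#) ≈ 0#
      ΣBox-0 zero    = refl
      ΣBox-0 (suc n) = Σ-0 xs (λ _ → ΣBox-0 n)

    ΣBox-↭ : ∀ {A : Set} {xs ys : List A} n (G : Vec A n → Carrier) → xs ↭ ys → ΣBox xs n G ≈ ΣBox ys n G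
    ΣBox-↭ zero    G p = refl
    ΣBox-↭ {ys = ys} (suc n) G p = trans (Σ-↭ _ p) (Σ-cong ys (λ x → ΣBox-↭ n (λ X → G (x ∷ X)) p))

    ΣBox-map : ∀ {A B : Set} (k : B → A) (xs : List B) n (G : Vec A n → Carrier) → ΣBox (map k xs) n G ≈ ΣBox xs n (λ X → G (V.map k X))
    ΣBox-map k xs zero    G = refl
    ΣBox-map k xs (suc n) G = trans (Σ-map k xs _) (Σ-cong xs (λ x → ΣBox-map k xs n (λ X → G (k x ∷ X))))

    indicator : {A : Set} → Dec A → Carrier
    indicator (yes _) = 1#
    indicator (no _)  = 0#

    indicator-cong : ∀ {A B : Set} (a : Dec A) (b : Dec B) → (A → B) → (B → A) → indicator a ≈ indicator b
    indicator-cong (yes _) (yes _) _ _ = refl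
    indicator-cong (no _)  (no _)  _ _ = refl
    indicator-cong (yes a) (no nb) f _ = contradiction (f a) nb
    indicator-cong (no na) (yes b) _ g = contradiction (g b) na

    count-filter : ∀ {A : Set} {P : A → Set} (P? : ∀ x → Dec (P x)) xs → nat (length (filter P? xs)) ≈ ΣL xs (λ x → indicator (P? x))
    count-filter P? []       = refl
    count-filter P? (x ∷ xs) with P? x
    ... | yes _ = +-congˡ (count-filter P? xs)
    ... | no _  = trans (count-filter P? xs) (sym (+-identityˡ _))

    infixr 8 _^^_
    _^^_ : ∀ {n} → Vec Carrier n → Vec ℕ n → Carrier
    []      ^^ []      = 1#
    (x ∷ X) ^^ (k ∷ e) = x ^ k * X ^^ e

    ^^-+ : ∀ {n} (X : Vec Carrier n) e f → X ^^ V.zipWith ℕ._+_ e f ≈ X ^^ e * X ^^ f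
    ^^-+ []      []      []      = sym (*-identityˡ 1#)
    ^^-+ (x ∷ X) (k ∷ e) (l ∷ f) = trans (*-cong (^-homo-* x k l) (^^-+ X e f)) (lem _ _ _ _)
      where
      lem : ∀ a b c d → a * b * (c * d) ≈ a * c * (b * d)
      lem = solve 4 (λ a b c d → a :* b :* (c :* d) := a :* c :* (b :* d)) refl

    ^^-* : ∀ {n} (X : Vec Carrier n) c e → X ^^ V.map (c ℕ.*_) e ≈ (X ^^ e) ^ c
    ^^-* []      c []      = sym (1^ c)
    ^^-* (x ∷ X) c (k ∷ e) = trans (*-cong (trans (^-congʳ x (ℕ.*-comm c k)) (sym (^-assocʳ x k c))) (^^-* X c e))
      (sym (^-distrib-* (x ^ k) (X ^^ e) c))

    ^^-0 : ∀ {n} (X : Vec Carrier n) → X ^^ V.replicate n 0 ≈ 1#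
    ^^-0 []      = refl
    ^^-0 (x ∷ X) = trans (*-identityˡ _) (^^-0 X)

    ΠL : {A : Set} → List A → (A → Carrier) → Carrier
    ΠL []       f = 1#
    ΠL (x ∷ xs) f = f x * ΠL xs f

    module _ {A : Set} where

      ΠL-cong∈ : ∀ (xs : List A) {f g} → (∀ {x} → x ∈ xs → f x ≈ g x) → ΠL xs f ≈ ΠL xs g
      ΠL-cong∈ []       eq = refl
      ΠL-cong∈ (x ∷ xs) eq = *-cong (eq (here ≡.refl)) (ΠL-cong∈ xs (λ i → eq (there i)))

      ΠL-* : ∀ (xs : List A) f g → ΠL xs (λ x → f x * g x) ≈ ΠL xs f * ΠL xs g
      ΠL-* []       f g = sym (*-identityˡ 1#)
      ΠL-* (x ∷ xs) f g = trans (*-congˡ (ΠL-* xs f g)) (lem (f x) (g x) (ΠL xs f) (ΠL xs g))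
        where
        lem : ∀ a b c d → a * b * (c * d) ≈ a * c * (b * d)
        lem = solve 4 (λ a b c d → a :* b :* (c :* d) := a :* c :* (b :* d)) refl

      ΠL-1 : ∀ (xs : List A) {f} → (∀ {x} → x ∈ xs → f x ≈ 1#) → ΠL xs f ≈ 1#
      ΠL-1 []       eq = refl
      ΠL-1 (x ∷ xs) eq = trans (*-cong (eq (here ≡.refl)) (ΠL-1 xs (λ i → eq (there i)))) (*-identityˡ 1#)

      ΠL-const : ∀ (xs : List A) c → ΠL xs (λ _ → c) ≈ c ^ length xs
      ΠL-const []       c = refl
      ΠL-const (x ∷ xs) c = *-congˡ (ΠL-const xs c)

      ΠL-↭ : ∀ {xs ys : List A} f → xs ↭ ys → ΠL xs f ≈ ΠL ys f
      ΠL-↭ f ↭.refl         = refl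
      ΠL-↭ f (↭.prep x p)   = *-congˡ (ΠL-↭ f p)
      ΠL-↭ f (↭.swap x y p) = trans (*-congˡ (*-congˡ (ΠL-↭ f p))) (lem (f x) (f y) _)
        where
        lem : ∀ a b c → a * (b * c) ≈ b * (a * c)
        lem = solve 3 (λ a b c → a :* (b :* c) := b :* (a :* c)) refl
      ΠL-↭ f (↭.trans p q)  = trans (ΠL-↭ f p) (ΠL-↭ f q)

      ΠL-map : ∀ {B : Set} (k : B → A) (xs : List B) f → ΠL (map k xs) f ≈ ΠL xs (λ x → f (k x))
      ΠL-map k []       f = refl
      ΠL-map k (x ∷ xs) f = *-congˡ (ΠL-map k xs f)

      ΠL-unique : ∀ {xs : List A} {a} f → Unique xs → a ∈ xs → (∀ {x} → x ∈ xs → ¬ x ≡ a → f x ≈ 1#) → ΠL xs f ≈ f a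
      ΠL-unique {x ∷ xs} f (u ∷ us) (here ≡.refl) z =
        trans (*-congˡ (ΠL-1 xs (λ i → z (there i) (λ e → All.lookup u i (≡.sym e))))) (*-identityʳ _)
      ΠL-unique {x ∷ xs} f (u ∷ us) (there i) z =
        trans (*-cong (z (here ≡.refl) (All.lookup u i)) (ΠL-unique f us i (λ j → z (there j)))) (*-identityˡ _)

    ΠN : ℕ → (ℕ → Carrier) → Carrier
    ΠN zero    f = 1#
    ΠN (suc n) f = ΠN n f * f n

    ΠN-cong : ∀ n {f g} → (∀ i → i ℕ.< n → f i ≈ g i) → ΠN n f ≈ ΠN n g
    ΠN-cong zero    e = refl
    ΠN-cong (suc n) e = *-cong (ΠN-cong n (λ i i<n → e i (ℕ.m<n⇒m<1+n i<n))) (e n ℕ.≤-refl)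

    ΠN-* : ∀ n f g → ΠN n (λ i → f i * g i) ≈ ΠN n f * ΠN n g
    ΠN-* zero    f g = sym (*-identityˡ 1#)
    ΠN-* (suc n) f g = trans (*-congʳ (ΠN-* n f g)) (lem _ _ _ _)
      where
      lem : ∀ a b c d → a * b * (c * d) ≈ a * c * (b * d)
      lem = solve 4 (λ a b c d → a :* b :* (c :* d) := a :* c :* (b :* d)) refl

    ΠN-1 : ∀ n {f} → (∀ i → i ℕ.< n → f i ≈ 1#) → ΠN n f ≈ 1#
    ΠN-1 zero    e = refl
    ΠN-1 (suc n) e = trans (*-cong (ΠN-1 n (λ i i<n → e i (ℕ.m<n⇒m<1+n i<n))) (e n ℕ.≤-refl)) (*-identityˡ 1#)

    ΠN-single : ∀ n {f j} → j ℕ.< n → (∀ i → i ℕ.< n → ¬ i ≡ j → f i ≈ 1#) → ΠN n f ≈ f j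
    ΠN-single (suc n) {f} {j} j<n e with j ℕ.≟ n
    ... | yes ≡.refl = trans (*-congʳ (ΠN-1 n (λ i i<n → e i (ℕ.m<n⇒m<1+n i<n) (ℕ.<⇒≢ i<n)))) (*-identityˡ _)
    ... | no j≢n = trans (*-cong (ΠN-single n (ℕ.≤∧≢⇒< (ℕ.s≤s⁻¹ j<n) j≢n) (λ i i<n → e i (ℕ.m<n⇒m<1+n i<n)))
        (e n ℕ.≤-refl (λ n≡j → j≢n (≡.sym n≡j)))) (*-identityʳ _)

    Unit : Carrier → Set
    Unit x = ∃ λ v → x * v ≈ 1#

    Unit-cancel : ∀ {x y} → Unit x → x * y ≈ 0# → y ≈ 0#
    Unit-cancel {x} {y} (v , e) xy = begin
      y           ≈⟨ *-identityˡ y ⟨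
      1# * y      ≈⟨ *-congʳ e ⟨
      x * v * y   ≈⟨ lem x v y ⟩
      v * (x * y) ≈⟨ *-congˡ xy ⟩
      v * 0#      ≈⟨ zeroʳ v ⟩
      0#          ∎
      where
      open ≈R
      lem : ∀ x v y → x * v * y ≈ v * (x * y)
      lem = solve 3 (λ x v y → x :* v :* y := v :* (x :* y)) refl

    Unit-cong : ∀ {x y} → x ≈ y → Unit x → Unit y
    Unit-cong e (v , xv) = v , trans (*-congʳ (sym e)) xv

    Unit-* : ∀ {x y} → Unit x → Unit y → Unit (x * y)
    Unit-* {x} {y} (v , e) (w , e′) = v * w , trans (lem x y v w) (trans (*-cong e e′) (*-identityˡ 1#))
      where
      lem : ∀ x y v w → x * y * (v * w) ≈ x * v * (y * w)
      lem = solve 4 (λ x y v w → x :* y :* (v :* w) := x :* v :* (y :* w)) refl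

    Unit-neg : ∀ {x y} → Unit (x - y) → Unit (y - x)
    Unit-neg {x} {y} (v , e) = - v , trans (lem x y v) e
      where
      lem : ∀ x y v → (y - x) * - v ≈ (x - y) * v
      lem = solve 3 (λ x y v → (y :- x) :* :- v := (x :- y) :* v) refl

    Σ-single : ∀ {xs t} f → AllPairs (λ x y → Unit (x - y)) xs → t ∈ xs →
      (∀ {x} → x ∈ xs → Unit (x - t) → f x ≈ 0#) → ΣL xs f ≈ f t
    Σ-single {x ∷ xs} f (u ∷ us) (here ≡.refl) z =
      trans (+-congˡ (Σ-0 xs (λ {y} i → z (there i) (Unit-neg (All.lookup u i))))) (+-identityʳ _)
    Σ-single {x ∷ xs} f (u ∷ us) (there i) z =
      trans (+-cong (z (here ≡.refl) (All.lookup u i)) (Σ-single f us i (λ j → z (there j)))) (+-identityˡ _)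

    Σ-unique : ∀ {A : Set} {xs : List A} {a} (f : A → Carrier) → Unique xs → a ∈ xs →
      (∀ {x} → x ∈ xs → ¬ x ≡ a → f x ≈ 0#) → ΣL xs f ≈ f a
    Σ-unique {xs = x ∷ xs} f (u ∷ us) (here ≡.refl) z =
      trans (+-congˡ (Σ-0 xs (λ i → z (there i) (λ e → All.lookup u i (≡.sym e))))) (+-identityʳ _)
    Σ-unique {xs = x ∷ xs} f (u ∷ us) (there i) z =
      trans (+-cong (z (here ≡.refl) (All.lookup u i)) (Σ-unique f us i (λ j → z (there j)))) (+-identityˡ _)

    -- Unit differences take the place of inequality: they allow cancellation in a ring with zero
    -- divisors such as ℤ_q / p^N, so that roots can be counted there as over a field.
    Separated : List Carrier → Set
    Separated = AllPairs (λ x y → Unit (x - y))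

    separate : ∀ {xs s t} → Separated xs → s ∈ xs → t ∈ xs → s ≈ t ⊎ Unit (s - t)
    separate (u ∷ us) (here ≡.refl) (here ≡.refl) = inj₁ refl
    separate (u ∷ us) (here ≡.refl) (there j)     = inj₂ (All.lookup u j)
    separate (u ∷ us) (there i) (here ≡.refl)     = inj₂ (Unit-neg (All.lookup u i))
    separate (u ∷ us) (there i) (there j)         = separate us i j

    peval : List Carrier → Carrier → Carrier
    peval []       x = 0#
    peval (c ∷ cs) x = c + x * peval cs x

    private
      -- Horner's scheme: with c the polynomial of `cs`, these are the coefficients of (x c(x) - r
      -- c(r)) / (x - r).
      quot : Carrier → List Carrier → List Carrier
      quot r []       = []
      quot r (c ∷ cs) = peval (c ∷ cs) r ∷ quot r cs

      quot-eq : ∀ r cs x → (x - r) * peval (quot r cs) x ≈ x * peval cs x - r * peval cs r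
      quot-eq r []       x = lem x r
        where
        lem : ∀ x r → (x - r) * 0# ≈ x * 0# - r * 0#
        lem = solve 2 (λ x r → (x :- r) :* con (ℤ.+ 0) := x :* con (ℤ.+ 0) :- r :* con (ℤ.+ 0)) refl
      quot-eq r (c ∷ cs) x = trans (lem c x r (peval cs r) (peval (quot r cs) x))
        (trans (+-congˡ (*-congˡ (quot-eq r cs x))) (lem₂ c x r (peval cs x) (peval cs r)))
        where
        lem : ∀ c x r p q → (x - r) * (c + r * p + x * q) ≈ (x - r) * (c + r * p) + x * ((x - r) * q)
        lem = solve 5 (λ c x r p q → (x :- r) :* (c :+ r :* p :+ x :* q) := (x :- r) :* (c :+ r :* p) :+ x :* ((x :- r) :* q)) refl
        lem₂ : ∀ c x r px p → (x - r) * (c + r * p) + x * (x * px - r * p) ≈ x * (c + x * px) - r * (c + r * p)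
        lem₂ = solve 5 (λ c x r px p → (x :- r) :* (c :+ r :* p) :+ x :* (x :* px :- r :* p) := x :* (c :+ x :* px) :- r :* (c :+ r :* p)) refl

      length-quot : ∀ r cs → length (quot r cs) ≡ length cs
      length-quot r []       = ≡.refl
      length-quot r (c ∷ cs) = ≡.cong suc (length-quot r cs)

      peval-0 : ∀ {cs} → All (_≈ 0#) cs → ∀ x → peval cs x ≈ 0#
      peval-0 []       x = refl
      peval-0 (e ∷ es) x = trans (+-cong e (trans (*-congˡ (peval-0 es x)) (zeroʳ x))) (+-identityˡ 0#)

      quot-0 : ∀ r cs → All (_≈ 0#) (quot r cs) → All (_≈ 0#) cs
      quot-0 r []       []       = []
      quot-0 r (c ∷ cs) (e ∷ es) = trans (trans (sym (+-identityʳ c)) (+-congˡ (sym (trans (*-congˡ (peval-0 ih r)) (zeroʳ r))))) e ∷ ih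
        where ih = quot-0 r cs es

    -- Dividing by x - r for one root r leaves the other roots, since s - r is a unit for each of
    -- them; then induction on the degree.
    too-many-roots : ∀ cs rs → Separated rs → length cs ℕ.≤ length rs →
      (∀ {r} → r ∈ rs → peval cs r ≈ 0#) → All (_≈ 0#) cs
    too-many-roots []       rs       sep le root = []
    too-many-roots (c ∷ cs) (r ∷ rs) (u ∷ us) (s≤s le) root = c≈0 ∷ cs≈0
      where
      open ≈R
      qroot : ∀ {s} → s ∈ rs → peval (quot r cs) s ≈ 0#
      qroot {s} i = Unit-cancel (Unit-neg (All.lookup u i)) (begin
        (s - r) * peval (quot r cs) s         ≈⟨ quot-eq r cs s ⟩
        s * peval cs s - r * peval cs r       ≈⟨ lem c (s * peval cs s) (r * peval cs r) ⟩
        (c + s * peval cs s) - (c + r * peval cs r) ≈⟨ +-cong (root (there i)) (-‿cong (root (here ≡.refl))) ⟩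
        0# - 0#                               ≈⟨ -‿inverseʳ 0# ⟩
        0#                                    ∎)
        where
        lem : ∀ c a b → a - b ≈ (c + a) - (c + b)
        lem = solve 3 (λ c a b → a :- b := (c :+ a) :- (c :+ b)) refl
      cs≈0 = quot-0 r cs (too-many-roots (quot r cs) rs us (≡.subst (ℕ._≤ length rs) (≡.sym (length-quot r cs)) le) qroot)
      c≈0 = trans (trans (sym (+-identityʳ c)) (+-congˡ (sym (trans (*-congˡ (peval-0 cs≈0 r)) (zeroʳ r))))) (root (here ≡.refl))

    -- The polynomial x (x^(n+1) - 1) has degree n + 2, so more roots kill its leading coefficient
    -- 1. For Teichmüller elements this says that, unless the ring is zero, no exponent below q - 1
    -- annihilates all of T^*.
    x^n-1-roots : ∀ rs n → Separated rs → suc (suc n) ℕ.< length rs →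
      (∀ {r} → r ∈ rs → r ≈ 0# ⊎ r ^ suc n ≈ 1#) → 1# ≈ 0#
    x^n-1-roots rs n sep le root = last n (All.tail (All.tail
      (too-many-roots (0# ∷ - 1# ∷ mono n) rs sep (≡.subst (λ k → suc (suc k) ℕ.≤ length rs) (≡.sym (len n)) le) vanish)))
      where
      mono : ℕ → List Carrier
      mono zero    = 1# ∷ []
      mono (suc n) = 0# ∷ mono n
      len : ∀ n → length (mono n) ≡ suc n
      len zero    = ≡.refl
      len (suc n) = ≡.cong suc (len n)
      last : ∀ n → All (_≈ 0#) (mono n) → 1# ≈ 0#
      last zero    (e ∷ []) = e
      last (suc n) (_ ∷ es) = last n es
      eval : ∀ n x → peval (mono n) x ≈ x ^ n
      eval zero    x = trans (+-congˡ (zeroʳ x)) (+-identityʳ 1#)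
      eval (suc n) x = trans (+-identityˡ _) (*-congˡ (eval n x))
      vanish : ∀ {r} → r ∈ rs → peval (0# ∷ - 1# ∷ mono n) r ≈ 0#
      vanish {r} i = trans (+-identityˡ _) (trans (*-congˡ (+-congˡ (*-congˡ (eval n r)))) (h (root i)))
        where
        h : r ≈ 0# ⊎ r ^ suc n ≈ 1# → r * (- 1# + r * r ^ n) ≈ 0#
        h (inj₁ e) = trans (*-congʳ e) (zeroˡ _)
        h (inj₂ e) = trans (*-congˡ (trans (+-congˡ e) (-‿inverseˡ 1#))) (zeroʳ r)

    binomial : ∀ n x y → (x + y) ^ n ≈ ΣL (upTo (suc n)) (λ k → nat (n C k) * (x ^ k * y ^ (n ℕ.∸ k)))
    binomial n x y = trans (B.theorem n x y) (trans (conv (suc n) (λ i → i) F)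
        (Σ-cong (upTo (suc n)) (λ k → ×≈nat* (n C k) _)))
      where
      module B = Algebra.Properties.CommutativeSemiring.Binomial commutativeSemiring
      module S = Algebra.Properties.Semiring.Sum semiring
      F : ℕ → Carrier
      F k = (n C k) · (x ^ k * y ^ (n ℕ.∸ k))
      conv : ∀ m (k : ℕ → ℕ) F → S.sum {m} (λ i → F (k (toℕ i))) ≈ ΣL (applyUpTo k m) F
      conv zero    k F = refl
      conv (suc m) k F = +-congˡ (conv m (λ i → k (suc i)) F)

    private
      shiftUpTo : ∀ n (k : ℕ → ℕ) f → ΣL (applyUpTo k (suc n)) f ≈ ΣL (applyUpTo k n) f + f (k n)
      shiftUpTo zero    k f = +-comm _ _
      shiftUpTo (suc n) k f = trans (+-congˡ (shiftUpTo n (λ i → k (suc i)) f)) (sym (+-assoc _ _ _))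

    -- The mixed terms are divisible by p and also by x. The factor x is kept because `^p-lift`
    -- takes x divisible by a power of p and needs the product of both divisibilities.
    freshman : ∀ {p} → Prime p → ∀ x y → ∃ λ w → (x + y) ^ p ≈ x ^ p + y ^ p + nat p * (x * w)
    freshman {suc p} pp x y = ΣL (upTo p) W , (begin
      (x + y) ^ suc p                        ≈⟨ binomial (suc p) x y ⟩
      F 0 + ΣL (applyUpTo suc (suc p)) F     ≈⟨ +-congˡ (shiftUpTo p suc F) ⟩
      F 0 + (ΣL (applyUpTo suc p) F + F (suc p))
        ≈⟨ +-cong first (+-cong (trans (app p (λ i → i)) (trans (Σ-cong∈ (upTo p) middle)
            (trans (Σ-*ˡ (upTo p) (nat (suc p)) _) (*-congˡ (Σ-*ˡ (upTo p) x W))))) final) ⟩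
      y ^ suc p + (nat (suc p) * (x * ΣL (upTo p) W) + x ^ suc p)
        ≈⟨ lem (y ^ suc p) (nat (suc p) * (x * ΣL (upTo p) W)) (x ^ suc p) ⟩
      x ^ suc p + y ^ suc p + nat (suc p) * (x * ΣL (upTo p) W) ∎)
      where
      open ≈R
      lem : ∀ a b c → a + (b + c) ≈ c + a + b
      lem = solve 3 (λ a b c → a :+ (b :+ c) := c :+ a :+ b) refl
      F : ℕ → Carrier
      F k = nat (suc p C k) * (x ^ k * y ^ (suc p ℕ.∸ k))
      quotient : ∀ k → ∃ λ c → suc k ℕ.< suc p → suc p C suc k ≡ c ℕ.* suc p
      quotient k with suc k ℕ.<? suc p
      ... | no n = 0 , λ l → contradiction l n
      ... | yes l with Nats.p∣pCk pp k l
      ... | divides c e = c , λ _ → e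
      W : ℕ → Carrier
      W k = nat (proj₁ (quotient k)) * (x ^ k * y ^ (p ℕ.∸ k))
      app : ∀ n (k : ℕ → ℕ) → ΣL (applyUpTo (λ i → suc (k i)) n) F ≈ ΣL (applyUpTo k n) (λ i → F (suc i))
      app zero    k = refl
      app (suc n) k = +-congˡ (app n (λ i → k (suc i)))
      middle : ∀ {k} → k ∈ upTo p → F (suc k) ≈ nat (suc p) * (x * W k)
      middle {k} i = trans (*-congʳ (trans (nat-cong (proj₂ (quotient k) (s≤s (∈-upTo⁻ i)))) (nat-* (proj₁ (quotient k)) (suc p))))
        (l2 (nat (proj₁ (quotient k))) (nat (suc p)) x (x ^ k) (y ^ (p ℕ.∸ k)))
        where
        l2 : ∀ c q x a b → c * q * (x * a * b) ≈ q * (x * (c * (a * b)))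
        l2 = solve 5 (λ c q x a b → c :* q :* (x :* a :* b) := q :* (x :* (c :* (a :* b)))) refl
      first : F 0 ≈ y ^ suc p
      first = trans (*-cong nat-1 (*-identityˡ _)) (*-identityˡ _)
      final : F (suc p) ≈ x ^ suc p
      final = trans (*-cong (trans (nat-cong (nCn≡1 (suc p))) nat-1)
        (trans (*-congˡ (^-congʳ y (ℕ.n∸n≡0 p))) (*-identityʳ _))) (*-identityˡ _)

    infix 4 _∣ᵣ_
    _∣ᵣ_ : Carrier → Carrier → Set
    c ∣ᵣ x = ∃ λ z → x ≈ c * z

    infix 4 _≡_mod_
    record _≡_mod_ (x y : Carrier) (n : ℕ) : Set where
      constructor _,_
      field
        factor : Carrier
        proof  : x ≈ y + nat n * factor

    ≈⇒≡ : ∀ {n x y} → x ≈ y → x ≡ y mod n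
    ≈⇒≡ {n} {x} {y} e = 0# , trans e (sym (trans (+-congˡ (zeroʳ (nat n))) (+-identityʳ y)))

    ≡-trans : ∀ {n x y z} → x ≡ y mod n → y ≡ z mod n → x ≡ z mod n
    ≡-trans {n} {x} {y} {z} (a , e) (b , e′) = b + a , trans e (trans (+-congʳ e′) (lem z (nat n) a b))
      where
      lem : ∀ z n a b → z + n * b + n * a ≈ z + n * (b + a)
      lem = solve 4 (λ z n a b → z :+ n :* b :+ n :* a := z :+ n :* (b :+ a)) refl

    ≡-sym : ∀ {n x y} → x ≡ y mod n → y ≡ x mod n
    ≡-sym {n} {x} {y} (a , e) = - a , trans (lem y (nat n) a) (+-congʳ (sym e))
      where
      lem : ∀ y n a → y ≈ y + n * a + n * - a
      lem = solve 3 (λ y n a → y := y :+ n :* a :+ n :* :- a) refl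

    ≡-+ : ∀ {n x y z w} → x ≡ y mod n → z ≡ w mod n → x + z ≡ y + w mod n
    ≡-+ {n} {x} {y} {z} {w} (a , e) (b , e′) = a + b , trans (+-cong e e′) (lem y w (nat n) a b)
      where
      lem : ∀ y w n a b → y + n * a + (w + n * b) ≈ y + w + n * (a + b)
      lem = solve 5 (λ y w n a b → y :+ n :* a :+ (w :+ n :* b) := y :+ w :+ n :* (a :+ b)) refl

    ≡-* : ∀ {n x y z w} → x ≡ y mod n → z ≡ w mod n → x * z ≡ y * w mod n
    ≡-* {n} {x} {y} {z} {w} (a , e) (b , e′) = a * w + y * b + nat n * a * b , trans (*-cong e e′) (lem y w (nat n) a b)
      where
      lem : ∀ y w n a b → (y + n * a) * (w + n * b) ≈ y * w + n * (a * w + y * b + n * a * b)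
      lem = solve 5 (λ y w n a b → (y :+ n :* a) :* (w :+ n :* b) := y :* w :+ n :* (a :* w :+ y :* b :+ n :* a :* b)) refl

    ≡-^ : ∀ {n x y} k → x ≡ y mod n → x ^ k ≡ y ^ k mod n
    ≡-^ zero    e = ≈⇒≡ refl
    ≡-^ (suc k) e = ≡-* e (≡-^ k e)

    ≡-Σ : ∀ {n} {A : Set} (xs : List A) {f g : A → Carrier} → (∀ {x} → x ∈ xs → f x ≡ g x mod n) → ΣL xs f ≡ ΣL xs g mod n
    ≡-Σ []       e = ≈⇒≡ refl
    ≡-Σ (x ∷ xs) e = ≡-+ (e (here ≡.refl)) (≡-Σ xs (λ i → e (there i)))

    ≡-Π : ∀ {n} {A : Set} (xs : List A) {f g : A → Carrier} → (∀ {x} → x ∈ xs → f x ≡ g x mod n) → ΠL xs f ≡ ΠL xs g mod n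
    ≡-Π []       e = ≈⇒≡ refl
    ≡-Π (x ∷ xs) e = ≡-* (e (here ≡.refl)) (≡-Π xs (λ i → e (there i)))

    module _ {p} (pp : Prime p) where

      freshman-Σ : ∀ {A : Set} (xs : List A) f → ΣL xs f ^ p ≡ ΣL xs (λ x → f x ^ p) mod p
      freshman-Σ []       f = ≈⇒≡ (0^ (ℕ.<⇒≤ (ℕ.nonTrivial⇒n>1 p {{prime⇒nonTrivial pp}})))
      freshman-Σ (x ∷ xs) f with freshman pp (f x) (ΣL xs f)
      ... | w , e = ≡-trans (f x * w , e) (≡-+ (≈⇒≡ refl) (freshman-Σ xs f))

      -- Expand (P z + y)^p with P = p^(k+1). The mixed terms carry p P, and (P z)^p carries P^2,
      -- hence p P as well; p ≥ 2 is matched on so that two factors P become visible.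
      ^p-lift : ∀ k {x y} → x ≡ y mod p ℕ.^ suc k → x ^ p ≡ y ^ p mod p ℕ.^ suc (suc k)
      ^p-lift k {x} {y} (z , e) = go p ≡.refl (proj₁ fr) (proj₂ fr)
        where
        open ≈R
        P = nat (p ℕ.^ suc k)
        fr = freshman pp (P * z) y
        go : ∀ p′ → p′ ≡ p → ∀ w → (P * z + y) ^ p ≈ (P * z) ^ p + y ^ p + nat p * (P * z * w) → x ^ p ≡ y ^ p mod p ℕ.^ suc (suc k)
        go zero ≡.refl = contradiction (ℕ.nonTrivial⇒n>1 0 {{prime⇒nonTrivial pp}}) λ ()
        go (suc zero) ≡.refl = contradiction (ℕ.nonTrivial⇒n>1 1 {{prime⇒nonTrivial pp}}) λ { (s≤s ()) }
        go (suc (suc p″)) ≡.refl w fr = nat (p ℕ.^ k) * (z * (z * (P * z) ^ p″)) + z * w , (begin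
          x ^ p                                            ≈⟨ ^-congˡ p (trans e (+-comm y _)) ⟩
          (P * z + y) ^ p                                  ≈⟨ fr ⟩
          P * z * (P * z * (P * z) ^ p″) + y ^ p + nat p * (P * z * w)
            ≈⟨ +-congʳ (+-congʳ (*-congʳ (*-congʳ (nat-* p (p ℕ.^ k))))) ⟩
          nat p * nat (p ℕ.^ k) * z * (P * z * (P * z) ^ p″) + y ^ p + nat p * (P * z * w)
            ≈⟨ lem (nat p) (nat (p ℕ.^ k)) z P ((P * z) ^ p″) (y ^ p) w ⟩
          y ^ p + nat p * P * (nat (p ℕ.^ k) * (z * (z * (P * z) ^ p″)) + z * w)
            ≈⟨ +-congˡ (*-congʳ (nat-* p (p ℕ.^ suc k))) ⟨
          y ^ p + nat (p ℕ.^ suc (suc k)) * (nat (p ℕ.^ k) * (z * (z * (P * z) ^ p″)) + z * w) ∎)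
          where
          lem : ∀ p q z P t y w → p * q * z * (P * z * t) + y + p * (P * z * w) ≈ y + p * P * (q * (z * (z * t)) + z * w)
          lem = solve 7 (λ p q z P t y w → p :* q :* z :* (P :* z :* t) :+ y :+ p :* (P :* z :* w) := y :+ p :* P :* (q :* (z :* (z :* t)) :+ z :* w)) refl

      ^p^-lift : ∀ i k {x y} → x ≡ y mod p ℕ.^ suc k → x ^ (p ℕ.^ i) ≡ y ^ (p ℕ.^ i) mod p ℕ.^ (i ℕ.+ suc k)
      ^p^-lift zero    k {x} {y} (z , e) = z , trans (*-identityʳ x) (trans e (+-congʳ (sym (*-identityʳ y))))
      ^p^-lift (suc i) k {x} {y} e with ^p^-lift i (suc k) (^p-lift k e)
      ... | z , e′ = z , trans (sym (^-assocʳ x p (p ℕ.^ i))) (trans e′ (+-cong (^-assocʳ y p (p ℕ.^ i))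
              (*-congʳ (nat-cong (≡.cong (p ℕ.^_) (ℕ.+-suc i (suc k)))))))

    module Nilpotent {p} (pp : Prime p) (N : ℕ) (p^N≈0 : nat (p ℕ.^ N) ≈ 0#) where

      private
        -- The truncated geometric series for 1 / (1 + x). For x = p z the error term disappears at
        -- n = N.
        partial : ∀ x n → ∃ λ v → ∃ λ w → (1# + x) * v ≈ 1# + x ^ n * w
        partial x zero    = 0# , - 1# , lem x
          where
          lem : ∀ x → (1# + x) * 0# ≈ 1# + 1# * - 1#
          lem = solve 1 (λ x → (con (ℤ.+ 1) :+ x) :* con (ℤ.+ 0) := con (ℤ.+ 1) :+ con (ℤ.+ 1) :* :- con (ℤ.+ 1)) refl
        partial x (suc n) with partial x n
        ... | v , w , e = v - x ^ n * w , - w , trans (lem x v (x ^ n) w) (trans (+-congʳ e) (lem₂ x (x ^ n) w))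
          where
          lem : ∀ x v t w → (1# + x) * (v - t * w) ≈ (1# + x) * v - (1# + x) * (t * w)
          lem = solve 4 (λ x v t w → (con (ℤ.+ 1) :+ x) :* (v :- t :* w) := (con (ℤ.+ 1) :+ x) :* v :- (con (ℤ.+ 1) :+ x) :* (t :* w)) refl
          lem₂ : ∀ x t w → 1# + t * w - (1# + x) * (t * w) ≈ 1# + x * t * - w
          lem₂ = solve 3 (λ x t w → con (ℤ.+ 1) :+ t :* w :- (con (ℤ.+ 1) :+ x) :* (t :* w) := con (ℤ.+ 1) :+ x :* t :* :- w) refl

      1+p*-unit : ∀ z → Unit (1# + nat p * z)
      1+p*-unit z with partial (nat p * z) N
      ... | v , w , e = v , trans e (trans (+-congˡ (trans (*-congʳ
              (trans (^-distrib-* (nat p) z N) (trans (*-congʳ (trans (sym (nat-^ p N)) p^N≈0)) (zeroˡ _)))) (zeroˡ w))) (+-identityʳ 1#))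

      Unit-mod : ∀ {x y} → x ≡ y mod p → Unit y → Unit x
      Unit-mod {x} {y} (z , e) (v , yv) = let (w , e′) = 1+p*-unit (v * z) in v * w , (begin
        x * (v * w)                    ≈⟨ *-congʳ e ⟩
        (y + nat p * z) * (v * w)      ≈⟨ lem y (nat p) z v w ⟩
        (y * v + nat p * (v * z)) * w  ≈⟨ *-congʳ (+-congʳ yv) ⟩
        (1# + nat p * (v * z)) * w     ≈⟨ e′ ⟩
        1#                             ∎)
        where
        open ≈R
        lem : ∀ y p z v w → (y + p * z) * (v * w) ≈ (y * v + p * (v * z)) * w
        lem = solve 5 (λ y p z v w → (y :+ p :* z) :* (v :* w) := (y :* v :+ p :* (v :* z)) :* w) refl

      p∤⇒unit : ∀ n → ¬ p ∣ n → Unit (nat n)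
      p∤⇒unit n nd with coprime-Bézout {p} {n} cop
        where
        cop : Coprime p n
        cop {d} (d∣p , d∣n) with prime⇒irreducible pp d∣p
        ... | inj₁ e = e
        ... | inj₂ ≡.refl = contradiction d∣n nd
      ... | Bézout.+- x y e = - (nat y * proj₁ u) , (begin
          nat n * - (nat y * v)     ≈⟨ lem (nat n) (nat y) v ⟩
          - (nat y * nat n) * v     ≈⟨ *-congʳ (lem₂ (nat y * nat n)) ⟩
          (1# - (1# + nat y * nat n)) * v ≈⟨ *-congʳ (+-congˡ (-‿cong (trans (+-congˡ (sym (nat-* y n))) (trans (nat-cong e) (nat-* x p))))) ⟩
          (1# - nat x * nat p) * v  ≈⟨ *-congʳ (lem₃ (nat x) (nat p)) ⟩
          (1# + nat p * - nat x) * v ≈⟨ proj₂ u ⟩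
          1#                        ∎)
        where
        open ≈R
        u = 1+p*-unit (- nat x)
        v = proj₁ u
        lem : ∀ n y v → n * - (y * v) ≈ - (y * n) * v
        lem = solve 3 (λ n y v → n :* :- (y :* v) := :- (y :* n) :* v) refl
        lem₂ : ∀ a → - a ≈ 1# - (1# + a)
        lem₂ = solve 1 (λ a → :- a := con (ℤ.+ 1) :- (con (ℤ.+ 1) :+ a)) refl
        lem₃ : ∀ x p → 1# - x * p ≈ 1# + p * - x
        lem₃ = solve 2 (λ x p → con (ℤ.+ 1) :- x :* p := con (ℤ.+ 1) :+ p :* :- x) refl
      ... | Bézout.-+ x y e = nat y * proj₁ u , (begin
          nat n * (nat y * v)     ≈⟨ lem (nat n) (nat y) v ⟩
          nat y * nat n * v       ≈⟨ *-congʳ (trans (sym (nat-* y n)) (trans (nat-cong (≡.sym e)) (+-congˡ (trans (nat-* x p) (*-comm _ _))))) ⟩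
          (1# + nat p * nat x) * v ≈⟨ proj₂ u ⟩
          1#                      ∎)
        where
        open ≈R
        u = 1+p*-unit (nat x)
        v = proj₁ u
        lem : ∀ n y v → n * (y * v) ≈ y * n * v
        lem = solve 3 (λ n y v → n :* (y :* v) := y :* n :* v) refl

open RingTheory

-- The group algebra of O/ϖO, its dilations and its linear functionals.

module GroupAlgebras where

  open import Level using (0ℓ)
  open import Algebra.Bundles using (CommutativeRing)
  open import Data.List using (List; []; _∷_; _++_; map; concatMap)
  open import Data.Product using (Σ; ∃; _×_; _,_)

  -- The group algebra O[O/ϖO]; [ x ] is the basis element of the class of x.
  record GroupAlgebra (O : CommutativeRing 0ℓ 0ℓ) (ϖ : CommutativeRing.Carrier O) : Set₁ where
    private module O = CommutativeRing O
    field
      B : CommutativeRing 0ℓ 0ℓ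
    open CommutativeRing B
    field
      ι      : O.Carrier → Carrier
      ι-cong : ∀ {c d} → c O.≈ d → ι c ≈ ι d
      ι-+    : ∀ c d → ι (c O.+ d) ≈ ι c + ι d
      ι-*    : ∀ c d → ι (c O.* d) ≈ ι c * ι d
      ι-1    : ι O.1# ≈ 1#
      [_]     : O.Carrier → Carrier
      []-cong : ∀ {x y} → x O.≈ y → [ x ] ≈ [ y ]
      []-+    : ∀ x y → [ x O.+ y ] ≈ [ x ] * [ y ]
      []-0    : [ O.0# ] ≈ 1#
      []-ϖ    : ∀ x → [ ϖ O.* x ] ≈ 1#
      induction : (P : Carrier → Set) → (∀ {x y} → x ≈ y → P x → P y) → P 0# →
        (∀ {x y} → P x → P y → P (x + y)) → (∀ c x → P (ι c * [ x ])) → ∀ b → P b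
      -- Functoriality under x ↦ s x, for any s: units of T give the torus action, s = p gives Ψ,
      -- and s = 0 is the augmentation.
      α      : O.Carrier → Carrier → Carrier
      α-cong : ∀ s {x y} → x ≈ y → α s x ≈ α s y
      α-+    : ∀ s x y → α s (x + y) ≈ α s x + α s y
      α-*    : ∀ s x y → α s (x * y) ≈ α s x * α s y
      α-ι    : ∀ s c → α s (ι c) ≈ ι c
      α-[]   : ∀ s x → α s [ x ] ≈ [ s O.* x ]
      -- A function on classes modulo ϖ extends linearly. With the indicator of the class of 0, a
      -- sum of elements `[ f(X) ]` becomes the number of zeros of f.
      functional : (φ : O.Carrier → O.Carrier) → (∀ {x y} → x O.≈ y → φ x O.≈ φ y) →
        (∀ x y → φ (x O.+ ϖ O.* y) O.≈ φ x) →
        ∃ λ (L : Carrier → O.Carrier) → (∀ {x y} → x ≈ y → L x O.≈ L y) ×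
          (∀ x y → L (x + y) O.≈ L x O.+ L y) × (∀ c x → L (ι c * x) O.≈ c O.* L x) × (∀ x → L [ x ] O.≈ φ x)

  -- Formal sums Σ c [ x ], identified when all ϖ-periodic functions agree on them: no quotient of O is needed.
  module GroupAlgebraConstruction (O : CommutativeRing 0ℓ 0ℓ) (ϖ : CommutativeRing.Carrier O) where
    open RingFacts O

    record Test : Set where
      field
        φ      : Carrier → Carrier
        cong   : ∀ {x y} → x ≈ y → φ x ≈ φ y
        period : ∀ x y → φ (x + ϖ * y) ≈ φ x
    open Test

    Elem : Set
    Elem = List (Carrier × Carrier)

    ev : Elem → (Carrier → Carrier) → Carrier
    ev b f = ΣL b (λ { (c , x) → c * f x })

    infix 4 _≋_
    _≋_ : Elem → Elem → Set
    b ≋ b′ = ∀ t → ev b (φ t) ≈ ev b′ (φ t)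

    ev-cong : ∀ b {f g} → (∀ x → f x ≈ g x) → ev b f ≈ ev b g
    ev-cong b e = Σ-cong b (λ { (c , x) → *-congˡ (e x) })

    shift : Carrier → Test → Test
    shift x t = record
      { φ      = λ y → φ t (x + y)
      ; cong   = λ e → cong t (+-congˡ e)
      ; period = λ y z → trans (cong t (sym (+-assoc x y (ϖ * z)))) (period t (x + y) z) }

    dilate : Carrier → Test → Test
    dilate s t = record
      { φ      = λ y → φ t (s * y)
      ; cong   = λ e → cong t (*-congˡ e)
      ; period = λ x y → trans (cong t (lem s x ϖ y)) (period t (s * x) (s * y)) }
      where
      lem : ∀ s x w y → s * (x + w * y) ≈ s * x + w * (s * y)
      lem = solve 4 (λ s x w y → s :* (x :+ w :* y) := s :* x :+ w :* (s :* y)) refl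

    _⊛_ : Elem → Elem → Elem
    b ⊛ b′ = concatMap (λ { (c , x) → map (λ { (d , y) → c * d , x + y }) b′ }) b

    -- The transpose of multiplication by b, acting on test functions. Since the result is periodic
    -- again, `_≋_` can be applied to it, and ring laws for `_⊛_` reduce to laws of addition in O.
    convolve : Elem → Test → Test
    convolve b t = record
      { φ      = λ x → ev b (λ y → φ t (x + y))
      ; cong   = λ e → ev-cong b (λ y → cong t (+-congʳ e))
      ; period = λ x z → ev-cong b (λ y → trans (cong t (lem x (ϖ * z) y)) (period t (x + y) z)) }
      where
      lem : ∀ x w y → x + w + y ≈ x + y + w
      lem = solve 3 (λ x w y → x :+ w :+ y := x :+ y :+ w) refl

    ev-⊛ : ∀ b b′ t → ev (b ⊛ b′) (φ t) ≈ ev b (φ (convolve b′ t))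
    ev-⊛ b b′ t = trans (Σ-concatMap _ b _) (Σ-cong b (λ { (c , x) → trans (Σ-map _ b′ _)
      (trans (Σ-cong b′ (λ { (d , y) → *-assoc c d _ })) (Σ-*ˡ b′ c _)) }))

    neg : Elem → Elem
    neg = map (λ { (c , x) → - c , x })

    one : Elem
    one = (1# , 0#) ∷ []

    ev-one : ∀ t → ev one (φ t) ≈ φ t 0#
    ev-one t = trans (+-identityʳ _) (*-identityˡ _)

    ev-neg : ∀ b f → ev (neg b) f ≈ - ev b f
    ev-neg b f = trans (Σ-map _ b _) (trans (Σ-cong b (λ { (c , x) → sym (-‿distribˡ-* c (f x)) })) (Σ-neg b _))

    dil : Carrier → Elem → Elem
    dil s = map (λ { (c , x) → c , s * x })

    ev-dil : ∀ s b t → ev (dil s b) (φ t) ≈ ev b (φ (dilate s t))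
    ev-dil s b t = Σ-map _ b _

    ⊛-comm : ∀ b b′ → b ⊛ b′ ≋ b′ ⊛ b
    ⊛-comm b b′ t = begin
      ev (b ⊛ b′) (φ t)                                              ≈⟨ ev-⊛ b b′ t ⟩
      ΣL b (λ { (c , x) → c * ev b′ (λ y → φ t (x + y)) })           ≈⟨ Σ-cong b (λ { (c , x) → sym (Σ-*ˡ b′ c _) }) ⟩
      ΣL b (λ { (c , x) → ΣL b′ (λ { (d , y) → c * (d * φ t (x + y)) }) })
        ≈⟨ Σ-swap b b′ _ ⟩
      ΣL b′ (λ { (d , y) → ΣL b (λ { (c , x) → c * (d * φ t (x + y)) }) })
        ≈⟨ Σ-cong b′ (λ { (d , y) → trans (Σ-cong b (λ { (c , x) → trans (*-congˡ (*-congˡ (cong t (+-comm x y)))) (lem c d _) })) (Σ-*ˡ b d _) }) ⟩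
      ev b′ (φ (convolve b t))                                       ≈⟨ ev-⊛ b′ b t ⟨
      ev (b′ ⊛ b) (φ t)                                              ∎
      where
      open ≈R
      lem : ∀ c d z → c * (d * z) ≈ d * (c * z)
      lem = solve 3 (λ c d z → c :* (d :* z) := d :* (c :* z)) refl

    ⊛-cong : ∀ {a b c d} → a ≋ b → c ≋ d → a ⊛ c ≋ b ⊛ d
    ⊛-cong {a} {b} {c} {d} ab cd t = begin
      ev (a ⊛ c) (φ t)           ≈⟨ ev-⊛ a c t ⟩
      ev a (φ (convolve c t))    ≈⟨ ev-cong a (λ x → cd (shift x t)) ⟩
      ev a (φ (convolve d t))    ≈⟨ ab (convolve d t) ⟩
      ev b (φ (convolve d t))    ≈⟨ ev-⊛ b d t ⟨
      ev (b ⊛ d) (φ t)           ∎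
      where open ≈R

    ⊛-assoc : ∀ a b c → (a ⊛ b) ⊛ c ≋ a ⊛ (b ⊛ c)
    ⊛-assoc a b c t = begin
      ev ((a ⊛ b) ⊛ c) (φ t)                   ≈⟨ ev-⊛ (a ⊛ b) c t ⟩
      ev (a ⊛ b) (φ (convolve c t))            ≈⟨ ev-⊛ a b (convolve c t) ⟩
      ev a (φ (convolve b (convolve c t)))     ≈⟨ ev-cong a (λ x → ev-cong b (λ y → ev-cong c (λ z → cong t (+-assoc x y z)))) ⟩
      ev a (λ x → ev b (φ (convolve c (shift x t)))) ≈⟨ ev-cong a (λ x → ev-⊛ b c (shift x t)) ⟨
      ev a (φ (convolve (b ⊛ c) t))            ≈⟨ ev-⊛ a (b ⊛ c) t ⟨
      ev (a ⊛ (b ⊛ c)) (φ t)                   ∎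
      where open ≈R

    ⊛-identityˡ : ∀ b → one ⊛ b ≋ b
    ⊛-identityˡ b t = trans (ev-⊛ one b t) (trans (ev-one (convolve b t)) (ev-cong b {λ x → φ t (0# + x)} {φ t} (λ x → cong t (+-identityˡ x))))

    ⊛-distribʳ : ∀ a b c → (b ++ c) ⊛ a ≋ (b ⊛ a) ++ (c ⊛ a)
    ⊛-distribʳ a b c t = trans (ev-⊛ (b ++ c) a t) (trans (Σ-++ b c _)
      (trans (+-cong (sym (ev-⊛ b a t)) (sym (ev-⊛ c a t))) (sym (Σ-++ (b ⊛ a) (c ⊛ a) _))))

    ++-cong : ∀ {a b c d} → a ≋ b → c ≋ d → a ++ c ≋ b ++ d
    ++-cong {a} {b} {c} {d} ab cd t = trans (Σ-++ a c _) (trans (+-cong (ab t) (cd t)) (sym (Σ-++ b d _)))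

    ++-comm′ : ∀ a b → a ++ b ≋ b ++ a
    ++-comm′ a b t = trans (Σ-++ a b _) (trans (+-comm _ _) (sym (Σ-++ b a _)))

    ++-assoc′ : ∀ a b c → (a ++ b) ++ c ≋ a ++ (b ++ c)
    ++-assoc′ a b c t = trans (Σ-++ (a ++ b) c _) (trans (+-congʳ (Σ-++ a b _)) (trans (+-assoc _ _ _)
      (trans (+-congˡ (sym (Σ-++ b c _))) (sym (Σ-++ a (b ++ c) _)))))

    neg-inverseˡ : ∀ b → neg b ++ b ≋ []
    neg-inverseˡ b t = trans (Σ-++ (neg b) b _) (trans (+-congʳ (ev-neg b _)) (-‿inverseˡ _))

    ≋-trans : ∀ {a b c} → a ≋ b → b ≋ c → a ≋ c
    ≋-trans ab bc t = trans (ab t) (bc t)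

    ≋-sym : ∀ {a b} → a ≋ b → b ≋ a
    ≋-sym ab t = sym (ab t)

    commutativeRing : CommutativeRing 0ℓ 0ℓ
    commutativeRing = record
      { Carrier = Elem ; _≈_ = _≋_ ; _+_ = _++_ ; _*_ = _⊛_ ; -_ = neg ; 0# = [] ; 1# = one
      ; isCommutativeRing = record
        { isRing = record
          { +-isAbelianGroup = record
            { isGroup = record
              { isMonoid = record
                { isSemigroup = record
                  { isMagma = record
                    { isEquivalence = record { refl = λ t → refl ; sym = λ {a} {b} → ≋-sym {a} {b} ; trans = λ {a} {b} {c} → ≋-trans {a} {b} {c} }
                    ; ∙-cong = λ {a} {b} {c} {d} → ++-cong {a} {b} {c} {d} }
                  ; assoc = ++-assoc′ }
                ; identity = (λ b t → refl) , (λ b → ++-comm′ b []) }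
              ; inverse = neg-inverseˡ , (λ b → ≋-trans {b ++ neg b} {neg b ++ b} {[]} (++-comm′ b (neg b)) (neg-inverseˡ b))
              ; ⁻¹-cong = λ {a} {b} ab t → trans (ev-neg a _) (trans (-‿cong (ab t)) (sym (ev-neg b _))) }
            ; comm = ++-comm′ }
          ; *-cong = λ {a} {b} {c} {d} → ⊛-cong {a} {b} {c} {d}
          ; *-assoc = ⊛-assoc
          ; *-identity = ⊛-identityˡ , (λ b → ≋-trans {b ⊛ one} {one ⊛ b} {b} (⊛-comm b one) (⊛-identityˡ b))
          ; distrib = (λ a b c → ≋-trans {a ⊛ (b ++ c)} {(b ++ c) ⊛ a} {(a ⊛ b) ++ (a ⊛ c)} (⊛-comm a (b ++ c))
                       (≋-trans {(b ++ c) ⊛ a} {(b ⊛ a) ++ (c ⊛ a)} {(a ⊛ b) ++ (a ⊛ c)} (⊛-distribʳ a b c)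
                         (++-cong {b ⊛ a} {a ⊛ b} {c ⊛ a} {a ⊛ c} (⊛-comm b a) (⊛-comm c a))))
                    , ⊛-distribʳ }
        ; *-comm = ⊛-comm } }

    single : Carrier → Carrier → Elem
    single c x = (c , x) ∷ []

    ev-single : ∀ c x f → ev (single c x) f ≈ c * f x
    ev-single c x f = +-identityʳ _

    single-cong : ∀ {c d x y} → c ≈ d → x ≈ y → single c x ≋ single d y
    single-cong {c} {d} {x} {y} cd xy t = +-congʳ (*-cong cd (cong t xy))

    single-⊛ : ∀ c x b t → ev (single c x ⊛ b) (φ t) ≈ c * ev b (λ y → φ t (x + y))
    single-⊛ c x b t = trans (ev-⊛ (single c x) b t) (ev-single c x (φ (convolve b t)))

    private
      0+0≈0 : 0# + 0# ≈ 0#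
      0+0≈0 = +-identityˡ 0#

    groupAlgebra : GroupAlgebra O ϖ
    groupAlgebra = record
      { B = commutativeRing
      ; ι = λ c → single c 0#
      ; ι-cong = λ e → single-cong e refl
      ; ι-+ = λ c d t → trans (+-congʳ (distribʳ _ c d)) (+-assoc _ _ _)
      ; ι-* = λ c d → single-cong refl (sym 0+0≈0)
      ; ι-1 = λ t → refl
      ; [_] = single 1#
      ; []-cong = single-cong refl
      ; []-+ = λ x y → single-cong (sym (*-identityˡ 1#)) refl
      ; []-0 = λ t → refl
      ; []-ϖ = λ x t → +-congʳ (*-congˡ (trans (cong t (sym (+-identityˡ _))) (period t 0# x)))
      ; induction = ind
      ; α = dil
      ; α-cong = λ s {x} {y} e t → trans (ev-dil s x t) (trans (e (dilate s t)) (sym (ev-dil s y t)))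
      ; α-+ = λ s x y t → trans (ev-dil s (x ++ y) t) (trans (Σ-++ x y _)
          (trans (+-cong (sym (ev-dil s x t)) (sym (ev-dil s y t))) (sym (Σ-++ (dil s x) (dil s y) _))))
      ; α-* = λ s x y t → dil-⊛ s x y t
      ; α-ι = λ s c → single-cong refl (zeroʳ s)
      ; α-[] = λ s x t → refl
      ; functional = λ f f-cong f-per →
          let t = record { φ = f ; cong = f-cong ; period = f-per }
          in (λ b → ev b f) , (λ e → e t) , (λ x y → Σ-++ x y _) ,
             (λ c b → trans (single-⊛ c 0# b t) (*-congˡ (ev-cong b {λ x → f (0# + x)} {f} (λ x → f-cong (+-identityˡ x))))) ,
             (λ x → trans (ev-single 1# x f) (*-identityˡ _))
      }
      where
      dil-⊛ : ∀ s x y t → ev (dil s (x ⊛ y)) (φ t) ≈ ev (dil s x ⊛ dil s y) (φ t)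
      dil-⊛ s x y t = begin
        ev (dil s (x ⊛ y)) (φ t)               ≈⟨ ev-dil s (x ⊛ y) t ⟩
        ev (x ⊛ y) (φ (dilate s t))            ≈⟨ ev-⊛ x y (dilate s t) ⟩
        ev x (φ (convolve y (dilate s t)))     ≈⟨ ev-cong x (λ u → trans (ev-cong y (λ v → cong t (distribˡ s u v))) (sym (ev-dil s y (shift (s * u) t)))) ⟩
        ev x (φ (dilate s (convolve (dil s y) t))) ≈⟨ ev-dil s x (convolve (dil s y) t) ⟨
        ev (dil s x) (φ (convolve (dil s y) t)) ≈⟨ ev-⊛ (dil s x) (dil s y) t ⟨
        ev (dil s x ⊛ dil s y) (φ t)           ∎
        where open ≈R
      ind : (P : Elem → Set) → (∀ {x y} → x ≋ y → P x → P y) → P [] →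
        (∀ {x y} → P x → P y → P (x ++ y)) → (∀ c x → P (single c 0# ⊛ single 1# x)) → ∀ b → P b
      ind P r p0 p+ pg [] = p0
      ind P r p0 p+ pg ((c , x) ∷ b) = p+ {single c x} {b}
        (r {single c 0# ⊛ single 1# x} {single c x} (single-cong (*-identityʳ c) (+-identityˡ x)) (pg c x))
        (ind P r p0 p+ pg b)

open GroupAlgebras

-- Power sums and character orthogonality on the Teichmüller set.

module TeichmüllerSets where

  open import Level using (0ℓ)
  open import Algebra.Bundles using (CommutativeRing)
  import Data.Integer as ℤ
  open import Data.Nat as ℕ using (ℕ; zero; suc; s≤s; z≤n; s≤s⁻¹)
  open import Data.Nat.Combinatorics using (_C_)
  open import Data.List.Membership.Propositional.Properties using (∈-upTo⁻; ∈-upTo⁺)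
  open import Data.List.Relation.Unary.Unique.Propositional.Properties using (upTo⁺)
  import Data.Nat.Properties as ℕ
  import Data.Nat.DivMod as ℕ
  open import Data.Nat.Divisibility using (_∣_; divides; ∣1⇒≡1; ∣m+n∣m⇒∣n; m%n≡0⇒n∣m; m∣m*n)
  open import Data.Nat.Primality using (Prime; prime⇒nonTrivial)
  open import Data.List using (List; []; _∷_; upTo; applyUpTo; length)
  open import Data.List.Properties using (length-upTo)
  open import Data.List.Membership.Propositional using (_∈_)
  open import Data.List.Relation.Unary.Any using (here; there)
  open import Data.List.Relation.Binary.Pointwise using (Pointwise)
  open import Data.List.Relation.Binary.Permutation.Propositional using (_↭_)
  open import Data.Product using (∃; _×_; _,_; proj₁; proj₂)
  open import Data.Sum using (_⊎_; inj₁; inj₂)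
  open import Relation.Nullary using (¬_; yes; no; contradiction)
  open import Relation.Binary.PropositionalEquality as ≡ using (_≡_)

  -- O plays the role of ℤ_q / p^N ℤ_q.
  record TeichmüllerSystem (O : CommutativeRing 0ℓ 0ℓ) (p h Q′ N : ℕ) : Set where
    open RingFacts O
    field
      prime     : Prime p
      q≡        : p ℕ.^ h ≡ suc (suc Q′)
      p^N≈0     : nat (p ℕ.^ N) ≈ 0#
      ts        : List Carrier
      separated : Separated ts
      size      : length ts ≡ p ℕ.^ h
      zero∈     : ∃ λ z → z ∈ ts × z ≈ 0#
      one∈      : ∃ λ z → z ∈ ts × z ≈ 1#
      *-closed  : ∀ {s t} → s ∈ ts → t ∈ ts → ∃ λ u → u ∈ ts × u ≈ s * t
      fermat    : ∀ {t} → t ∈ ts → t ≈ 0# ⊎ t ^ suc Q′ ≈ 1#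
      rotate    : ∀ {u} → u ∈ ts → u ^ suc Q′ ≈ 1# →
                  ∃ λ ts′ → ts′ ↭ ts × Pointwise (λ t t′ → u * t ≈ t′) ts ts′
      decompose : ∀ x → ∃ λ t → t ∈ ts × ∃ λ y → x ≈ t + nat p * y

  module PowerSums (O : CommutativeRing 0ℓ 0ℓ) (p h Q′ N : ℕ) (D : TeichmüllerSystem O p h Q′ N) where
    open TeichmüllerSystem D
    open Residues Q′
    open RingFacts O

    1≈0⇒ : 1# ≈ 0# → ∀ x → x ≈ 0#
    1≈0⇒ e x = trans (sym (*-identityˡ x)) (trans (*-congʳ e) (zeroˡ x))

    ^Q∣ : ∀ {t n} → t ^ Q ≈ 1# → Q ∣ n → t ^ n ≈ 1#
    ^Q∣ {t} e (divides k ≡.refl) = trans (^-congʳ t (ℕ.*-comm k Q)) (trans (sym (^-assocʳ t Q k)) (trans (^-congˡ k e) (1^ k)))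

    -- Only the residue of the exponent matters for a (q-1)-th root of unity. Positivity is for t =
    -- 0, where 0^0 = 1 would break the equality.
    ^∼ : ∀ {t a b} → t ∈ ts → 1 ℕ.≤ a → 1 ℕ.≤ b → a ∼ b → t ^ a ≈ t ^ b
    ^∼ {t} {a} {b} i 1≤a 1≤b e with fermat i
    ... | inj₁ t0 = trans (trans (^-congˡ a t0) (0^ 1≤a)) (sym (trans (^-congˡ b t0) (0^ 1≤b)))
    ... | inj₂ t1 = trans (mod a) (trans (^-congʳ t e) (sym (mod b)))
      where
      mod : ∀ a → t ^ a ≈ t ^ (a ℕ.% Q)
      mod a = trans (^-congʳ t (ℕ.m≡m%n+[m/n]*n a Q)) (trans (^-homo-* t (a ℕ.% Q) _)
        (trans (*-congˡ (^Q∣ t1 (divides (a ℕ./ Q) ≡.refl))) (*-identityʳ _)))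

    ^-closed : ∀ {t} n → t ∈ ts → ∃ λ u → u ∈ ts × u ≈ t ^ n
    ^-closed zero    i = one∈
    ^-closed (suc n) i with ^-closed n i
    ... | u , j , e with *-closed i j
    ... | v , k , e′ = v , k , trans e′ (*-congˡ e)

    S : ℕ → Carrier
    S n = ΣL ts (_^ n)

    S-0 : S 0 ≈ nat (p ℕ.^ h)
    S-0 = trans (Σ-const ts) (nat-cong size)

    private
      -- Equality in O is not decided. Up to `_≈_` both x^n and 1 are members of `ts`, so `separate`
      -- tells whether they agree or differ by a unit.
      search : ∀ n xs → (∀ {x} → x ∈ xs → x ∈ ts) →
        (∀ {x} → x ∈ xs → x ≈ 0# ⊎ x ^ n ≈ 1#) ⊎ ∃ λ x → x ∈ ts × x ^ Q ≈ 1# × Unit (x ^ n - 1#)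
      search n []       sub = inj₁ (λ ())
      search n (x ∷ xs) sub with search n xs (λ i → sub (there i))
      ... | inj₂ r = inj₂ r
      ... | inj₁ f with fermat (sub (here ≡.refl))
      ... | inj₁ x0 = inj₁ λ { (here ≡.refl) → inj₁ x0 ; (there i) → f i }
      ... | inj₂ x1 with ^-closed n (sub (here ≡.refl)) | one∈
      ... | u , i , e | o , j , eo with separate separated i j
      ... | inj₁ eq = inj₁ λ { (here ≡.refl) → inj₂ (trans (sym e) (trans eq eo)) ; (there i) → f i }
      ... | inj₂ un = inj₂ (x , sub (here ≡.refl) , x1 , Unit-cong (+-cong e (-‿cong eo)) un)

    -- If u^n - 1 is a unit for some u in T^*, then multiplying the summation variable by u gives
    -- u^n S n = S n, and S n vanishes. If there is no such u, all q elements are roots of x (x^r -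
    -- 1) with r = n mod Q, whose degree is below q; the ring is then zero.
    S-zero : ∀ {n} → 1 ℕ.≤ n → ¬ Q ∣ n → S n ≈ 0#
    S-zero {n} 1≤n nd with search n ts (λ i → i)
    ... | inj₁ f with n ℕ.% Q in eq | ℕ.m%n<n n Q
    ...   | zero | _ = contradiction (m%n≡0⇒n∣m n Q eq) nd
    ...   | suc k | lt = 1≈0⇒ (x^n-1-roots ts k separated (≡.subst (suc (suc k) ℕ.<_) (≡.sym (≡.trans size q≡)) (s≤s lt)) root) (S n)
      where
      root : ∀ {r} → r ∈ ts → r ≈ 0# ⊎ r ^ suc k ≈ 1#
      root i with f i
      ... | inj₁ e = inj₁ e
      ... | inj₂ e = inj₂ (trans (^∼ i (s≤s z≤n) 1≤n (≡.trans (ℕ.m<n⇒m%n≡m lt) (≡.sym eq))) e)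
    S-zero {n} 1≤n nd | inj₂ (u , i , u1 , un) with rotate i u1
    ... | ts′ , perm , pw = Unit-cancel un (begin
      (u ^ n - 1#) * S n       ≈⟨ lem (u ^ n) (S n) ⟩
      u ^ n * S n - S n        ≈⟨ +-congʳ (Σ-*ˡ ts (u ^ n) (_^ n)) ⟨
      ΣL ts (λ t → u ^ n * t ^ n) - S n ≈⟨ +-congʳ (trans (Σ-pointwise (Pointwise-map pw)) (Σ-↭ (_^ n) perm)) ⟩
      S n - S n                ≈⟨ -‿inverseʳ (S n) ⟩
      0#                       ∎)
      where
      open ≈R
      lem : ∀ a s → (a - 1#) * s ≈ a * s - s
      lem = solve 2 (λ a s → (a :- con (ℤ.+ 1)) :* s := a :* s :- s) refl
      Pointwise-map : ∀ {xs ys} → Pointwise (λ t t′ → u * t ≈ t′) xs ys → Pointwise (λ t t′ → u ^ n * t ^ n ≈ t′ ^ n) xs ys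
      Pointwise-map Pointwise.[] = Pointwise.[]
      Pointwise-map (e Pointwise.∷ es) = trans (sym (^-distrib-* u _ n)) (^-congˡ n e) Pointwise.∷ Pointwise-map es

    -- On `ts` the function 1 - t^n is the indicator of 0. The value is Q and not q as in `S-0`,
    -- where 0^0 = 1 counts too; variables of exponent 0 must therefore be kept apart from those
    -- whose exponent is a positive multiple of Q.
    S-full : ∀ {n} → 1 ℕ.≤ n → Q ∣ n → S n ≈ nat Q
    S-full {n} 1≤n d with zero∈
    ... | z , i , z0 = begin
      S n                                        ≈⟨ Σ-cong ts (λ t → lem (t ^ n)) ⟩
      ΣL ts (λ t → 1# - (1# - t ^ n))            ≈⟨ Σ-- ts _ _ ⟩
      ΣL ts (λ _ → 1#) - ΣL ts (λ t → 1# - t ^ n) ≈⟨ +-cong (trans (Σ-const ts) (nat-cong (≡.trans size q≡)))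
                                                     (-‿cong (trans (Σ-single _ separated i away) (+-congˡ (-‿cong (trans (^-congˡ n z0) (0^ 1≤n)))))) ⟩
      1# + nat Q - (1# - 0#)                     ≈⟨ lem₂ (nat Q) ⟩
      nat Q                                      ∎
      where
      open ≈R
      lem : ∀ a → a ≈ 1# - (1# - a)
      lem = solve 1 (λ a → a := con (ℤ.+ 1) :- (con (ℤ.+ 1) :- a)) refl
      lem₂ : ∀ a → 1# + a - (1# - 0#) ≈ a
      lem₂ = solve 1 (λ a → con (ℤ.+ 1) :+ a :- (con (ℤ.+ 1) :- con (ℤ.+ 0)) := a) refl
      away : ∀ {x} → x ∈ ts → Unit (x - z) → 1# - x ^ n ≈ 0#
      away {x} j (v , e) with fermat j
      ... | inj₁ x0 = 1≈0⇒ (trans (sym e) (trans (*-congʳ (trans (+-cong x0 (-‿cong z0)) (-‿inverseʳ 0#))) (zeroˡ v))) _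
      ... | inj₂ x1 = trans (+-congˡ (-‿cong (^Q∣ x1 d))) (-‿inverseʳ 1#)

    open Nilpotent prime N p^N≈0 public

    Q-unit : Unit (nat Q)
    Q-unit = p∤⇒unit Q λ p∣Q → ℕ.nonTrivial⇒≢1 {{prime⇒nonTrivial prime}} (∣1⇒≡1 (∣m+n∣m⇒∣n′ p∣Q))
      where
      p∣q : ∀ h → p ℕ.^ h ≡ suc Q → p ∣ suc Q
      p∣q (suc h) e = ≡.subst (p ∣_) e (m∣m*n (p ℕ.^ h))
      ∣m+n∣m⇒∣n′ : p ∣ Q → p ∣ 1
      ∣m+n∣m⇒∣n′ d = ∣m+n∣m⇒∣n (≡.subst (p ∣_) (ℕ.+-comm 1 Q) (p∣q h q≡)) d

    ν : Carrier
    ν = proj₁ Q-unit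

    νQ : nat Q * ν ≈ 1#
    νQ = proj₂ Q-unit

    -- The sum of s^(-r) t^r over all characters r = 1, ..., q - 1 of T^*, where the exponent `neg`
    -- makes it vanish at s = 0 as well.
    orthogonality : Carrier → Carrier → Carrier
    orthogonality s t = ΣL (upTo Q) (λ i → s ^ neg (suc i) * t ^ suc i)

    private
      telescope : ∀ v n (k : ℕ) → (v - 1#) * ΣL (applyUpTo (ℕ._+_ k) n) (λ i → v ^ suc i) ≈ v ^ suc (k ℕ.+ n) - v ^ suc k
      telescope v zero k = trans (zeroʳ _) (sym (trans (+-congʳ (^-congʳ v (≡.cong suc (ℕ.+-identityʳ k)))) (-‿inverseʳ _)))
      telescope v (suc n) k = begin
        (v - 1#) * (v ^ suc (k ℕ.+ 0) + ΣL (applyUpTo (λ i → k ℕ.+ suc i) n) (λ i → v ^ suc i))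
          ≈⟨ *-congˡ (+-cong (^-congʳ v (≡.cong suc (ℕ.+-identityʳ k))) (reindex n (λ i → k ℕ.+ suc i) (λ i → suc k ℕ.+ i) (ℕ.+-suc k))) ⟩
        (v - 1#) * (v ^ suc k + ΣL (applyUpTo (ℕ._+_ (suc k)) n) (λ i → v ^ suc i))
          ≈⟨ distribˡ _ _ _ ⟩
        (v - 1#) * v ^ suc k + (v - 1#) * ΣL (applyUpTo (ℕ._+_ (suc k)) n) (λ i → v ^ suc i)
          ≈⟨ +-congˡ (telescope v n (suc k)) ⟩
        (v - 1#) * v ^ suc k + (v ^ suc (suc k ℕ.+ n) - v ^ suc (suc k))
          ≈⟨ +-congˡ (+-congʳ (^-congʳ v (≡.cong suc (≡.sym (ℕ.+-suc k n))))) ⟩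
        (v - 1#) * v ^ suc k + (v ^ suc (k ℕ.+ suc n) - v * v ^ suc k)
          ≈⟨ lem v (v ^ suc k) _ ⟩
        v ^ suc (k ℕ.+ suc n) - v ^ suc k ∎
        where
        open ≈R
        lem : ∀ v a b → (v - 1#) * a + (b - v * a) ≈ b - a
        lem = solve 3 (λ v a b → (v :- con (ℤ.+ 1)) :* a :+ (b :- v :* a) := b :- a) refl
        reindex : ∀ n (f g : ℕ → ℕ) → (∀ i → f i ≡ g i) → ∀ {F : ℕ → Carrier} → ΣL (applyUpTo f n) F ≈ ΣL (applyUpTo g n) F
        reindex zero    f g e = refl
        reindex (suc n) f g e {F} = +-cong (reflexive (≡.cong F (e 0))) (reindex n (λ i → f (suc i)) (λ i → g (suc i)) (λ i → e (suc i)))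

      as-powers : ∀ {s} t → s ^ Q ≈ 1# → orthogonality s t ≈ ΣL (upTo Q) (λ i → (s ^ Q′ * t) ^ suc i)
      as-powers {s} t s1 = Σ-cong (upTo Q) λ i → begin
        s ^ neg (suc i) * t ^ suc i                ≈⟨ *-congʳ (^-homo-* s (Q′ ℕ.* suc i) Q) ⟩
        s ^ (Q′ ℕ.* suc i) * s ^ Q * t ^ suc i     ≈⟨ *-congʳ (trans (*-congˡ s1) (*-identityʳ _)) ⟩
        s ^ (Q′ ℕ.* suc i) * t ^ suc i             ≈⟨ *-congʳ (^-assocʳ s Q′ (suc i)) ⟨
        (s ^ Q′) ^ suc i * t ^ suc i               ≈⟨ ^-distrib-* (s ^ Q′) t (suc i) ⟨
        (s ^ Q′ * t) ^ suc i                       ∎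
        where open ≈R

    orthogonal-0 : ∀ {s t} → s ≈ 0# → orthogonality s t ≈ 0#
    orthogonal-0 s0 = Σ-0 (upTo Q) λ {i} _ → trans (*-congʳ (trans (^-congˡ (neg (suc i)) s0) (0^ (1≤neg (suc i))))) (zeroˡ _)

    orthogonal-≢ : ∀ {s t} → s ∈ ts → t ∈ ts → Unit (s - t) → orthogonality s t ≈ 0#
    orthogonal-≢ {s} {t} i j un with fermat i
    ... | inj₁ s0 = orthogonal-0 s0
    ... | inj₂ s1 = trans (as-powers t s1) (Unit-cancel v-1-unit (trans (telescope v Q 0) vQ))
      where
      open ≈R
      -- This is t / s because s^Q = 1. The sum is the geometric series v + ... + v^Q; it is killed
      -- by v - 1 since v^(Q+1) = v, also for t = 0, and s (v - 1) = t - s is a unit.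
      v = s ^ Q′ * t
      vQ : v ^ suc Q - v ^ 1 ≈ 0#
      vQ with fermat j
      ... | inj₁ t0 = trans (+-cong (trans (*-congʳ v0) (zeroˡ _)) (-‿cong (trans (*-congʳ v0) (zeroˡ _)))) (-‿inverseʳ 0#)
        where
        v0 : v ≈ 0#
        v0 = trans (*-congˡ t0) (zeroʳ _)
      ... | inj₂ t1 = trans (+-congʳ (*-congˡ (trans (^-distrib-* (s ^ Q′) t Q)
              (trans (*-cong (trans (^-assocʳ s Q′ Q) (^Q∣ s1 (divides Q′ ≡.refl))) t1) (*-identityˡ 1#))))) (-‿inverseʳ _)
      v-1-unit : Unit (v - 1#)
      v-1-unit with Unit-neg un
      ... | w , e = s * w , (begin
        (v - 1#) * (s * w)                ≈⟨ lem s (s ^ Q′) t w ⟩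
        (s * s ^ Q′ * t - s) * w          ≈⟨ *-congʳ (+-congʳ (trans (*-congʳ s1) (*-identityˡ t))) ⟩
        (t - s) * w                       ≈⟨ e ⟩
        1#                                ∎)
        where
        lem : ∀ s a t w → (a * t - 1#) * (s * w) ≈ (s * a * t - s) * w
        lem = solve 4 (λ s a t w → (a :* t :- con (ℤ.+ 1)) :* (s :* w) := (s :* a :* t :- s) :* w) refl

    orthogonal-≡ : ∀ {t} → t ^ Q ≈ 1# → orthogonality t t ≈ nat Q
    orthogonal-≡ {t} t1 = trans (as-powers t t1) (trans
      (Σ-cong (upTo Q) (λ i → trans (^-congˡ (suc i) (trans (*-comm _ t) t1)) (1^ (suc i))))
      (trans (Σ-const (upTo Q)) (nat-cong (length-upTo Q))))

    defect : Carrier → Carrier → ℕ → Carrier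
    defect t t′ r = (t + t′) ^ r - t ^ r - t′ ^ r

    -- The Fourier coefficient of `defect` at a pair of characters. In the ranges used it extracts
    -- from (t + t′)^r the coefficient of t^a t′^b, multiplied by Q^2; the two pure powers
    -- contribute nothing for 1 ≤ a, b < Q.
    defectSum : ℕ → ℕ → ℕ → Carrier
    defectSum a b r = ΣL ts (λ t → ΣL ts (λ t′ → t ^ neg a * t′ ^ neg b * defect t t′ r))

    private
      S-neg+ : ∀ a k → ΣL ts (λ t → t ^ neg a * t ^ k) ≈ S (neg a ℕ.+ k)
      S-neg+ a k = Σ-cong ts (λ t → sym (^-homo-* t (neg a) k))

      S-neg+-vanish : ∀ {a k} → 1 ℕ.≤ a → a ℕ.< Q → k ℕ.≤ Q → ¬ k ≡ a → S (neg a ℕ.+ k) ≈ 0#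
      S-neg+-vanish {a} {k} 1≤a a<Q k≤Q ne = S-zero (ℕ.≤-trans (1≤neg a) (ℕ.m≤m+n (neg a) k)) λ d → ne (same (∼-neg {a} {k} d))
        where
        same : k ∼ a → k ≡ a
        same e with ℕ.m≤n⇒m<n∨m≡n k≤Q
        ... | inj₁ k<Q = ≡.trans (≡.sym (ℕ.m<n⇒m%n≡m k<Q)) (≡.trans e (ℕ.m<n⇒m%n≡m a<Q))
        ... | inj₂ ≡.refl = contradiction (≡.trans (≡.sym (ℕ.n%n≡0 Q)) (≡.trans e (ℕ.m<n⇒m%n≡m a<Q))) (ℕ.<⇒≢ 1≤a)

      S-neg-vanish : ∀ {a} → 1 ℕ.≤ a → a ℕ.< Q → ΣL ts (λ t → t ^ neg a) ≈ 0#
      S-neg-vanish {a} 1≤a a<Q = trans (reflexive (≡.cong S (≡.sym (ℕ.+-identityʳ (neg a)))))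
        (S-neg+-vanish 1≤a a<Q z≤n (ℕ.<⇒≢ 1≤a))

      defectSum-expand : ∀ {a b} → 1 ℕ.≤ a → a ℕ.< Q → 1 ℕ.≤ b → b ℕ.< Q → ∀ r →
        defectSum a b r ≈ ΣL (upTo (suc r)) (λ k → nat (r C k) * (S (neg a ℕ.+ k) * S (neg b ℕ.+ (r ℕ.∸ k))))
      defectSum-expand {a} {b} 1≤a a<Q 1≤b b<Q r = begin
        defectSum a b r
          ≈⟨ Σ-cong ts (λ t → trans (Σ-cong ts (λ t′ → lem _ _ _ _ _)) (trans (Σ-- ts _ _) (+-congʳ (Σ-- ts _ _)))) ⟩
        ΣL ts (λ t → ΣL ts (λ t′ → t ^ neg a * t′ ^ neg b * (t + t′) ^ r) - ΣL ts (λ t′ → (t ^ neg a * t ^ r) * t′ ^ neg b)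
          - ΣL ts (λ t′ → t ^ neg a * (t′ ^ neg b * t′ ^ r)))
          ≈⟨ trans (Σ-- ts _ _) (+-congʳ (Σ-- ts _ _)) ⟩
        ΣL ts (λ t → ΣL ts (λ t′ → t ^ neg a * t′ ^ neg b * (t + t′) ^ r)) - ΣL ts (λ t → ΣL ts (λ t′ → (t ^ neg a * t ^ r) * t′ ^ neg b))
          - ΣL ts (λ t → ΣL ts (λ t′ → t ^ neg a * (t′ ^ neg b * t′ ^ r)))
          ≈⟨ +-cong (+-congˡ (-‿cong (trans (sym (Σ-product ts ts _ _)) (trans (*-congˡ (S-neg-vanish 1≤b b<Q)) (zeroʳ _)))))
               (-‿cong (trans (sym (Σ-product ts ts _ _)) (trans (*-congʳ (S-neg-vanish 1≤a a<Q)) (zeroˡ _)))) ⟩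
        ΣL ts (λ t → ΣL ts (λ t′ → t ^ neg a * t′ ^ neg b * (t + t′) ^ r)) - 0# - 0#
          ≈⟨ lem₀ _ ⟩
        ΣL ts (λ t → ΣL ts (λ t′ → t ^ neg a * t′ ^ neg b * (t + t′) ^ r))
          ≈⟨ Σ-cong ts (λ t → Σ-cong ts (λ t′ → trans (*-congˡ (binomial r t t′)) (trans (sym (Σ-*ˡ (upTo (suc r)) _ _))
               (Σ-cong (upTo (suc r)) (λ k → lem₁ _ _ _ _ _))))) ⟩
        ΣL ts (λ t → ΣL ts (λ t′ → ΣL (upTo (suc r)) (λ k → nat (r C k) * ((t ^ neg a * t ^ k) * (t′ ^ neg b * t′ ^ (r ℕ.∸ k))))))
          ≈⟨ trans (Σ-cong ts (λ t → Σ-swap ts (upTo (suc r)) _)) (Σ-swap ts (upTo (suc r)) _) ⟩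
        ΣL (upTo (suc r)) (λ k → ΣL ts (λ t → ΣL ts (λ t′ → nat (r C k) * ((t ^ neg a * t ^ k) * (t′ ^ neg b * t′ ^ (r ℕ.∸ k))))))
          ≈⟨ Σ-cong (upTo (suc r)) (λ k → trans (Σ-cong ts (λ t → Σ-*ˡ ts _ _)) (trans (Σ-*ˡ ts _ _)
               (*-congˡ (trans (sym (Σ-product ts ts _ _)) (*-cong (S-neg+ a k) (S-neg+ b (r ℕ.∸ k))))))) ⟩
        ΣL (upTo (suc r)) (λ k → nat (r C k) * (S (neg a ℕ.+ k) * S (neg b ℕ.+ (r ℕ.∸ k)))) ∎
        where
        open ≈R
        lem : ∀ a b x y z → a * b * (x - y - z) ≈ a * b * x - a * y * b - a * (b * z)
        lem = solve 5 (λ a b x y z → a :* b :* (x :- y :- z) := a :* b :* x :- a :* y :* b :- a :* (b :* z)) refl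
        lem₀ : ∀ a → a - 0# - 0# ≈ a
        lem₀ = solve 1 (λ a → a :- con (ℤ.+ 0) :- con (ℤ.+ 0) := a) refl
        lem₁ : ∀ a b c x y → a * b * (c * (x * y)) ≈ c * ((a * x) * (b * y))
        lem₁ = solve 5 (λ a b c x y → a :* b :* (c :* (x :* y)) := c :* ((a :* x) :* (b :* y))) refl

    -- For r ≤ Q both exponents k and r - k lie in [0, Q], where congruence to a and b forces
    -- equality; so a surviving term would have r = a + b.
    defectSum-≢ : ∀ {a b} → 1 ℕ.≤ a → a ℕ.< Q → 1 ℕ.≤ b → b ℕ.< Q → ∀ {r} → r ℕ.≤ Q → ¬ r ≡ a ℕ.+ b → defectSum a b r ≈ 0#
    defectSum-≢ {a} {b} 1≤a a<Q 1≤b b<Q {r} r≤Q ne = trans (defectSum-expand 1≤a a<Q 1≤b b<Q r) (Σ-0 (upTo (suc r)) vanish)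
      where
      vanish : ∀ {k} → k ∈ upTo (suc r) → nat (r C k) * (S (neg a ℕ.+ k) * S (neg b ℕ.+ (r ℕ.∸ k))) ≈ 0#
      vanish {k} i with k ℕ.≟ a
      ... | no k≢a = trans (*-congˡ (trans (*-congʳ (S-neg+-vanish 1≤a a<Q (ℕ.≤-trans (s≤s⁻¹ (∈-upTo⁻ i)) r≤Q) k≢a)) (zeroˡ _))) (zeroʳ _)
      ... | yes ≡.refl = trans (*-congˡ (trans (*-congˡ (S-neg+-vanish 1≤b b<Q (ℕ.≤-trans (ℕ.m∸n≤m r k) r≤Q)
              (λ e → ne (≡.trans (≡.sym (ℕ.m+[n∸m]≡n (s≤s⁻¹ (∈-upTo⁻ i)))) (≡.cong (k ℕ.+_) e))))) (zeroʳ _))) (zeroʳ _)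

    defectSum-≡ : ∀ {a b} → 1 ℕ.≤ a → a ℕ.< Q → 1 ℕ.≤ b → b ℕ.< Q →
      defectSum a b (a ℕ.+ b) ≈ nat ((a ℕ.+ b) C a) * (nat Q * nat Q)
    defectSum-≡ {a} {b} 1≤a a<Q 1≤b b<Q = trans (defectSum-expand 1≤a a<Q 1≤b b<Q (a ℕ.+ b))
      (trans (Σ-unique _ (upTo⁺ (suc (a ℕ.+ b))) (∈-upTo⁺ (s≤s (ℕ.m≤m+n a b))) vanish)
        (*-congˡ (*-cong (full {a} {a} 1≤a ≡.refl) (trans (reflexive (≡.cong (λ z → S (neg b ℕ.+ z)) (ℕ.m+n∸m≡n a b))) (full {b} {b} 1≤b ≡.refl)))))
      where
      full : ∀ {a k} → 1 ℕ.≤ a → k ∼ a → S (neg a ℕ.+ k) ≈ nat Q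
      full {a} {k} _ e = S-full (ℕ.≤-trans (1≤neg a) (ℕ.m≤m+n (neg a) k)) (neg-∼ {a} {k} e)
      vanish : ∀ {k} → k ∈ upTo (suc (a ℕ.+ b)) → ¬ k ≡ a →
        nat ((a ℕ.+ b) C k) * (S (neg a ℕ.+ k) * S (neg b ℕ.+ (a ℕ.+ b ℕ.∸ k))) ≈ 0#
      vanish {k} i k≢a with k ℕ.≤? Q
      ... | yes k≤Q = trans (*-congˡ (trans (*-congʳ (S-neg+-vanish 1≤a a<Q k≤Q k≢a)) (zeroˡ _))) (zeroʳ _)
      -- For k > Q congruence of k to a proves nothing, but the complementary exponent a + b - k is
      -- then smaller than b and makes the other factor vanish.
      ... | no k≰Q = trans (*-congˡ (trans (*-congˡ (S-neg+-vanish 1≤b b<Q small (ℕ.<⇒≢ lt))) (zeroʳ _))) (zeroʳ _)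
        where
        lt : a ℕ.+ b ℕ.∸ k ℕ.< b
        lt = ℕ.+-cancelˡ-< k _ _ (ℕ.≤-<-trans (ℕ.≤-reflexive (ℕ.m+[n∸m]≡n (s≤s⁻¹ (∈-upTo⁻ i)))) (ℕ.+-monoˡ-< b (ℕ.<-trans a<Q (ℕ.≰⇒> k≰Q))))
        small : a ℕ.+ b ℕ.∸ k ℕ.≤ Q
        small = ℕ.≤-trans (ℕ.<⇒≤ lt) (ℕ.<⇒≤ b<Q)

open TeichmüllerSets

-- Eigenvectors of the torus action and the Frobenius congruence.

module FrobeniusEigenvectors where

  open import Level using (0ℓ)
  open import Algebra.Bundles using (CommutativeRing)
  import Data.Integer as ℤ
  open import Data.Nat as ℕ using (ℕ; zero; suc)
  import Data.Nat.Properties as ℕ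
  import Data.Nat.DivMod as ℕ
  open import Data.Nat.Divisibility using (_∣_; m∣m*n)
  open import Data.List using (List; []; _∷_; upTo)
  open import Data.List.Membership.Propositional using (_∈_)
  open import Data.List.Relation.Unary.Any using (here; there)
  import Data.List.Relation.Unary.All as All
  import Data.List.Relation.Unary.AllPairs as AP
  open import Data.List.Relation.Binary.Pointwise as Pointwise using (Pointwise)
  open import Data.Product using (_,_)
  open import Data.Sum using (_⊎_; inj₁; inj₂)
  open import Relation.Binary.PropositionalEquality as ≡ using (_≡_)

  -- The modulus of the argument of [_] is p^m with m = suc μ.
  module Eigenvectors (O : CommutativeRing 0ℓ 0ℓ) (p h Q′ N : ℕ) (D : TeichmüllerSystem O p h Q′ N)
    (μ : ℕ) (GA : GroupAlgebra O (RingFacts.nat O (p ℕ.^ suc μ))) where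
    private module O = RingFacts O
    open TeichmüllerSystem D
    open Residues Q′
    open Powers p h prime q≡
    private module PS = PowerSums O p h Q′ N D
    open PS using (ν; νQ)
    open GroupAlgebra GA
    open RingFacts B

    ι-0 : ι O.0# ≈ 0#
    ι-0 = +-cancelˡ (ι O.0#) _ _ (trans (sym (ι-+ O.0# O.0#)) (trans (ι-cong (O.+-identityʳ O.0#)) (sym (+-identityʳ _))))

    ι-neg : ∀ c → ι (O.- c) ≈ - ι c
    ι-neg c = +-cancelˡ (ι c) _ _ (trans (sym (ι-+ c (O.- c))) (trans (ι-cong (O.-‿inverseʳ c)) (trans ι-0 (sym (-‿inverseʳ _)))))

    ι-nat : ∀ n → ι (O.nat n) ≈ nat n
    ι-nat zero    = ι-0
    ι-nat (suc n) = trans (ι-+ O.1# (O.nat n)) (+-cong ι-1 (ι-nat n))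

    ι-^ : ∀ c n → ι (c O.^ n) ≈ ι c ^ n
    ι-^ c zero    = ι-1
    ι-^ c (suc n) = trans (ι-* c (c O.^ n)) (*-congˡ (ι-^ c n))

    ι-Σ : ∀ {A : Set} (xs : List A) f → ι (O.ΣL xs f) ≈ ΣL xs (λ x → ι (f x))
    ι-Σ []       f = ι-0
    ι-Σ (x ∷ xs) f = trans (ι-+ (f x) (O.ΣL xs f)) (+-congˡ (ι-Σ xs f))

    α-0 : ∀ s → α s 0# ≈ 0#
    α-0 s = trans (α-cong s (sym ι-0)) (trans (α-ι s O.0#) ι-0)

    α-1 : ∀ s → α s 1# ≈ 1#
    α-1 s = trans (α-cong s (sym ι-1)) (trans (α-ι s O.1#) ι-1)

    α-nat : ∀ s n → α s (nat n) ≈ nat n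
    α-nat s n = trans (α-cong s (sym (ι-nat n))) (trans (α-ι s (O.nat n)) (ι-nat n))

    α-neg : ∀ s x → α s (- x) ≈ - α s x
    α-neg s x = +-cancelˡ (α s x) _ _ (trans (sym (α-+ s x (- x))) (trans (α-cong s (-‿inverseʳ x)) (trans (α-0 s) (sym (-‿inverseʳ _)))))

    α-^ : ∀ s x n → α s (x ^ n) ≈ α s x ^ n
    α-^ s x zero    = α-1 s
    α-^ s x (suc n) = trans (α-* s x (x ^ n)) (*-congˡ (α-^ s x n))

    α-Σ : ∀ {A : Set} s (xs : List A) f → α s (ΣL xs f) ≈ ΣL xs (λ x → α s (f x))
    α-Σ s []       f = α-0 s
    α-Σ s (x ∷ xs) f = trans (α-+ s (f x) (ΣL xs f)) (+-congˡ (α-Σ s xs f))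

    α-ι* : ∀ s c x → α s (ι c * x) ≈ ι c * α s x
    α-ι* s c x = trans (α-* s (ι c) x) (*-congʳ (α-ι s c))

    p^N≈0ᴮ : nat (p ℕ.^ N) ≈ 0#
    p^N≈0ᴮ = trans (sym (ι-nat (p ℕ.^ N))) (trans (ι-cong p^N≈0) ι-0)

    e : O.Carrier → Carrier
    e x = [ x ] - 1#

    e-cong : ∀ {x y} → x O.≈ y → e x ≈ e y
    e-cong eq = +-congʳ ([]-cong eq)

    []≈1+e : ∀ x → [ x ] ≈ 1# + e x
    []≈1+e x = lem [ x ]
      where
      lem : ∀ a → a ≈ 1# + (a - 1#)
      lem = solve 1 (λ a → a := con (ℤ.+ 1) :+ (a :- con (ℤ.+ 1))) refl

    e-0 : ∀ {x} → x O.≈ O.0# → e x ≈ 0#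
    e-0 x0 = trans (+-congʳ (trans ([]-cong x0) []-0)) (-‿inverseʳ 1#)

    e-+ : ∀ x y → e (x O.+ y) ≈ e x + e y + e x * e y
    e-+ x y = trans (+-congʳ ([]-+ x y)) (lem [ x ] [ y ])
      where
      lem : ∀ a b → a * b - 1# ≈ (a - 1#) + (b - 1#) + (a - 1#) * (b - 1#)
      lem = solve 2 (λ a b → a :* b :- con (ℤ.+ 1) := (a :- con (ℤ.+ 1)) :+ (b :- con (ℤ.+ 1)) :+ (a :- con (ℤ.+ 1)) :* (b :- con (ℤ.+ 1))) refl

    α-e : ∀ s x → α s (e x) ≈ e (s O.* x)
    α-e s x = trans (α-+ s [ x ] (- 1#)) (+-cong (α-[] s x) (trans (α-neg s 1#) (-‿cong (α-1 s))))

    []-nat : ∀ n x → [ O.nat n O.* x ] ≈ [ x ] ^ n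
    []-nat zero    x = trans ([]-cong (O.zeroˡ x)) []-0
    []-nat (suc n) x = trans ([]-cong (O.trans (O.distribʳ x O.1# (O.nat n)) (O.+-congʳ (O.*-identityˡ x))))
      (trans ([]-+ x (O.nat n O.* x)) (*-congˡ ([]-nat n x)))

    e-frobenius : ∀ x → e x ^ p ≡ e (O.nat p O.* x) mod p
    e-frobenius x with freshman prime (e x) 1#
    ... | w , eq = - (e x * w) , (begin
      e x ^ p                                                ≈⟨ lem (e x ^ p) (1# ^ p) (nat p * (e x * w)) ⟩
      e x ^ p + 1# ^ p + nat p * (e x * w) - 1# ^ p - nat p * (e x * w)
        ≈⟨ +-cong (+-cong (trans (sym eq) (trans (^-congˡ p (lem₂ [ x ])) (sym ([]-nat p x)))) (-‿cong (1^ p))) (-‿distribʳ-* _ _) ⟩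
      e (O.nat p O.* x) + nat p * - (e x * w)                ∎)
      where
      open ≈R
      lem : ∀ a b c → a ≈ a + b + c - b - c
      lem = solve 3 (λ a b c → a := a :+ b :+ c :- b :- c) refl
      lem₂ : ∀ a → a - 1# + 1# ≈ a
      lem₂ = solve 1 (λ a → a :- con (ℤ.+ 1) :+ con (ℤ.+ 1) := a) refl

    -- Up to the unit Q, the Fourier coefficients of t ↦ [ t ] - 1 on the Teichmüller set; see e-expand.
    E : ℕ → Carrier
    E r = ΣL ts (λ t → ι (t O.^ neg r) * e t)

    α-E : ∀ s r → α s (E r) ≈ ΣL ts (λ t → ι (t O.^ neg r) * e (s O.* t))
    α-E s r = trans (α-Σ s ts _) (Σ-cong ts (λ t → trans (α-ι* s _ (e t)) (*-congˡ (α-e s t))))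

    neg-cong : ∀ {a b} → a ∼ b → neg a ∼ neg b
    neg-cong {a} {b} ab = ∼-+ {Q′ ℕ.* a} {Q′ ℕ.* b} {Q} {Q} (∼-* {Q′} {Q′} {a} {b} ≡.refl ab) ≡.refl

    E-cong : ∀ {a b} → a ∼ b → E a ≈ E b
    E-cong {a} {b} ab = Σ-cong∈ ts (λ i → *-congʳ (ι-cong (PS.^∼ i (1≤neg a) (1≤neg b) (neg-cong ab))))

    -- Fourier inversion on T^*: after exchanging the sums, `orthogonality` leaves only the term s =
    -- t. At t = 0 both sides vanish because e 0 = 0.
    e-expand : ∀ {t} → t ∈ ts → e t ≈ ι ν * ΣL (upTo Q) (λ i → ι (t O.^ suc i) * E (suc i))
    e-expand {t} i = sym (begin
      ι ν * ΣL (upTo Q) (λ i → ι (t O.^ suc i) * E (suc i))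
        ≈⟨ *-congˡ (Σ-cong (upTo Q) (λ i → trans (sym (Σ-*ˡ ts _ _)) (Σ-cong ts (λ s → trans (lem _ _ _) (*-congʳ (sym (ι-* _ _))))))) ⟩
      ι ν * ΣL (upTo Q) (λ i → ΣL ts (λ s → ι (s O.^ neg (suc i) O.* t O.^ suc i) * e s))
        ≈⟨ *-congˡ (Σ-swap (upTo Q) ts _) ⟩
      ι ν * ΣL ts (λ s → ΣL (upTo Q) (λ i → ι (s O.^ neg (suc i) O.* t O.^ suc i) * e s))
        ≈⟨ *-congˡ (Σ-cong ts (λ s → trans (Σ-*ʳ (upTo Q) (e s) _) (*-congʳ (sym (ι-Σ (upTo Q) _))))) ⟩
      ι ν * ΣL ts (λ s → ι (PS.orthogonality s t) * e s)
        ≈⟨ *-congˡ (single (fermat i)) ⟩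
      ι ν * (nat Q * e t)
        ≈⟨ trans (sym (*-assoc _ _ _)) (*-congʳ (trans (*-congˡ (sym (ι-nat Q))) (trans (sym (ι-* _ _)) (trans (ι-cong (O.trans (O.*-comm _ _) νQ)) ι-1)))) ⟩
      1# * e t ≈⟨ *-identityˡ _ ⟩
      e t ∎)
      where
      open ≈R
      lem : ∀ a b c → a * (b * c) ≈ b * a * c
      lem = solve 3 (λ a b c → a :* (b :* c) := b :* a :* c) refl
      support : ∀ {xs} → O.Separated xs → t ∈ xs → (∀ {x} → x ∈ xs → x ∈ ts) → ΣL xs (λ s → ι (PS.orthogonality s t) * e s) ≈ ι (PS.orthogonality t t) * e t
      support (u AP.∷ us) (here ≡.refl) sub = trans (+-congˡ (Σ-0 _ (λ j → vanish (sub (there j)) (O.Unit-neg (All.lookup u j))))) (+-identityʳ _)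
        where
        vanish : ∀ {s} → s ∈ ts → O.Unit (s O.- t) → ι (PS.orthogonality s t) * e s ≈ 0#
        vanish j un = trans (*-congʳ (trans (ι-cong (PS.orthogonal-≢ j i un)) ι-0)) (zeroˡ _)
      support (u AP.∷ us) (there k) sub = trans (+-cong (trans (*-congʳ (trans (ι-cong (PS.orthogonal-≢ (sub (here ≡.refl)) i (All.lookup u k))) ι-0)) (zeroˡ _))
        (support us k (λ j → sub (there j)))) (+-identityˡ _)
      single : t O.≈ O.0# ⊎ t O.^ Q O.≈ O.1# → ΣL ts (λ s → ι (PS.orthogonality s t) * e s) ≈ nat Q * e t
      single (inj₁ t0) = trans (support separated i (λ j → j)) (trans (*-congˡ (e-0 t0)) (trans (zeroʳ _) (sym (trans (*-congˡ (e-0 t0)) (zeroʳ _)))))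
      single (inj₂ t1) = trans (support separated i (λ j → j)) (*-congʳ (trans (ι-cong (PS.orthogonal-≡ t1)) (ι-nat Q)))

    -- The element u = 0 of `ts` is included. As α 0 is the augmentation, for ρ ≥ 1 an eigenvector
    -- lies in the augmentation ideal, which separates the exponent Q from the exponent 0.
    record Weight (ρ : ℕ) (x : Carrier) : Set where
      constructor weight
      field
        scaled : ∀ {u} → u ∈ ts → α u x ≈ ι (u O.^ ρ) * x

    Weight-resp : ∀ {ρ x y} → x ≈ y → Weight ρ x → Weight ρ y
    Weight-resp eq (weight w) = weight λ {u} i → trans (α-cong u (sym eq)) (trans (w i) (*-congˡ eq))

    Weight-∼ : ∀ {ρ σ x} → 1 ℕ.≤ ρ → 1 ℕ.≤ σ → ρ ∼ σ → Weight ρ x → Weight σ x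
    Weight-∼ a b c (weight w) = weight λ i → trans (w i) (*-congʳ (ι-cong (PS.^∼ i a b c)))

    Weight-+ : ∀ {ρ x y} → Weight ρ x → Weight ρ y → Weight ρ (x + y)
    Weight-+ (weight wx) (weight wy) = weight λ {u} i → trans (α-+ u _ _) (trans (+-cong (wx i) (wy i)) (sym (distribˡ _ _ _)))

    Weight-neg : ∀ {ρ x} → Weight ρ x → Weight ρ (- x)
    Weight-neg (weight wx) = weight λ {u} i → trans (α-neg u _) (trans (-‿cong (wx i)) (-‿distribʳ-* _ _))

    Weight-* : ∀ {ρ σ x y} → Weight ρ x → Weight σ y → Weight (ρ ℕ.+ σ) (x * y)
    Weight-* {ρ} {σ} {x} {y} (weight wx) (weight wy) = weight λ {u} i → trans (α-* u _ _) (trans (*-cong (wx i) (wy i))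
      (trans (lem _ _ _ _) (*-congʳ (trans (sym (ι-* _ _)) (ι-cong (O.sym (O.^-homo-* u ρ σ)))))))
      where
      lem : ∀ a x b y → a * x * (b * y) ≈ a * b * (x * y)
      lem = solve 4 (λ a x b y → a :* x :* (b :* y) := a :* b :* (x :* y)) refl

    Weight-1 : Weight 0 1#
    Weight-1 = weight λ {u} i → trans (α-1 u) (sym (trans (*-congʳ ι-1) (*-identityˡ 1#)))

    Weight-^ : ∀ {ρ x} n → Weight ρ x → Weight (n ℕ.* ρ) (x ^ n)
    Weight-^ zero    w = Weight-1
    Weight-^ (suc n) w = Weight-* w (Weight-^ n w)

    -- The permutation t ↦ u t of the summation variable leaves the factor u^r behind; for u = 0
    -- both sides vanish since r ≥ 1. The dilation s commutes with all this and is carried along for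
    -- the sake of Ψ.
    scaled-αE : ∀ s {r} → 1 ℕ.≤ r → ∀ {u} → u ∈ ts → α u (α s (E r)) ≈ ι (u O.^ r) * α s (E r)
    scaled-αE s {r} 1≤r {u} i with fermat i
    ... | inj₁ u0 = trans (α-cong u (α-E s r)) (trans (α-Σ u ts _) (trans (Σ-0 ts (λ {t} _ →
          trans (α-ι* u _ _) (trans (*-congˡ (trans (α-e u _) (e-0 (O.trans (O.*-congʳ u0) (O.zeroˡ _))))) (zeroʳ _))))
          (sym (trans (*-congʳ (trans (ι-cong (O.trans (O.^-congˡ r u0) (O.0^ 1≤r))) ι-0)) (zeroˡ _)))))
    ... | inj₂ u1 with rotate i u1
    ... | ts′ , perm , pw = begin
      α u (α s (E r))        ≈⟨ trans (α-cong u (α-E s r)) (trans (α-Σ u ts _) (Σ-cong ts (λ t → trans (α-ι* u _ _) (*-congˡ (trans (α-e u _) (e-cong (swap u s t))))))) ⟩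
      ΣL ts (λ t → ι (t O.^ neg r) * e (s O.* (u O.* t)))
        ≈⟨ sym (trans (*-congʳ unity) (*-identityˡ _)) ⟩
      ι (u O.^ r) * ι (u O.^ neg r) * ΣL ts (λ t → ι (t O.^ neg r) * e (s O.* (u O.* t)))
        ≈⟨ trans (*-assoc _ _ _) (*-congˡ (sym (Σ-*ˡ ts _ _))) ⟩
      ι (u O.^ r) * ΣL ts (λ t → ι (u O.^ neg r) * (ι (t O.^ neg r) * e (s O.* (u O.* t))))
        ≈⟨ *-congˡ (Σ-cong ts (λ t → trans (sym (*-assoc _ _ _)) (*-congʳ (trans (sym (ι-* _ _)) (ι-cong (O.sym (O.^-distrib-* u t (neg r)))))))) ⟩
      ι (u O.^ r) * ΣL ts (λ t → G (u O.* t))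
        ≈⟨ *-congˡ (trans (Σ-pointwise (Pointwise.map G-cong pw)) (Σ-↭ G perm)) ⟩
      ι (u O.^ r) * ΣL ts G  ≈⟨ *-congˡ (α-E s r) ⟨
      ι (u O.^ r) * α s (E r) ∎
      where
      open ≈R
      G : O.Carrier → Carrier
      G t = ι (t O.^ neg r) * e (s O.* t)
      G-cong : ∀ {x y} → x O.≈ y → G x ≈ G y
      G-cong eq = *-cong (ι-cong (O.^-congˡ (neg r) eq)) (e-cong (O.*-congˡ eq))
      swap : ∀ u s t → u O.* (s O.* t) O.≈ s O.* (u O.* t)
      swap u s t = O.trans (O.sym (O.*-assoc u s t)) (O.trans (O.*-congʳ (O.*-comm u s)) (O.*-assoc s u t))
      unity : ι (u O.^ r) * ι (u O.^ neg r) ≈ 1#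
      unity = trans (sym (ι-* _ _)) (trans (ι-cong (O.trans (O.*-comm _ _) (O.trans (O.sym (O.^-homo-* u (neg r) r))
        (PS.^Q∣ u1 (≡.subst (Q ∣_) (≡.sym (neg+ r)) (m∣m*n (suc r))))))) ι-1)

    Weight-αE : ∀ s {r} → 1 ℕ.≤ r → Weight r (α s (E r))
    Weight-αE s 1≤r = weight (scaled-αE s 1≤r)

    α1 : ∀ x → α O.1# x ≈ x
    α1 = induction (λ x → α O.1# x ≈ x) (λ eq h → trans (α-cong _ (sym eq)) (trans h eq)) (α-0 _)
      (λ a b → trans (α-+ _ _ _) (+-cong a b)) (λ c x → trans (α-ι* _ c _) (*-congˡ (trans (α-[] _ x) ([]-cong (O.*-identityˡ x)))))

    Weight-E : ∀ {r} → 1 ℕ.≤ r → Weight r (E r)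
    Weight-E 1≤r = Weight-resp (α1 _) (Weight-αE O.1# 1≤r)

    Ψ : Carrier → Carrier
    Ψ = α (O.nat p)

    frobenius : ∀ {r r′} → 1 ℕ.≤ r → r′ ∼ p ℕ.* r → E r ^ p ≡ Ψ (E r′) mod p
    frobenius {r} {r′} 1≤r r∼ = ≡-trans (freshman-Σ prime ts _) (≡-trans (≡-Σ ts term) (≈⇒≡ (sym (α-E (O.nat p) r′))))
      where
      exps : neg r ℕ.* p ∼ neg r′
      exps = ∼-neg′
        where
        open ≡.≡-Reasoning
        total : neg r ℕ.* p ℕ.+ r′ ∼ Q ℕ.* (suc r ℕ.* p)
        total = ≡.trans (∼-+ {neg r ℕ.* p} {neg r ℕ.* p} {r′} {p ℕ.* r} ≡.refl r∼) (≡.cong (ℕ._% Q) (≡.trans (≡.cong (neg r ℕ.* p ℕ.+_) (ℕ.*-comm p r))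
          (≡.trans (≡.sym (ℕ.*-distribʳ-+ p (neg r) r)) (≡.trans (≡.cong (ℕ._* p) (neg+ r)) (ℕ.*-assoc Q (suc r) p)))))
        ∼-neg′ : neg r ℕ.* p ∼ neg r′
        ∼-neg′ = begin
          (neg r ℕ.* p) ℕ.% Q                            ≡⟨ +Q∼ (neg r ℕ.* p) (suc r′) ⟨
          (neg r ℕ.* p ℕ.+ Q ℕ.* suc r′) ℕ.% Q           ≡⟨ ≡.cong (λ z → (neg r ℕ.* p ℕ.+ z) ℕ.% Q) (≡.trans (≡.sym (neg+ r′)) (ℕ.+-comm (neg r′) r′)) ⟩
          (neg r ℕ.* p ℕ.+ (r′ ℕ.+ neg r′)) ℕ.% Q        ≡⟨ ≡.cong (ℕ._% Q) (ℕ.+-assoc (neg r ℕ.* p) r′ (neg r′)) ⟨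
          (neg r ℕ.* p ℕ.+ r′ ℕ.+ neg r′) ℕ.% Q          ≡⟨ ∼-+ {neg r ℕ.* p ℕ.+ r′} {Q ℕ.* (suc r ℕ.* p)} {neg r′} {neg r′} total ≡.refl ⟩
          (Q ℕ.* (suc r ℕ.* p) ℕ.+ neg r′) ℕ.% Q         ≡⟨ ≡.cong (ℕ._% Q) (ℕ.+-comm (Q ℕ.* (suc r ℕ.* p)) (neg r′)) ⟩
          (neg r′ ℕ.+ Q ℕ.* (suc r ℕ.* p)) ℕ.% Q         ≡⟨ +Q∼ (neg r′) (suc r ℕ.* p) ⟩
          neg r′ ℕ.% Q                                   ∎
      1≤p : 1 ℕ.≤ p
      1≤p = ℕ.<⇒≤ 2≤p
      term : ∀ {t} → t ∈ ts → (ι (t O.^ neg r) * e t) ^ p ≡ ι (t O.^ neg r′) * e (O.nat p O.* t) mod p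
      term {t} i = ≡-trans (≈⇒≡ (^-distrib-* _ _ p)) (≡-* (≈⇒≡ (trans (sym (ι-^ _ p)) (ι-cong (O.trans (O.^-assocʳ t (neg r) p)
        (PS.^∼ i (ℕ.*-mono-≤ (1≤neg r) 1≤p) (1≤neg r′) exps))))) (e-frobenius t))

open FrobeniusEigenvectors

-- Powers of the augmentation ideal modulo p, and which E_r lie in its square.

module AugmentationIdeal where

  open import Level using (0ℓ)
  open import Algebra.Bundles using (CommutativeRing)
  import Data.Integer as ℤ
  open import Data.Nat as ℕ using (ℕ; zero; suc; s≤s; z≤n)
  import Data.Nat.Properties as ℕ
  import Data.Nat.DivMod as ℕ
  open import Data.Nat.Tactic.RingSolver using () renaming (solve-∀ to solveℕ-∀)
  open import Data.Nat.Combinatorics using (_C_)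
  open import Data.Nat.Divisibility using (_∣_)
  open import Data.List using (List; []; _∷_; upTo; length; map)
  open import Data.List.Membership.Propositional using (_∈_)
  open import Data.List.Membership.Propositional.Properties using (∈-upTo⁻; ∈-upTo⁺; ∈-map⁺)
  open import Data.List.Relation.Unary.Unique.Propositional.Properties using (upTo⁺)
  open import Data.List.Relation.Unary.Any using (here; there)
  open import Data.Product using (∃; _×_; _,_)
  open import Data.Sum using (_⊎_; inj₁; inj₂)
  open import Relation.Nullary using (¬_; yes; no)
  open import Relation.Binary.PropositionalEquality as ≡ using (_≡_)

  module Generation (O : CommutativeRing 0ℓ 0ℓ) (p h Q′ N : ℕ) (D : TeichmüllerSystem O p h Q′ N)
    (μ : ℕ) (GA : GroupAlgebra O (RingFacts.nat O (p ℕ.^ suc μ))) where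
    private module O = RingFacts O
    open TeichmüllerSystem D
    open Residues Q′
    open Powers p h prime q≡
    open Nats
    private module PS = PowerSums O p h Q′ N D
    open PS using (ν; νQ)
    open GroupAlgebra GA
    open RingFacts B
    open Eigenvectors O p h Q′ N D μ GA

    data Span (P : Carrier → Set) : Carrier → Set where
      nil   : Span P 0#
      cons  : ∀ c {x b} → P x → Span P b → Span P (ι c * x + b)
      ≈span : ∀ {x y} → x ≈ y → Span P x → Span P y

    Span-one : ∀ {P x} → P x → Span P x
    Span-one px = ≈span (trans (+-identityʳ _) (trans (*-congʳ ι-1) (*-identityˡ _))) (cons O.1# px nil)

    Span-+ : ∀ {P x y} → Span P x → Span P y → Span P (x + y)
    Span-+ nil            t = ≈span (sym (+-identityˡ _)) t
    Span-+ (cons c px s)  t = ≈span (sym (+-assoc _ _ _)) (cons c px (Span-+ s t))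
    Span-+ (≈span eq s)   t = ≈span (+-congʳ eq) (Span-+ s t)

    Span-ι* : ∀ {P x} c → Span P x → Span P (ι c * x)
    Span-ι* c nil           = ≈span (sym (zeroʳ _)) nil
    Span-ι* c (cons d px s) = ≈span (trans (+-congʳ (trans (*-congʳ (ι-* c d)) (*-assoc _ _ _))) (sym (distribˡ _ _ _))) (cons (c O.* d) px (Span-ι* c s))
    Span-ι* c (≈span eq s)  = ≈span (*-congˡ eq) (Span-ι* c s)

    Span-bind : ∀ {P R : Carrier → Set} → (∀ {x} → P x → Span R x) → ∀ {x} → Span P x → Span R x
    Span-bind f nil           = nil
    Span-bind f (cons c px s) = Span-+ (Span-ι* c (f px)) (Span-bind f s)
    Span-bind f (≈span eq s)  = ≈span eq (Span-bind f s)

    Span-* : ∀ {P R T : Carrier → Set} → (∀ {x y} → P x → R y → T (x * y)) → ∀ {x y} → Span P x → Span R y → Span T (x * y)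
    Span-* f nil           t = ≈span (sym (zeroˡ _)) nil
    Span-* f (cons c px s) t = ≈span (sym (trans (distribʳ _ _ _) (+-congʳ (*-assoc _ _ _))))
      (Span-+ (Span-ι* c (left t)) (Span-* f s t))
      where
      left : ∀ {y} → Span _ y → Span _ (_ * y)
      left nil           = ≈span (sym (zeroʳ _)) nil
      left (cons d py u) = ≈span (trans (+-congʳ (lem _ _ _)) (sym (distribˡ _ _ _))) (cons d (f px py) (left u))
        where
        lem : ∀ a b c → a * (b * c) ≈ b * (a * c)
        lem = solve 3 (λ a b c → a :* (b :* c) := b :* (a :* c)) refl
      left (≈span eq u)  = ≈span (*-congˡ eq) (left u)
    Span-* f (≈span eq s)  t = ≈span (*-congʳ eq) (Span-* f s t)

    Span-Σ : ∀ {P} {A : Set} (xs : List A) {f : A → Carrier} → (∀ {a} → a ∈ xs → Span P (f a)) → Span P (ΣL xs f)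
    Span-Σ []       g = nil
    Span-Σ (x ∷ xs) g = Span-+ (g (here ≡.refl)) (Span-Σ xs (λ i → g (there i)))

    ιO-1 : ∀ x → ι (O.- O.1#) * x ≈ - x
    ιO-1 x = trans (*-congʳ (trans (ι-neg O.1#) (-‿cong ι-1))) (lem x)
      where
      lem : ∀ x → - 1# * x ≈ - x
      lem = solve 1 (λ x → :- con (ℤ.+ 1) :* x := :- x) refl

    private

      data Mono : List Carrier → ℕ → Carrier → Set where
        []  : Mono [] 0 1#
        _∷_ : ∀ {x G k b} a → Mono G k b → Mono (x ∷ G) (a ℕ.+ k) (x ^ a * b)

      Monoᵈ : List Carrier → ℕ → Carrier → Set
      Monoᵈ G k x = ∃ λ l → k ℕ.≤ l × ∃ λ d → x ≈ d × Mono G l d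

      Mono-* : ∀ {G k l x y} → Mono G k x → Mono G l y → ∃ λ d → x * y ≈ d × Mono G (k ℕ.+ l) d
      Mono-* [] [] = 1# , *-identityˡ 1# , []
      Mono-* (_∷_ {x} {G} {k} {b} a m) (_∷_ {k = l} {b′} a′ m′) with Mono-* m m′
      ... | d , eq , m″ = x ^ (a ℕ.+ a′) * d ,
          trans (lem _ _ _ _) (*-cong (sym (^-homo-* x a a′)) eq) ,
          ≡.subst (λ n → Mono (x ∷ G) n (x ^ (a ℕ.+ a′) * d)) (lemℕ a a′ k l) ((a ℕ.+ a′) ∷ m″)
        where
        lem : ∀ a b c d → a * b * (c * d) ≈ a * c * (b * d)
        lem = solve 4 (λ a b c d → a :* b :* (c :* d) := a :* c :* (b :* d)) refl
        lemℕ : ∀ a a′ k l → a ℕ.+ a′ ℕ.+ (k ℕ.+ l) ≡ a ℕ.+ k ℕ.+ (a′ ℕ.+ l)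
        lemℕ = solveℕ-∀

      Mono-1 : ∀ G → ∃ λ d → 1# ≈ d × Mono G 0 d
      Mono-1 []      = 1# , refl , []
      Mono-1 (x ∷ G) with Mono-1 G
      ... | d , eq , m = x ^ 0 * d , trans eq (sym (*-identityˡ d)) , 0 ∷ m

      Mono-gen : ∀ {G x} → x ∈ G → ∃ λ d → x ≈ d × Mono G 1 d
      Mono-gen {x ∷ G} (here ≡.refl) with Mono-1 G
      ... | d , eq , m = x ^ 1 * d , sym (trans (*-cong (*-identityʳ x) (sym eq)) (*-identityʳ x)) , 1 ∷ m
      Mono-gen {y ∷ G} (there i) with Mono-gen i
      ... | d , eq , m = y ^ 0 * d , trans eq (sym (*-identityˡ d)) , 0 ∷ m

      -- Pigeonhole: once the degree exceeds P times the number of generators, some exponent reaches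
      -- P.
      Mono-nilpotent : ∀ {G} P → (∀ {x} → x ∈ G → nat p ∣ᵣ x ^ P) → ∀ {k d} → length G ℕ.* P ℕ.< k → Mono G k d → nat p ∣ᵣ d
      Mono-nilpotent P f lt (_∷_ {x} {G} {k} {b} a m) with P ℕ.≤? a
      ... | yes P≤a = let (z , eq) = f (here ≡.refl) in z * (x ^ (a ℕ.∸ P) * b) , (begin
          x ^ a * b                          ≈⟨ *-congʳ (trans (^-congʳ x (≡.sym (ℕ.m+[n∸m]≡n P≤a))) (^-homo-* x P (a ℕ.∸ P))) ⟩
          x ^ P * x ^ (a ℕ.∸ P) * b          ≈⟨ *-congʳ (*-congʳ eq) ⟩
          nat p * z * x ^ (a ℕ.∸ P) * b      ≈⟨ lem _ _ _ _ ⟩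
          nat p * (z * (x ^ (a ℕ.∸ P) * b))  ∎)
        where
        open ≈R
        lem : ∀ p z c b → p * z * c * b ≈ p * (z * (c * b))
        lem = solve 4 (λ p z c b → p :* z :* c :* b := p :* (z :* (c :* b))) refl
      ... | no P≰a = let (z , eq) = Mono-nilpotent P (λ i → f (there i)) lt′ m in x ^ a * z , trans (*-congˡ eq) (lem _ _ _)
        where
        lem : ∀ a p z → a * (p * z) ≈ p * (a * z)
        lem = solve 3 (λ a p z → a :* (p :* z) := p :* (a :* z)) refl
        lt′ : length G ℕ.* P ℕ.< k
        lt′ = ℕ.+-cancelˡ-< a _ _ (ℕ.≤-<-trans (ℕ.+-monoˡ-≤ _ (ℕ.<⇒≤ (ℕ.≰⇒> P≰a))) lt)

      e-frobenius^ : ∀ i x → e x ^ (p ℕ.^ i) ≡ e (O.nat (p ℕ.^ i) O.* x) mod p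
      e-frobenius^ zero    x = ≈⇒≡ (trans (*-identityʳ _) (e-cong (O.sym (O.trans (O.*-congʳ O.nat-1) (O.*-identityˡ x)))))
      e-frobenius^ (suc i) x = ≡-trans (≈⇒≡ (sym (^-assocʳ (e x) p (p ℕ.^ i)))) (≡-trans (≡-^ (p ℕ.^ i) (e-frobenius x))
        (≡-trans (e-frobenius^ i (O.nat p O.* x)) (≈⇒≡ (e-cong (O.trans (O.sym (O.*-assoc _ _ _)) (O.*-congʳ
          (O.trans (O.*-comm _ _) (O.sym (O.nat-* p (p ℕ.^ i))))))))))

    -- Membership in I^k + pB, where I is the augmentation ideal.
    data Aug : ℕ → Carrier → Set where
      cst  : ∀ c → Aug 0 (ι c)
      gen  : ∀ r → r ℕ.< Q → Aug 1 (E (suc r))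
      ptm  : ∀ k b → Aug k (nat p * b)
      add  : ∀ {k x y} → Aug k x → Aug k y → Aug k (x + y)
      mul  : ∀ {k l x y} → Aug k x → Aug l y → Aug (k ℕ.+ l) (x * y)
      low  : ∀ {k l x} → k ℕ.≤ l → Aug l x → Aug k x
      ≈aug : ∀ {k x y} → x ≈ y → Aug k x → Aug k y

    Aug-0 : ∀ k → Aug k 0#
    Aug-0 k = ≈aug (zeroʳ _) (ptm k 0#)

    Aug-ι* : ∀ {k x} c → Aug k x → Aug k (ι c * x)
    Aug-ι* c a = mul (cst c) a

    Aug-neg : ∀ {k x} → Aug k x → Aug k (- x)
    Aug-neg {k} {x} a = ≈aug (ιO-1 x) (Aug-ι* (O.- O.1#) a)

    Aug-Σ : ∀ {k} {A : Set} (xs : List A) {f : A → Carrier} → (∀ {a} → a ∈ xs → Aug k (f a)) → Aug k (ΣL xs f)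
    Aug-Σ {k} [] g = Aug-0 k
    Aug-Σ (x ∷ xs) g = add (g (here ≡.refl)) (Aug-Σ xs (λ i → g (there i)))

    Aug-^ : ∀ {x} n → Aug 1 x → Aug n (x ^ n)
    Aug-^ zero    a = ≈aug ι-1 (cst O.1#)
    Aug-^ (suc n) a = mul a (Aug-^ n a)

    Aug-≡ : ∀ {k x y} → x ≡ y mod p → Aug k y → Aug k x
    Aug-≡ (z , eq) a = ≈aug (sym eq) (add a (ptm _ z))

    private
      -- Normal forms for `Aug`: up to O-linear combinations only multiples of p and monomials in
      -- the finitely many `e t` remain, and to these the pigeonhole argument applies.
      NF : ℕ → Carrier → Set
      NF k x = (nat p ∣ᵣ x) ⊎ Monoᵈ (map e ts) k x

      NF-* : ∀ {k l x y} → NF k x → NF l y → NF (k ℕ.+ l) (x * y)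
      NF-* (inj₁ (z , eq)) _ = inj₁ (_ , trans (*-congʳ eq) (*-assoc _ _ _))
      NF-* (inj₂ _) (inj₁ (z , eq)) = inj₁ (_ , trans (*-congˡ eq) (lem _ _ _))
        where
        lem : ∀ a p z → a * (p * z) ≈ p * (a * z)
        lem = solve 3 (λ a p z → a :* (p :* z) := p :* (a :* z)) refl
      NF-* (inj₂ (k′ , le , d , eq , m)) (inj₂ (l′ , le′ , d′ , eq′ , m′)) with Mono-* m m′
      ... | d″ , eq″ , m″ = inj₂ (k′ ℕ.+ l′ , ℕ.+-mono-≤ le le′ , d″ , trans (*-cong eq eq′) eq″ , m″)

      Aug⇒NF : ∀ {k x} → Aug k x → Span (NF k) x
      Aug⇒NF (cst c) with Mono-1 (map e ts)
      ... | d , eq , m = ≈span (*-identityʳ _) (Span-ι* c (Span-one (inj₂ (0 , z≤n , d , eq , m))))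
      Aug⇒NF (gen r r<Q) = Span-Σ ts λ {t} i → Span-ι* _ (Span-one (let (d , eq , m) = Mono-gen (∈-map⁺ e i) in inj₂ (1 , ℕ.≤-refl , d , eq , m)))
      Aug⇒NF (ptm k b) = Span-one (inj₁ (b , refl))
      Aug⇒NF (add a b) = Span-+ (Aug⇒NF a) (Aug⇒NF b)
      Aug⇒NF (mul a b) = Span-* NF-* (Aug⇒NF a) (Aug⇒NF b)
      Aug⇒NF (low le a) = Span-bind (λ { (inj₁ d) → Span-one (inj₁ d) ; (inj₂ (l , le′ , r)) → Span-one (inj₂ (l , ℕ.≤-trans le le′ , r)) }) (Aug⇒NF a)
      Aug⇒NF (≈aug eq a) = ≈span eq (Aug⇒NF a)

    -- Beyond this degree a monomial in the elements `e t` contains some (e t)^(p^m), which modulo p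
    -- is e (p^m t) = 0.
    top : ℕ
    top = suc (length (map e ts) ℕ.* p ℕ.^ suc μ)

    Aug-nilpotent : ∀ {k x} → top ℕ.≤ k → Aug k x → nat p ∣ᵣ x
    Aug-nilpotent {k} le a = go (Aug⇒NF a)
      where
      P = p ℕ.^ suc μ
      kill : ∀ t → nat p ∣ᵣ e t ^ P
      kill t = z , trans eq (trans (+-congʳ (trans (+-congʳ ([]-ϖ t)) (-‿inverseʳ 1#))) (+-identityˡ _))
        where open _≡_mod_ (e-frobenius^ (suc μ) t) renaming (factor to z; proof to eq)
      gens : ∀ us {x} → x ∈ map e us → nat p ∣ᵣ x ^ P
      gens (t ∷ us) (here ≡.refl) = kill t
      gens (t ∷ us) (there i)     = gens us i
      nf : ∀ {x} → NF k x → nat p ∣ᵣ x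
      nf (inj₁ d) = d
      nf (inj₂ (l , le′ , d , eq , m)) = let (z , eq′) = Mono-nilpotent P (gens ts) (ℕ.≤-trans le le′) m in z , trans eq eq′
      lem : ∀ c p z w → c * (p * z) + p * w ≈ p * (c * z + w)
      lem = solve 4 (λ c p z w → c :* (p :* z) :+ p :* w := p :* (c :* z :+ w)) refl
      go : ∀ {x} → Span (NF k) x → nat p ∣ᵣ x
      go nil = 0# , sym (zeroʳ _)
      go (cons c px s) = let (z , eq) = nf px ; (w , eq′) = go s in
        ι c * z + w , trans (+-cong (*-congˡ eq) eq′) (lem _ _ _ _)
      go (≈span eq s) = let (z , eq′) = go s in z , trans (sym eq) eq′

    -- The digits of x are peeled off with `decompose`: `scaled` treats p^i x, moves from i to i +
    -- 1, and ends at i = m, where the class is trivial.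
    Aug-e : ∀ x → Aug 1 (e x)
    Aug-e x = ≈aug (e-cong (O.trans (O.*-congʳ O.nat-1) (O.*-identityˡ x))) (scaled (suc μ) 0 (ℕ.+-identityʳ _) x)
      where
      on-ts : ∀ {t} → t ∈ ts → Aug 1 (e t)
      on-ts i = ≈aug (sym (e-expand i)) (Aug-ι* ν (Aug-Σ (upTo Q) (λ {r} j → Aug-ι* _ (gen r (∈-upTo⁻ j)))))
      plus : ∀ {x y} → Aug 1 (e x) → Aug 1 (e y) → Aug 1 (e (x O.+ y))
      plus {x} {y} a b = ≈aug (sym (e-+ x y)) (add (add a b) (low (s≤s z≤n) (mul a b)))
      multiple : ∀ n {x} → Aug 1 (e x) → Aug 1 (e (O.nat n O.* x))
      multiple zero    a = ≈aug (sym (e-0 (O.zeroˡ _))) (Aug-0 1)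
      multiple (suc n) {x} a = ≈aug (e-cong (O.sym (O.trans (O.distribʳ x O.1# (O.nat n)) (O.+-congʳ (O.*-identityˡ x))))) (plus a (multiple n a))
      scaled : ∀ f i → f ℕ.+ i ≡ suc μ → ∀ x → Aug 1 (e (O.nat (p ℕ.^ i) O.* x))
      scaled zero i ≡.refl x = ≈aug (sym (trans (+-congʳ ([]-ϖ x)) (-‿inverseʳ 1#))) (Aug-0 1)
      scaled (suc f) i eq x with decompose x
      ... | t , j , y , x≈ = ≈aug (e-cong (O.sym (O.trans (O.*-congˡ x≈) (O.trans (O.distribˡ _ _ _) (O.+-congˡ
              (O.trans (O.sym (O.*-assoc _ _ _)) (O.*-congʳ (O.trans (O.*-comm _ _) (O.sym (O.nat-* p (p ℕ.^ i)))))))))))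
            (plus (multiple (p ℕ.^ i) (on-ts j)) (scaled f (suc i) (≡.trans (ℕ.+-suc f i) eq) y))

    private
      -- Modulo p this element is the p-th power of e u, and p ≥ 2.
      Aug-e-p* : ∀ u → Aug 2 (e (O.nat p O.* u))
      Aug-e-p* u = Aug-≡ (≡-sym (e-frobenius u)) (low 2≤p (Aug-^ p (Aug-e u)))

      -- Addition of arguments produces only the quadratic error of `e-+`, and the multiple p u
      -- contributes to I^2 + pB by `Aug-e-p*`. So the Teichmüller representative s can stand for
      -- the sum t + t′.
      additive : ∀ {s t t′ u} → t O.+ t′ O.≈ s O.+ O.nat p O.* u → Aug 2 (e s - e t - e t′)
      additive {s} {t} {t′} {u} eq = ≈aug value (add (mul (Aug-e t) (Aug-e t′))
          (Aug-neg (add (Aug-e-p* u) (low (ℕ.n≤1+n 2) (mul (Aug-e s) (Aug-e-p* u))))))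
        where
        open ≈R
        value : e t * e t′ + - (e (O.nat p O.* u) + e s * e (O.nat p O.* u)) ≈ e s - e t - e t′
        value = begin
          e t * e t′ + - (e pu + e s * e pu)  ≈⟨ lem (e t) (e t′) (e s) (e pu) ⟩
          (e t + e t′ + e t * e t′) - (e s + e pu + e s * e pu) + (e s - e t - e t′)
            ≈⟨ +-congʳ (+-cong (sym (e-+ t t′)) (-‿cong (sym (e-+ s pu)))) ⟩
          (e (t O.+ t′) - e (s O.+ pu)) + (e s - e t - e t′)
            ≈⟨ +-congʳ (trans (+-congʳ (e-cong eq)) (-‿inverseʳ _)) ⟩
          0# + (e s - e t - e t′) ≈⟨ +-identityˡ _ ⟩
          e s - e t - e t′ ∎
          where
          pu = O.nat p O.* u
          lem : ∀ a b s u → a * b + - (u + s * u) ≈ (a + b + a * b) - (s + u + s * u) + (s - a - b)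
          lem = solve 4 (λ a b s u → a :* b :+ :- (u :+ s :* u) := (a :+ b :+ a :* b) :- (s :+ u :+ s :* u) :+ (s :- a :- b)) refl

      -- The Fourier expansion of `additive` is a linear relation among the E_r modulo I^2 + pB.
      -- Since s is congruent to t + t′ modulo p, its coefficients s^r can be replaced by (t +
      -- t′)^r, which is polynomial in t and t′.
      Aug-defect : ∀ {t t′} → t ∈ ts → t′ ∈ ts → Aug 2 (ΣL (upTo Q) (λ i → ι (PS.defect t t′ (suc i)) * E (suc i)))
      Aug-defect {t} {t′} i j with decompose (t O.+ t′)
      ... | s , k , u , eq = Aug-≡ (≡-Σ (upTo Q) (λ {r} _ → ≡-* (coefficient (suc r)) (≈⇒≡ refl)))
            -- The factor Q cancels the ν of `e-expand`.
            (≈aug combine (Aug-ι* (O.nat Q) (additive eq)))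
        where
        open ≈R
        X : O.Carrier → Carrier
        X s = ΣL (upTo Q) (λ i → ι (s O.^ suc i) * E (suc i))
        coefficient : ∀ r → ι (PS.defect t t′ r) ≡ ι (s O.^ r O.- t O.^ r O.- t′ O.^ r) mod p
        coefficient r with O.≡-^ {p} r (O._,_ u eq)
        ... | z O., eq′ = ι z , trans (ι-cong (O.trans (O.+-congʳ (O.+-congʳ eq′)) (O.solve 5 (λ a b c d e → (a O.:+ b O.:* e) O.:- c O.:- d O.:= (a O.:- c O.:- d) O.:+ b O.:* e) O.refl _ _ _ _ _)))
                (trans (ι-+ _ _) (+-congˡ (trans (ι-* _ _) (*-congʳ (ι-nat p)))))
        expand : ∀ {s} → s ∈ ts → ι (O.nat Q) * e s ≈ X s
        expand k = trans (*-congˡ (e-expand k)) (trans (sym (*-assoc _ _ _)) (trans (*-congʳ (trans (sym (ι-* _ _)) (trans (ι-cong νQ) ι-1))) (*-identityˡ _)))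
        combine : ι (O.nat Q) * (e s - e t - e t′) ≈ ΣL (upTo Q) (λ i → ι (s O.^ suc i O.- t O.^ suc i O.- t′ O.^ suc i) * E (suc i))
        combine = begin
          ι (O.nat Q) * (e s - e t - e t′)   ≈⟨ lem _ _ _ _ ⟩
          ι (O.nat Q) * e s - ι (O.nat Q) * e t - ι (O.nat Q) * e t′ ≈⟨ +-cong (+-cong (expand k) (-‿cong (expand i))) (-‿cong (expand j)) ⟩
          X s - X t - X t′ ≈⟨ trans (Σ-- (upTo Q) _ _) (+-congʳ (Σ-- (upTo Q) _ _)) ⟨
          ΣL (upTo Q) (λ i → ι (s O.^ suc i) * E (suc i) - ι (t O.^ suc i) * E (suc i) - ι (t′ O.^ suc i) * E (suc i))
            ≈⟨ Σ-cong (upTo Q) (λ r → trans (lem₂ _ _ _ _) (*-congʳ (sym (trans (ι-+ _ _) (+-cong (trans (ι-+ _ _) (+-congˡ (ι-neg _))) (ι-neg _)))))) ⟩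
          ΣL (upTo Q) (λ i → ι (s O.^ suc i O.- t O.^ suc i O.- t′ O.^ suc i) * E (suc i)) ∎
          where
          lem : ∀ q a b c → q * (a - b - c) ≈ q * a - q * b - q * c
          lem = solve 4 (λ q a b c → q :* (a :- b :- c) := q :* a :- q :* b :- q :* c) refl
          lem₂ : ∀ a b c x → a * x - b * x - c * x ≈ (a - b - c) * x
          lem₂ = solve 4 (λ a b c x → a :* x :- b :* x :- c :* x := (a :- b :- c) :* x) refl

      defect-sum : ∀ a b → Aug 2 (ΣL (upTo Q) (λ i → ι (PS.defectSum a b (suc i)) * E (suc i)))
      defect-sum a b = ≈aug rearrange (Aug-Σ ts (λ i → Aug-Σ ts (λ j → Aug-ι* _ (Aug-defect i j))))
        where
        open ≈R
        w : O.Carrier → O.Carrier → O.Carrier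
        w t t′ = t O.^ neg a O.* t′ O.^ neg b
        rearrange : ΣL ts (λ t → ΣL ts (λ t′ → ι (w t t′) * ΣL (upTo Q) (λ i → ι (PS.defect t t′ (suc i)) * E (suc i))))
          ≈ ΣL (upTo Q) (λ i → ι (PS.defectSum a b (suc i)) * E (suc i))
        rearrange = begin
          ΣL ts (λ t → ΣL ts (λ t′ → ι (w t t′) * ΣL (upTo Q) (λ i → ι (PS.defect t t′ (suc i)) * E (suc i))))
            ≈⟨ Σ-cong ts (λ t → Σ-cong ts (λ t′ → trans (sym (Σ-*ˡ (upTo Q) _ _)) (Σ-cong (upTo Q) (λ i → trans (sym (*-assoc _ _ _)) (*-congʳ (sym (ι-* _ _))))))) ⟩
          ΣL ts (λ t → ΣL ts (λ t′ → ΣL (upTo Q) (λ i → ι (w t t′ O.* PS.defect t t′ (suc i)) * E (suc i))))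
            ≈⟨ Σ-cong ts (λ t → Σ-swap ts (upTo Q) _) ⟩
          ΣL ts (λ t → ΣL (upTo Q) (λ i → ΣL ts (λ t′ → ι (w t t′ O.* PS.defect t t′ (suc i)) * E (suc i))))
            ≈⟨ Σ-swap ts (upTo Q) _ ⟩
          ΣL (upTo Q) (λ i → ΣL ts (λ t → ΣL ts (λ t′ → ι (w t t′ O.* PS.defect t t′ (suc i)) * E (suc i))))
            ≈⟨ Σ-cong (upTo Q) (λ i → trans (Σ-cong ts (λ t → Σ-*ʳ ts _ _)) (trans (Σ-*ʳ ts _ _)
                (*-congʳ (sym (trans (ι-Σ ts _) (Σ-cong ts (λ t → ι-Σ ts _))))))) ⟩
          ΣL (upTo Q) (λ i → ι (PS.defectSum a b (suc i)) * E (suc i)) ∎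

      Aug-unit : ∀ {k c x} → O.Unit c → Aug k (ι c * x) → Aug k x
      Aug-unit {k} {c} {x} (v , eq) a = ≈aug (trans (sym (*-assoc _ _ _)) (trans (*-congʳ (trans (sym (ι-* _ _)) (trans (ι-cong (O.trans (O.*-comm _ _) eq)) ι-1))) (*-identityˡ x))) (Aug-ι* v a)

    -- Averaging the relations `Aug-defect` against the characters a = p^v and b = p^v (r + 1)
    -- leaves E_(a+b) alone, with coefficient Q^2 C(a + b, a). It is a unit, because r + 2 is prime
    -- to p.
    Aug-E-composite : ∀ v r → ¬ p ∣ suc (suc r) → p ℕ.^ v ℕ.* suc (suc r) ℕ.≤ Q → Aug 2 (E (p ℕ.^ v ℕ.* suc (suc r)))
    Aug-E-composite v r nd le = ≡.subst (λ n → Aug 2 (E n)) split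
      (Aug-unit unit (≈aug (trans (Σ-unique _ (upTo⁺ Q) (∈-upTo⁺ i₀<Q) others) (*-cong (ι-cong at-i₀) refl)) (defect-sum a b)))
      where
      a = p ℕ.^ v
      b = p ℕ.^ v ℕ.* suc r
      1≤a : 1 ℕ.≤ a
      1≤a = 1≤p^ v
      1≤b : 1 ℕ.≤ b
      1≤b = ℕ.*-mono-≤ 1≤a (s≤s (z≤n {r}))
      split : suc (ℕ.pred (a ℕ.+ b)) ≡ p ℕ.^ v ℕ.* suc (suc r)
      split = ≡.trans (ℕ.suc-pred (a ℕ.+ b) {{ℕ.>-nonZero (ℕ.≤-trans 1≤a (ℕ.m≤m+n a b))}}) (≡.sym (ℕ.*-suc a (suc r)))
      i₀ = ℕ.pred (a ℕ.+ b)
      a+b≡ : suc i₀ ≡ a ℕ.+ b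
      a+b≡ = ℕ.suc-pred (a ℕ.+ b) {{ℕ.>-nonZero (ℕ.≤-trans 1≤a (ℕ.m≤m+n a b))}}
      a+b≤Q : a ℕ.+ b ℕ.≤ Q
      a+b≤Q = ≡.subst (ℕ._≤ Q) (ℕ.*-suc a (suc r)) le
      i₀<Q : i₀ ℕ.< Q
      i₀<Q = ≡.subst (ℕ._≤ Q) (≡.sym a+b≡) a+b≤Q
      a<Q : a ℕ.< Q
      a<Q = ℕ.<-≤-trans (ℕ.m<m+n a 1≤b) a+b≤Q
      b<Q : b ℕ.< Q
      b<Q = ℕ.<-≤-trans (ℕ.m<n+m b 1≤a) a+b≤Q
      others : ∀ {i} → i ∈ upTo Q → ¬ i ≡ i₀ → ι (PS.defectSum a b (suc i)) * E (suc i) ≈ 0#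
      others {i} j ne = trans (*-congʳ (trans (ι-cong (PS.defectSum-≢ 1≤a a<Q 1≤b b<Q (∈-upTo⁻ j) (λ eq → ne (ℕ.suc-injective (≡.trans eq (≡.sym a+b≡)))))) ι-0)) (zeroˡ _)
      coefficient = O.nat ((a ℕ.+ b) C a) O.* (O.nat Q O.* O.nat Q)
      at-i₀ : PS.defectSum a b (suc i₀) O.≈ coefficient
      at-i₀ = O.trans (O.reflexive (≡.cong (PS.defectSum a b) a+b≡)) (PS.defectSum-≡ 1≤a a<Q 1≤b b<Q)
      unit : O.Unit coefficient
      unit = O.Unit-* (PS.p∤⇒unit _ (≡.subst (λ n → ¬ p ∣ (n C a)) (ℕ.*-suc a (suc r)) (p∤C prime v (suc (suc r)) nd)))
        (O.Unit-* (ν , νQ) (ν , νQ))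

open AugmentationIdeal

-- The group algebra is spanned by monomials in y_0, ..., y_(h-1).

module MonomialBasis where

  open import Level using (0ℓ)
  open import Algebra.Bundles using (CommutativeRing)
  open import Data.Nat as ℕ using (ℕ; zero; suc; s≤s; z≤n)
  import Data.Nat.Properties as ℕ
  import Data.Nat.DivMod as ℕ
  open import Data.Nat.Divisibility using (_∣_)
  open import Data.Product using (∃; _×_; _,_)
  open import Data.Sum using (_⊎_; inj₁; inj₂)
  open import Relation.Nullary using (¬_; contradiction)
  open import Relation.Binary.PropositionalEquality as ≡ using (_≡_)

  module Spanning (O : CommutativeRing 0ℓ 0ℓ) (p h Q′ N : ℕ) (D : TeichmüllerSystem O p h Q′ N)
    (μ : ℕ) (GA : GroupAlgebra O (RingFacts.nat O (p ℕ.^ suc μ))) where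
    private module O = RingFacts O
    open TeichmüllerSystem D
    open Residues Q′
    open Powers p h prime q≡
    open Nats
    open GroupAlgebra GA
    open RingFacts B
    open Eigenvectors O p h Q′ N D μ GA
    open Generation O p h Q′ N D μ GA

    y : ℕ → Carrier
    y j = E (p ℕ.^ j)

    mon : (ℕ → ℕ) → Carrier
    mon K = ΠN h (λ j → y j ^ K j)

    mon-+ : ∀ K L → mon (λ j → K j ℕ.+ L j) ≈ mon K * mon L
    mon-+ K L = trans (ΠN-cong h (λ j _ → ^-homo-* (y j) (K j) (L j))) (ΠN-* h _ _)

    mon-cong : ∀ {K L} → (∀ j → j ℕ.< h → K j ≡ L j) → mon K ≈ mon L
    mon-cong eq = ΠN-cong h (λ j j<h → ^-congʳ (y j) (eq j j<h))

    mon-0 : mon (λ _ → 0) ≈ 1#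
    mon-0 = ΠN-1 h (λ _ _ → refl)

    mon-spike : ∀ {j} n → j ℕ.< h → mon (spike j n) ≈ y j ^ n
    mon-spike {j} n j<h = trans (ΠN-single h j<h (λ i _ ne → ^-congʳ (y i) (spike-≢ n ne))) (^-congʳ (y j) (spike-≡ j n))

    Monomial : Carrier → Set
    Monomial x = ∃ λ K → x ≈ mon K

    private
      Sub : Carrier → Set
      Sub x = ∃ λ s → ∃ λ z → Span Monomial s × x ≈ s + nat p * z

      Monomial-* : ∀ {a b} → Monomial a → Monomial b → Monomial (a * b)
      Monomial-* (K , eq) (L , eq′) = (λ j → K j ℕ.+ L j) , trans (*-cong eq eq′) (sym (mon-+ K L))

      Sub-+ : ∀ {a b} → Sub a → Sub b → Sub (a + b)
      Sub-+ (s , z , ps , eq) (t , w , pt , eq′) = s + t , z + w , Span-+ ps pt , trans (+-cong eq eq′) (lem _ _ _ _ _)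
        where
        lem : ∀ s p z t w → s + p * z + (t + p * w) ≈ s + t + p * (z + w)
        lem = solve 5 (λ s p z t w → s :+ p :* z :+ (t :+ p :* w) := s :+ t :+ p :* (z :+ w)) refl

      Sub-* : ∀ {a b} → Sub a → Sub b → Sub (a * b)
      Sub-* (s , z , ps , eq) (t , w , pt , eq′) = s * t , (z * t + s * w + nat p * z * w) , Span-* Monomial-* ps pt ,
          trans (*-cong eq eq′) (lem _ _ _ _ _)
        where
        lem : ∀ s p z t w → (s + p * z) * (t + p * w) ≈ s * t + p * (z * t + s * w + p * z * w)
        lem = solve 5 (λ s p z t w → (s :+ p :* z) :* (t :+ p :* w) := s :* t :+ p :* (z :* t :+ s :* w :+ p :* z :* w)) refl

      Sub-p : ∀ z → Sub (nat p * z)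
      Sub-p z = 0# , z , nil , sym (+-identityˡ _)

      Sub-span : ∀ {x} → Span Monomial x → Sub x
      Sub-span s = _ , 0# , s , sym (trans (+-congˡ (zeroʳ _)) (+-identityʳ _))

      Sub-≈ : ∀ {a b} → a ≈ b → Sub a → Sub b
      Sub-≈ ab (s , z , ps , eq) = s , z , ps , trans (sym ab) eq

      -- One step of approximation along the powers of I. That the main part s stays in I^k is
      -- recorded because the cross terms of a product need it.
      Split : ℕ → Carrier → Set
      Split k x = ∃ λ s → ∃ λ j → x ≈ s + j × Sub s × Aug k s × Aug (suc k) j

      to-higher : ∀ {k x} → Aug (suc k) x → Split k x
      to-higher {k} a = 0# , _ , sym (+-identityˡ _) , Sub-span nil , Aug-0 k , a

      p^v<⇒v<h : ∀ {v} → p ℕ.^ v ℕ.≤ Q → v ℕ.< h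
      p^v<⇒v<h {v} le = ℕ.≰⇒> λ h≤v → ℕ.<⇒≱ (s≤s le) (≡.subst (ℕ._≤ p ℕ.^ v) q≡
        (ℕ.^-monoʳ-≤ p {{ℕ.>-nonZero (ℕ.<⇒≤ 2≤p)}} h≤v))

      split-gen : ∀ r → r ℕ.< Q → Split 1 (E (suc r))
      split-gen r r<Q = go (p-part prime (suc (suc r)) (suc r) ℕ.≤-refl (s≤s z≤n))
        where
        go : (∃ λ v → ∃ λ s → suc r ≡ p ℕ.^ v ℕ.* s × ¬ p ∣ s) → Split 1 (E (suc r))
        go (v , zero , eq , _) = contradiction (≡.trans eq (ℕ.*-zeroʳ (p ℕ.^ v))) λ ()
        go (v , suc zero , eq , _) = E (suc r) , 0# , sym (+-identityʳ _) ,
            Sub-span (Span-one (spike v 1 , trans (E-cong (≡.cong (ℕ._% Q) eq′)) (sym (trans (mon-spike 1 v<h) (*-identityʳ _))))) ,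
            gen r r<Q , Aug-0 2
          where
          eq′ = ≡.trans eq (ℕ.*-identityʳ (p ℕ.^ v))
          v<h = p^v<⇒v<h {v} (≡.subst (ℕ._≤ Q) eq′ r<Q)
        go (v , suc (suc s) , eq , nd) = to-higher (≈aug (E-cong (≡.cong (ℕ._% Q) (≡.sym eq)))
          (Aug-E-composite v s nd (≡.subst (ℕ._≤ Q) eq r<Q)))

      split : ∀ {k x} → Aug k x → Split k x
      split (cst c) = ι c , 0# , sym (+-identityʳ _) , Sub-span (≈span (trans (*-congˡ mon-0) (*-identityʳ _)) (Span-ι* c (Span-one ((λ _ → 0) , refl)))) ,
        cst c , Aug-0 1
      split (gen r r<Q) = split-gen r r<Q
      split (ptm k b) = to-higher (ptm (suc k) b)
      split (add a b) =
        let (s , j , eq , ss , as , aj) = split a ; (t , l , eq′ , st , at , al) = split b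
        in s + t , j + l , trans (+-cong eq eq′) (lem _ _ _ _) , Sub-+ ss st , add as at , add aj al
        where
        lem : ∀ s j t l → s + j + (t + l) ≈ s + t + (j + l)
        lem = solve 4 (λ s j t l → s :+ j :+ (t :+ l) := s :+ t :+ (j :+ l)) refl
      split (mul {k} {l} a b) =
        let (s , j , eq , ss , as , aj) = split a ; (t , i , eq′ , st , at , ai) = split b
        in s * t , (j * t + s * i + j * i) , trans (*-cong eq eq′) (lem _ _ _ _) , Sub-* ss st , mul as at ,
           add (add (mul aj at) (low (ℕ.≤-reflexive (≡.sym (ℕ.+-suc k l))) (mul as ai)))
               (low (s≤s (ℕ.+-monoʳ-≤ k (ℕ.n≤1+n l))) (mul aj ai))
        where
        lem : ∀ s j t i → (s + j) * (t + i) ≈ s * t + (j * t + s * i + j * i)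
        lem = solve 4 (λ s j t i → (s :+ j) :* (t :+ i) := s :* t :+ (j :* t :+ s :* i :+ j :* i)) refl
      split (low {k} {l} k≤l a) = go (ℕ.m≤n⇒m<n∨m≡n k≤l)
        where
        go : k ℕ.< l ⊎ k ≡ l → Split k _
        go (inj₁ k<l)    = to-higher (low k<l a)
        go (inj₂ ≡.refl) = split a
      split (≈aug xy a) = let (s , j , eq , r) = split a in s , j , trans (sym xy) eq , r

      -- A Nakayama argument: every round of `split` pushes the remainder into the next power of I,
      -- until `Aug-nilpotent` turns it into a multiple of p.
      Aug⇒Sub : ∀ f {k x} → top ℕ.≤ f ℕ.+ k → Aug k x → Sub x
      Aug⇒Sub zero    le a = let (z , eq) = Aug-nilpotent le a in Sub-≈ (sym eq) (Sub-p z)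
      Aug⇒Sub (suc f) {k} le a = let (s , j , eq , ss , _ , aj) = split a in
        Sub-≈ (sym eq) (Sub-+ ss (Aug⇒Sub f (≡.subst (top ℕ.≤_) (≡.sym (ℕ.+-suc f k)) le) aj))

      all-Aug : ∀ x → Aug 0 x
      all-Aug = induction (Aug 0) ≈aug (Aug-0 0) add
        (λ c x → Aug-ι* c (≈aug (sym ([]≈1+e x)) (add (≈aug ι-1 (cst O.1#)) (low z≤n (Aug-e x)))))

      -- The remainder p^i z is improved by splitting z again; at i = N it is zero.
      approximate : ∀ i x → ∃ λ s → ∃ λ z → Span Monomial s × x ≈ s + nat (p ℕ.^ i) * z
      approximate zero    x = 0# , x , nil , sym (trans (+-identityˡ _) (trans (*-congʳ nat-1) (*-identityˡ x)))
      approximate (suc i) x =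
        let (s , z , ps , eq) = approximate i x
            (t , w , pt , eq′) = Aug⇒Sub top {0} (ℕ.≤-reflexive (≡.sym (ℕ.+-identityʳ top))) (all-Aug z)
        in s + ι (O.nat (p ℕ.^ i)) * t , w , Span-+ ps (Span-ι* _ pt) ,
           trans eq (trans (+-congˡ (*-congˡ eq′)) (trans (lem _ _ _ _ _)
             (+-cong (+-congˡ (*-congʳ (sym (ι-nat (p ℕ.^ i))))) (*-congʳ (sym (nat-* p (p ℕ.^ i)))))))
        where
        lem : ∀ s q t p w → s + q * (t + p * w) ≈ s + q * t + p * q * w
        lem = solve 5 (λ s q t p w → s :+ q :* (t :+ p :* w) := s :+ q :* t :+ p :* q :* w) refl

    spanning : ∀ x → Span Monomial x
    spanning x = let (s , z , ps , eq) = approximate N x in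
      ≈span (sym (trans eq (trans (+-congˡ (trans (*-congʳ p^N≈0ᴮ) (zeroˡ z))) (+-identityʳ s)))) ps

open MonomialBasis

-- The weight filtration and its behaviour under Frobenius.

module WeightFiltration where

  open import Level using (0ℓ)
  open import Algebra.Bundles using (CommutativeRing)
  open import Data.Nat as ℕ using (ℕ; zero; suc; s≤s; z≤n; pred)
  import Data.Nat.Properties as ℕ
  import Data.Nat.DivMod as ℕ
  open import Data.Nat.Divisibility using (_∣_; _∣?_; m∣m*n)
  open import Data.Nat.Tactic.RingSolver using () renaming (solve-∀ to solveℕ-∀)
  open import Data.Product using (_,_; proj₁; proj₂)
  open import Data.Sum using (_⊎_; inj₁; inj₂)
  open import Relation.Nullary using (¬_; yes; no; contradiction; Dec)
  open import Relation.Binary.PropositionalEquality as ≡ using (_≡_)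

  module Filtration (O : CommutativeRing 0ℓ 0ℓ) (p h Q′ N : ℕ) (D : TeichmüllerSystem O p h Q′ N)
    (μ : ℕ) (GA : GroupAlgebra O (RingFacts.nat O (p ℕ.^ suc μ))) where
    private module O = RingFacts O
    open TeichmüllerSystem D
    open Residues Q′
    open Powers p h prime q≡
    open Nats
    private module PS = PowerSums O p h Q′ N D
    open PS using (S; S-zero; S-full; ν; νQ)
    open GroupAlgebra GA
    open RingFacts B
    open Eigenvectors O p h Q′ N D μ GA
    open Generation O p h Q′ N D μ GA
    open Spanning O p h Q′ N D μ GA

    W : (ℕ → ℕ) → ℕ → ℕ
    W K l = sumN h (λ j → K j ℕ.* rep (j ℕ.+ l))

    -- Fil i k w: the elements of weight at least w l in each of the h Frobenius twists l, with at least k explicit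
    -- factors p; each such factor counts for Q p^i in one twist of choice.
    data Fil (i : ℕ) : ℕ → (ℕ → ℕ) → Carrier → Set where
      zer  : ∀ {k w} → Fil i k w 0#
      pw   : ∀ a k → Periodic h a → sumN h a ℕ.≤ k → Fil i k (λ l → Q ℕ.* p ℕ.^ i ℕ.* a l) (nat (p ℕ.^ k))
      cst  : ∀ c → Fil i 0 (λ _ → 0) (ι c)
      gen  : ∀ j → j ℕ.< h → Fil i 0 (λ l → rep (j ℕ.+ l)) (y j)
      add  : ∀ {k w x x′} → Fil i k w x → Fil i k w x′ → Fil i k w (x + x′)
      mul  : ∀ {k k′ w w′ x x′} → Fil i k w x → Fil i k′ w′ x′ → Fil i (k ℕ.+ k′) (λ l → w l ℕ.+ w′ l) (x * x′)
      weak : ∀ {k k′ w w′ x x′} → k′ ℕ.≤ k → (∀ l → w′ l ℕ.≤ w l) → x ≈ x′ → Fil i k w x → Fil i k′ w′ x′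

    Fil-≈ : ∀ {i k w x x′} → x ≈ x′ → Fil i k w x → Fil i k w x′
    Fil-≈ eq f = weak ℕ.≤-refl (λ _ → ℕ.≤-refl) eq f

    Fil-ι* : ∀ {i k w x} c → Fil i k w x → Fil i k w (ι c * x)
    Fil-ι* c f = mul (cst c) f

    Fil-^ : ∀ {i w x} n → Fil i 0 w x → Fil i 0 (λ l → n ℕ.* w l) (x ^ n)
    Fil-^ zero    f = Fil-≈ ι-1 (cst O.1#)
    Fil-^ (suc n) f = mul f (Fil-^ n f)

    -- A factor p of greater value only adds weight. This brings elements obtained by fewer than m
    -- applications of Ψ to the common value Q p^μ.
    Fil-mono : ∀ {i i′ k w x} → i ℕ.≤ i′ → Fil i k w x → Fil i′ k w x
    Fil-mono le zer            = zer
    Fil-mono le (pw a k per s) = weak ℕ.≤-refl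
      (λ l → ℕ.*-monoˡ-≤ (a l) (ℕ.*-monoʳ-≤ Q (ℕ.^-monoʳ-≤ p {{ℕ.>-nonZero (ℕ.<⇒≤ 2≤p)}} le))) refl (pw a k per s)
    Fil-mono le (cst c)        = cst c
    Fil-mono le (gen j j<h)    = gen j j<h
    Fil-mono le (add f g)      = add (Fil-mono le f) (Fil-mono le g)
    Fil-mono le (mul f g)      = mul (Fil-mono le f) (Fil-mono le g)
    Fil-mono le (weak a b c f) = weak a b c (Fil-mono le f)

    Fil-mon : ∀ i K → Fil i 0 (W K) (mon K)
    Fil-mon i K = go h ℕ.≤-refl
      where
      go : ∀ n → n ℕ.≤ h → Fil i 0 (λ l → sumN n (λ j → K j ℕ.* rep (j ℕ.+ l))) (ΠN n (λ j → y j ^ K j))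
      go zero    _  = Fil-≈ ι-1 (cst O.1#)
      go (suc n) le = mul (go n (ℕ.<⇒≤ le)) (Fil-^ (K n) (gen n le))

    Weight-mon : ∀ K → Weight (sumN h (λ j → K j ℕ.* p ℕ.^ j)) (mon K)
    Weight-mon K = go h
      where
      go : ∀ n → Weight (sumN n (λ j → K j ℕ.* p ℕ.^ j)) (ΠN n (λ j → y j ^ K j))
      go zero    = Weight-1
      go (suc n) = Weight-* (go n) (Weight-^ (K n) (Weight-E (1≤p^ n)))

    private
      z₀ : O.Carrier
      z₀ = proj₁ zero∈

      -- The projection onto the part of weight ρ; subtracting α z₀ x removes the constants, which matters when Q ∣ ρ.
      π : ℕ → Carrier → Carrier
      π ρ x = ι ν * ΣL ts (λ u → ι (u O.^ neg ρ) * (α u x - α z₀ x))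

      π-cong : ∀ ρ {x x′} → x ≈ x′ → π ρ x ≈ π ρ x′
      π-cong ρ eq = *-congˡ (Σ-cong ts (λ u → *-congˡ (+-cong (α-cong u eq) (-‿cong (α-cong z₀ eq)))))

      π-+ : ∀ ρ x x′ → π ρ (x + x′) ≈ π ρ x + π ρ x′
      π-+ ρ x x′ = trans (*-congˡ (trans (Σ-cong ts (λ u → trans (*-congˡ (+-cong (α-+ u x x′) (-‿cong (α-+ z₀ x x′)))) (lem _ _ _ _ _)))
        (Σ-+ ts _ _))) (distribˡ _ _ _)
        where
        lem : ∀ c a b d e → c * (a + b - (d + e)) ≈ c * (a - d) + c * (b - e)
        lem = solve 5 (λ c a b d e → c :* (a :+ b :- (d :+ e)) := c :* (a :- d) :+ c :* (b :- e)) refl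

      π-ι* : ∀ ρ c x → π ρ (ι c * x) ≈ ι c * π ρ x
      π-ι* ρ c x = trans (*-congˡ (trans (Σ-cong ts (λ u → trans (*-congˡ (+-cong (α-ι* u c x) (-‿cong (α-ι* z₀ c x)))) (lem _ _ _ _)))
        (Σ-*ˡ ts _ _))) (lem₂ _ _ _)
        where
        lem : ∀ u c a b → u * (c * a - c * b) ≈ c * (u * (a - b))
        lem = solve 4 (λ u c a b → u :* (c :* a :- c :* b) := c :* (u :* (a :- b))) refl
        lem₂ : ∀ a b c → a * (b * c) ≈ b * (a * c)
        lem₂ = solve 3 (λ a b c → a :* (b :* c) := b :* (a :* c)) refl

      z₀-scaled : ∀ {σ x} → 1 ℕ.≤ σ → Weight σ x → α z₀ x ≈ 0#
      z₀-scaled {σ} 1≤σ w = trans (Weight.scaled w (proj₁ (proj₂ zero∈)))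
        (trans (*-congʳ (trans (ι-cong (O.trans (O.^-congˡ σ (proj₂ (proj₂ zero∈))) (O.0^ 1≤σ))) ι-0)) (zeroˡ _))

      π-weight : ∀ ρ {σ x} → 1 ℕ.≤ σ → Weight σ x → π ρ x ≈ ι (ν O.* S (neg ρ ℕ.+ σ)) * x
      π-weight ρ {σ} {x} 1≤σ w = begin
        π ρ x ≈⟨ *-congˡ (Σ-cong∈ ts (λ {u} i → trans (*-congˡ (trans (+-cong (Weight.scaled w i) (trans (-‿cong (z₀-scaled 1≤σ w)) -0#≈0#)) (+-identityʳ _)))
                   (trans (sym (*-assoc _ _ _)) (*-congʳ (trans (sym (ι-* _ _)) (ι-cong (O.sym (O.^-homo-* u (neg ρ) σ)))))))) ⟩
        ι ν * ΣL ts (λ u → ι (u O.^ (neg ρ ℕ.+ σ)) * x) ≈⟨ *-congˡ (trans (Σ-*ʳ ts x _) (*-congʳ (sym (ι-Σ ts _)))) ⟩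
        ι ν * (ι (S (neg ρ ℕ.+ σ)) * x) ≈⟨ trans (sym (*-assoc _ _ _)) (*-congʳ (sym (ι-* _ _))) ⟩
        ι (ν O.* S (neg ρ ℕ.+ σ)) * x ∎
        where open ≈R

      1≤neg+ : ∀ ρ σ → 1 ℕ.≤ neg ρ ℕ.+ σ
      1≤neg+ ρ σ = ℕ.≤-trans (1≤neg ρ) (ℕ.m≤m+n (neg ρ) σ)

      π-fix : ∀ {ρ x} → 1 ℕ.≤ ρ → Weight ρ x → π ρ x ≈ x
      π-fix {ρ} {x} 1≤ρ w = trans (π-weight ρ 1≤ρ w) (trans (*-congʳ (trans (ι-cong
        (O.trans (O.*-congˡ (S-full (1≤neg+ ρ ρ) (≡.subst (Q ∣_) (≡.sym (neg+ ρ)) (m∣m*n (suc ρ))))) (O.trans (O.*-comm _ _) νQ))) ι-1)) (*-identityˡ x))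

      π-1 : ∀ ρ → π ρ 1# ≈ 0#
      π-1 ρ = trans (*-congˡ (Σ-0 ts (λ {u} _ → trans (*-congˡ (trans (+-cong (α-1 u) (-‿cong (α-1 z₀))) (-‿inverseʳ 1#))) (zeroʳ _)))) (zeroʳ _)

      -- A monomial has a single character σ, so the projection kills it or fixes it. If it is
      -- fixed, its weight in the twist l is positive and congruent to p^l ρ, hence at least the
      -- residue of p^l ρ in [1, Q]. The constant monomial, of weight 0, is killed by `π-1`.
      π-mon : ∀ i ρ → 1 ℕ.≤ ρ → ∀ K → Fil i 0 (λ l → res (p ℕ.^ l ℕ.* ρ)) (π ρ (mon K))
      π-mon i ρ 1≤ρ K = go (σ ℕ.≟ 0) (Q ∣? neg ρ ℕ.+ σ)
        where
        σ = sumN h (λ j → K j ℕ.* p ℕ.^ j)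
        K≡0 : σ ≡ 0 → ∀ j → j ℕ.< h → K j ≡ 0
        K≡0 σ0 j j<h = zero-factor (ℕ.m*n≡0⇒m≡0∨n≡0 (K j) (ℕ.n≤0⇒n≡0 (≡.subst (K j ℕ.* p ℕ.^ j ℕ.≤_) σ0 (sumN-term h (λ j → K j ℕ.* p ℕ.^ j) j<h))))
          where
          zero-factor : K j ≡ 0 ⊎ p ℕ.^ j ≡ 0 → K j ≡ 0
          zero-factor (inj₁ e) = e
          zero-factor (inj₂ e) = contradiction (1≤p^ j) (ℕ.<⇒≱ (s≤s (ℕ.≤-reflexive e)))
        W∼ : ∀ l → W K l ∼ p ℕ.^ l ℕ.* σ
        W∼ l = ≡.trans (sum∼ h) (≡.cong (ℕ._% Q) (sumN-* h (p ℕ.^ l) (λ j → K j ℕ.* p ℕ.^ j)))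
          where
          sum∼ : ∀ n → sumN n (λ j → K j ℕ.* rep (j ℕ.+ l)) ∼ sumN n (λ j → p ℕ.^ l ℕ.* (K j ℕ.* p ℕ.^ j))
          sum∼ zero    = ≡.refl
          sum∼ (suc n) = ∼-+ {sumN n (λ j → K j ℕ.* rep (j ℕ.+ l))} {sumN n (λ j → p ℕ.^ l ℕ.* (K j ℕ.* p ℕ.^ j))} {K n ℕ.* rep (n ℕ.+ l)} {p ℕ.^ l ℕ.* (K n ℕ.* p ℕ.^ n)} (sum∼ n)
            (≡.trans (∼-* {K n} {K n} ≡.refl (res∼ (1≤p^ (n ℕ.+ l)))) (≡.cong (ℕ._% Q) (≡.trans (≡.cong (K n ℕ.*_) (ℕ.^-distribˡ-+-* p n l)) (lem (K n) (p ℕ.^ n) (p ℕ.^ l)))))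
            where
            lem : ∀ a b c → a ℕ.* (b ℕ.* c) ≡ c ℕ.* (a ℕ.* b)
            lem = solveℕ-∀
        1≤W : ¬ σ ≡ 0 → ∀ l → 1 ℕ.≤ W K l
        1≤W ne l = ℕ.n≢0⇒n>0 λ W0 → ne (sumN-0 h (λ j j<h → ≡.cong (ℕ._* p ℕ.^ j) (zero-K W0 j j<h)))
          where
          zero-K : W K l ≡ 0 → ∀ j → j ℕ.< h → K j ≡ 0
          zero-K W0 j j<h = zero-factor (ℕ.m*n≡0⇒m≡0∨n≡0 (K j) (ℕ.n≤0⇒n≡0 (≡.subst (K j ℕ.* rep (j ℕ.+ l) ℕ.≤_) W0 (sumN-term h (λ j → K j ℕ.* rep (j ℕ.+ l)) j<h))))
            where
            zero-factor : K j ≡ 0 ⊎ rep (j ℕ.+ l) ≡ 0 → K j ≡ 0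
            zero-factor (inj₁ e) = e
        go : Dec (σ ≡ 0) → Dec (Q ∣ neg ρ ℕ.+ σ) → Fil i 0 (λ l → res (p ℕ.^ l ℕ.* ρ)) (π ρ (mon K))
        go (yes σ0) _ = Fil-≈ (sym (trans (π-cong ρ (trans (mon-cong (K≡0 σ0)) mon-0)) (π-1 ρ))) zer
        go (no ne) (no nd) = Fil-≈ (sym (trans (π-weight ρ (ℕ.n≢0⇒n>0 ne) (Weight-mon K)) (trans (*-congʳ (trans (ι-cong
          (O.trans (O.*-congˡ (S-zero (1≤neg+ ρ σ) nd)) (O.zeroʳ ν))) ι-0)) (zeroˡ _)))) zer
        go (no ne) (yes d) = weak z≤n
          (λ l → res-least (ℕ.*-mono-≤ (1≤p^ l) 1≤ρ) (1≤W ne l) (≡.trans (W∼ l) (∼-* {p ℕ.^ l} {p ℕ.^ l} ≡.refl (∼-neg {ρ} {σ} d))))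
          (sym (π-weight ρ (ℕ.n≢0⇒n>0 ne) (Weight-mon K))) (Fil-ι* _ (Fil-mon i K))

      π-Fil : ∀ i ρ → 1 ℕ.≤ ρ → ∀ {x} → Span Monomial x → Fil i 0 (λ l → res (p ℕ.^ l ℕ.* ρ)) (π ρ x)
      π-Fil i ρ 1≤ρ nil = Fil-≈ (sym (trans (π-cong ρ (sym (trans (*-congʳ ι-0) (zeroˡ 0#)))) (trans (π-ι* ρ O.0# 0#) (trans (*-congʳ ι-0) (zeroˡ _))))) zer
      π-Fil i ρ 1≤ρ (cons c {x} {b} (K , eq) s) = Fil-≈ (sym (trans (π-+ ρ (ι c * x) b) (+-congʳ (trans (π-ι* ρ c x) (*-congˡ (π-cong ρ eq))))))
        (add (Fil-ι* c (π-mon i ρ 1≤ρ K)) (π-Fil i ρ 1≤ρ s))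
      π-Fil i ρ 1≤ρ (≈span eq s) = Fil-≈ (π-cong ρ eq) (π-Fil i ρ 1≤ρ s)

    -- The eigenvalue u^ρ fixes the weight in the twist l modulo Q, hence bounds it below by the residue of p^l ρ in [1, Q].
    Fil-eigenvector : ∀ i k a {ρ x} → 1 ℕ.≤ ρ → Periodic h a → sumN h a ℕ.≤ k → Weight ρ x → nat (p ℕ.^ k) ∣ᵣ x →
      Fil i k (λ l → Q ℕ.* p ℕ.^ i ℕ.* a l ℕ.+ res (p ℕ.^ l ℕ.* ρ)) x
    Fil-eigenvector i k a {ρ} {x} 1≤ρ per sum≤ w (x′ , eq) = weak (ℕ.≤-reflexive (≡.sym (ℕ.+-identityʳ k))) (λ l → ℕ.≤-refl)
      (sym (trans (sym (π-fix 1≤ρ w)) (trans (π-cong ρ (trans eq (*-congʳ (sym (ι-nat (p ℕ.^ k)))))) (trans (π-ι* ρ _ x′) (*-congʳ (ι-nat (p ℕ.^ k)))))))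
      (mul (pw a k per sum≤) (π-Fil i ρ 1≤ρ (spanning x′)))

    private
      no-carry : Periodic h (λ _ → 0)
      no-carry _ = ≡.refl

      sum-0 : ∀ {k} → sumN h (λ _ → 0) ℕ.≤ k
      sum-0 = ≡.subst (ℕ._≤ _) (≡.sym (sumN-0 h (λ _ _ → ≡.refl))) z≤n

    Fil-E : ∀ i r → 1 ℕ.≤ r → Fil i 0 (λ l → res (p ℕ.^ l ℕ.* r)) (E r)
    Fil-E i r 1≤r = weak z≤n (λ l → ℕ.m≤n+m _ _) refl
      (Fil-eigenvector i 0 (λ _ → 0) 1≤r no-carry sum-0 (Weight-E 1≤r) (E r , sym (trans (*-congʳ nat-1) (*-identityˡ _))))

    Fil-y : ∀ i j → Fil i 0 (λ l → rep (j ℕ.+ l)) (y j)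
    Fil-y i j = weak z≤n (λ l → ℕ.≤-reflexive (≡.cong res (≡.trans (ℕ.^-distribˡ-+-* p j l) (ℕ.*-comm (p ℕ.^ j) _)))) refl (Fil-E i (p ℕ.^ j) (1≤p^ j))

    h≢0 : suc (pred h) ≡ h
    h≢0 = go h q≡
      where
      go : ∀ n → p ℕ.^ n ≡ suc Q → suc (pred n) ≡ n
      go (suc n) _ = ≡.refl

    private
      -- On h-periodic sequences adding h - 1 is subtracting 1, so twists rotate backwards without
      -- truncated subtraction.
      h′ : ℕ
      h′ = pred h

      rep-shift : ∀ j l → rep (suc j ℕ.+ (l ℕ.+ h′)) ≡ rep (j ℕ.+ l)
      rep-shift j l = ≡.trans (≡.cong rep (≡.trans (lem j l h′) (≡.cong (ℕ._+ (j ℕ.+ l)) h≢0))) (rep-periodic (j ℕ.+ l))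
        where
        lem : ∀ j l k → suc j ℕ.+ (l ℕ.+ k) ≡ suc k ℕ.+ (j ℕ.+ l)
        lem = solveℕ-∀

      p^1 : nat p ≈ nat (p ℕ.^ 1)
      p^1 = nat-cong (≡.sym (ℕ.*-identityʳ p))

      -- With J in the place of j - 1, `frobenius` writes Ψ y_j as y_J^p plus an eigenvector
      -- divisible by p. The power has the weight claimed. The eigenvector is guaranteed only the
      -- residue weight and misses Q times a carry, so its factor p is spent in the twist where that
      -- carry occurs.
      Ψ-y : ∀ i j → Fil (suc i) 0 (λ l → p ℕ.* rep (j ℕ.+ (l ℕ.+ h′))) (Ψ (y j))
      Ψ-y i j = Fil-≈ (sym eq) (add
          (weak ℕ.≤-refl (λ l → ℕ.≤-reflexive (≡.cong (λ k → p ℕ.* rep k) (lem₁ j l h′))) refl (Fil-^ p (Fil-y (suc i) J)))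
          (weak z≤n bound refl (Fil-eigenvector (suc i) 1 (λ l → carry (l ℕ.+ J)) (1≤p^ j)
            (Periodic-+ {h} {carry} J carry-periodic) (ℕ.≤-reflexive (≡.trans (sumN-shift+ h carry J carry-periodic) sum-carry)) w-d
            (z , *-congʳ p^1))))
        where
        J = j ℕ.+ h′
        lem₁ : ∀ j l k → j ℕ.+ (l ℕ.+ k) ≡ j ℕ.+ k ℕ.+ l
        lem₁ = solveℕ-∀
        wraps : p ℕ.^ j ∼ p ℕ.* p ℕ.^ J
        wraps = ≡.trans (≡.sym (p^h+∼ j)) (≡.cong (λ n → (p ℕ.^ n) ℕ.% Q) (≡.trans (≡.cong (ℕ._+ j) (≡.sym h≢0)) (≡.cong suc (ℕ.+-comm h′ j))))
        open _≡_mod_ (≡-sym (frobenius {p ℕ.^ J} {p ℕ.^ j} (1≤p^ J) wraps)) renaming (factor to z; proof to eq)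
        w-d : Weight (p ℕ.^ j) (nat p * z)
        w-d = Weight-resp (trans (+-congʳ eq) (lem _ _)) (Weight-+ (Weight-αE (O.nat p) (1≤p^ j))
                (Weight-neg (Weight-∼ (1≤p^ (suc J)) (1≤p^ j) (≡.sym wraps) (Weight-^ p (Weight-E (1≤p^ J))))))
          where
          lem : ∀ a b → a + b - a ≈ b
          lem = solve 2 (λ a b → a :+ b :- a := b) refl
        bound : ∀ l → p ℕ.* rep (j ℕ.+ (l ℕ.+ h′)) ℕ.≤ Q ℕ.* p ℕ.^ suc i ℕ.* carry (l ℕ.+ J) ℕ.+ res (p ℕ.^ l ℕ.* p ℕ.^ j)
        bound l = begin
          p ℕ.* rep (j ℕ.+ (l ℕ.+ h′))                        ≡⟨ ≡.cong (λ k → p ℕ.* rep k) (lem₂ j l h′) ⟩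
          p ℕ.* rep (l ℕ.+ J)                                 ≡⟨ carry-eq (l ℕ.+ J) ⟩
          rep (suc (l ℕ.+ J)) ℕ.+ Q ℕ.* carry (l ℕ.+ J)       ≡⟨ ℕ.+-comm _ (Q ℕ.* carry (l ℕ.+ J)) ⟩
          Q ℕ.* carry (l ℕ.+ J) ℕ.+ rep (suc (l ℕ.+ J))
            ≤⟨ ℕ.+-mono-≤ (ℕ.*-monoˡ-≤ (carry (l ℕ.+ J)) (ℕ.m≤m*n Q (p ℕ.^ suc i) {{ℕ.>-nonZero (1≤p^ (suc i))}}))
                 (ℕ.≤-reflexive (rep-shift l j)) ⟩
          Q ℕ.* p ℕ.^ suc i ℕ.* carry (l ℕ.+ J) ℕ.+ rep (l ℕ.+ j)
            ≡⟨ ≡.cong (λ k → Q ℕ.* p ℕ.^ suc i ℕ.* carry (l ℕ.+ J) ℕ.+ res k) (ℕ.^-distribˡ-+-* p l j) ⟩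
          Q ℕ.* p ℕ.^ suc i ℕ.* carry (l ℕ.+ J) ℕ.+ res (p ℕ.^ l ℕ.* p ℕ.^ j) ∎
          where
          open ℕ.≤-Reasoning
          lem₂ : ∀ j l k → j ℕ.+ (l ℕ.+ k) ≡ l ℕ.+ (j ℕ.+ k)
          lem₂ = solveℕ-∀

    -- Ψ is a ring homomorphism, so only generators matter, and `Ψ-y` treats them. It fixes the
    -- number p, whose value must be multiplied by p along with all weights; hence the step from i
    -- to suc i.
    Ψ-Fil : ∀ {i k w x} → Fil i k w x → Fil (suc i) k (λ l → p ℕ.* w (l ℕ.+ pred h)) (Ψ x)
    Ψ-Fil zer = Fil-≈ (sym (α-0 _)) zer
    Ψ-Fil {i} (pw a k per s) = weak ℕ.≤-refl (λ l → ℕ.≤-reflexive (lem p Q (p ℕ.^ i) (a (l ℕ.+ h′)))) (sym (α-nat _ (p ℕ.^ k)))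
      (pw (λ l → a (l ℕ.+ h′)) k (Periodic-+ {h} {a} h′ per) (≡.subst (ℕ._≤ k) (≡.sym (sumN-shift+ h a h′ per)) s))
      where
      lem : ∀ p q r a → p ℕ.* (q ℕ.* r ℕ.* a) ≡ q ℕ.* (p ℕ.* r) ℕ.* a
      lem = solveℕ-∀
    Ψ-Fil (cst c) = weak z≤n (λ l → ℕ.≤-reflexive (ℕ.*-zeroʳ p)) (sym (α-ι _ c)) (cst c)
    Ψ-Fil {i} (gen j j<h) = Ψ-y i j
    Ψ-Fil (add f g) = Fil-≈ (sym (α-+ _ _ _)) (add (Ψ-Fil f) (Ψ-Fil g))
    Ψ-Fil (mul f g) = weak ℕ.≤-refl (λ l → ℕ.≤-reflexive (ℕ.*-distribˡ-+ p _ _)) (sym (α-* _ _ _)) (mul (Ψ-Fil f) (Ψ-Fil g))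
    Ψ-Fil (weak a b c f) = weak a (λ l → ℕ.*-monoʳ-≤ p (b (l ℕ.+ h′))) (α-cong _ c) (Ψ-Fil f)

    Ψ^ : ℕ → Carrier → Carrier
    Ψ^ zero    x = x
    Ψ^ (suc i) x = Ψ (Ψ^ i x)

    Ψ^-E : ∀ i r → Ψ^ i (E r) ≈ ΣL ts (λ t → ι (t O.^ neg r) * e (O.nat (p ℕ.^ i) O.* t))
    Ψ^-E zero    r = Σ-cong ts (λ t → *-congˡ (e-cong (O.sym (O.trans (O.*-congʳ O.nat-1) (O.*-identityˡ t)))))
    Ψ^-E (suc i) r = trans (α-cong _ (Ψ^-E i r)) (trans (α-Σ _ ts _) (Σ-cong ts (λ t → trans (α-ι* _ _ _) (*-congˡ (trans (α-e _ _)
      (e-cong (O.trans (O.sym (O.*-assoc _ _ _)) (O.*-congʳ (O.sym (O.nat-* p (p ℕ.^ i)))))))))))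

    private
      -- Telescoping: the difference for suc i is (A^(p^i) - C^(p^i)) + Ψ X with A = y_j^p, C = Ψ
      -- y_(j+1) and X the difference one stage earlier. As A ≡ C modulo p, the first part is an
      -- eigenvector divisible by p^(i+1); its i + 1 factors p are spent at the i + 1 carries, which
      -- by `carries-bound` make up for the lost weight at the value Q p^i.
      y-power-Ψ : ∀ i j → Fil (pred i) 1 (λ l → p ℕ.^ i ℕ.* rep (j ℕ.+ l)) (y j ^ (p ℕ.^ i) - Ψ^ i (y (i ℕ.+ j)))
      y-power-Ψ zero j = Fil-≈ (sym (trans (+-congʳ (*-identityʳ (y j))) (-‿inverseʳ (y j)))) zer
      y-power-Ψ (suc i) j = Fil-≈ total (add (weak (s≤s z≤n) bound (sym d₁) (Fil-eigenvector i (suc i) (λ l → carries (suc i) (l ℕ.+ j))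
            (ℕ.*-mono-≤ (1≤p^ i) (1≤p^ (suc j))) (Periodic-+ {h} {carries (suc i)} j (carries-periodic (suc i)))
            (ℕ.≤-reflexive (≡.trans (sumN-shift+ h (carries (suc i)) j (carries-periodic (suc i))) (sum-carries (suc i))))
            (Weight-resp d₁ (Weight-+ (Weight-^ (p ℕ.^ i) (Weight-^ p (Weight-E (1≤p^ j)))) (Weight-neg (Weight-^ (p ℕ.^ i) (Weight-αE _ (1≤p^ (suc j)))))))
            (z , *-congʳ (nat-cong (≡.cong (p ℕ.^_) (ℕ.+-comm i 1)))))) (second i))
        where
        A = y j ^ p
        C = Ψ (y (suc j))
        X = y (suc j) ^ (p ℕ.^ i) - Ψ^ i (y (i ℕ.+ suc j))
        A≡C : A ≡ C mod p ℕ.^ 1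
        A≡C = let (z , eq) = frobenius {p ℕ.^ j} {p ℕ.^ suc j} (1≤p^ j) ≡.refl in z , trans eq (+-congˡ (*-congʳ p^1))
        open _≡_mod_ (^p^-lift prime i 0 A≡C) renaming (factor to z; proof to eq)
        d₁ : A ^ (p ℕ.^ i) - C ^ (p ℕ.^ i) ≈ nat (p ℕ.^ (i ℕ.+ 1)) * z
        d₁ = trans (+-congʳ eq) (lem _ _)
          where
          lem : ∀ a b → a + b - a ≈ b
          lem = solve 2 (λ a b → a :+ b :- a := b) refl
        total : (A ^ (p ℕ.^ i) - C ^ (p ℕ.^ i)) + Ψ X ≈ y j ^ (p ℕ.^ suc i) - Ψ^ (suc i) (y (suc i ℕ.+ j))
        total = trans (+-congˡ (trans (α-+ _ _ _) (+-cong (α-^ _ (y (suc j)) (p ℕ.^ i)) (α-neg _ _)))) (trans (lem _ _ _)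
          (+-cong (^-assocʳ (y j) p (p ℕ.^ i)) (-‿cong (reflexive (≡.cong (λ k → Ψ^ (suc i) (y k)) (ℕ.+-suc i j))))))
          where
          lem : ∀ a b c → a - b + (b + - c) ≈ a - c
          lem = solve 3 (λ a b c → a :- b :+ (b :+ :- c) := a :- c) refl
        bound : ∀ l → p ℕ.^ suc i ℕ.* rep (j ℕ.+ l) ℕ.≤ Q ℕ.* p ℕ.^ i ℕ.* carries (suc i) (l ℕ.+ j) ℕ.+ res (p ℕ.^ l ℕ.* (p ℕ.^ i ℕ.* p ℕ.^ suc j))
        bound l = ℕ.≤-trans (ℕ.≤-reflexive (≡.cong (λ k → p ℕ.^ suc i ℕ.* rep k) (ℕ.+-comm j l)))
          (ℕ.≤-trans (carries-bound (suc i) (l ℕ.+ j)) (ℕ.≤-reflexive (≡.cong (λ k → Q ℕ.* p ℕ.^ i ℕ.* carries (suc i) (l ℕ.+ j) ℕ.+ res k)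
            (≡.trans (≡.cong (p ℕ.^_) (lem i l j)) (≡.trans (ℕ.^-distribˡ-+-* p l (i ℕ.+ suc j)) (≡.cong (p ℕ.^ l ℕ.*_) (ℕ.^-distribˡ-+-* p i (suc j))))))))
          where
          lem : ∀ i l j → suc i ℕ.+ (l ℕ.+ j) ≡ l ℕ.+ (i ℕ.+ suc j)
          lem = solveℕ-∀
        second : ∀ i → Fil i 1 (λ l → p ℕ.^ suc i ℕ.* rep (j ℕ.+ l)) (Ψ (y (suc j) ^ (p ℕ.^ i) - Ψ^ i (y (i ℕ.+ suc j))))
        -- Here pred 0 is 0, so `Ψ-Fil` would end at level 1 instead of 0; but X is zero. For suc i
        -- the levels fit.
        second zero = Fil-≈ (sym (trans (α-cong _ (trans (+-congʳ (*-identityʳ _)) (-‿inverseʳ _))) (α-0 _))) zer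
        second (suc i) = weak ℕ.≤-refl (λ l → ℕ.≤-reflexive (≡.trans (ℕ.*-assoc p (p ℕ.^ suc i) (rep (j ℕ.+ l)))
            (≡.cong (λ k → p ℕ.* (p ℕ.^ suc i ℕ.* k)) (≡.sym (rep-shift j l))))) refl (Ψ-Fil (y-power-Ψ (suc i) (suc j)))

    -- Ψ^m annihilates the augmentation ideal because [p^m t] = 1, so the difference in `y-power-Ψ`
    -- is the power itself. The relation lowers an exponent at no cost in weight and produces a
    -- factor p.
    y-power : ∀ j → Fil μ 1 (λ l → p ℕ.^ suc μ ℕ.* rep (j ℕ.+ l)) (y j ^ (p ℕ.^ suc μ))
    y-power j = Fil-≈ (trans (+-congˡ (trans (-‿cong vanish) -0#≈0#)) (+-identityʳ _)) (y-power-Ψ (suc μ) j)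
      where
      vanish : Ψ^ (suc μ) (y (suc μ ℕ.+ j)) ≈ 0#
      vanish = trans (Ψ^-E (suc μ) _) (Σ-0 ts (λ {t} _ → trans (*-congˡ (trans (+-congʳ ([]-ϖ t)) (-‿inverseʳ 1#))) (zeroʳ _)))

open WeightFiltration

-- Reduction to exponents below p^m and the resulting divisibility.

module MonomialReduction where

  open import Defs using (ceilDiv)
  open import Level using (0ℓ)
  open import Algebra.Bundles using (CommutativeRing)
  open import Data.Nat as ℕ using (ℕ; zero; suc; s≤s; z≤n)
  import Data.Nat.Properties as ℕ
  open import Data.Nat.Tactic.RingSolver using () renaming (solve-∀ to solveℕ-∀)
  open import Data.Product using (Σ; ∃; _×_; _,_)
  open import Data.Sum using (_⊎_; inj₁; inj₂)
  open import Relation.Nullary using (yes; no)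
  open import Relation.Binary.PropositionalEquality as ≡ using (_≡_)

  module Reduction (O : CommutativeRing 0ℓ 0ℓ) (p h Q′ N : ℕ) (D : TeichmüllerSystem O p h Q′ N)
    (μ : ℕ) (GA : GroupAlgebra O (RingFacts.nat O (p ℕ.^ suc μ))) where
    open TeichmüllerSystem D
    open Residues Q′
    open Powers p h prime q≡
    open Nats
    open Ceilings
    open GroupAlgebra GA
    open RingFacts B
    open Eigenvectors O p h Q′ N D μ GA
    open Generation O p h Q′ N D μ GA
    open Spanning O p h Q′ N D μ GA
    open Filtration O p h Q′ N D μ GA

    W-+ : ∀ K L l → W (λ j → K j ℕ.+ L j) l ≡ W K l ℕ.+ W L l
    W-+ K L l = ≡.trans (sumN-cong h (λ j _ → ℕ.*-distribʳ-+ (rep (j ℕ.+ l)) (K j) (L j))) (sumN-+ h _ _)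

    W-cong : ∀ {K L} l → (∀ j → K j ≡ L j) → W K l ≡ W L l
    W-cong l eq = sumN-cong h (λ j _ → ≡.cong (ℕ._* rep (j ℕ.+ l)) (eq j))

    W-spike : ∀ {j} n l → j ℕ.< h → W (spike j n) l ≡ n ℕ.* rep (j ℕ.+ l)
    W-spike {j} n l j<h = ≡.trans (sumN-single h j<h (λ i _ ne → ≡.cong (ℕ._* rep (i ℕ.+ l)) (spike-≢ n ne)))
      (≡.cong (ℕ._* rep (j ℕ.+ l)) (spike-≡ j n))

    -- A monomial times p^k′ together with a plan for its factors p: `a l` of them are credited to
    -- the twist l, and at most k′ in all.
    record Term (k : ℕ) (w : ℕ → ℕ) (x : Carrier) : Set where
      constructor term
      field
        k′   : ℕ
        k≤k′ : k ℕ.≤ k′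
        a    : ℕ → ℕ
        K    : ℕ → ℕ
        sum≤ : sumN h a ℕ.≤ k′
        w≤   : ∀ l → w l ℕ.≤ Q ℕ.* p ℕ.^ μ ℕ.* a l ℕ.+ W K l
        eq   : x ≈ nat (p ℕ.^ k′) * mon K

    Term-* : ∀ {k l v w x x′} → Term k v x → Term l w x′ → Term (k ℕ.+ l) (λ i → v i ℕ.+ w i) (x * x′)
    Term-* (term k′ k≤ a K s v≤ eq) (term l′ l≤ b L s′ w≤ eq′) = term (k′ ℕ.+ l′) (ℕ.+-mono-≤ k≤ l≤) (λ i → a i ℕ.+ b i) (λ j → K j ℕ.+ L j)
      (ℕ.≤-trans (ℕ.≤-reflexive (sumN-+ h a b)) (ℕ.+-mono-≤ s s′))
      (λ i → ℕ.≤-trans (ℕ.+-mono-≤ (v≤ i) (w≤ i)) (ℕ.≤-reflexive (≡.trans (lemℕ (Q ℕ.* p ℕ.^ μ) (a i) (W K i) (b i) (W L i))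
        (≡.cong (Q ℕ.* p ℕ.^ μ ℕ.* (a i ℕ.+ b i) ℕ.+_) (≡.sym (W-+ K L i))))))
      (trans (*-cong eq eq′) (trans (lem _ _ _ _) (*-cong (sym (trans (nat-cong (ℕ.^-distribˡ-+-* p k′ l′)) (nat-* (p ℕ.^ k′) (p ℕ.^ l′)))) (sym (mon-+ K L)))))
      where
      lemℕ : ∀ c a x b y → c ℕ.* a ℕ.+ x ℕ.+ (c ℕ.* b ℕ.+ y) ≡ c ℕ.* (a ℕ.+ b) ℕ.+ (x ℕ.+ y)
      lemℕ = solveℕ-∀
      lem : ∀ a b c d → a * b * (c * d) ≈ a * c * (b * d)
      lem = solve 4 (λ a b c d → a :* b :* (c :* d) := a :* c :* (b :* d)) refl

    Term-weak : ∀ {k k′ w w′ x x′} → k′ ℕ.≤ k → (∀ l → w′ l ℕ.≤ w l) → x ≈ x′ → Term k w x → Term k′ w′ x′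
    Term-weak le w≤′ xx (term k₁ k≤ a K s w≤ eq) = term k₁ (ℕ.≤-trans le k≤) a K s (λ l → ℕ.≤-trans (w≤′ l) (w≤ l)) (trans (sym xx) eq)

    private
      sum-0 : sumN h (λ _ → 0) ℕ.≤ 0
      sum-0 = ℕ.≤-reflexive (sumN-0 h (λ _ _ → ≡.refl))

      *mon-0 : ∀ {x} → x ≈ x * mon (λ _ → 0)
      *mon-0 = sym (trans (*-congˡ mon-0) (*-identityʳ _))

      p^0* : ∀ {x} → x ≈ nat (p ℕ.^ 0) * x
      p^0* = sym (trans (*-congʳ nat-1) (*-identityˡ _))

    Fil⇒Span : ∀ {k w x} → Fil μ k w x → Span (Term k w) x
    Fil⇒Span zer            = nil
    Fil⇒Span (pw a k _ s)   = Span-one (term k ℕ.≤-refl a (λ _ → 0) s (λ l → ℕ.m≤m+n _ _) *mon-0)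
    Fil⇒Span (cst c)        = ≈span (*-identityʳ _) (Span-ι* c (Span-one (term 0 z≤n (λ _ → 0) (λ _ → 0) sum-0 (λ _ → z≤n) (trans (sym mon-0) p^0*))))
    Fil⇒Span (gen j j<h)    = Span-one (term 0 z≤n (λ _ → 0) (spike j 1) sum-0
      (λ l → ℕ.≤-trans (ℕ.≤-reflexive (≡.sym (≡.trans (W-spike 1 l j<h) (ℕ.*-identityˡ _)))) (ℕ.m≤n+m _ _))
      (trans (sym (trans (mon-spike 1 j<h) (*-identityʳ _))) p^0*))
    Fil⇒Span (add f g)      = Span-+ (Fil⇒Span f) (Fil⇒Span g)
    Fil⇒Span (mul f g)      = Span-* Term-* (Fil⇒Span f) (Fil⇒Span g)
    Fil⇒Span (weak a b c f) = ≈span c (Span-bind (λ t → Span-one (Term-weak a b refl t)) (Fil⇒Span f))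

    Reduced : (ℕ → ℕ) → Carrier → Set
    Reduced w x = Σ (Term 0 w x) λ t → ∀ j → j ℕ.< h → Term.K t j ℕ.< p ℕ.^ suc μ

    private
      P : ℕ
      P = p ℕ.^ suc μ

      search : ∀ n (K : ℕ → ℕ) → (∀ j → j ℕ.< n → K j ℕ.< P) ⊎ ∃ λ j → j ℕ.< n × P ℕ.≤ K j
      search zero    K = inj₁ (λ _ ())
      search (suc n) K with search n K | P ℕ.≤? K n
      ... | inj₂ (j , j<n , le) | _      = inj₂ (j , ℕ.m<n⇒m<1+n j<n , le)
      ... | inj₁ _              | yes le = inj₂ (n , ℕ.≤-refl , le)
      ... | inj₁ small          | no nle = inj₁ bounded
        where
        bounded : ∀ j → j ℕ.< suc n → K j ℕ.< P
        bounded j j<n with ℕ.m≤n⇒m<n∨m≡n (ℕ.s≤s⁻¹ j<n)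
        ... | inj₁ lt     = small j lt
        ... | inj₂ ≡.refl = ℕ.≰⇒> nle

      -- The factor y_j^P is split off and rewritten by `y-power`; the new terms have at least its
      -- weight and one factor p more.
      extract : ∀ {k w x} (t : Term k w x) j → j ℕ.< h → P ℕ.≤ Term.K t j → Span (Term (suc k) w) x
      extract {k} {w} (term k′ k≤ a K s w≤ eq) j j<h le = ≈span (trans (*-comm _ _) (trans (trans (*-assoc _ _ _) (*-congˡ factored)) (sym eq)))
        (Span-bind (λ t → Span-one (Term-weak (s≤s k≤) weights refl t))
          (Span-* Term-* (Fil⇒Span (y-power j)) (Span-one rest)))
        where
        K′ : ℕ → ℕ
        K′ i = K i ℕ.∸ spike j P i
        spike≤ : ∀ i → spike j P i ℕ.≤ K i
        spike≤ i with i ℕ.≟ j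
        ... | yes ≡.refl = le
        ... | no _       = z≤n
        K≡ : ∀ i → spike j P i ℕ.+ K′ i ≡ K i
        K≡ i = ℕ.m+[n∸m]≡n (spike≤ i)
        rest : Term k′ (λ l → Q ℕ.* p ℕ.^ μ ℕ.* a l ℕ.+ W K′ l) (nat (p ℕ.^ k′) * mon K′)
        rest = term k′ ℕ.≤-refl a K′ s (λ l → ℕ.≤-refl) refl
        factored : mon K′ * y j ^ P ≈ mon K
        factored = trans (*-comm _ _) (trans (*-congʳ (sym (mon-spike P j<h))) (trans (sym (mon-+ (spike j P) K′)) (mon-cong (λ i _ → K≡ i))))
        weights : ∀ l → w l ℕ.≤ P ℕ.* rep (j ℕ.+ l) ℕ.+ (Q ℕ.* p ℕ.^ μ ℕ.* a l ℕ.+ W K′ l)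
        weights l = ℕ.≤-trans (w≤ l) (ℕ.≤-reflexive (≡.trans (≡.cong (Q ℕ.* p ℕ.^ μ ℕ.* a l ℕ.+_)
          (≡.trans (≡.sym (W-cong l K≡)) (≡.trans (W-+ (spike j P) K′ l) (≡.cong (ℕ._+ W K′ l) (W-spike P l j<h)))))
          (lem (Q ℕ.* p ℕ.^ μ ℕ.* a l) (P ℕ.* rep (j ℕ.+ l)) (W K′ l))))
          where
          lem : ∀ a b c → a ℕ.+ (b ℕ.+ c) ≡ b ℕ.+ (a ℕ.+ c)
          lem = solveℕ-∀

      vanishes : ∀ {k w x} → N ℕ.≤ k → Term k w x → x ≈ 0#
      vanishes le (term k′ k≤ a K s w≤ eq) = trans eq (trans (*-congʳ (trans (nat-cong (≡.trans (≡.cong (p ℕ.^_) (≡.sym (ℕ.m+[n∸m]≡n (ℕ.≤-trans le k≤))))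
        (ℕ.^-distribˡ-+-* p N (k′ ℕ.∸ N)))) (trans (nat-* (p ℕ.^ N) _) (trans (*-congʳ p^N≈0ᴮ) (zeroˡ _))))) (zeroˡ _))

    -- Each rewriting of some y_j^(p^m) costs a factor p, so p^N = 0 bounds the number of rounds.
    reduce : ∀ f {k w x} → N ℕ.≤ f ℕ.+ k → Term k w x → Span (Reduced w) x
    reduce zero    le t = ≈span (sym (vanishes le t)) nil
    reduce (suc f) {k} {w} {x} le t = go (search h (Term.K t))
      where
      go : (∀ j → j ℕ.< h → Term.K t j ℕ.< P) ⊎ (∃ λ j → j ℕ.< h × P ℕ.≤ Term.K t j) → Span (Reduced w) x
      go (inj₁ small) = Span-one (Term-weak z≤n (λ _ → ℕ.≤-refl) refl t , small)
      go (inj₂ (j , j<h , big)) = Span-bind (reduce f (≡.subst (N ℕ.≤_) (≡.sym (ℕ.+-suc f k)) le)) (extract t j j<h big)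

    private
      [p-1]*sum-rep : (p ℕ.∸ 1) ℕ.* sumN h rep ≡ Q
      [p-1]*sum-rep = ≡.trans (ℕ.*-distribʳ-∸ (sumN h rep) p 1) (≡.trans (≡.cong₂ ℕ._∸_ p*sum-rep (ℕ.*-identityˡ (sumN h rep))) (ℕ.m+n∸m≡n (sumN h rep) Q))

    -- Exponents are at most p^m - 1, and in each twist the weights of the generators add up to Q /
    -- (p - 1). This is where the term (p^m - 1)/(p - 1) of the bound comes from.
    W-bounded : ∀ K → (∀ j → j ℕ.< h → K j ℕ.< P) → ∀ l → W K l ℕ.≤ repunit p (suc μ) ℕ.* Q
    W-bounded K small l = begin
      sumN h (λ j → K j ℕ.* rep (j ℕ.+ l))            ≤⟨ sumN-mono h (λ j j<h → ℕ.*-monoˡ-≤ (rep (j ℕ.+ l)) (ℕ.∸-monoˡ-≤ 1 (small j j<h))) ⟩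
      sumN h (λ j → (P ℕ.∸ 1) ℕ.* rep (j ℕ.+ l))      ≡⟨ sumN-* h (P ℕ.∸ 1) _ ⟩
      (P ℕ.∸ 1) ℕ.* sumN h (λ j → rep (j ℕ.+ l))      ≡⟨ ≡.cong ((P ℕ.∸ 1) ℕ.*_) (sum-rep l) ⟩
      (P ℕ.∸ 1) ℕ.* sumN h rep                        ≡⟨ ≡.cong (ℕ._* sumN h rep) (repunit-eq p (suc μ) 2≤p) ⟨
      repunit p (suc μ) ℕ.* (p ℕ.∸ 1) ℕ.* sumN h rep  ≡⟨ ℕ.*-assoc (repunit p (suc μ)) (p ℕ.∸ 1) _ ⟩
      repunit p (suc μ) ℕ.* ((p ℕ.∸ 1) ℕ.* sumN h rep) ≡⟨ ≡.cong (repunit p (suc μ) ℕ.*_) [p-1]*sum-rep ⟩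
      repunit p (suc μ) ℕ.* Q                         ∎
      where open ℕ.≤-Reasoning

    Span-∣ : ∀ {R : Carrier → Set} {c} → (∀ {x} → R x → c ∣ᵣ x) → ∀ {x} → Span R x → c ∣ᵣ x
    Span-∣ f nil = 0# , sym (zeroʳ _)
    Span-∣ f (cons c px s) = let (z , eq) = f px ; (z′ , eq′) = Span-∣ f s in
      ι c * z + z′ , trans (+-cong (*-congˡ eq) eq′) (lem _ _ _ _)
      where
      lem : ∀ c p z w → c * (p * z) + p * w ≈ p * (c * z + w)
      lem = solve 4 (λ c p z w → c :* (p :* z) :+ p :* w := p :* (c :* z :+ w)) refl
    Span-∣ f (≈span eq s) = let (z , eq′) = Span-∣ f s in z , trans (sym eq) eq′

    ceiling : ℕ → ℕ → ℕ
    ceiling s d = ceilDiv (s ℕ.∸ repunit p (suc μ) ℕ.* d) (p ℕ.^ μ ℕ.* d)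

    module _ (s d : ℕ) (1≤d : 1 ℕ.≤ d) (w : ℕ → ℕ) (heavy : ∀ l → Q ℕ.* s ℕ.≤ w l ℕ.* d) where

      private
        -- A reduced monomial supplies at most `repunit` times Q in the twist l; what w l still
        -- demands must be met by `a l` factors of value Q p^μ. Multiplying by d and cancelling Q
        -- leaves the inequality defining the ceiling.
        ceiling≤a : ∀ {x} → ((t , _) : Reduced w x) → ∀ l → ceiling s d ℕ.≤ Term.a t l
        ceiling≤a (term k′ k≤ a K sum≤ w≤ eq , small) l = ceilDiv-least _ (p ℕ.^ μ ℕ.* d) (a l) (ℕ.*-mono-≤ (1≤p^ μ) 1≤d)
          (ℕ.m≤n+o⇒m∸n≤o s (R ℕ.* d) (ℕ.*-cancelˡ-≤ Q (begin
            Q ℕ.* s                                           ≤⟨ heavy l ⟩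
            w l ℕ.* d                                         ≤⟨ ℕ.*-monoˡ-≤ d (ℕ.≤-trans (w≤ l) (ℕ.+-monoʳ-≤ _ (W-bounded K small l))) ⟩
            (Q ℕ.* p ℕ.^ μ ℕ.* a l ℕ.+ R ℕ.* Q) ℕ.* d         ≡⟨ lem Q (p ℕ.^ μ) (a l) R d ⟩
            Q ℕ.* (R ℕ.* d ℕ.+ p ℕ.^ μ ℕ.* d ℕ.* a l)         ∎)))
          where
          open ℕ.≤-Reasoning
          R = repunit p (suc μ)
          lem : ∀ q r a t d → (q ℕ.* r ℕ.* a ℕ.+ t ℕ.* q) ℕ.* d ≡ q ℕ.* (t ℕ.* d ℕ.+ r ℕ.* d ℕ.* a)
          lem = solveℕ-∀

        -- Each of the h twists needs `ceiling s d` factors p of its own, and the sum of all `a l`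
        -- is at most the number k′ present.
        reduced-divisible : ∀ {x} → Reduced w x → nat (p ℕ.^ (h ℕ.* ceiling s d)) ∣ᵣ x
        reduced-divisible r@(term k′ k≤ a K sum≤ w≤ eq , small) = nat (p ℕ.^ (k′ ℕ.∸ c)) * mon K ,
          trans eq (trans (*-congʳ (trans (nat-cong (≡.trans (≡.cong (p ℕ.^_) (≡.sym (ℕ.m+[n∸m]≡n c≤))) (ℕ.^-distribˡ-+-* p c (k′ ℕ.∸ c)))) (nat-* (p ℕ.^ c) _))) (*-assoc _ _ _))
          where
          c = h ℕ.* ceiling s d
          c≤ : c ℕ.≤ k′
          c≤ = ℕ.≤-trans (ℕ.≤-reflexive (≡.sym (sumN-const h (ceiling s d)))) (ℕ.≤-trans (sumN-mono h (λ l _ → ceiling≤a r l)) sum≤)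

      Fil-divisible : ∀ {x} → Fil μ 0 w x → nat (p ℕ.^ (h ℕ.* ceiling s d)) ∣ᵣ x
      Fil-divisible f = Span-∣ reduced-divisible (Span-bind (reduce N (ℕ.≤-reflexive (≡.sym (ℕ.+-identityʳ N)))) (Fil⇒Span f))

open MonomialReduction

-- Sums over the Teichmüller box.

module BoxCounting where

  open import Defs using (divN)
  open import Level using (0ℓ)
  open import Algebra.Bundles using (CommutativeRing)
  open import Data.Nat as ℕ using (ℕ; zero; suc; s≤s; z≤n; pred)
  import Data.Nat.Properties as ℕ
  import Data.Nat.DivMod as ℕ
  open import Data.Nat.Divisibility using (_∣_; _∣?_; ∣⇒≤; m%n≡0⇒n∣m; n∣m⇒m%n≡0)
  open import Data.Nat.Tactic.RingSolver using () renaming (solve-∀ to solveℕ-∀)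
  open import Data.List using (List; []; _∷_; upTo)
  open import Data.List.Membership.Propositional using (_∈_)
  open import Data.List.Membership.Propositional.Properties using (∈-upTo⁻)
  open import Data.List.Relation.Unary.Any using (here; there)
  import Data.List.Relation.Unary.All as LAll
  open import Data.Vec as V using (Vec; []; _∷_)
  open import Data.Vec.Relation.Unary.All using (All; []; _∷_)
  open import Data.Vec.Relation.Binary.Pointwise.Inductive using (Pointwise; []; _∷_)
  open import Data.Product using (∃; _×_; _,_; proj₁; proj₂)
  open import Data.Sum using (_⊎_; inj₁; inj₂)
  open import Relation.Nullary using (yes; no; contradiction; Dec)
  open import Relation.Binary.PropositionalEquality as ≡ using (_≡_)

  module BoxSums (O : CommutativeRing 0ℓ 0ℓ) (p h Q′ N : ℕ) (D : TeichmüllerSystem O p h Q′ N)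
    (μ : ℕ) (GA : GroupAlgebra O (RingFacts.nat O (p ℕ.^ suc μ))) (d : ℕ) (1≤d : 1 ℕ.≤ d) where
    private module O = RingFacts O
    open TeichmüllerSystem D
    open Residues Q′
    open Powers p h prime q≡
    open Nats
    open Ceilings
    private module PS = PowerSums O p h Q′ N D
    open PS using (S; S-0; S-zero; ν)
    open GroupAlgebra GA
    open RingFacts B hiding (_^^_; ^^-+; ^^-*; ^^-0)
    open RingFacts O using (_^^_; ^^-+; ^^-*; ^^-0)
    open Eigenvectors O p h Q′ N D μ GA
    open Generation O p h Q′ N D μ GA
    open Spanning O p h Q′ N D μ GA
    open Filtration O p h Q′ N D μ GA
    open Reduction O p h Q′ N D μ GA

    -- The second clause keeps a positive exponent positive after twisting, so that a positive
    -- multiple of Q becomes at least Q and not 0.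
    Linked : ℕ → ℕ → ℕ → Set
    Linked l x x′ = x′ ∼ p ℕ.^ l ℕ.* x × (x′ ≡ 0 → x ≡ 0)

    -- ε 0 is the exponent of a monomial and ε l stands for its twist by p^l, reduced modulo Q term by term.
    Admissible : ∀ {n} → (ℕ → ℕ) → (ℕ → Vec ℕ n) → Set
    Admissible w ε = ∀ l → Pointwise (Linked l) (ε 0) (ε l) × V.sum (ε l) ℕ.≤ w l ℕ.* d

    -- Sums of terms c X^ε whose coefficient is heavy enough, in every twist, for the degree of the
    -- twisted exponents. The class is closed under products, which is how `[ f(X) ]` is reached
    -- from its terms.
    data Good {n : ℕ} : (Vec O.Carrier n → Carrier) → Set where
      zer  : Good (λ _ → 0#)
      trm  : ∀ w c ε → Fil μ 0 w c → Admissible w ε → Good (λ X → c * ι (X ^^ ε 0))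
      add  : ∀ {G H} → Good G → Good H → Good (λ X → G X + H X)
      resp : ∀ {G H} → (∀ X → All (_∈ ts) X → G X ≈ H X) → Good G → Good H

    private

      sum-+ : ∀ {n} (e f : Vec ℕ n) → V.sum (V.zipWith ℕ._+_ e f) ≡ V.sum e ℕ.+ V.sum f
      sum-+ []      []      = ≡.refl
      sum-+ (k ∷ e) (l ∷ f) = ≡.trans (≡.cong (k ℕ.+ l ℕ.+_) (sum-+ e f)) (lem k l (V.sum e) (V.sum f))
        where
        lem : ∀ a b c d → a ℕ.+ b ℕ.+ (c ℕ.+ d) ≡ a ℕ.+ c ℕ.+ (b ℕ.+ d)
        lem = solveℕ-∀

      sum-* : ∀ {n} c (e : Vec ℕ n) → V.sum (V.map (c ℕ.*_) e) ≡ c ℕ.* V.sum e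
      sum-* c []      = ≡.sym (ℕ.*-zeroʳ c)
      sum-* c (k ∷ e) = ≡.trans (≡.cong (c ℕ.* k ℕ.+_) (sum-* c e)) (≡.sym (ℕ.*-distribˡ-+ c k _))

      Linked-+ : ∀ {l x x′ y y′} → Linked l x x′ → Linked l y y′ → Linked l (x ℕ.+ y) (x′ ℕ.+ y′)
      Linked-+ {l} {x} {x′} {y} {y′} (c , z) (c′ , z′) =
        ≡.trans (∼-+ {x′} {p ℕ.^ l ℕ.* x} {y′} {p ℕ.^ l ℕ.* y} c c′) (≡.cong (ℕ._% Q) (≡.sym (ℕ.*-distribˡ-+ (p ℕ.^ l) x y))) ,
        λ e → ≡.cong₂ ℕ._+_ (z (ℕ.m+n≡0⇒m≡0 x′ e)) (z′ (ℕ.m+n≡0⇒n≡0 x′ e))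

      Pointwise-+ : ∀ {l n} {e e′ f f′ : Vec ℕ n} → Pointwise (Linked l) e e′ → Pointwise (Linked l) f f′ →
        Pointwise (Linked l) (V.zipWith ℕ._+_ e f) (V.zipWith ℕ._+_ e′ f′)
      Pointwise-+ []       []       = []
      Pointwise-+ {l} (_∷_ {x = x} {y = x′} a as) (_∷_ {x = y} {y = y′} b bs) = Linked-+ {l} {x} {x′} {y} {y′} a b ∷ Pointwise-+ {l} as bs

      Admissible-+ : ∀ {n} {v w} {ε δ : ℕ → Vec ℕ n} → Admissible v ε → Admissible w δ →
        Admissible (λ l → v l ℕ.+ w l) (λ l → V.zipWith ℕ._+_ (ε l) (δ l))
      Admissible-+ {v = v} {w} {ε} {δ} A B l = Pointwise-+ {l} (proj₁ (A l)) (proj₁ (B l)) ,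
        ℕ.≤-trans (ℕ.≤-reflexive (sum-+ (ε l) (δ l))) (ℕ.≤-trans (ℕ.+-mono-≤ (proj₂ (A l)) (proj₂ (B l)))
          (ℕ.≤-reflexive (≡.sym (ℕ.*-distribʳ-+ d (v l) (w l)))))

      Good-trm* : ∀ {n} w c ε → Fil μ 0 w c → Admissible w ε → ∀ {H} → Good {n} H → Good (λ X → c * ι (X ^^ ε 0) * H X)
      Good-trm* w c ε f A zer = resp (λ X _ → sym (zeroʳ _)) zer
      Good-trm* w c ε f A (trm v b δ g A′) = resp (λ X _ → trans (*-congˡ (trans (ι-cong (^^-+ X (ε 0) (δ 0))) (ι-* _ _))) (lem _ _ _ _))
        (trm (λ l → w l ℕ.+ v l) (c * b) _ (mul f g) (Admissible-+ {v = w} {v} {ε} {δ} A A′))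
        where
        lem : ∀ a b c d → a * b * (c * d) ≈ a * c * (b * d)
        lem = solve 4 (λ a b c d → a :* b :* (c :* d) := a :* c :* (b :* d)) refl
      Good-trm* w c ε f A (add g h) = resp (λ X _ → sym (distribˡ _ _ _)) (add (Good-trm* w c ε f A g) (Good-trm* w c ε f A h))
      Good-trm* w c ε f A (resp eq g) = resp (λ X a → *-congˡ (eq X a)) (Good-trm* w c ε f A g)

    Good-* : ∀ {n} {G H : Vec O.Carrier n → Carrier} → Good G → Good H → Good (λ X → G X * H X)
    Good-* zer g = resp (λ X _ → sym (zeroˡ _)) zer
    Good-* (trm w c ε f A) g = Good-trm* w c ε f A g
    Good-* (add f f′) g = resp (λ X _ → sym (distribʳ _ _ _)) (add (Good-* f g) (Good-* f′ g))
    Good-* (resp eq f) g = resp (λ X a → *-congʳ (eq X a)) (Good-* f g)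

    private
      SV : ∀ {n} → Vec ℕ n → O.Carrier
      SV []      = O.1#
      SV (k ∷ e) = S k O.* SV e

      zeros nonzeros : ∀ {n} → Vec ℕ n → ℕ
      zeros []          = 0
      zeros (zero ∷ e)  = suc (zeros e)
      zeros (suc k ∷ e) = zeros e
      nonzeros []          = 0
      nonzeros (zero ∷ e)  = nonzeros e
      nonzeros (suc k ∷ e) = suc (nonzeros e)

      nonzeros+zeros : ∀ {n} (e : Vec ℕ n) → nonzeros e ℕ.+ zeros e ≡ n
      nonzeros+zeros []          = ≡.refl
      nonzeros+zeros (zero ∷ e)  = ≡.trans (ℕ.+-suc _ _) (≡.cong suc (nonzeros+zeros e))
      nonzeros+zeros (suc k ∷ e) = ≡.cong suc (nonzeros+zeros e)

      box-monomial : ∀ {n} (e : Vec ℕ n) c → ΣBox ts n (λ X → c * ι (X ^^ e)) ≈ c * ι (SV e)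
      box-monomial []      c = refl
      box-monomial {suc n} (k ∷ e) c = begin
        ΣL ts (λ x → ΣBox ts n (λ X → c * ι (x O.^ k O.* X ^^ e)))
          ≈⟨ Σ-cong ts (λ x → trans (ΣBox-cong ts n (λ X _ → trans (*-congˡ (ι-* _ _)) (sym (*-assoc _ _ _)))) (box-monomial e (c * ι (x O.^ k)))) ⟩
        ΣL ts (λ x → c * ι (x O.^ k) * ι (SV e))
          ≈⟨ trans (Σ-*ʳ ts _ _) (*-congʳ (Σ-*ˡ ts c _)) ⟩
        c * ΣL ts (λ x → ι (x O.^ k)) * ι (SV e)
          ≈⟨ trans (*-assoc _ _ _) (*-congˡ (trans (*-congʳ (sym (ι-Σ ts _))) (sym (ι-* _ _)))) ⟩
        c * ι (S k O.* SV e) ∎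
        where open ≈R

      -- A variable of exponent 0 contributes S 0 = q; any other exponent makes the product vanish
      -- unless Q divides it.
      SV-cases : ∀ {n} (e : Vec ℕ n) → SV e O.≈ O.0# ⊎ (All (Q ∣_) e × O.nat (p ℕ.^ (h ℕ.* zeros e)) O.∣ᵣ SV e)
      SV-cases [] = inj₂ ([] , O.1# , O.sym (O.trans (O.*-identityʳ _) (O.trans (O.nat-cong (≡.cong (p ℕ.^_) (ℕ.*-zeroʳ h))) O.nat-1)))
      SV-cases (zero ∷ e) = go (SV-cases e)
        where
        go : SV e O.≈ O.0# ⊎ (All (Q ∣_) e × O.nat (p ℕ.^ (h ℕ.* zeros e)) O.∣ᵣ SV e) → _
        go (inj₁ eq) = inj₁ (O.trans (O.*-congˡ eq) (O.zeroʳ _))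
        go (inj₂ (a , z , eq)) = inj₂ (m%n≡0⇒n∣m 0 Q ≡.refl ∷ a , z , O.trans (O.*-cong S-0 eq) (O.trans (O.sym (O.*-assoc _ _ _))
          (O.*-congʳ (O.trans (O.sym (O.nat-* (p ℕ.^ h) _)) (O.nat-cong (≡.trans (≡.sym (ℕ.^-distribˡ-+-* p h _)) (≡.cong (p ℕ.^_) (≡.sym (ℕ.*-suc h (zeros e))))))))))
      SV-cases (suc k ∷ e) = go (Q ∣? suc k) (SV-cases e)
        where
        go : Dec (Q ∣ suc k) → SV e O.≈ O.0# ⊎ (All (Q ∣_) e × O.nat (p ℕ.^ (h ℕ.* zeros e)) O.∣ᵣ SV e) → _
        go (no nd) _ = inj₁ (O.trans (O.*-congʳ (S-zero (s≤s z≤n) nd)) (O.zeroˡ _))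
        go (yes _) (inj₁ eq) = inj₁ (O.trans (O.*-congˡ eq) (O.zeroʳ _))
        go (yes dv) (inj₂ (a , z , eq)) = inj₂ (dv ∷ a , S (suc k) O.* z , O.trans (O.*-congˡ eq)
          (O.trans (O.sym (O.*-assoc _ _ _)) (O.trans (O.*-congʳ (O.*-comm _ _)) (O.*-assoc _ _ _))))

      -- Divisibility by Q survives the twist, and positivity does by `Linked`; so every variable
      -- that occurs adds at least Q to the twisted degree.
      nonzeros-weigh : ∀ {l n} {e e′ : Vec ℕ n} → All (Q ∣_) e → Pointwise (Linked l) e e′ → Q ℕ.* nonzeros e ℕ.≤ V.sum e′
      nonzeros-weigh [] [] = ℕ.≤-reflexive (ℕ.*-zeroʳ Q)
      nonzeros-weigh {l} {e = zero ∷ e} (_ ∷ a) (_∷_ {y = y′} _ ps) = ℕ.≤-trans (nonzeros-weigh {l} a ps) (ℕ.m≤n+m _ y′)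
      nonzeros-weigh {l} {e = suc k ∷ e} (dv ∷ a) (_∷_ {y = zero} (_ , z) ps) = contradiction (z ≡.refl) λ ()
      nonzeros-weigh {l} {e = suc k ∷ e} (dv ∷ a) (_∷_ {y = suc y′} (c , _) ps) = ℕ.≤-trans (ℕ.≤-reflexive (ℕ.*-suc Q (nonzeros e)))
        (ℕ.+-mono-≤ (∣⇒≤ (m%n≡0⇒n∣m (suc y′) Q (≡.trans c (≡.trans (∼-* {p ℕ.^ l} {p ℕ.^ l} {suc k} {0} ≡.refl (n∣m⇒m%n≡0 (suc k) Q dv))
          (≡.cong (ℕ._% Q) (ℕ.*-zeroʳ (p ℕ.^ l))))))) (nonzeros-weigh {l} a ps))

      ∣ᵣ-resp : ∀ {c x x′} → x ≈ x′ → c ∣ᵣ x → c ∣ᵣ x′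
      ∣ᵣ-resp xx (z , eq) = z , trans (sym xx) eq

      ∣ᵣ-weaken : ∀ {a b x} → a ℕ.≤ b → nat (p ℕ.^ b) ∣ᵣ x → nat (p ℕ.^ a) ∣ᵣ x
      ∣ᵣ-weaken {a} {b} le (z , eq) = nat (p ℕ.^ (b ℕ.∸ a)) * z , trans eq (trans (*-congʳ (trans
        (nat-cong (≡.trans (≡.cong (p ℕ.^_) (≡.sym (ℕ.m+[n∸m]≡n le))) (ℕ.^-distribˡ-+-* p a (b ℕ.∸ a)))) (nat-* (p ℕ.^ a) _))) (*-assoc _ _ _))

    -- In a surviving term the z variables of exponent 0 give p^(h z), and the s others force weight
    -- at least Q s / d on the coefficient in each twist, hence a further p^(h · ceiling).
    -- `ceilDiv-step` combines the two with s + z = n.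
    Good-divisible : ∀ {n} {G : Vec O.Carrier n → Carrier} → Good G → nat (p ℕ.^ (h ℕ.* ceiling n d)) ∣ᵣ ΣBox ts n G
    Good-divisible {n} zer = 0# , trans (ΣBox-0 ts n) (sym (zeroʳ _))
    Good-divisible {n} (add f g) = let (z , eq) = Good-divisible f ; (z′ , eq′) = Good-divisible g in
      z + z′ , trans (ΣBox-+ ts n _ _) (trans (+-cong eq eq′) (sym (distribˡ _ _ _)))
    Good-divisible {n} (resp eq g) = ∣ᵣ-resp (ΣBox-cong ts n eq) (Good-divisible g)
    Good-divisible {n} (trm w c ε f A) = ∣ᵣ-resp (sym (box-monomial (ε 0) c)) (go (SV-cases (ε 0)))
      where
      s = nonzeros (ε 0)
      z = zeros (ε 0)
      go : SV (ε 0) O.≈ O.0# ⊎ (All (Q ∣_) (ε 0) × O.nat (p ℕ.^ (h ℕ.* z)) O.∣ᵣ SV (ε 0)) →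
        nat (p ℕ.^ (h ℕ.* ceiling n d)) ∣ᵣ c * ι (SV (ε 0))
      go (inj₁ eq) = 0# , trans (*-congˡ (trans (ι-cong eq) ι-0)) (trans (zeroʳ _) (sym (zeroʳ _)))
      go (inj₂ (a , u , eq)) = let (v , eq′) = Fil-divisible s d 1≤d w (λ l → ℕ.≤-trans (nonzeros-weigh {l} a (proj₁ (A l))) (proj₂ (A l))) f in
        ∣ᵣ-weaken enough (v * ι u , trans (*-cong eq′ (trans (ι-cong eq) (trans (ι-* _ _) (*-congʳ (ι-nat (p ℕ.^ (h ℕ.* z)))))))
          (trans (lem _ _ _ _) (*-congʳ (trans (sym (nat-* (p ℕ.^ (h ℕ.* z)) _)) (nat-cong (≡.trans (≡.sym (ℕ.^-distribˡ-+-* p (h ℕ.* z) _))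
            (≡.cong (p ℕ.^_) (≡.sym (ℕ.*-distribˡ-+ h z (ceiling s d))))))))))
        where
        lem : ∀ a b c d → a * b * (c * d) ≈ c * a * (b * d)
        lem = solve 4 (λ a b c d → a :* b :* (c :* d) := c :* a :* (b :* d)) refl
        enough : h ℕ.* ceiling n d ℕ.≤ h ℕ.* (z ℕ.+ ceiling s d)
        enough = ℕ.*-monoʳ-≤ h (≡.subst (λ k → ceiling k d ℕ.≤ z ℕ.+ ceiling s d) (nonzeros+zeros (ε 0))
          (ceilDiv-step s z (repunit p (suc μ) ℕ.* d) (p ℕ.^ μ ℕ.* d) (ℕ.*-mono-≤ (1≤p^ μ) 1≤d)))

    record PolyTerm (n : ℕ) : Set where
      constructor polyTerm
      field
        level    : ℕ
        coeff    : O.Carrier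
        exponent : Vec ℕ n

    Bounded : ∀ {n} → PolyTerm n → Set
    Bounded (polyTerm i a e) = i ℕ.≤ μ × a ∈ ts × (a O.≈ O.0# ⊎ V.sum e ℕ.≤ d ℕ.* p ℕ.^ (h ℕ.* divN i h))

    evalTerm : ∀ {n} → PolyTerm n → Vec O.Carrier n → O.Carrier
    evalTerm (polyTerm i a e) X = O.nat (p ℕ.^ i) O.* (a O.* X ^^ e)

    private
      h′ : ℕ
      h′ = pred h

      Ψ^-Fil-E : ∀ i R → 1 ℕ.≤ R → Fil i 0 (λ l → p ℕ.^ i ℕ.* res (p ℕ.^ (l ℕ.+ i ℕ.* h′) ℕ.* R)) (Ψ^ i (E R))
      Ψ^-Fil-E zero    R 1≤R = weak z≤n (λ l → ℕ.≤-reflexive (≡.trans (ℕ.*-identityˡ _) (≡.cong (λ k → res (p ℕ.^ k ℕ.* R)) (ℕ.+-identityʳ l)))) refl (Fil-E 0 R 1≤R)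
      Ψ^-Fil-E (suc i) R 1≤R = weak z≤n (λ l → ℕ.≤-reflexive (≡.trans (ℕ.*-assoc p (p ℕ.^ i) _)
        (≡.cong (λ k → p ℕ.* (p ℕ.^ i ℕ.* res (p ℕ.^ k ℕ.* R))) (≡.sym (ℕ.+-assoc l h′ (i ℕ.* h′)))))) refl (Ψ-Fil (Ψ^-Fil-E i R 1≤R))

      p^hk∼ : ∀ k l → p ℕ.^ (h ℕ.* k ℕ.+ l) ∼ p ℕ.^ l
      p^hk∼ zero    l = ≡.cong (λ j → (p ℕ.^ (j ℕ.+ l)) ℕ.% Q) (ℕ.*-zeroʳ h)
      p^hk∼ (suc k) l = ≡.trans (≡.cong (λ j → (p ℕ.^ j) ℕ.% Q) (≡.trans (≡.cong (ℕ._+ l) (ℕ.*-suc h k)) (ℕ.+-assoc h (h ℕ.* k) l)))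
        (≡.trans (p^h+∼ (h ℕ.* k ℕ.+ l)) (p^hk∼ k l))

      1≤h : 1 ℕ.≤ h
      1≤h = ≡.subst (1 ℕ.≤_) h≢0 (s≤s z≤n)

      -- Put i = b + c h. Ψ^i rotates the twists by -i, and p^b undoes this modulo Q: p^b times the
      -- rotated residue is congruent to p^l R, hence at least its residue. Only p^(c h) remains as
      -- a gain in all twists, whence the exponent h ⌊i/h⌋ in the degree condition.
      twisted : ∀ i R → 1 ℕ.≤ R → ∀ l → p ℕ.^ (h ℕ.* divN i h) ℕ.* res (p ℕ.^ l ℕ.* R) ℕ.≤ p ℕ.^ i ℕ.* res (p ℕ.^ (l ℕ.+ i ℕ.* h′) ℕ.* R)
      twisted i R 1≤R l = go (divN-spec i h 1≤h)
        where
        open ℕ.≤-Reasoning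
        c = divN i h
        go : (∃ λ b → i ≡ b ℕ.+ c ℕ.* h) → _
        go (b , eq) = begin
          p ℕ.^ (h ℕ.* c) ℕ.* res (p ℕ.^ l ℕ.* R)
            ≤⟨ ℕ.*-monoʳ-≤ (p ℕ.^ (h ℕ.* c)) (res-least (1≤ l) (ℕ.*-mono-≤ (1≤p^ b) (1≤res (p ℕ.^ L ℕ.* R))) shifted) ⟩
          p ℕ.^ (h ℕ.* c) ℕ.* (p ℕ.^ b ℕ.* res (p ℕ.^ (l ℕ.+ i ℕ.* h′) ℕ.* R))
            ≡⟨ ℕ.*-assoc (p ℕ.^ (h ℕ.* c)) (p ℕ.^ b) _ ⟨
          p ℕ.^ (h ℕ.* c) ℕ.* p ℕ.^ b ℕ.* res (p ℕ.^ (l ℕ.+ i ℕ.* h′) ℕ.* R)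
            ≡⟨ ≡.cong (ℕ._* res (p ℕ.^ (l ℕ.+ i ℕ.* h′) ℕ.* R)) (≡.trans (≡.sym (ℕ.^-distribˡ-+-* p (h ℕ.* c) b))
                 (≡.cong (p ℕ.^_) (≡.trans (≡.trans (ℕ.+-comm (h ℕ.* c) b) (≡.cong (b ℕ.+_) (ℕ.*-comm h c))) (≡.sym eq)))) ⟩
          p ℕ.^ i ℕ.* res (p ℕ.^ (l ℕ.+ i ℕ.* h′) ℕ.* R) ∎
          where
          1≤ : ∀ k → 1 ℕ.≤ p ℕ.^ k ℕ.* R
          1≤ k = ℕ.*-mono-≤ (1≤p^ k) 1≤R
          -- As i ≡ b and h′ ≡ -1 modulo h, the number b + i h′ is a multiple of h.
          exps : b ℕ.+ (l ℕ.+ i ℕ.* h′) ≡ h ℕ.* (b ℕ.+ c ℕ.* h′) ℕ.+ l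
          exps = ≡.trans (≡.cong (λ i → b ℕ.+ (l ℕ.+ i ℕ.* h′)) (≡.trans eq (≡.cong (λ h → b ℕ.+ c ℕ.* h) (≡.sym h≢0))))
            (≡.trans (lem b l c h′) (≡.cong (λ k → k ℕ.* (b ℕ.+ c ℕ.* h′) ℕ.+ l) h≢0))
            where
            lem : ∀ b l c k → b ℕ.+ (l ℕ.+ (b ℕ.+ c ℕ.* suc k) ℕ.* k) ≡ suc k ℕ.* (b ℕ.+ c ℕ.* k) ℕ.+ l
            lem = solveℕ-∀
          L = l ℕ.+ i ℕ.* h′
          shifted : p ℕ.^ b ℕ.* res (p ℕ.^ L ℕ.* R) ∼ p ℕ.^ l ℕ.* R
          shifted = ≡.trans (∼-* {p ℕ.^ b} {p ℕ.^ b} {res (p ℕ.^ L ℕ.* R)} {p ℕ.^ L ℕ.* R} ≡.refl (res∼ (1≤ L)))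
            (≡.trans (≡.cong (ℕ._% Q) (≡.trans (≡.sym (ℕ.*-assoc (p ℕ.^ b) (p ℕ.^ L) R)) (≡.cong (ℕ._* R)
                (≡.trans (≡.sym (ℕ.^-distribˡ-+-* p b L)) (≡.cong (p ℕ.^_) exps)))))
              (∼-* {p ℕ.^ (h ℕ.* (b ℕ.+ c ℕ.* h′) ℕ.+ l)} {p ℕ.^ l} {R} {R} (p^hk∼ (b ℕ.+ c ℕ.* h′) l) ≡.refl))

      Ψ^-ι* : ∀ i c x → Ψ^ i (ι c * x) ≈ ι c * Ψ^ i x
      Ψ^-ι* zero    c x = refl
      Ψ^-ι* (suc i) c x = trans (α-cong _ (Ψ^-ι* i c x)) (α-ι* _ c _)

      Ψ^-Σ : ∀ {A : Set} i (xs : List A) f → Ψ^ i (ΣL xs f) ≈ ΣL xs (λ x → Ψ^ i (f x))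
      Ψ^-Σ zero    xs f = refl
      Ψ^-Σ (suc i) xs f = trans (α-cong _ (Ψ^-Σ i xs f)) (α-Σ _ xs _)

      Ψ^-cong : ∀ i {x x′} → x ≈ x′ → Ψ^ i x ≈ Ψ^ i x′
      Ψ^-cong zero    eq = eq
      Ψ^-cong (suc i) eq = α-cong _ (Ψ^-cong i eq)

      Ψ^-e : ∀ i x → Ψ^ i (e x) ≈ e (O.nat (p ℕ.^ i) O.* x)
      Ψ^-e zero    x = e-cong (O.sym (O.trans (O.*-congʳ O.nat-1) (O.*-identityˡ x)))
      Ψ^-e (suc i) x = trans (α-cong _ (Ψ^-e i x)) (trans (α-e _ _) (e-cong (O.trans (O.sym (O.*-assoc _ _ _)) (O.*-congʳ (O.sym (O.nat-* p (p ℕ.^ i)))))))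

      ^^-closed : ∀ {n} {X : Vec O.Carrier n} → All (_∈ ts) X → ∀ e → ∃ λ t → t ∈ ts × t O.≈ X ^^ e
      ^^-closed [] [] = one∈
      ^^-closed (i ∷ a) (k ∷ e) = let (t , j , eq) = PS.^-closed k i ; (t′ , j′ , eq′) = ^^-closed a e ; (u , l , eq″) = *-closed j j′ in
        u , l , O.trans eq″ (O.*-cong eq eq′)

      -- For X in the box the term has the value p^i t with t Teichmüller, so [p^i t] = 1 + Ψ^i (e
      -- t), and Ψ^i is applied to the Fourier expansion of e t. The powers of t are monomials in X.
      expand-term : ∀ {n} i {a} → a ∈ ts → (e′ : Vec ℕ n) → ∀ X → All (_∈ ts) X →
        1# + ΣL (upTo Q) (λ r → ι (ν O.* a O.^ suc r) * Ψ^ i (E (suc r)) * ι (X ^^ V.map (suc r ℕ.*_) e′)) ≈ [ evalTerm (polyTerm i a e′) X ]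
      expand-term i {a} a∈ e′ X X∈ = go (^^-closed X∈ e′)
        where
        go : (∃ λ t → t ∈ ts × t O.≈ X ^^ e′) → _
        go (t₀ , j₀ , eq₀) = go′ (*-closed a∈ j₀)
          where
          go′ : (∃ λ t → t ∈ ts × t O.≈ a O.* t₀) → 1# + ΣL (upTo Q) (λ r → ι (ν O.* a O.^ suc r) * Ψ^ i (E (suc r)) * ι (X ^^ V.map (suc r ℕ.*_) e′)) ≈ [ evalTerm (polyTerm i a e′) X ]
          go′ (t , j , eq₁) = sym (begin
            [ O.nat (p ℕ.^ i) O.* (a O.* X ^^ e′) ]  ≈⟨ []-cong (O.*-congˡ (O.sym eq)) ⟩
            [ O.nat (p ℕ.^ i) O.* t ]                ≈⟨ []≈1+e _ ⟩
            1# + e (O.nat (p ℕ.^ i) O.* t)           ≈⟨ +-congˡ (sym (Ψ^-e i t)) ⟩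
            1# + Ψ^ i (e t)                          ≈⟨ +-congˡ (trans (Ψ^-cong i (e-expand j)) (trans (Ψ^-ι* i ν _) (*-congˡ (trans (Ψ^-Σ i (upTo Q) _) (Σ-cong (upTo Q) (λ r → Ψ^-ι* i _ _)))))) ⟩
            1# + ι ν * ΣL (upTo Q) (λ r → ι (t O.^ suc r) * Ψ^ i (E (suc r)))
              ≈⟨ +-congˡ (trans (sym (Σ-*ˡ (upTo Q) (ι ν) _)) (Σ-cong (upTo Q) (λ r → trans (*-congˡ (*-congʳ (trans (ι-cong (power (suc r))) (ι-* _ _))))
                   (trans (lem _ _ _ _) (*-congʳ (*-congʳ (sym (ι-* _ _)))))))) ⟩
            1# + ΣL (upTo Q) (λ r → ι (ν O.* a O.^ suc r) * Ψ^ i (E (suc r)) * ι (X ^^ V.map (suc r ℕ.*_) e′)) ∎)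
            where
            open ≈R
            eq : t O.≈ a O.* X ^^ e′
            eq = O.trans eq₁ (O.*-congˡ eq₀)
            power : ∀ r → t O.^ r O.≈ a O.^ r O.* X ^^ V.map (r ℕ.*_) e′
            power r = O.trans (O.^-congˡ r eq) (O.trans (O.^-distrib-* a (X ^^ e′) r) (O.*-congˡ (O.sym (^^-* X r e′))))
            lem : ∀ n a x y → n * (a * x * y) ≈ n * a * y * x
            lem = solve 4 (λ n a x y → n :* (a :* x :* y) := n :* a :* y :* x) refl

      -- The same residue multiplies the exponents and the weight, so the degree condition on e is
      -- just what is required. It is positive, so only zeros of e become zero.
      admissible : ∀ {n} i R (e : Vec ℕ n) → 1 ℕ.≤ R → V.sum e ℕ.≤ d ℕ.* p ℕ.^ (h ℕ.* divN i h) →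
        Admissible (λ l → p ℕ.^ (h ℕ.* divN i h) ℕ.* res (p ℕ.^ l ℕ.* R)) (λ l → V.map (res (p ℕ.^ l ℕ.* R) ℕ.*_) e)
      admissible i R e 1≤R deg l = links e , (begin
        V.sum (V.map (c ℕ.*_) e)                     ≡⟨ sum-* c e ⟩
        c ℕ.* V.sum e                                ≤⟨ ℕ.*-monoʳ-≤ c deg ⟩
        c ℕ.* (d ℕ.* p ℕ.^ (h ℕ.* divN i h))         ≡⟨ lem c d (p ℕ.^ (h ℕ.* divN i h)) ⟩
        p ℕ.^ (h ℕ.* divN i h) ℕ.* c ℕ.* d           ∎)
        where
        open ℕ.≤-Reasoning
        c = res (p ℕ.^ l ℕ.* R)
        c₀ = res (p ℕ.^ 0 ℕ.* R)
        lem : ∀ a b c → a ℕ.* (b ℕ.* c) ≡ c ℕ.* a ℕ.* b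
        lem = solveℕ-∀
        c∼ : c ∼ p ℕ.^ l ℕ.* c₀
        c∼ = ≡.trans (res∼ (ℕ.*-mono-≤ (1≤p^ l) 1≤R)) (≡.sym (≡.trans (∼-* {p ℕ.^ l} {p ℕ.^ l} {c₀} {p ℕ.^ 0 ℕ.* R} ≡.refl (res∼ (ℕ.*-mono-≤ (1≤p^ 0) 1≤R)))
          (≡.cong (λ k → (p ℕ.^ l ℕ.* k) ℕ.% Q) (ℕ.*-identityˡ R))))
        link : ∀ k → Linked l (c₀ ℕ.* k) (c ℕ.* k)
        link k = ≡.trans (∼-* {c} {p ℕ.^ l ℕ.* c₀} {k} {k} c∼ ≡.refl) (≡.cong (ℕ._% Q) (ℕ.*-assoc (p ℕ.^ l) c₀ k)) ,
          λ eq → ≡.trans (≡.cong (c₀ ℕ.*_) (zero-factor (ℕ.m*n≡0⇒m≡0∨n≡0 c eq))) (ℕ.*-zeroʳ c₀)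
          where
          zero-factor : ∀ {k} → c ≡ 0 ⊎ k ≡ 0 → k ≡ 0
          zero-factor (inj₂ e) = e
        links : ∀ {n} (e : Vec ℕ n) → Pointwise (Linked l) (V.map (c₀ ℕ.*_) e) (V.map (c ℕ.*_) e)
        links []      = []
        links (k ∷ e) = link k ∷ links e

      zero-vector : ∀ {n} → Admissible {n} (λ _ → 0) (λ _ → V.replicate n 0)
      zero-vector {n} l = links n , ℕ.≤-reflexive (sum-0 n)
        where
        links : ∀ n → Pointwise (Linked l) (V.replicate n 0) (V.replicate n 0)
        links zero    = []
        links (suc n) = (≡.cong (ℕ._% Q) (≡.sym (ℕ.*-zeroʳ (p ℕ.^ l))) , λ e → e) ∷ links n
        sum-0 : ∀ n → V.sum (V.replicate n 0) ≡ 0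
        sum-0 zero    = ≡.refl
        sum-0 (suc n) = sum-0 n

    Good-1 : ∀ {n} → Good {n} (λ _ → 1#)
    Good-1 {n} = resp (λ X _ → trans (*-cong ι-1 (trans (ι-cong (^^-0 X)) ι-1)) (*-identityˡ 1#))
      (trm (λ _ → 0) (ι O.1#) (λ _ → V.replicate n 0) (cst O.1#) zero-vector)

    private
      Good-Σ : ∀ {n} (xs : List ℕ) {G : ℕ → Vec O.Carrier n → Carrier} → (∀ {r} → r ∈ xs → Good (G r)) → Good (λ X → ΣL xs (λ r → G r X))
      Good-Σ []       g = zer
      Good-Σ (x ∷ xs) g = add (g (here ≡.refl)) (Good-Σ xs (λ i → g (there i)))

    Good-term : ∀ {n} (τ : PolyTerm n) → Bounded τ → Good (λ X → [ evalTerm τ X ])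
    Good-term (polyTerm i a e) (i≤μ , a∈ , inj₁ a0) = resp (λ X _ → sym (trans ([]-cong (O.trans (O.*-congˡ (O.trans (O.*-congʳ a0) (O.zeroˡ _))) (O.zeroʳ _))) []-0)) Good-1
    Good-term (polyTerm i a e) (i≤μ , a∈ , inj₂ deg) = resp (expand-term i a∈ e) (add Good-1 (Good-Σ (upTo Q) λ {r} r∈ → resp (λ X _ →
        -- In the twist 0 the residue of r + 1 is r + 1 itself, because r < Q.
        *-congˡ (reflexive (≡.cong (λ k → ι (X ^^ V.map (k ℕ.*_) e)) (≡.trans (≡.cong res (ℕ.*-identityˡ (suc r))) (res-id (s≤s z≤n) (∈-upTo⁻ r∈))))))
        (trm (λ l → p ℕ.^ (h ℕ.* divN i h) ℕ.* res (p ℕ.^ l ℕ.* suc r)) (ι (ν O.* a O.^ suc r) * Ψ^ i (E (suc r))) (λ l → V.map (res (p ℕ.^ l ℕ.* suc r) ℕ.*_) e)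
          (Fil-ι* _ (weak z≤n (twisted i (suc r) (s≤s z≤n)) refl (Fil-mono i≤μ (Ψ^-Fil-E i (suc r) (s≤s z≤n)))))
          (admissible i (suc r) e (s≤s z≤n) deg))))

    evalPoly : ∀ {n} → List (PolyTerm n) → Vec O.Carrier n → O.Carrier
    evalPoly fs X = O.ΣL fs (λ τ → evalTerm τ X)

    Good-poly : ∀ {n} (fs : List (PolyTerm n)) → LAll.All Bounded fs → Good (λ X → [ evalPoly fs X ])
    Good-poly []       _ = resp (λ X _ → sym []-0) Good-1
    Good-poly (τ ∷ fs) (b LAll.∷ bs) = resp (λ X _ → sym ([]-+ (evalTerm τ X) (evalPoly fs X))) (Good-* (Good-term τ b) (Good-poly fs bs))

    -- The functional is O-linear, so the divisibility of the sum of `[ f(X) ]` in the group algebra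
    -- descends to the sum of its values φ (f(X)) in O.
    box-count : ∀ {n} (fs : List (PolyTerm n)) → LAll.All Bounded fs → (φ : O.Carrier → O.Carrier) → (∀ {x y} → x O.≈ y → φ x O.≈ φ y) →
      (∀ x y → φ (x O.+ O.nat (p ℕ.^ suc μ) O.* y) O.≈ φ x) →
      O.nat (p ℕ.^ (h ℕ.* ceiling n d)) O.∣ᵣ O.ΣBox ts n (λ X → φ (evalPoly fs X))
    box-count {n} fs bs φ φ-cong φ-per =
      let (L , L-cong , L-+ , L-ι* , L-[]) = functional φ φ-cong φ-per
          (z , eq) = Good-divisible (Good-poly fs bs)
          L-0 = O.trans (L-cong (sym (trans (*-congʳ ι-0) (zeroˡ 0#)))) (O.trans (L-ι* O.0# 0#) (O.zeroˡ _))
          k = p ℕ.^ (h ℕ.* ceiling n d)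
      in L z , O.trans (O.sym (L-box L L-cong L-+ L-0 L-[] n (evalPoly fs)))
           (O.trans (L-cong (trans eq (*-congʳ (sym (ι-nat k))))) (L-ι* (O.nat k) z))
      where
      module _ (L : Carrier → O.Carrier) (L-cong : ∀ {x y} → x ≈ y → L x O.≈ L y) (L-+ : ∀ x y → L (x + y) O.≈ L x O.+ L y)
        (L-0 : L 0# O.≈ O.0#) (L-[] : ∀ x → L [ x ] O.≈ φ x) where
        L-Σ : ∀ (xs : List O.Carrier) f → L (ΣL xs f) O.≈ O.ΣL xs (λ x → L (f x))
        L-Σ []       f = L-0
        L-Σ (x ∷ xs) f = O.trans (L-+ (f x) _) (O.+-congˡ (L-Σ xs f))
        L-box : ∀ n (F : Vec O.Carrier n → O.Carrier) → L (ΣBox ts n (λ X → [ F X ])) O.≈ O.ΣBox ts n (λ X → φ (F X))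
        L-box zero    F = L-[] (F [])
        L-box (suc n) F = O.trans (L-Σ ts _) (O.Σ-cong ts (λ x → L-box n (λ X → F (x ∷ X))))

open BoxCounting

-- The ring (ℤ/M)[t]/(G) on coefficient vectors.

module QuotientRings where

  open import Defs
  open import Level using (0ℓ)
  open import Algebra.Bundles using (CommutativeRing)
  open import Data.Nat as ℕ using (ℕ; zero; suc; z≤n; NonZero)
  import Data.Nat.Properties as ℕ
  open import Data.Nat.Tactic.RingSolver using () renaming (solve-∀ to solveℕ-∀)
  open import Data.Nat.DivMod using (_%_; %-distribˡ-+; %-distribˡ-*; n%n≡0; m%n<n; m<n⇒m%n≡m)
  open import Data.Fin as Fin using (Fin; zero; suc; toℕ; inject₁; fromℕ)
  import Data.Fin.Properties as Fin
  open import Data.List as L using (List; []; _∷_; allFin)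
  import Data.List.Properties as L
  open import Data.List.Membership.Propositional.Properties using (∈-allFin)
  open import Data.List.Relation.Unary.Unique.Propositional.Properties using (allFin⁺)
  open import Data.Vec as V using (Vec; []; _∷_; lookup)
  import Data.Vec.Properties as V
  open import Data.Product using (_×_; _,_; proj₁; proj₂)
  open import Relation.Nullary using (¬_; contradiction)
  open import Relation.Binary.PropositionalEquality as ≡ using (_≡_)

  modN≡% : ∀ x M .{{_ : NonZero M}} → modN x M ≡ x % M
  modN≡% x (suc k) = ≡.refl

  module Modular (M : ℕ) (1≤M : 1 ℕ.≤ M) where

    private
      instance
        M≢0 : NonZero M
        M≢0 = ℕ.>-nonZero 1≤M

    infix 4 _≈ₘ_
    record _≈ₘ_ (x y : ℕ) : Set where
      constructor eqₘ
      field
        residues : modN x M ≡ modN y M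

    open _≈ₘ_ public

    from% : ∀ {x y} → x % M ≡ y % M → x ≈ₘ y
    from% {x} {y} e = eqₘ (≡.trans (modN≡% x M) (≡.trans e (≡.sym (modN≡% y M))))

    to% : ∀ {x y} → x ≈ₘ y → x % M ≡ y % M
    to% {x} {y} (eqₘ e) = ≡.trans (≡.sym (modN≡% x M)) (≡.trans e (modN≡% y M))

    modN< : ∀ x → modN x M ℕ.< M
    modN< x = ≡.subst (ℕ._< M) (≡.sym (modN≡% x M)) (m%n<n x M)

    modN-small : ∀ {x} → x ℕ.< M → modN x M ≡ x
    modN-small {x} lt = ≡.trans (modN≡% x M) (m<n⇒m%n≡m lt)

    modN≈ : ∀ x → modN x M ≈ₘ x
    modN≈ x = eqₘ (modN-small (modN< x))

    ≡⇒≈ₘ : ∀ {x y} → x ≡ y → x ≈ₘ y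
    ≡⇒≈ₘ ≡.refl = eqₘ ≡.refl

    M≈0 : M ≈ₘ 0
    M≈0 = from% (≡.trans (n%n≡0 M) (≡.sym (m<n⇒m%n≡m 1≤M)))

    +-congₘ : ∀ {a b c d} → a ≈ₘ b → c ≈ₘ d → a ℕ.+ c ≈ₘ b ℕ.+ d
    +-congₘ {a} {b} {c} {d} e f = from% (≡.trans (%-distribˡ-+ a c M) (≡.trans (≡.cong₂ (λ x y → (x ℕ.+ y) % M) (to% e) (to% f)) (≡.sym (%-distribˡ-+ b d M))))

    *-congₘ : ∀ {a b c d} → a ≈ₘ b → c ≈ₘ d → a ℕ.* c ≈ₘ b ℕ.* d
    *-congₘ {a} {b} {c} {d} e f = from% (≡.trans (%-distribˡ-* a c M) (≡.trans (≡.cong₂ (λ x y → (x ℕ.* y) % M) (to% e) (to% f)) (≡.sym (%-distribˡ-* b d M))))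

    symₘ : ∀ {a b} → a ≈ₘ b → b ≈ₘ a
    symₘ (eqₘ e) = eqₘ (≡.sym e)

    transₘ : ∀ {a b c} → a ≈ₘ b → b ≈ₘ c → a ≈ₘ c
    transₘ (eqₘ e) (eqₘ f) = eqₘ (≡.trans e f)

    negₘ : ℕ → ℕ
    negₘ x = M ℕ.∸ modN x M

    neg-inverse : ∀ x → negₘ x ℕ.+ x ≈ₘ 0
    neg-inverse x = transₘ (+-congₘ {negₘ x} (eqₘ ≡.refl) (symₘ (modN≈ x))) (transₘ (≡⇒≈ₘ (ℕ.m∸n+n≡m (ℕ.<⇒≤ (modN< x)))) M≈0)

    ℤ/M : CommutativeRing 0ℓ 0ℓ
    ℤ/M = record
      { Carrier = ℕ ; _≈_ = _≈ₘ_ ; _+_ = ℕ._+_ ; _*_ = ℕ._*_ ; -_ = negₘ ; 0# = 0 ; 1# = 1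
      ; isCommutativeRing = record
        { isRing = record
          { +-isAbelianGroup = record
            { isGroup = record
              { isMonoid = record
                { isSemigroup = record
                  { isMagma = record
                    { isEquivalence = record { refl = eqₘ ≡.refl ; sym = symₘ ; trans = transₘ }
                    ; ∙-cong = +-congₘ }
                  ; assoc = λ a b c → ≡⇒≈ₘ (ℕ.+-assoc a b c) }
                ; identity = (λ a → eqₘ ≡.refl) , (λ a → ≡⇒≈ₘ (ℕ.+-identityʳ a)) }
              ; inverse = neg-inverse , (λ x → transₘ (≡⇒≈ₘ (ℕ.+-comm x (negₘ x))) (neg-inverse x))
              ; ⁻¹-cong = λ { (eqₘ e) → eqₘ (≡.cong (λ z → modN (M ℕ.∸ z) M) e) } }
            ; comm = λ a b → ≡⇒≈ₘ (ℕ.+-comm a b) }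
          ; *-cong = *-congₘ
          ; *-assoc = λ a b c → ≡⇒≈ₘ (ℕ.*-assoc a b c)
          ; *-identity = (λ a → ≡⇒≈ₘ (ℕ.*-identityˡ a)) , (λ a → ≡⇒≈ₘ (ℕ.*-identityʳ a))
          ; distrib = (λ a b c → ≡⇒≈ₘ (ℕ.*-distribˡ-+ a b c)) , (λ a b c → ≡⇒≈ₘ (ℕ.*-distribʳ-+ a b c)) }
        ; *-comm = λ a b → ≡⇒≈ₘ (ℕ.*-comm a b) } }

  lookup-init : ∀ {A : Set} {n} (v : Vec A (suc n)) i → lookup (V.init v) i ≡ lookup v (inject₁ i)
  lookup-init (x ∷ y ∷ v) zero    = ≡.refl
  lookup-init (x ∷ y ∷ v) (suc i) = lookup-init (y ∷ v) i

  last≡lookup : ∀ {A : Set} {n} (v : Vec A (suc n)) → V.last v ≡ lookup v (fromℕ n)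
  last≡lookup (x ∷ [])    = ≡.refl
  last≡lookup (x ∷ y ∷ v) = last≡lookup (y ∷ v)

  module QuotientRing (M : ℕ) (1≤M : 1 ℕ.≤ M) {k : ℕ} (g : Vec ℕ (suc k)) where
    open Modular M 1≤M public
    open Ring M g public
    private
      open module Z = RingFacts ℤ/M using (ΣL; Σ-cong; Σ-+; Σ-*ˡ; Σ-*ʳ; Σ-swap; Σ-0; Σ-unique; Σ-map; Σ-concatMap)

      h : ℕ
      h = suc k

      Is : List (Fin h)
      Is = allFin h

      allFin-suc : ∀ n → allFin (suc n) ≡ zero ∷ L.map suc (allFin n)
      allFin-suc n = ≡.cong (zero ∷_) (≡.sym (L.map-tabulate (λ i → i) suc))

      Σ-front : ∀ n (f : Fin (suc n) → ℕ) → ΣL (allFin (suc n)) f ≈ₘ f zero ℕ.+ ΣL (allFin n) (λ i → f (suc i))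
      Σ-front n f = transₘ (≡⇒≈ₘ (≡.cong (λ xs → ΣL xs f) (allFin-suc n))) (+-congₘ {f zero} (eqₘ ≡.refl) (Σ-map suc (allFin n) f))

      Σ-back : ∀ n (f : Fin (suc n) → ℕ) → ΣL (allFin (suc n)) f ≈ₘ ΣL (allFin n) (λ i → f (inject₁ i)) ℕ.+ f (fromℕ n)
      Σ-back zero    f = ≡⇒≈ₘ (ℕ.+-comm (f zero) 0)
      Σ-back (suc n) f = transₘ (Σ-front (suc n) f) (transₘ (+-congₘ {f zero} (eqₘ ≡.refl) (Σ-back n (λ i → f (suc i))))
        (transₘ (≡⇒≈ₘ (≡.sym (ℕ.+-assoc (f zero) _ _))) (+-congₘ (symₘ (Σ-front n (λ i → f (inject₁ i)))) (eqₘ ≡.refl))))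

    infix 4 _≋_
    record _≋_ (a b : Elt h) : Set where
      constructor coords
      field
        at : ∀ c → lookup a c ≈ₘ lookup b c

    open _≋_ public

    lookup-norm : ∀ a c → lookup (norm a) c ≈ₘ lookup a c
    lookup-norm a c = transₘ (≡⇒≈ₘ (V.lookup-map c _ a)) (modN≈ _)

    lookup-⊕ : ∀ a b c → lookup (a ⊕ b) c ≈ₘ lookup a c ℕ.+ lookup b c
    lookup-⊕ a b c = transₘ (lookup-norm (V.zipWith ℕ._+_ a b) c) (≡⇒≈ₘ (V.lookup-zipWith ℕ._+_ c a b))

    lookup-scale : ∀ x a c → lookup (scale x a) c ≈ₘ x ℕ.* lookup a c
    lookup-scale x a c = transₘ (lookup-norm (V.map (x ℕ.*_) a) c) (≡⇒≈ₘ (V.lookup-map c (x ℕ.*_) a))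

    lookup-zeroE : ∀ c → lookup zeroE c ≈ₘ 0
    lookup-zeroE c = ≡⇒≈ₘ (V.lookup-replicate c 0)

    lookup-sumE : ∀ xs c → lookup (sumE xs) c ≈ₘ ΣL xs (λ v → lookup v c)
    lookup-sumE []       c = lookup-zeroE c
    lookup-sumE (x ∷ xs) c = transₘ (lookup-⊕ x (sumE xs) c) (+-congₘ (eqₘ ≡.refl) (lookup-sumE xs c))

    private
      t : ℕ → Fin h → ℕ
      t n c = lookup (tpow n) c

      n̂ : Fin h → ℕ
      n̂ c = lookup negg c

      top : Fin h
      top = fromℕ k

    lookup-⊗ : ∀ a b c → lookup (a ⊗ b) c ≈ₘ ΣL (allFin h) (λ i → ΣL (allFin h) (λ j → lookup a i ℕ.* lookup b j ℕ.* lookup (tpow (toℕ i ℕ.+ toℕ j)) c))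
    lookup-⊗ a b c = transₘ (lookup-sumE (L.concatMap (λ i → L.map (F i) Is) Is) c) (transₘ (Σ-concatMap (λ i → L.map (F i) Is) Is at-c)
      (Σ-cong Is (λ i → transₘ (Σ-map (F i) Is at-c) (Σ-cong Is (λ j → lookup-scale (lookup a i ℕ.* lookup b j) (tpow (toℕ i ℕ.+ toℕ j)) c)))))
      where
      F : Fin h → Fin h → Elt h
      F i j = scale (lookup a i ℕ.* lookup b j) (tpow (toℕ i ℕ.+ toℕ j))
      at-c : Elt h → ℕ
      at-c v = lookup v c

    mulT-zero : ∀ v → lookup (mulT v) zero ≈ₘ lookup v (fromℕ k) ℕ.* lookup negg zero
    mulT-zero v = transₘ (lookup-norm (V.zipWith ℕ._+_ (0 ∷ V.init v) (V.map (V.last v ℕ.*_) negg)) zero)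
      (≡⇒≈ₘ (≡.trans (V.lookup-zipWith ℕ._+_ zero (0 ∷ V.init v) (V.map (V.last v ℕ.*_) negg))
        (≡.trans (V.lookup-map zero (V.last v ℕ.*_) negg) (≡.cong (ℕ._* lookup negg zero) (last≡lookup v)))))

    mulT-suc : ∀ v i → lookup (mulT v) (suc i) ≈ₘ lookup v (inject₁ i) ℕ.+ lookup v (fromℕ k) ℕ.* lookup negg (suc i)
    mulT-suc v i = transₘ (lookup-norm (V.zipWith ℕ._+_ (0 ∷ V.init v) (V.map (V.last v ℕ.*_) negg)) (suc i))
      (≡⇒≈ₘ (≡.trans (V.lookup-zipWith ℕ._+_ (suc i) (0 ∷ V.init v) (V.map (V.last v ℕ.*_) negg))
        (≡.cong₂ ℕ._+_ (lookup-init v i) (≡.trans (V.lookup-map (suc i) (V.last v ℕ.*_) negg) (≡.cong (ℕ._* lookup negg (suc i)) (last≡lookup v))))))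

    private
      -- Up to t^(h-1) the powers of t are unit vectors: below that exponent the top coordinate is
      -- 0, so multiplication by t only shifts.
      basis : ∀ j → j ℕ.≤ k → ∀ c → (toℕ c ≡ j → t j c ≈ₘ 1) × (¬ toℕ c ≡ j → t j c ≈ₘ 0)
      basis zero j≤k zero    = (λ _ → modN≈ 1) , (λ ne → contradiction ≡.refl ne)
      basis zero j≤k (suc c) = (λ ()) , (λ _ → ≡⇒≈ₘ (V.lookup-replicate c 0))
      basis (suc j) j<k c = go c
        where
        top-0 : t j top ≈ₘ 0
        top-0 = proj₂ (basis j (ℕ.<⇒≤ j<k) top) (λ e → ℕ.<⇒≢ j<k (≡.sym (≡.trans (≡.sym (Fin.toℕ-fromℕ k)) e)))
        go : ∀ c → (toℕ c ≡ suc j → t (suc j) c ≈ₘ 1) × (¬ toℕ c ≡ suc j → t (suc j) c ≈ₘ 0)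
        go zero = (λ ()) , (λ _ → transₘ (mulT-zero (tpow j)) (*-congₘ top-0 (eqₘ {n̂ zero} ≡.refl)))
        go (suc i) = (λ e → transₘ step (proj₁ (basis j (ℕ.<⇒≤ j<k) (inject₁ i)) (≡.trans (Fin.toℕ-inject₁ i) (ℕ.suc-injective e)))) ,
                     (λ ne → transₘ step (proj₂ (basis j (ℕ.<⇒≤ j<k) (inject₁ i)) (λ e → ne (≡.cong suc (≡.trans (≡.sym (Fin.toℕ-inject₁ i)) e)))))
          where
          step : t (suc j) (suc i) ≈ₘ t j (inject₁ i)
          step = transₘ (mulT-suc (tpow j) i) (transₘ (+-congₘ {t j (inject₁ i)} (eqₘ ≡.refl) (*-congₘ top-0 (eqₘ {n̂ (suc i)} ≡.refl))) (≡⇒≈ₘ (ℕ.+-identityʳ _)))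

      toℕ≤k : ∀ (i : Fin h) → toℕ i ℕ.≤ k
      toℕ≤k i = ℕ.s≤s⁻¹ (Fin.toℕ<n i)

      -- Λ y v represents T^y v.
      Λ : ℕ → (Fin h → ℕ) → Fin h → ℕ
      Λ y v c = ΣL Is (λ i → v i ℕ.* t (toℕ i ℕ.+ y) c)

      Λ-0 : ∀ v c → Λ 0 v c ≈ₘ v c
      Λ-0 v c = transₘ (Σ-cong Is (λ i → ≡⇒≈ₘ (≡.cong (λ n → v i ℕ.* t n c) (ℕ.+-identityʳ (toℕ i)))))
        (transₘ (Σ-unique _ (allFin⁺ h) (∈-allFin c) (λ {i} _ ne → transₘ (*-congₘ {v i} (eqₘ ≡.refl)
            (proj₂ (basis (toℕ i) (toℕ≤k i) c) (λ e → ne (≡.sym (Fin.toℕ-injective e))))) (≡⇒≈ₘ (ℕ.*-zeroʳ (v i)))))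
          (transₘ (*-congₘ {v c} (eqₘ ≡.refl) (proj₁ (basis (toℕ c) (toℕ≤k c) c) ≡.refl)) (≡⇒≈ₘ (ℕ.*-identityʳ (v c)))))

      t-suc-zero : ∀ n → t (suc n) zero ≈ₘ t n top ℕ.* n̂ zero
      t-suc-zero n = mulT-zero (tpow n)

      t-suc-suc : ∀ n i → t (suc n) (suc i) ≈ₘ t n (inject₁ i) ℕ.+ t n top ℕ.* n̂ (suc i)
      t-suc-suc n i = mulT-suc (tpow n) i

      Λ-suc-zero : ∀ y v → Λ (suc y) v zero ≈ₘ Λ y v top ℕ.* n̂ zero
      Λ-suc-zero y v = transₘ (Σ-cong Is (λ i → transₘ (*-congₘ {v i} (eqₘ ≡.refl) (transₘ (≡⇒≈ₘ (≡.cong (λ n → t n zero) (ℕ.+-suc (toℕ i) y))) (t-suc-zero (toℕ i ℕ.+ y))))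
        (≡⇒≈ₘ (≡.sym (ℕ.*-assoc (v i) (t (toℕ i ℕ.+ y) top) (n̂ zero)))))) (Σ-*ʳ Is (n̂ zero) (λ i → v i ℕ.* t (toℕ i ℕ.+ y) top))

      Λ-suc-suc : ∀ y v c → Λ (suc y) v (suc c) ≈ₘ Λ y v (inject₁ c) ℕ.+ Λ y v top ℕ.* n̂ (suc c)
      Λ-suc-suc y v c = transₘ (Σ-cong Is (λ i → transₘ (*-congₘ {v i} (eqₘ ≡.refl) (transₘ (≡⇒≈ₘ (≡.cong (λ n → t n (suc c)) (ℕ.+-suc (toℕ i) y))) (t-suc-suc (toℕ i ℕ.+ y) c)))
        (≡⇒≈ₘ (≡.trans (ℕ.*-distribˡ-+ (v i) (t (toℕ i ℕ.+ y) (inject₁ c)) _) (≡.cong (v i ℕ.* t (toℕ i ℕ.+ y) (inject₁ c) ℕ.+_) (≡.sym (ℕ.*-assoc (v i) (t (toℕ i ℕ.+ y) top) (n̂ (suc c)))))))))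
        (transₘ (Σ-+ Is (λ i → v i ℕ.* t (toℕ i ℕ.+ y) (inject₁ c)) (λ i → v i ℕ.* t (toℕ i ℕ.+ y) top ℕ.* n̂ (suc c)))
          (+-congₘ {Λ y v (inject₁ c)} (eqₘ ≡.refl) (Σ-*ʳ Is (n̂ (suc c)) (λ i → v i ℕ.* t (toℕ i ℕ.+ y) top))))

      top-1 : t k top ≈ₘ 1
      top-1 = proj₁ (basis k ℕ.≤-refl top) (Fin.toℕ-fromℕ k)

      -- The defining relation of G, namely t^h equal to the combination with coefficients `negg`,
      -- multiplied by t^y.
      Λ-negg : ∀ y c → Λ y n̂ c ≈ₘ t (suc k ℕ.+ y) c
      Λ-negg zero c = transₘ (Λ-0 n̂ c) (transₘ (symₘ (go c)) (≡⇒≈ₘ (≡.cong (λ n → t (suc n) c) (≡.sym (ℕ.+-identityʳ k)))))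
        where
        go : ∀ c → t (suc k) c ≈ₘ n̂ c
        go zero    = transₘ (t-suc-zero k) (transₘ (*-congₘ top-1 (eqₘ {n̂ zero} ≡.refl)) (≡⇒≈ₘ (ℕ.*-identityˡ _)))
        go (suc i) = transₘ (t-suc-suc k i) (transₘ (+-congₘ (proj₂ (basis k ℕ.≤-refl (inject₁ i)) (λ e → ℕ.<⇒≢ (Fin.toℕ<n i) (≡.trans (≡.sym (Fin.toℕ-inject₁ i)) e)))
          (*-congₘ top-1 (eqₘ {n̂ (suc i)} ≡.refl))) (≡⇒≈ₘ (ℕ.*-identityˡ _)))
      Λ-negg (suc y) zero = transₘ (Λ-suc-zero y n̂) (transₘ (*-congₘ (Λ-negg y top) (eqₘ {n̂ zero} ≡.refl))
        (transₘ (symₘ (t-suc-zero (suc k ℕ.+ y))) (≡⇒≈ₘ (≡.cong (λ n → t n zero) (≡.sym (ℕ.+-suc (suc k) y))))))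
      Λ-negg (suc y) (suc c) = transₘ (Λ-suc-suc y n̂ c) (transₘ (+-congₘ (Λ-negg y (inject₁ c)) (*-congₘ (Λ-negg y top) (eqₘ {n̂ (suc c)} ≡.refl)))
        (transₘ (symₘ (t-suc-suc (suc k ℕ.+ y) c)) (≡⇒≈ₘ (≡.cong (λ n → t n (suc c)) (≡.sym (ℕ.+-suc (suc k) y))))))

      -- Multiplication by t shifts the coordinates and replaces the overflow of the top one by
      -- `negg`; `Λ-negg` converts that overflow back into the missing summand t^(h+y).
      Λ-mulT : ∀ y v c → Λ y (lookup (mulT v)) c ≈ₘ Λ (suc y) (lookup v) c
      Λ-mulT y v c = begin
        Λ y (lookup (mulT v)) c ≈⟨ Σ-front k _ ⟩
        lookup (mulT v) zero ℕ.* t y c ℕ.+ ΣL (allFin k) (λ i → lookup (mulT v) (suc i) ℕ.* t (suc (toℕ i) ℕ.+ y) c)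
          ≈⟨ +-congₘ (*-congₘ (mulT-zero v) (eqₘ {t y c} ≡.refl)) (transₘ (Σ-cong (allFin k) (λ i → transₘ (*-congₘ (mulT-suc v i) (eqₘ {t (suc (toℕ i) ℕ.+ y) c} ≡.refl))
               (≡⇒≈ₘ (≡.trans (ℕ.*-distribʳ-+ (t (suc (toℕ i) ℕ.+ y) c) (lookup v (inject₁ i)) _) (≡.cong₂ ℕ._+_
                 (≡.cong (λ n → lookup v (inject₁ i) ℕ.* t n c) (≡.trans (≡.cong (λ n → suc n ℕ.+ y) (≡.sym (Fin.toℕ-inject₁ i))) (≡.sym (ℕ.+-suc _ y))))
                 (ℕ.*-assoc (lookup v top) (n̂ (suc i)) _)))))) (transₘ (Σ-+ (allFin k) _ _) (+-congₘ (eqₘ ≡.refl) (Σ-*ˡ (allFin k) (lookup v top) _)))) ⟩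
        lookup v top ℕ.* n̂ zero ℕ.* t y c ℕ.+ (ΣL (allFin k) (λ i → lookup v (inject₁ i) ℕ.* t (toℕ (inject₁ i) ℕ.+ suc y) c)
            ℕ.+ lookup v top ℕ.* ΣL (allFin k) (λ i → n̂ (suc i) ℕ.* t (suc (toℕ i) ℕ.+ y) c))
          ≈⟨ ≡⇒≈ₘ (lem (lookup v top) (n̂ zero) (t y c) _ _) ⟩
        ΣL (allFin k) (λ i → lookup v (inject₁ i) ℕ.* t (toℕ (inject₁ i) ℕ.+ suc y) c)
            ℕ.+ lookup v top ℕ.* (n̂ zero ℕ.* t y c ℕ.+ ΣL (allFin k) (λ i → n̂ (suc i) ℕ.* t (suc (toℕ i) ℕ.+ y) c))
          ≈⟨ +-congₘ (eqₘ {ΣL (allFin k) (λ i → lookup v (inject₁ i) ℕ.* t (toℕ (inject₁ i) ℕ.+ suc y) c)} ≡.refl)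
               (*-congₘ {lookup v top} (eqₘ ≡.refl) (transₘ (symₘ (Σ-front k (λ i → n̂ i ℕ.* t (toℕ i ℕ.+ y) c)))
               (transₘ (Λ-negg y c) (≡⇒≈ₘ (≡.cong (λ n → t n c) (≡.trans (≡.sym (ℕ.+-suc k y)) (≡.cong (ℕ._+ suc y) (≡.sym (Fin.toℕ-fromℕ k))))))))) ⟩
        ΣL (allFin k) (λ i → lookup v (inject₁ i) ℕ.* t (toℕ (inject₁ i) ℕ.+ suc y) c) ℕ.+ lookup v top ℕ.* t (toℕ top ℕ.+ suc y) c
          ≈⟨ symₘ (Σ-back k (λ i → lookup v i ℕ.* t (toℕ i ℕ.+ suc y) c)) ⟩
        Λ (suc y) (lookup v) c ∎
        where
        open Z.≈R
        lem : ∀ a b c x y → a ℕ.* b ℕ.* c ℕ.+ (x ℕ.+ a ℕ.* y) ≡ x ℕ.+ a ℕ.* (b ℕ.* c ℕ.+ y)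
        lem = solveℕ-∀

      Λ-tpow : ∀ x y c → Λ y (t x) c ≈ₘ t (x ℕ.+ y) c
      Λ-tpow zero y c = transₘ (Σ-unique _ (allFin⁺ h) (∈-allFin zero) (λ {i} _ ne → transₘ (*-congₘ (proj₂ (basis 0 z≤n i) (λ e → ne (Fin.toℕ-injective e))) (eqₘ {t (toℕ i ℕ.+ y) c} ≡.refl)) (eqₘ ≡.refl)))
        (transₘ (*-congₘ (proj₁ (basis 0 z≤n zero) ≡.refl) (eqₘ {t y c} ≡.refl)) (≡⇒≈ₘ (ℕ.*-identityˡ _)))
      Λ-tpow (suc x) y c = transₘ (Λ-mulT y (tpow x) c) (transₘ (Λ-tpow x (suc y) c) (≡⇒≈ₘ (≡.cong (λ n → t n c) (ℕ.+-suc x y))))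

      -- The threefold product with all powers of t gathered in one exponent, a form in which the
      -- three factors play symmetric roles.
      triple : Elt h → Elt h → Elt h → Fin h → ℕ
      triple a b c e = ΣL Is (λ i → ΣL Is (λ j → ΣL Is (λ n → lookup a i ℕ.* lookup b j ℕ.* (lookup c n ℕ.* t (toℕ i ℕ.+ toℕ j ℕ.+ toℕ n) e))))

      ⊗⊗ : ∀ a b c e → lookup ((a ⊗ b) ⊗ c) e ≈ₘ triple a b c e
      ⊗⊗ a b c e = begin
        lookup ((a ⊗ b) ⊗ c) e ≈⟨ lookup-⊗ (a ⊗ b) c e ⟩
        ΣL Is (λ l → ΣL Is (λ n → lookup (a ⊗ b) l ℕ.* lookup c n ℕ.* t (toℕ l ℕ.+ toℕ n) e))
          ≈⟨ Σ-cong Is (λ l → Σ-cong Is (λ n → *-congₘ (*-congₘ (lookup-⊗ a b l) (eqₘ {lookup c n} ≡.refl)) (eqₘ {t (toℕ l ℕ.+ toℕ n) e} ≡.refl))) ⟩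
        ΣL Is (λ l → ΣL Is (λ n → ΣL Is (λ i → ΣL Is (λ j → lookup a i ℕ.* lookup b j ℕ.* t (toℕ i ℕ.+ toℕ j) l)) ℕ.* lookup c n ℕ.* t (toℕ l ℕ.+ toℕ n) e))
          ≈⟨ Σ-cong Is (λ l → Σ-cong Is (λ n → factor l n)) ⟩
        ΣL Is (λ l → ΣL Is (λ n → ΣL Is (λ i → ΣL Is (λ j → lookup a i ℕ.* lookup b j ℕ.* (lookup c n ℕ.* (t (toℕ i ℕ.+ toℕ j) l ℕ.* t (toℕ l ℕ.+ toℕ n) e))))))
          ≈⟨ transₘ (Σ-cong Is (λ l → transₘ (Σ-swap Is Is _) (Σ-cong Is (λ i → Σ-swap Is Is _)))) (transₘ (Σ-swap Is Is _) (Σ-cong Is (λ i → transₘ (Σ-swap Is Is _) (Σ-cong Is (λ j → Σ-swap Is Is _))))) ⟩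
        ΣL Is (λ i → ΣL Is (λ j → ΣL Is (λ n → ΣL Is (λ l → lookup a i ℕ.* lookup b j ℕ.* (lookup c n ℕ.* (t (toℕ i ℕ.+ toℕ j) l ℕ.* t (toℕ l ℕ.+ toℕ n) e))))))
          ≈⟨ Σ-cong Is (λ i → Σ-cong Is (λ j → Σ-cong Is (λ n → transₘ (Σ-*ˡ Is (lookup a i ℕ.* lookup b j) _) (*-congₘ {lookup a i ℕ.* lookup b j} (eqₘ ≡.refl)
               (transₘ (Σ-*ˡ Is (lookup c n) _) (*-congₘ {lookup c n} (eqₘ ≡.refl) (Λ-tpow (toℕ i ℕ.+ toℕ j) (toℕ n) e))))))) ⟩
        triple a b c e ∎
        where
        open Z.≈R
        lem : ∀ x t c s → x ℕ.* t ℕ.* (c ℕ.* s) ≡ x ℕ.* (c ℕ.* (t ℕ.* s))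
        lem = solveℕ-∀
        f : Fin h → Fin h → Fin h → ℕ
        f l i j = lookup a i ℕ.* lookup b j ℕ.* t (toℕ i ℕ.+ toℕ j) l
        factor : ∀ l n → ΣL Is (λ i → ΣL Is (f l i)) ℕ.* lookup c n ℕ.* t (toℕ l ℕ.+ toℕ n) e ≈ₘ
          ΣL Is (λ i → ΣL Is (λ j → lookup a i ℕ.* lookup b j ℕ.* (lookup c n ℕ.* (t (toℕ i ℕ.+ toℕ j) l ℕ.* t (toℕ l ℕ.+ toℕ n) e))))
        factor l n = transₘ (≡⇒≈ₘ (ℕ.*-assoc (ΣL Is (λ i → ΣL Is (f l i))) (lookup c n) (t (toℕ l ℕ.+ toℕ n) e)))
          (transₘ (symₘ (Σ-*ʳ Is s (λ i → ΣL Is (f l i)))) (Σ-cong Is (λ i → transₘ (symₘ (Σ-*ʳ Is s (f l i)))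
            (Σ-cong Is (λ j → ≡⇒≈ₘ (lem (lookup a i ℕ.* lookup b j) (t (toℕ i ℕ.+ toℕ j) l) (lookup c n) (t (toℕ l ℕ.+ toℕ n) e)))))))
          where s = lookup c n ℕ.* t (toℕ l ℕ.+ toℕ n) e

      -- With commutativity, cyclic symmetry is enough for associativity: (ab)c = (bc)a = a(bc).
      rotate : ∀ a b c e → triple b c a e ≈ₘ triple a b c e
      rotate a b c e = transₘ (Σ-cong Is (λ j → Σ-swap Is Is _)) (transₘ (Σ-swap Is Is _) (Σ-cong Is (λ i → Σ-cong Is (λ j → Σ-cong Is (λ n →
        ≡⇒≈ₘ (≡.trans (lem (lookup a i) (lookup b j) (lookup c n) _) (≡.cong (λ m → lookup a i ℕ.* lookup b j ℕ.* (lookup c n ℕ.* t m e)) (lem₂ (toℕ i) (toℕ j) (toℕ n)))))))))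
        where
        lem : ∀ a b c t → b ℕ.* c ℕ.* (a ℕ.* t) ≡ a ℕ.* b ℕ.* (c ℕ.* t)
        lem = solveℕ-∀
        lem₂ : ∀ i j n → j ℕ.+ n ℕ.+ i ≡ i ℕ.+ j ℕ.+ n
        lem₂ = solveℕ-∀

    ⊗-comm : ∀ a b → a ⊗ b ≋ b ⊗ a
    ⊗-comm a b = coords λ c → transₘ (lookup-⊗ a b c) (transₘ (Σ-swap Is Is _) (transₘ (Σ-cong Is (λ j → Σ-cong Is (λ i →
      ≡⇒≈ₘ (≡.cong₂ ℕ._*_ (ℕ.*-comm (lookup a i) (lookup b j)) (≡.cong (λ n → t n c) (ℕ.+-comm (toℕ i) (toℕ j))))))) (symₘ (lookup-⊗ b a c))))

    ≋-sym : ∀ {a b} → a ≋ b → b ≋ a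
    ≋-sym (coords e) = coords λ c → symₘ (e c)

    ≋-trans : ∀ {a b c} → a ≋ b → b ≋ c → a ≋ c
    ≋-trans (coords e) (coords f) = coords λ c → transₘ (e c) (f c)

    ⊗-cong : ∀ {a b c d} → a ≋ b → c ≋ d → a ⊗ c ≋ b ⊗ d
    ⊗-cong {a} {b} {c} {d} (coords e) (coords f) = coords λ x → transₘ (lookup-⊗ a c x) (transₘ (Σ-cong Is (λ i → Σ-cong Is (λ j →
      *-congₘ (*-congₘ (e i) (f j)) (eqₘ {t (toℕ i ℕ.+ toℕ j) x} ≡.refl)))) (symₘ (lookup-⊗ b d x)))

    ⊗-assoc : ∀ a b c → (a ⊗ b) ⊗ c ≋ a ⊗ (b ⊗ c)
    ⊗-assoc a b c = coords λ e → transₘ (⊗⊗ a b c e) (transₘ (symₘ (rotate a b c e)) (transₘ (symₘ (⊗⊗ b c a e)) (at (⊗-comm (b ⊗ c) a) e)))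

    ⊗-identityˡ : ∀ a → oneE ⊗ a ≋ a
    ⊗-identityˡ a = coords λ c → transₘ (lookup-⊗ oneE a c) (transₘ (Σ-unique _ (allFin⁺ h) (∈-allFin zero)
        (λ {i} _ ne → Σ-0 Is (λ {j} _ → *-congₘ (*-congₘ (proj₂ (basis 0 z≤n i) (λ e → ne (Fin.toℕ-injective e))) (eqₘ {lookup a j} ≡.refl)) (eqₘ {t (toℕ i ℕ.+ toℕ j) c} ≡.refl))))
      (transₘ (Σ-cong Is (λ j → transₘ (*-congₘ (*-congₘ (proj₁ (basis 0 z≤n zero) ≡.refl) (eqₘ {lookup a j} ≡.refl)) (eqₘ {t (toℕ j) c} ≡.refl))
        (≡⇒≈ₘ (≡.cong₂ ℕ._*_ (ℕ.*-identityˡ (lookup a j)) (≡.cong (λ n → t n c) (≡.sym (ℕ.+-identityʳ (toℕ j)))))))) (Λ-0 (lookup a) c)))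

    ⊗-distribʳ : ∀ a b c → (b ⊕ c) ⊗ a ≋ (b ⊗ a) ⊕ (c ⊗ a)
    ⊗-distribʳ a b c = coords λ x → transₘ (lookup-⊗ (b ⊕ c) a x) (transₘ (Σ-cong Is (λ i → transₘ (Σ-cong Is (λ j →
        transₘ (*-congₘ (*-congₘ (lookup-⊕ b c i) (eqₘ {lookup a j} ≡.refl)) (eqₘ {t (toℕ i ℕ.+ toℕ j) x} ≡.refl))
          (≡⇒≈ₘ (lem (lookup b i) (lookup c i) (lookup a j) _)))) (Σ-+ Is (f b x i) (f c x i))))
      (transₘ (Σ-+ Is (λ i → ΣL Is (f b x i)) (λ i → ΣL Is (f c x i))) (transₘ (+-congₘ (symₘ (lookup-⊗ b a x)) (symₘ (lookup-⊗ c a x))) (symₘ (lookup-⊕ (b ⊗ a) (c ⊗ a) x)))))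
      where
      f : Elt h → Fin h → Fin h → Fin h → ℕ
      f b x i j = lookup b i ℕ.* lookup a j ℕ.* t (toℕ i ℕ.+ toℕ j) x
      lem : ∀ b c a t → (b ℕ.+ c) ℕ.* a ℕ.* t ≡ b ℕ.* a ℕ.* t ℕ.+ c ℕ.* a ℕ.* t
      lem = solveℕ-∀

    ⊕-cong : ∀ {a b c d} → a ≋ b → c ≋ d → a ⊕ c ≋ b ⊕ d
    ⊕-cong {a} {b} {c} {d} (coords e) (coords f) = coords λ x → transₘ (lookup-⊕ a c x) (transₘ (+-congₘ (e x) (f x)) (symₘ (lookup-⊕ b d x)))

    ⊕-comm : ∀ a b → a ⊕ b ≋ b ⊕ a
    ⊕-comm a b = coords λ x → transₘ (lookup-⊕ a b x) (transₘ (≡⇒≈ₘ (ℕ.+-comm (lookup a x) _)) (symₘ (lookup-⊕ b a x)))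

    ⊕-assoc : ∀ a b c → (a ⊕ b) ⊕ c ≋ a ⊕ (b ⊕ c)
    ⊕-assoc a b c = coords λ x → transₘ (lookup-⊕ (a ⊕ b) c x) (transₘ (+-congₘ (lookup-⊕ a b x) (eqₘ {lookup c x} ≡.refl))
      (transₘ (≡⇒≈ₘ (ℕ.+-assoc (lookup a x) _ _)) (symₘ (transₘ (lookup-⊕ a (b ⊕ c) x) (+-congₘ {lookup a x} (eqₘ ≡.refl) (lookup-⊕ b c x))))))

    ⊕-identityˡ : ∀ a → zeroE ⊕ a ≋ a
    ⊕-identityˡ a = coords λ x → transₘ (lookup-⊕ zeroE a x) (+-congₘ (lookup-zeroE x) (eqₘ {lookup a x} ≡.refl))

    ⊖_ : Elt h → Elt h
    ⊖_ = V.map negₘ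

    ⊖-inverseˡ : ∀ a → (⊖ a) ⊕ a ≋ zeroE
    ⊖-inverseˡ a = coords λ x → transₘ (lookup-⊕ (⊖ a) a x) (transₘ (+-congₘ (≡⇒≈ₘ (V.lookup-map x negₘ a)) (eqₘ {lookup a x} ≡.refl))
      (transₘ (neg-inverse (lookup a x)) (symₘ (lookup-zeroE x))))

    commutativeRing : CommutativeRing 0ℓ 0ℓ
    commutativeRing = record
      { Carrier = Elt h ; _≈_ = _≋_ ; _+_ = _⊕_ ; _*_ = _⊗_ ; -_ = ⊖_ ; 0# = zeroE ; 1# = oneE
      ; isCommutativeRing = record
        { isRing = record
          { +-isAbelianGroup = record
            { isGroup = record
              { isMonoid = record
                { isSemigroup = record
                  { isMagma = record
                    { isEquivalence = record { refl = coords λ _ → eqₘ ≡.refl ; sym = ≋-sym ; trans = ≋-trans }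
                    ; ∙-cong = ⊕-cong }
                  ; assoc = ⊕-assoc }
                ; identity = ⊕-identityˡ , (λ a → ≋-trans (⊕-comm a zeroE) (⊕-identityˡ a)) }
              ; inverse = ⊖-inverseˡ , (λ a → ≋-trans (⊕-comm a (⊖ a)) (⊖-inverseˡ a))
              ; ⁻¹-cong = λ { {a} {b} (coords e) → coords λ x → transₘ (≡⇒≈ₘ (V.lookup-map x negₘ a))
                  (transₘ (≡⇒≈ₘ (≡.cong (M ℕ.∸_) (residues (e x)))) (≡⇒≈ₘ (≡.sym (V.lookup-map x negₘ b)))) } }
            ; comm = ⊕-comm }
          ; *-cong = ⊗-cong
          ; *-assoc = ⊗-assoc
          ; *-identity = ⊗-identityˡ , (λ a → ≋-trans (⊗-comm a oneE) (⊗-identityˡ a))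
          ; distrib = (λ a b c → ≋-trans (⊗-comm a (b ⊕ c)) (≋-trans (⊗-distribʳ a b c) (⊕-cong (⊗-comm b a) (⊗-comm c a)))) , ⊗-distribʳ }
        ; *-comm = ⊗-comm } }

open QuotientRings

-- Change of modulus and enumeration of the elements.

module ModulusReduction where

  open import Defs
  open import Data.Nat as ℕ using (ℕ; zero; suc; NonZero)
  import Data.Nat.Properties as ℕ
  open import Data.Nat.DivMod using (_%_; m∣n⇒o%n%m≡o%m)
  open import Data.Nat.Divisibility using (_∣_)
  open import Data.Fin using (zero; suc; toℕ; inject₁; fromℕ)
  open import Data.List as L using (List; []; _∷_; allFin; _++_)
  import Data.List.Properties as L
  open import Data.List.Membership.Propositional using (_∈_)
  open import Data.List.Membership.Propositional.Properties using (∈-map⁺; ∈-map⁻; ∈-∃++; ∈-upTo⁺; ∈-upTo⁻; ∈-++⁺ˡ; ∈-++⁺ʳ; ∈-++⁻)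
  open import Data.List.Relation.Unary.Any using (here; there)
  open import Data.List.Relation.Unary.All as All using (All; []; _∷_)
  import Data.List.Relation.Unary.All.Properties as All
  open import Data.List.Relation.Unary.AllPairs using ([]; _∷_)
  open import Data.List.Relation.Unary.Unique.Propositional using (Unique)
  import Data.List.Relation.Unary.Unique.Propositional.Properties as Unique
  open import Data.List.Relation.Binary.Pointwise using ([]; _∷_)
  open import Data.List.Relation.Binary.Permutation.Propositional as ↭ using (_↭_; ↭-sym; ↭-trans; prep)
  open import Data.List.Relation.Binary.Permutation.Propositional.Properties using (shift; map⁺)
  open import Data.Vec as V using (Vec; []; _∷_; lookup)
  import Data.Vec.Properties as V
  import Data.Vec.Relation.Unary.All as VAll
  import Data.Vec.Relation.Unary.All.Properties as VAll
  open import Data.Product using (∃; _×_; _,_)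
  open import Data.Sum using (_⊎_; inj₁; inj₂)
  open import Relation.Nullary using (¬_; yes; no; contradiction; Dec)
  open import Relation.Binary.PropositionalEquality as ≡ using (_≡_; _≢_)

  module Lists where

    Unique-map : ∀ {A B : Set} (f : A → B) xs → (∀ {x y} → x ∈ xs → y ∈ xs → f x ≡ f y → x ≡ y) → Unique xs → Unique (L.map f xs)
    Unique-map f []       inj []       = []
    Unique-map f (x ∷ xs) inj (u ∷ us) = All.map⁺ (All.tabulate (λ {y} i e → All.lookup u i (inj (here ≡.refl) (there i) e)))
      ∷ Unique-map f xs (λ i j → inj (there i) (there j)) us

    unique-↭ : ∀ {A : Set} (xs ys : List A) → Unique xs → Unique ys → (∀ {z} → z ∈ xs → z ∈ ys) → (∀ {z} → z ∈ ys → z ∈ xs) → xs ↭ ys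
    unique-↭ []       []       _        _  _ _ = ↭.refl
    unique-↭ []       (y ∷ ys) _        _  _ g = contradiction (g (here ≡.refl)) λ ()
    unique-↭ (x ∷ xs) ys       (u ∷ us) uy f g = go (∈-∃++ (f (here ≡.refl)))
      where
      go : (∃ λ as → ∃ λ bs → ys ≡ as ++ x ∷ bs) → x ∷ xs ↭ ys
      go (as , bs , ≡.refl) = ↭-trans (prep x (unique-↭ xs (as ++ bs) us (remove as uy) into from)) (↭-sym (shift x as bs))
        where
        remove : ∀ as → Unique (as ++ x ∷ bs) → Unique (as ++ bs)
        remove []       (_ ∷ u) = u
        remove (a ∷ as) (v ∷ u) = All.++⁺ (All.++⁻ˡ as v) (All.tail (All.++⁻ʳ as v)) ∷ remove as u
        fresh : ∀ as → Unique (as ++ x ∷ bs) → ¬ x ∈ as ++ bs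
        fresh []       (v ∷ _) i         = All.lookup v i ≡.refl
        fresh (a ∷ as) (v ∷ u) (here e)  = All.lookup v (∈-++⁺ʳ as (here ≡.refl)) (≡.sym e)
        fresh (a ∷ as) (v ∷ u) (there i) = fresh as u i
        into : ∀ {z} → z ∈ xs → z ∈ as ++ bs
        into i with ∈-++⁻ as (f (there i))
        ... | inj₁ j             = ∈-++⁺ˡ j
        ... | inj₂ (here ≡.refl) = contradiction ≡.refl (All.lookup u i)
        ... | inj₂ (there j)     = ∈-++⁺ʳ as j
        from : ∀ {z} → z ∈ as ++ bs → z ∈ xs
        from {z} i = back (g (widen (∈-++⁻ as i)))
          where
          widen : z ∈ as ⊎ z ∈ bs → z ∈ as ++ x ∷ bs
          widen (inj₁ j) = ∈-++⁺ˡ j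
          widen (inj₂ j) = ∈-++⁺ʳ as (there j)
          back : z ∈ x ∷ xs → z ∈ xs
          back (here ≡.refl) = contradiction i (fresh as uy)
          back (there j)     = j

  module Reduce (M M′ : ℕ) (1≤M : 1 ℕ.≤ M) (1≤M′ : 1 ℕ.≤ M′) (M′∣M : M′ ∣ M) {k : ℕ} (g : Vec ℕ (suc k)) where
    private
      module R = QuotientRing M 1≤M g
      module R′ = QuotientRing M′ 1≤M′ g
      module RF = RingFacts R.commutativeRing
      module RF′ = RingFacts R′.commutativeRing
      open R′ using (_≈ₘ_; eqₘ; symₘ; transₘ; +-congₘ; *-congₘ; ≡⇒≈ₘ)
      instance
        M≢0 : NonZero M
        M≢0 = ℕ.>-nonZero 1≤M
        M′≢0 : NonZero M′
        M′≢0 = ℕ.>-nonZero 1≤M′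

    reduceₘ : ∀ {x y} → x R.≈ₘ y → x ≈ₘ y
    reduceₘ {x} {y} e = R′.from% (≡.trans (≡.sym (m∣n⇒o%n%m≡o%m M′ M x M′∣M)) (≡.trans (≡.cong (_% M′) (R.to% e)) (m∣n⇒o%n%m≡o%m M′ M y M′∣M)))

    reduce : ∀ {a b} → a R.≋ b → a R′.≋ b
    reduce (R.coords e) = R′.coords λ c → reduceₘ (e c)

    private
      -- Modulo M′ both entries are additive inverses of the same coefficient of g.
      negg-reduce : ∀ c → lookup R.negg c ≈ₘ lookup R′.negg c
      negg-reduce c = transₘ (≡⇒≈ₘ (V.lookup-map c R.negₘ g)) (transₘ cancel (≡⇒≈ₘ (≡.sym (V.lookup-map c R′.negₘ g))))
        where
        x = lookup g c
        module Z′ = RingFacts R′.ℤ/M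
        cancel : R.negₘ x ≈ₘ R′.negₘ x
        cancel = Z′.+-cancelˡ x _ _ (transₘ (≡⇒≈ₘ (ℕ.+-comm x _)) (transₘ (reduceₘ (R.neg-inverse x)) (transₘ (symₘ (R′.neg-inverse x)) (≡⇒≈ₘ (ℕ.+-comm (R′.negₘ x) x)))))

      mulT-reduce : ∀ v w → (∀ c → lookup v c ≈ₘ lookup w c) → ∀ c → lookup (R.mulT v) c ≈ₘ lookup (R′.mulT w) c
      mulT-reduce v w e zero = transₘ (reduceₘ (R.mulT-zero v)) (transₘ (*-congₘ (e (fromℕ k)) (negg-reduce zero)) (symₘ (R′.mulT-zero w)))
      mulT-reduce v w e (suc i) = transₘ (reduceₘ (R.mulT-suc v i)) (transₘ (+-congₘ (e (inject₁ i)) (*-congₘ (e (fromℕ k)) (negg-reduce (suc i)))) (symₘ (R′.mulT-suc w i)))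

      tpow-reduce : ∀ n c → lookup (R.tpow n) c ≈ₘ lookup (R′.tpow n) c
      tpow-reduce zero    zero    = transₘ (reduceₘ (R.modN≈ 1)) (symₘ (R′.modN≈ 1))
      tpow-reduce zero    (suc c) = eqₘ ≡.refl
      tpow-reduce (suc n) c       = mulT-reduce (R.tpow n) (R′.tpow n) (tpow-reduce n) c

      Σ-reduce : ∀ {A : Set} (xs : List A) {f f′ : A → ℕ} → (∀ x → f x ≈ₘ f′ x) → RingFacts.ΣL R.ℤ/M xs f ≈ₘ RingFacts.ΣL R′.ℤ/M xs f′
      Σ-reduce []       e = eqₘ ≡.refl
      Σ-reduce (x ∷ xs) e = +-congₘ (e x) (Σ-reduce xs e)

    ⊗-reduce : ∀ a b → (a R.⊗ b) R′.≋ (a R′.⊗ b)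
    ⊗-reduce a b = R′.coords λ c → transₘ (reduceₘ (R.lookup-⊗ a b c)) (transₘ (Σ-reduce (allFin (suc k)) (λ i → Σ-reduce (allFin (suc k)) (λ j →
      *-congₘ {lookup a i ℕ.* lookup b j} (eqₘ ≡.refl) (tpow-reduce (toℕ i ℕ.+ toℕ j) c)))) (symₘ (R′.lookup-⊗ a b c)))

    ⊕-reduce : ∀ a b → (a R.⊕ b) R′.≋ (a R′.⊕ b)
    ⊕-reduce a b = R′.coords λ c → transₘ (reduceₘ (R.lookup-⊕ a b c)) (symₘ (R′.lookup-⊕ a b c))

    oneE-reduce : R.oneE R′.≋ R′.oneE
    oneE-reduce = R′.coords (tpow-reduce 0)

    ^-reduce : ∀ a n → (a RF.^ n) R′.≋ (a RF′.^ n)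
    ^-reduce a zero    = oneE-reduce
    ^-reduce a (suc n) = R′.≋-trans (⊗-reduce a (a RF.^ n)) (R′.⊗-cong {a} {a} (RF′.refl {a}) (^-reduce a n))

    nat-reduce : ∀ n → RF.nat n R′.≋ RF′.nat n
    nat-reduce zero    = RF′.refl
    nat-reduce (suc n) = R′.≋-trans (⊕-reduce R.oneE (RF.nat n)) (R′.⊕-cong oneE-reduce (nat-reduce n))

  module Elements (M : ℕ) (1≤M : 1 ℕ.≤ M) {k : ℕ} (g : Vec ℕ (suc k)) where
    open QuotientRing M 1≤M g
    open RingFacts commutativeRing using (nat; _·_; ×≈nat*; refl; trans; sym)
    open Lists

    lookup-nat* : ∀ n x c → lookup (nat n ⊗ x) c ≈ₘ n ℕ.* lookup x c
    lookup-nat* n x c = transₘ (symₘ (at (×≈nat* n x) c)) (go n)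
      where
      go : ∀ n → lookup (n · x) c ≈ₘ n ℕ.* lookup x c
      go zero    = lookup-zeroE c
      go (suc n) = transₘ (lookup-⊕ x (n · x) c) (+-congₘ {lookup x c} (eqₘ ≡.refl) (go n))

    canonical-≡ : ∀ {a b} → Canonical a → Canonical b → a ≋ b → a ≡ b
    canonical-≡ {a} {b} ca cb (coords e) = ≡.trans (≡.sym (V.tabulate∘lookup a)) (≡.trans (V.tabulate-cong same) (V.tabulate∘lookup b))
      where
      same : ∀ c → lookup a c ≡ lookup b c
      same c = ≡.trans (≡.sym (modN-small (VAll.lookup⁺ ca c))) (≡.trans (residues (e c)) (modN-small (VAll.lookup⁺ cb c)))

    norm≋ : ∀ a → norm a ≋ a
    norm≋ a = coords (lookup-norm a)

    norm-canonical : ∀ a → Canonical (norm a)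
    norm-canonical a = VAll.map⁺ (VAll.universal modN< a)

    norm-cong : ∀ {a b} → a ≋ b → norm a ≡ norm b
    norm-cong {a} {b} e = canonical-≡ (norm-canonical a) (norm-canonical b) (≋-trans (norm≋ a) (≋-trans e (≋-sym (norm≋ b))))

    zeroE-canonical : Canonical zeroE
    zeroE-canonical = zeros (suc k)
      where
      zeros : ∀ n → VAll.All (ℕ._< M) (V.replicate n 0)
      zeros zero    = VAll.[]
      zeros (suc n) = 1≤M VAll.∷ zeros n

    _≋?_ : ∀ a b → Dec (a ≋ b)
    a ≋? b with V.≡-dec ℕ._≟_ (norm a) (norm b)
    ... | yes e = yes (≋-trans (≋-sym (norm≋ a)) (≋-trans (coords λ c → ≡⇒≈ₘ (≡.cong (λ v → lookup v c) e)) (norm≋ b)))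
    ... | no ne = no λ e → ne (norm-cong e)

    allVecs-length : ∀ n → L.length (allVecs n) ≡ M ℕ.^ n
    allVecs-length zero    = ≡.refl
    allVecs-length (suc n) = ≡.trans (go (L.upTo M)) (≡.cong₂ ℕ._*_ (L.length-upTo M) ≡.refl)
      where
      go : ∀ cs → L.length (L.concatMap (λ c → L.map (c ∷_) (allVecs n)) cs) ≡ L.length cs ℕ.* M ℕ.^ n
      go []       = ≡.refl
      go (c ∷ cs) = ≡.trans (L.length-++ (L.map (c ∷_) (allVecs n))) (≡.cong₂ ℕ._+_ (≡.trans (L.length-map (c ∷_) (allVecs n)) (allVecs-length n)) (go cs))

    ∈-concatMap-intro : ∀ {A B : Set} (f : A → List B) {x y} xs → x ∈ xs → y ∈ f x → y ∈ L.concatMap f xs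
    ∈-concatMap-intro f (x ∷ xs) (here ≡.refl) j = ∈-++⁺ˡ j
    ∈-concatMap-intro f (x ∷ xs) (there i)     j = ∈-++⁺ʳ (f x) (∈-concatMap-intro f xs i j)

    ∈-concatMap-elim : ∀ {A B : Set} (f : A → List B) {y} xs → y ∈ L.concatMap f xs → ∃ λ x → x ∈ xs × y ∈ f x
    ∈-concatMap-elim f (x ∷ xs) i with ∈-++⁻ (f x) i
    ... | inj₁ j = x , here ≡.refl , j
    ... | inj₂ j with ∈-concatMap-elim f xs j
    ... | x′ , i′ , j′ = x′ , there i′ , j′

    ∈-allVecs : ∀ {n} (v : Vec ℕ n) → VAll.All (ℕ._< M) v → v ∈ allVecs n
    ∈-allVecs []      VAll.[]       = here ≡.refl
    ∈-allVecs {suc n} (c ∷ v) (lt VAll.∷ a) = ∈-concatMap-intro (λ c → L.map (c ∷_) (allVecs n)) (L.upTo M) (∈-upTo⁺ lt) (∈-map⁺ (c ∷_) (∈-allVecs v a))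

    allVecs-canonical : ∀ n {v} → v ∈ allVecs n → VAll.All (ℕ._< M) v
    allVecs-canonical zero    (here ≡.refl) = VAll.[]
    allVecs-canonical (suc n) i =
      let (c , j , l) = ∈-concatMap-elim (λ c → L.map (c ∷_) (allVecs n)) (L.upTo M) i
          (w , l′ , e) = ∈-map⁻ (c ∷_) l
      in ≡.subst (VAll.All (ℕ._< M)) (≡.sym e) (∈-upTo⁻ j VAll.∷ allVecs-canonical n l′)

    allVecs-unique : ∀ n → Unique (allVecs n)
    allVecs-unique zero    = [] ∷ []
    allVecs-unique (suc n) = go (L.upTo M) (Unique.upTo⁺ M)
      where
      f : ℕ → List (Vec ℕ (suc n))
      f c = L.map (c ∷_) (allVecs n)
      disjoint : ∀ {c cs v} → All (c ≢_) cs → v ∈ f c → v ∈ L.concatMap f cs → c ≢ c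
      disjoint {c} {cs} u i j =
        let (w , _ , e) = ∈-map⁻ (c ∷_) i
            (c′ , j′ , l) = ∈-concatMap-elim f cs j
            (w′ , _ , e′) = ∈-map⁻ (c′ ∷_) l
        in contradiction (≡.cong V.head (≡.trans (≡.sym e) e′)) (All.lookup u j′)
      go : ∀ cs → Unique cs → Unique (L.concatMap f cs)
      go []       []       = []
      go (c ∷ cs) (u ∷ us) = Unique.++⁺ (Unique-map (c ∷_) (allVecs n) (λ _ _ → V.∷-injectiveʳ) (allVecs-unique n)) (go cs us)
        (λ (i , j) → disjoint u i j ≡.refl)

    ∈-allElts : ∀ a → Canonical a → a ∈ allElts
    ∈-allElts = ∈-allVecs

open ModulusReduction

-- Fermat's congruence and Teichmüller lifts in a local ring.

module TeichmüllerRepresentatives where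

  open import Level using (0ℓ)
  open import Algebra.Bundles using (CommutativeRing)
  import Data.Integer as ℤ
  open import Data.Nat as ℕ using (ℕ; zero; suc; s≤s; z≤n)
  import Data.Nat.Properties as ℕ
  open import Data.Nat.Primality using (Prime)
  open import Data.List as L using (List; []; _∷_; length)
  import Data.List.Properties as L
  open import Data.List.Membership.Propositional using (_∈_)
  open import Data.List.Membership.Propositional.Properties using (∈-map⁺; ∈-map⁻)
  open import Data.List.Relation.Unary.Any using (here; there)
  open import Data.List.Relation.Unary.All as All using (All; []; _∷_)
  import Data.List.Relation.Unary.All.Properties as All
  open import Data.List.Relation.Unary.AllPairs using ([]; _∷_)
  open import Data.List.Relation.Unary.Unique.Propositional using (Unique)
  open import Data.List.Relation.Binary.Pointwise using (Pointwise; []; _∷_)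
  open import Data.List.Relation.Binary.Permutation.Propositional using (_↭_)
  open import Data.List.Relation.Binary.Permutation.Propositional.Properties using (map⁺)
  open import Data.Product using (∃; _×_; _,_; proj₁; proj₂)
  open import Data.Sum using (_⊎_; inj₁; inj₂)
  open import Relation.Nullary using (¬_; contradiction)
  open import Relation.Binary.PropositionalEquality as ≡ using (_≡_; _≢_)

  -- O is local with maximal ideal pO and residue field of size p^h, and xs represents the residue classes.
  record LocalRing (O : CommutativeRing 0ℓ 0ℓ) (p h Q′ N : ℕ) : Set where
    open RingFacts O
    field
      prime    : Prime p
      q≡       : p ℕ.^ h ≡ suc (suc Q′)
      p^N≈0    : nat (p ℕ.^ N) ≈ 0#
      xs       : List Carrier
      unique   : Unique xs
      size     : length xs ≡ p ℕ.^ h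
      rep      : Carrier → Carrier
      rep∈     : ∀ x → rep x ∈ xs
      rep≡     : ∀ x → x ≡ rep x mod p
      distinct : ∀ {x y} → x ∈ xs → y ∈ xs → x ≡ y mod p → x ≡ y
      field′   : ∀ x → x ≡ 0# mod p ⊎ Unit x

  module TeichmüllerLift (O : CommutativeRing 0ℓ 0ℓ) (p h Q′ N : ℕ) (R : LocalRing O p h Q′ N) where
    open LocalRing R
    open RingFacts O
    open Nilpotent prime N p^N≈0
    open Lists

    private
      Q : ℕ
      Q = suc Q′

      1≢0 : ¬ 1# ≡ 0# mod p
      1≢0 e = go xs unique (≡.trans size q≡) distinct
        where
        all≡ : ∀ x y → x ≡ y mod p
        all≡ x y = ≡-trans (to-zero x) (≡-sym (to-zero y))
          where
          to-zero : ∀ x → x ≡ 0# mod p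
          to-zero x = ≡-trans (≈⇒≡ (sym (*-identityʳ x))) (≡-trans (≡-* (≈⇒≡ (refl {x})) e) (≈⇒≡ (zeroʳ x)))
        go : ∀ xs → Unique xs → length xs ≡ suc (suc Q′) → ¬ (∀ {x y} → x ∈ xs → y ∈ xs → x ≡ y mod p → x ≡ y)
        go (x ∷ y ∷ _) ((ne ∷ _) ∷ _) _ d = ne (d (here ≡.refl) (there (here ≡.refl)) (all≡ x y))

      Unit⇒≢0 : ∀ {x} → Unit x → ¬ x ≡ 0# mod p
      Unit⇒≢0 (v , e) x0 = 1≢0 (≡-trans (≈⇒≡ (sym e)) (≡-trans (≡-* x0 (≈⇒≡ (refl {v}))) (≈⇒≡ (zeroˡ v))))

      ≡0-unique : ∀ {x} → x ∈ xs → x ≡ 0# mod p → x ≡ rep 0#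
      ≡0-unique i e = distinct i (rep∈ 0#) (≡-trans e (rep≡ 0#))

      module Rotation (u : Carrier) (uu : Unit u) where

        σ : Carrier → Carrier
        σ x = rep (u * x)

        unit-cancel-mod : ∀ {x y} → u * x ≡ u * y mod p → x ≡ y mod p
        unit-cancel-mod {x} {y} e = ≡-trans (≈⇒≡ (divide x)) (≡-trans (≡-* (≈⇒≡ (refl {v})) e) (≈⇒≡ (sym (divide y))))
          where
          v = proj₁ uu
          divide : ∀ x → x ≈ v * (u * x)
          divide x = sym (trans (sym (*-assoc v u x)) (trans (*-congʳ (trans (*-comm v u) (proj₂ uu))) (*-identityˡ x)))

        σ↭ : L.map σ xs ↭ xs
        σ↭ = unique-↭ (L.map σ xs) xs
          (Unique-map σ xs (λ {x} {y} i j e → distinct i j (unit-cancel-mod (≡-trans (rep≡ (u * x)) (≡-trans (≈⇒≡ (reflexive e)) (≡-sym (rep≡ (u * y))))))) unique)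
          unique (λ i → let (x , _ , e) = ∈-map⁻ σ i in ≡.subst (_∈ xs) (≡.sym e) (rep∈ (u * x)))
          (λ {z} i → ≡.subst (_∈ L.map σ xs) (onto z i) (∈-map⁺ σ (rep∈ (v * z))))
          where
          v = proj₁ uu
          onto : ∀ z → z ∈ xs → σ (rep (v * z)) ≡ z
          onto z i = distinct (rep∈ _) i (≡-trans (≡-sym (rep≡ _)) (≡-trans (≡-* (≈⇒≡ (refl {u})) (≡-sym (rep≡ (v * z))))
            (≈⇒≡ (trans (sym (*-assoc u v z)) (trans (*-congʳ (proj₂ uu)) (*-identityˡ z))))))

        choose : {A : Set} → A → A → ∀ {x} → x ≡ 0# mod p ⊎ Unit x → A
        choose a b (inj₁ _) = a
        choose a b (inj₂ _) = b

        -- Bookkeeping for Fermat's congruence by multiplying over all residue classes. θ replaces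
        -- the zero class by 1, so that its product is a unit; κ is the factor by which θ changes
        -- under σ; κ₀ is the complementary factor, with κ κ₀ = u, and differs from 1 only at the
        -- zero class. Then u^q = Πκ · Πκ₀ ≡ 1 · u.
        θ κ κ₀ : Carrier → Carrier
        θ x  = choose 1# x (field′ x)
        κ x  = choose 1# u (field′ x)
        κ₀ x = choose u 1# (field′ x)

        Unit-1 : Unit 1#
        Unit-1 = 1# , *-identityˡ 1#

        θ-unit : ∀ x → Unit (θ x)
        θ-unit x with field′ x
        ... | inj₁ _ = Unit-1
        ... | inj₂ v = v

        Unit-ΠL : ∀ ys → Unit (ΠL ys θ)
        Unit-ΠL []       = Unit-1
        Unit-ΠL (y ∷ ys) = Unit-* (θ-unit y) (Unit-ΠL ys)

        θσ : ∀ x → θ (σ x) ≡ κ x * θ x mod p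
        θσ x with field′ x | field′ (σ x)
        ... | inj₁ _  | inj₁ _  = ≈⇒≡ (sym (*-identityˡ 1#))
        ... | inj₂ _  | inj₂ _  = ≡-sym (rep≡ (u * x))
        ... | inj₁ x0 | inj₂ v  = contradiction (≡-trans (≡-sym (rep≡ (u * x))) (≡-trans (≡-* (≈⇒≡ (refl {u})) x0) (≈⇒≡ (zeroʳ u)))) (Unit⇒≢0 v)
        ... | inj₂ v  | inj₁ s0 = contradiction (≡-trans (rep≡ (u * x)) s0) (Unit⇒≢0 (Unit-* uu v))

        κκ₀ : ∀ x → κ x * κ₀ x ≈ u
        κκ₀ x with field′ x
        ... | inj₁ _ = *-identityˡ u
        ... | inj₂ _ = *-identityʳ u

        κ₀-away : ∀ {x} → x ∈ xs → ¬ x ≡ rep 0# → κ₀ x ≈ 1#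
        κ₀-away {x} i ne with field′ x
        ... | inj₁ x0 = contradiction (≡0-unique i x0) ne
        ... | inj₂ _  = refl

        κ₀-at : κ₀ (rep 0#) ≈ u
        κ₀-at with field′ (rep 0#)
        ... | inj₁ _ = refl
        ... | inj₂ v = contradiction (≡-sym (rep≡ 0#)) (Unit⇒≢0 v)

        -- Since σ permutes the classes it preserves the product of θ, a unit that can be cancelled.
        Πκ≡1 : ΠL xs κ ≡ 1# mod p
        Πκ≡1 = let (v , e) = Unit-ΠL xs in
          ≡-trans (≈⇒≡ (sym (trans (*-assoc _ _ v) (trans (*-congˡ e) (*-identityʳ _)))))
            (≡-trans (≡-* main (≈⇒≡ (refl {v}))) (≈⇒≡ e))
          where
          main : ΠL xs κ * ΠL xs θ ≡ ΠL xs θ mod p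
          main = ≡-trans (≈⇒≡ (sym (ΠL-* xs κ θ))) (≡-trans (≡-sym (≡-Π xs (λ {x} _ → θσ x))) (≈⇒≡ (trans (sym (ΠL-map σ xs θ)) (ΠL-↭ θ σ↭))))

        fermat-unit : u ^ (p ℕ.^ h) ≡ u mod p
        fermat-unit = ≡-trans (≈⇒≡ (sym (trans (trans (sym (ΠL-* xs κ κ₀)) (ΠL-cong∈ xs (λ {x} _ → κκ₀ x))) (trans (ΠL-const xs u) (^-congʳ u size)))))
          (≡-trans (≡-* Πκ≡1 (≈⇒≡ (trans (ΠL-unique κ₀ unique (rep∈ 0#) κ₀-away) κ₀-at))) (≈⇒≡ (*-identityˡ u)))

      1≤p^ : ∀ k → 1 ℕ.≤ p ℕ.^ k
      1≤p^ = Residues.Powers.1≤p^ Q′ p h prime q≡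

    frobenius-mod : ∀ x → x ^ (p ℕ.^ h) ≡ x mod p
    frobenius-mod x with field′ x
    ... | inj₁ x0 = ≡-trans (≡-^ (p ℕ.^ h) x0) (≡-trans (≈⇒≡ (0^ (1≤p^ h))) (≡-sym x0))
    ... | inj₂ v  = Rotation.fermat-unit x v

    -- This is x^(q^N), a member of the sequence x^(q^i) that defines the Teichmüller
    -- representative; at precision p^N it has already become stationary.
    τ : Carrier → Carrier
    τ x = x ^ (p ℕ.^ (h ℕ.* N))

    private
      frobenius-mod^ : ∀ x i → x ^ (p ℕ.^ (h ℕ.* i)) ≡ x mod p
      frobenius-mod^ x zero    = ≈⇒≡ (trans (^-congʳ x (≡.cong (p ℕ.^_) (ℕ.*-zeroʳ h))) (*-identityʳ x))
      frobenius-mod^ x (suc i) = ≡-trans (≈⇒≡ (trans (^-congʳ x (≡.trans (≡.cong (p ℕ.^_) (ℕ.*-suc h i)) (ℕ.^-distribˡ-+-* p h (h ℕ.* i))))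
        (sym (^-assocʳ x (p ℕ.^ h) (p ℕ.^ (h ℕ.* i)))))) (≡-trans (≡-^ (p ℕ.^ (h ℕ.* i)) (frobenius-mod x)) (frobenius-mod^ x i))

      1≤h : 1 ℕ.≤ h
      1≤h = go h q≡
        where
        go : ∀ n → p ℕ.^ n ≡ suc (suc Q′) → 1 ℕ.≤ n
        go (suc n) _ = s≤s z≤n

    τ-mod : ∀ x → τ x ≡ x mod p
    τ-mod x = frobenius-mod^ x N

    -- The power p^(hN) lifts a congruence modulo p to one modulo p^(hN+1), and this exponent is at
    -- least N.
    τ-cong : ∀ {x y} → x ≡ y mod p → τ x ≈ τ y
    τ-cong {x} {y} (z , e) = let (w , e′) = lifted in
      trans e′ (trans (+-congˡ (trans (*-congʳ vanish) (zeroˡ w))) (+-identityʳ _))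
      where
      lifted : τ x ≡ τ y mod p ℕ.^ (h ℕ.* N ℕ.+ 1)
      lifted = ^p^-lift prime (h ℕ.* N) 0 (z , trans e (+-congˡ (*-congʳ (nat-cong (≡.sym (ℕ.*-identityʳ p))))))
      N≤ : N ℕ.≤ h ℕ.* N ℕ.+ 1
      N≤ = ℕ.≤-trans (ℕ.m≤n*m N h {{ℕ.>-nonZero 1≤h}}) (ℕ.m≤m+n _ 1)
      vanish : nat (p ℕ.^ (h ℕ.* N ℕ.+ 1)) ≈ 0#
      vanish = trans (nat-cong (≡.trans (≡.cong (p ℕ.^_) (≡.sym (ℕ.m+[n∸m]≡n N≤))) (ℕ.^-distribˡ-+-* p N _)))
        (trans (nat-* (p ℕ.^ N) _) (trans (*-congʳ p^N≈0) (zeroˡ _)))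

    τ-* : ∀ x y → τ (x * y) ≈ τ x * τ y
    τ-* x y = ^-distrib-* x y (p ℕ.^ (h ℕ.* N))

    τ-0 : τ 0# ≈ 0#
    τ-0 = 0^ (1≤p^ (h ℕ.* N))

    τ-q : ∀ x → τ x ^ (p ℕ.^ h) ≈ τ x
    τ-q x = trans (trans (^-assocʳ x (p ℕ.^ (h ℕ.* N)) (p ℕ.^ h)) (trans (^-congʳ x (ℕ.*-comm (p ℕ.^ (h ℕ.* N)) (p ℕ.^ h)))
      (sym (^-assocʳ x (p ℕ.^ h) (p ℕ.^ (h ℕ.* N)))))) (τ-cong (frobenius-mod x))

    private
      ts : List Carrier
      ts = L.map τ xs

      τ-rep∈ : ∀ x → ∃ λ t → t ∈ ts × t ≈ τ x
      τ-rep∈ x = τ (rep x) , ∈-map⁺ τ (rep∈ x) , τ-cong (≡-sym (rep≡ x))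

      τ-separates : ∀ {x y} → x ∈ xs → y ∈ xs → x ≢ y → Unit (τ x - τ y)
      τ-separates {x} {y} i j ne = Unit-mod (≡-+ (τ-mod x) (≡-neg (τ-mod y))) (go (field′ (x - y)))
        where
        ≡-neg : ∀ {a b} → a ≡ b mod p → - a ≡ - b mod p
        ≡-neg {a} {b} (z , e) = - z , trans (-‿cong e) (lem b (nat p) z)
          where
          lem : ∀ b p z → - (b + p * z) ≈ - b + p * - z
          lem = solve 3 (λ b p z → :- (b :+ p :* z) := :- b :+ p :* :- z) refl
        go : (x - y) ≡ 0# mod p ⊎ Unit (x - y) → Unit (x - y)
        go (inj₂ v) = v
        go (inj₁ (z , e)) = contradiction (distinct i j (z , trans (lem x y) (+-congˡ (trans e (+-identityˡ _))))) ne
          where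
          lem : ∀ x y → x ≈ y + (x - y)
          lem = solve 2 (λ x y → x := y :+ (x :- y)) refl

      separated′ : ∀ ys → (∀ {y} → y ∈ ys → y ∈ xs) → Unique ys → Separated (L.map τ ys)
      separated′ []       sub []       = []
      separated′ (y ∷ ys) sub (u ∷ us) = All.map⁺ (All.tabulate (λ {z} i → τ-separates (sub (here ≡.refl)) (sub (there i)) (All.lookup u i)))
        ∷ separated′ ys (λ i → sub (there i)) us

      τ-fermat : ∀ x → τ x ≈ 0# ⊎ τ x ^ Q ≈ 1#
      τ-fermat x with field′ x
      ... | inj₁ x0 = inj₁ (trans (τ-cong x0) τ-0)
      ... | inj₂ v  = inj₂ (begin
        τ x ^ Q                  ≈⟨ lem (τ x ^ Q) ⟩
        (τ x ^ Q - 1#) + 1#      ≈⟨ +-congʳ (Unit-cancel (Unit-mod (τ-mod x) v) (trans (lem₂ (τ x) (τ x ^ Q))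
                                      (trans (+-congʳ (trans (^-congʳ (τ x) (≡.sym q≡)) (τ-q x))) (-‿inverseʳ _)))) ⟩
        0# + 1#                  ≈⟨ +-identityˡ 1# ⟩
        1#                       ∎)
        where
        open ≈R
        lem : ∀ a → a ≈ (a - 1#) + 1#
        lem = solve 1 (λ a → a := (a :- con (ℤ.+ 1)) :+ con (ℤ.+ 1)) refl
        lem₂ : ∀ t a → t * (a - 1#) ≈ t * a - t
        lem₂ = solve 2 (λ t a → t :* (a :- con (ℤ.+ 1)) := t :* a :- t) refl

      τ-rotate : ∀ x → τ x ^ Q ≈ 1# → ∃ λ ts′ → ts′ ↭ ts × Pointwise (λ t t′ → τ x * t ≈ t′) ts ts′
      τ-rotate x e with field′ x
      ... | inj₁ x0 = contradiction (≈⇒≡ (trans (sym e) (trans (^-congˡ Q (trans (τ-cong x0) τ-0)) (zeroˡ _)))) 1≢0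
      ... | inj₂ v  = L.map τ (L.map σ xs) , map⁺ τ σ↭ , pointwise xs
        where
        open Rotation x v
        pointwise : ∀ ys → Pointwise (λ t t′ → τ x * t ≈ t′) (L.map τ ys) (L.map τ (L.map σ ys))
        pointwise []       = []
        pointwise (y ∷ ys) = trans (sym (τ-* x y)) (τ-cong (rep≡ (x * y))) ∷ pointwise ys

    teichmüllerSystem : TeichmüllerSystem O p h Q′ N
    teichmüllerSystem = record
      { prime = prime ; q≡ = q≡ ; p^N≈0 = p^N≈0
      ; ts = ts
      ; separated = separated′ xs (λ i → i) unique
      ; size = ≡.trans (L.length-map τ xs) size
      ; zero∈ = let (t , i , e) = τ-rep∈ 0# in t , i , trans e τ-0
      ; one∈ = let (t , i , e) = τ-rep∈ 1# in t , i , trans e (1^ (p ℕ.^ (h ℕ.* N)))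
      ; *-closed = λ i j →
          let (x , _ , e) = ∈-map⁻ τ i ; (y , _ , e′) = ∈-map⁻ τ j ; (t , l , e″) = τ-rep∈ (x * y)
          in t , l , trans e″ (trans (τ-* x y) (*-cong (reflexive (≡.sym e)) (reflexive (≡.sym e′))))
      ; fermat = λ i → let (x , _ , e) = ∈-map⁻ τ i in ≡.subst (λ t → t ≈ 0# ⊎ t ^ Q ≈ 1#) (≡.sym e) (τ-fermat x)
      ; rotate = λ {u} i → let (x , _ , e) = ∈-map⁻ τ i in
          ≡.subst (λ u → u ^ Q ≈ 1# → ∃ λ ts′ → ts′ ↭ ts × Pointwise (λ t t′ → u * t ≈ t′) ts ts′) (≡.sym e) (τ-rotate x)
      ; decompose = λ x →
          let (z , e) = ≡-trans (rep≡ x) (≡-sym (τ-mod (rep x)))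
          in τ (rep x) , ∈-map⁺ τ (rep∈ x) , z , e
      }

open TeichmüllerRepresentatives

-- The quotient ring modulo p^N as a local ring.

module GaloisRings where

  open import Defs
  open import Data.Nat as ℕ using (ℕ; suc; NonZero)
  import Data.Nat.Properties as ℕ
  open import Data.Nat.Tactic.RingSolver using () renaming (solve-∀ to solveℕ-∀)
  open import Data.Nat.DivMod using (_/_; m<n⇒m%n≡m; m/n*n≡m)
  open import Data.Nat.Divisibility using (_∣_; m%n≡0⇒n∣m; m∣m*n)
  open import Data.Nat.Primality using (Prime; prime⇒nonZero)
  open import Data.Fin using (Fin; suc)
  open import Data.Vec as V using (Vec; lookup)
  import Data.Vec.Properties as V
  open import Data.Product using (_,_; proj₁; proj₂)
  open import Data.Sum using (_⊎_; inj₁; inj₂)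
  open import Relation.Nullary using (yes; no; Dec)
  open import Relation.Binary.PropositionalEquality as ≡ using (_≡_)

  module Congruence (M M′ : ℕ) (1≤M : 1 ℕ.≤ M) (1≤M′ : 1 ℕ.≤ M′) (M′∣M : M′ ∣ M) {k : ℕ} (g : Vec ℕ (suc k)) where
    private
      module R = QuotientRing M 1≤M g
      module R′ = QuotientRing M′ 1≤M′ g
      module RF = RingFacts R.commutativeRing
      module E = Elements M 1≤M g
      open R′ using (_≈ₘ_; eqₘ; symₘ; transₘ; +-congₘ; *-congₘ; ≡⇒≈ₘ)
      instance
        M′≢0 : NonZero M′
        M′≢0 = ℕ.>-nonZero 1≤M′
    open Reduce M M′ 1≤M 1≤M′ M′∣M g

    multiple-vanishes : ∀ y z → (y R.⊕ (RF.nat M′ R.⊗ z)) R′.≋ y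
    multiple-vanishes y z = R′.coords λ c → transₘ (reduceₘ (R.lookup-⊕ y _ c)) (transₘ (+-congₘ {lookup y c} (eqₘ ≡.refl)
      (transₘ (reduceₘ (E.lookup-nat* M′ z c)) (*-congₘ R′.M≈0 (eqₘ {lookup z c} ≡.refl)))) (≡⇒≈ₘ (ℕ.+-identityʳ _)))

    from-multiple : ∀ {x y} → x RF.≡ y mod M′ → x R′.≋ y
    from-multiple {x} {y} (z RF., e) = R′.≋-trans (reduce e) (multiple-vanishes y z)

    -- The witness is x - y divided by M′ coordinatewise. The negative of y is formed modulo M, and
    -- this is harmless because M′ divides M.
    to-multiple : ∀ {x y} → x R′.≋ y → x RF.≡ y mod M′
    to-multiple {x} {y} (R′.coords e) = z RF., R.≋-sym (R.coords λ c → begin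
        lookup (y R.⊕ (RF.nat M′ R.⊗ z)) c              ≈⟨ R.lookup-⊕ y (RF.nat M′ R.⊗ z) c ⟩
        lookup y c ℕ.+ lookup (RF.nat M′ R.⊗ z) c       ≈⟨ R.+-congₘ {lookup y c} (R.eqₘ ≡.refl) (E.lookup-nat* M′ z c) ⟩
        lookup y c ℕ.+ M′ ℕ.* lookup z c                ≡⟨ ≡.cong (lookup y c ℕ.+_) (quotient c) ⟩
        lookup y c ℕ.+ D c                              ≡⟨ lem (lookup y c) (lookup x c) (R.negₘ (lookup y c)) ⟩
        lookup x c ℕ.+ (R.negₘ (lookup y c) ℕ.+ lookup y c) ≈⟨ R.+-congₘ {lookup x c} (R.eqₘ ≡.refl) (R.neg-inverse (lookup y c)) ⟩
        lookup x c ℕ.+ 0                                ≡⟨ ℕ.+-identityʳ (lookup x c) ⟩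
        lookup x c                                      ∎)
      where
      lem : ∀ y x n → y ℕ.+ (x ℕ.+ n) ≡ x ℕ.+ (n ℕ.+ y)
      lem = solveℕ-∀
      D : Fin (suc k) → ℕ
      D c = lookup x c ℕ.+ R.negₘ (lookup y c)
      M′∣D : ∀ c → M′ ∣ D c
      M′∣D c = m%n≡0⇒n∣m (D c) M′ (≡.trans (R′.to% (transₘ (+-congₘ (e c) (eqₘ {R.negₘ (lookup y c)} ≡.refl))
        (transₘ (≡⇒≈ₘ (ℕ.+-comm (lookup y c) _)) (reduceₘ (R.neg-inverse (lookup y c)))))) (m<n⇒m%n≡m 1≤M′))
      z : Elt (suc k)
      z = V.tabulate (λ c → D c / M′)
      quotient : ∀ c → M′ ℕ.* lookup z c ≡ D c
      quotient c = ≡.trans (≡.cong (M′ ℕ.*_) (V.lookup∘tabulate (λ c → D c / M′) c)) (≡.trans (ℕ.*-comm M′ (D c / M′)) (m/n*n≡m (M′∣D c)))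
      open RingFacts.≈R R.ℤ/M

  module GaloisRing (p : ℕ) (prime : Prime p) {k : ℕ} (g : Vec ℕ (suc k)) (isField : Ring.IsField p g) (N : ℕ) (1≤N : 1 ℕ.≤ N)
    (Q′ : ℕ) (q≡ : p ℕ.^ suc k ≡ suc (suc Q′)) where

    1≤p : 1 ℕ.≤ p
    1≤p = ℕ.>-nonZero⁻¹ p {{prime⇒nonZero prime}}

    1≤p^ : ∀ n → 1 ℕ.≤ p ℕ.^ n
    1≤p^ n = ℕ.m^n>0 p {{prime⇒nonZero prime}} n

    p^-∣ : ∀ {a b} → a ℕ.≤ b → p ℕ.^ a ∣ p ℕ.^ b
    p^-∣ {a} {b} le = ≡.subst (p ℕ.^ a ∣_) (≡.trans (≡.sym (ℕ.^-distribˡ-+-* p a (b ℕ.∸ a))) (≡.cong (p ℕ.^_) (ℕ.m+[n∸m]≡n le))) (m∣m*n _)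

    p∣p^N : p ∣ p ℕ.^ N
    p∣p^N = ≡.subst (_∣ p ℕ.^ N) (ℕ.*-identityʳ p) (p^-∣ 1≤N)

    module R = QuotientRing (p ℕ.^ N) (1≤p^ N) g
    module RF = RingFacts R.commutativeRing
    private
      module R₁ = QuotientRing p 1≤p g
      module F = RingFacts R₁.commutativeRing
      module E = Elements (p ℕ.^ N) (1≤p^ N) g
      module E₁ = Elements p 1≤p g
      open Congruence (p ℕ.^ N) p (1≤p^ N) 1≤p p∣p^N g
      open Reduce (p ℕ.^ N) p (1≤p^ N) 1≤p p∣p^N g

    p^N≈0 : RF.nat (p ℕ.^ N) R.≋ R.zeroE
    p^N≈0 = R.≋-trans (R.≋-sym (RF.*-identityʳ (RF.nat (p ℕ.^ N)))) (R.coords λ c → R.transₘ (E.lookup-nat* (p ℕ.^ N) R.oneE c)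
      (R.transₘ (R.*-congₘ R.M≈0 (R.eqₘ {lookup R.oneE c} ≡.refl)) (R.symₘ (R.lookup-zeroE c))))

    private
      open RF.Nilpotent prime N p^N≈0 using (Unit-mod)

      -- If the residue of x is nonzero, `isField` provides an inverse modulo p; the product with x
      -- is congruent to 1 modulo p and hence a unit.
      unit-or-zero : ∀ x → x RF.≡ R.zeroE mod p ⊎ RF.Unit x
      unit-or-zero x = go (x E₁.≋? R₁.zeroE)
        where
        go : Dec (x R₁.≋ R₁.zeroE) → x RF.≡ R.zeroE mod p ⊎ RF.Unit x
        go (yes e) = inj₁ (to-multiple e)
        go (no ne) = inj₂ (b R.⊗ v , R.≋-trans (R.≋-sym (R.⊗-assoc x b v)) e′)
          where
          inverse = isField (R₁.norm x) (E₁.norm-canonical x) (λ e → ne (R₁.≋-trans (R₁.≋-sym (E₁.norm≋ x)) (R₁.coords λ c → R₁.≡⇒≈ₘ (≡.cong (λ v → lookup v c) e))))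
          b = proj₁ inverse
          xb≡1 : (x R.⊗ b) RF.≡ R.oneE mod p
          xb≡1 = to-multiple (R₁.≋-trans (⊗-reduce x b) (R₁.≋-trans (R₁.⊗-cong {x} {R₁.norm x} {b} {b} (R₁.≋-sym (E₁.norm≋ x)) (F.refl {b}))
            (R₁.≋-trans (R₁.coords λ c → R₁.≡⇒≈ₘ (≡.cong (λ v → lookup v c) (proj₂ inverse))) (R₁.≋-sym oneE-reduce))))
          unit = Unit-mod xb≡1 (R.oneE , RF.*-identityˡ R.oneE)
          v = proj₁ unit
          e′ = proj₂ unit

    localRing : LocalRing R.commutativeRing p (suc k) Q′ N
    localRing = record
      { prime = prime ; q≡ = q≡ ; p^N≈0 = p^N≈0
      ; xs = R₁.allElts
      ; unique = E₁.allVecs-unique (suc k)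
      ; size = E₁.allVecs-length (suc k)
      ; rep = R₁.norm
      ; rep∈ = λ x → E₁.∈-allElts (R₁.norm x) (E₁.norm-canonical x)
      ; rep≡ = λ x → to-multiple (R₁.≋-sym (E₁.norm≋ x))
      ; distinct = λ i j e → E₁.canonical-≡ (E₁.allVecs-canonical (suc k) i) (E₁.allVecs-canonical (suc k) j) (from-multiple e)
      ; field′ = unit-or-zero
      }

open GaloisRings

-- Transfer to the count of zeros modulo p^m.

module ZeroCounting where

  open import Defs
  open import Data.Nat as ℕ using (ℕ; zero; suc; s≤s; z≤n; NonZero)
  import Data.Nat.Properties as ℕ
  open import Data.Nat.DivMod using (_%_; m∣n⇒o%n%m≡o%m)
  open import Data.Nat.Divisibility using (_∣_; m%n≡0⇒n∣m; n∣m⇒m%n≡0; m∣m*n)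
  open import Data.Nat.Primality using (Prime)
  open import Data.Fin as Fin using (Fin; zero; suc)
  open import Data.List as L using (List; []; _∷_)
  import Data.List.Properties as L
  open import Data.List.Membership.Propositional using (_∈_)
  open import Data.List.Membership.Propositional.Properties using (∈-map⁺; ∈-map⁻; ∈-upTo⁻; ∈-filter⁺; ∈-filter⁻)
  open import Data.List.Relation.Unary.Any using (here; there)
  open import Data.List.Relation.Unary.All as All using (All; []; _∷_)
  open import Data.List.Relation.Unary.Unique.Propositional using (Unique)
  import Data.List.Relation.Unary.Unique.Propositional.Properties as Unique
  open import Data.List.Relation.Binary.Permutation.Propositional using (_↭_)
  open import Data.Vec as V using (Vec; []; _∷_; lookup)
  import Data.Vec.Properties as V
  open import Data.Product using (_×_; _,_; proj₁; proj₂)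
  open import Data.Sum using (_⊎_; inj₁; inj₂)
  open import Relation.Nullary using (yes; no; Dec)
  open import Relation.Binary.PropositionalEquality as ≡ using (_≡_; _≢_)

  module ZeroCount (p : ℕ) (prime : Prime p) {k : ℕ} (g : Vec ℕ (suc k)) (isField : Ring.IsField p g)
    (Q′ : ℕ) (q≡ : p ℕ.^ suc k ≡ suc (suc Q′)) (n μ d : ℕ) (1≤d : 1 ℕ.≤ d) (f : TPoly n (suc k))
    (teich : All (λ t → ∀ i → Setup.IsTeich p (suc k) (suc μ) g (p ℕ.^ suc k) (proj₂ t i)) f)
    (degrees : ∀ i → i ℕ.< suc μ → Setup.DegLe p (suc k) (suc μ) g f i (d ℕ.* p ℕ.^ (suc k ℕ.* divN i (suc k)))) where

    private
      -- The exponent to be reached is e. The count is taken in the ring modulo p^N: from e ≤ N,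
      -- divisibility by p^e there gives divisibility of the integer, and from m ≤ N the ring maps
      -- onto the one modulo p^m, in which V is defined.
      h q m e N : ℕ
      h = suc k
      q = p ℕ.^ h
      m = suc μ
      e = h ℕ.* bound p n m d
      N = m ℕ.+ e

      1≤N : 1 ℕ.≤ N
      1≤N = s≤s z≤n

      open GaloisRing p prime g isField N 1≤N Q′ q≡
      open TeichmüllerLift R.commutativeRing p h Q′ N localRing
      open LocalRing localRing using (xs; rep; rep∈; rep≡; distinct; unique)

      module Rm = QuotientRing (p ℕ.^ m) (1≤p^ m) g
      module Fm = RingFacts Rm.commutativeRing
      module Em = Elements (p ℕ.^ m) (1≤p^ m) g
      module EN = Elements (p ℕ.^ N) (1≤p^ N) g
      module S = Setup p h m g

      p^m∣p^N : p ℕ.^ m ∣ p ℕ.^ N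
      p^m∣p^N = p^-∣ (ℕ.m≤m+n m e)

      open Reduce (p ℕ.^ N) (p ℕ.^ m) (1≤p^ N) (1≤p^ m) p^m∣p^N g
      open Congruence (p ℕ.^ N) (p ℕ.^ m) (1≤p^ N) (1≤p^ m) p^m∣p^N g using (multiple-vanishes)

      module P₁ = Reduce (p ℕ.^ m) p (1≤p^ m) 1≤p (≡.subst (_∣ p ℕ.^ m) (ℕ.*-identityʳ p) (p^-∣ {1} {m} (s≤s z≤n))) g
      module CN₁ = Congruence (p ℕ.^ N) p (1≤p^ N) 1≤p p∣p^N g

      powE≡^ : ∀ x n → Rm.powE x n ≡ x Fm.^ n
      powE≡^ x zero    = ≡.refl
      powE≡^ x (suc n) = ≡.cong (x Rm.⊗_) (powE≡^ x n)

      sumE≡ΣL : ∀ ys → Rm.sumE ys ≡ Fm.ΣL ys (λ x → x)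
      sumE≡ΣL []       = ≡.refl
      sumE≡ΣL (y ∷ ys) = ≡.cong (y Rm.⊕_) (sumE≡ΣL ys)

      sumE-canonical : ∀ ys → Rm.Canonical (Rm.sumE ys)
      sumE-canonical []       = Em.zeroE-canonical
      sumE-canonical (y ∷ ys) = Em.norm-canonical (V.zipWith ℕ._+_ y (Rm.sumE ys))

      powE-canonical : ∀ x {n} → 1 ℕ.≤ n → Rm.Canonical (Rm.powE x n)
      powE-canonical x {suc n} _ = sumE-canonical (L.concatMap (λ i → L.map (λ j →
        Rm.scale (lookup x i ℕ.* lookup (Rm.powE x n) j) (Rm.tpow (Fin.toℕ i ℕ.+ Fin.toℕ j))) (L.allFin h)) (L.allFin h))

      ≡⇒≋ : ∀ {a b} → a ≡ b → a Rm.≋ b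
      ≡⇒≋ ≡.refl = Fm.refl

      fixed^ : ∀ a → (a Fm.^ q) Rm.≋ a → ∀ i → (a Fm.^ (p ℕ.^ (h ℕ.* i))) Rm.≋ a
      fixed^ a fix zero    = Rm.≋-trans (Fm.^-congʳ a (≡.cong (p ℕ.^_) (ℕ.*-zeroʳ h))) (Fm.*-identityʳ a)
      fixed^ a fix (suc i) = Rm.≋-trans (Fm.^-congʳ a (≡.trans (≡.cong (p ℕ.^_) (ℕ.*-suc h i)) (ℕ.^-distribˡ-+-* p h (h ℕ.* i))))
        (Rm.≋-trans (Rm.≋-sym (Fm.^-assocʳ a q (p ℕ.^ (h ℕ.* i)))) (Rm.≋-trans (Fm.^-congˡ (p ℕ.^ (h ℕ.* i)) fix) (fixed^ a fix i)))

      -- Being fixed by the q-th power, a equals a^(q^N), which is the reduction of τ at its own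
      -- residue class.
      τ-lifts : ∀ {a} → S.IsTeich q a → τ (rep a) Rm.≋ a
      τ-lifts {a} (_ , fix) = Rm.≋-trans (reduce (τ-cong (RF.≡-sym (rep≡ a)))) (Rm.≋-trans (^-reduce a (p ℕ.^ (h ℕ.* N)))
        (fixed^ a (≡⇒≋ (≡.trans (≡.sym (powE≡^ a q)) fix)) N))

      τ̄ : Elt h → Elt h
      τ̄ c = Rm.norm (τ c)

      τ̄≋τ : ∀ c → τ̄ c Rm.≋ τ c
      τ̄≋τ c = Em.norm≋ (τ c)

      τ̄-teich : ∀ c → S.IsTeich q (τ̄ c)
      τ̄-teich c = Em.norm-canonical (τ c) , Em.canonical-≡ (powE-canonical (τ̄ c) (1≤p^ h)) (Em.norm-canonical (τ c))
        (Rm.≋-trans (≡⇒≋ (powE≡^ (τ̄ c) q)) (Rm.≋-trans (Fm.^-congˡ q (τ̄≋τ c)) (Rm.≋-trans (Rm.≋-sym (^-reduce (τ c) q))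
          (Rm.≋-trans (reduce (τ-q c)) (Rm.≋-sym (τ̄≋τ c))))))

      -- Solutions of x^q = x modulo p^m are matched with reductions of the lifts made modulo p^N.
      -- Distinct classes stay distinct because reduction down to p recovers them.
      teichList↭ : S.teichList q ↭ L.map τ̄ xs
      teichList↭ = Lists.unique-↭ (S.teichList q) (L.map τ̄ xs)
        (Unique.filter⁺ (λ x → V.≡-dec ℕ._≟_ (S.powE x q) x) (Em.allVecs-unique h))
        (Lists.Unique-map τ̄ xs injective unique)
        (λ {z} i → let (j , fix) = ∈-filter⁻ (λ x → V.≡-dec ℕ._≟_ (S.powE x q) x) {xs = S.allElts} i
                       t = Em.allVecs-canonical h j , fix
                   in ≡.subst (_∈ L.map τ̄ xs) (Em.canonical-≡ (Em.norm-canonical (τ (rep z))) (proj₁ t) (Rm.≋-trans (τ̄≋τ (rep z)) (τ-lifts t)))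
                        (∈-map⁺ τ̄ (rep∈ z)))
        (λ {z} i → let (c , _ , eq) = ∈-map⁻ τ̄ i in ≡.subst (_∈ S.teichList q) (≡.sym eq)
          (∈-filter⁺ (λ x → V.≡-dec ℕ._≟_ (S.powE x q) x) (Em.∈-allElts (τ̄ c) (proj₁ (τ̄-teich c))) (proj₂ (τ̄-teich c))))
        where
        injective : ∀ {x y} → x ∈ xs → y ∈ xs → τ̄ x ≡ τ̄ y → x ≡ y
        injective {x} {y} i j eq = distinct i j (RF.≡-trans (RF.≡-sym (τ-mod x)) (RF.≡-trans (CN₁.to-multiple (P₁.reduce
          (Rm.≋-trans (Rm.≋-sym (τ̄≋τ x)) (Rm.≋-trans (≡⇒≋ eq) (τ̄≋τ y))))) (τ-mod y)))

      system : TeichmüllerSystem R.commutativeRing p h Q′ N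
      system = teichmüllerSystem

      groupAlgebra : GroupAlgebra R.commutativeRing (RF.nat (p ℕ.^ m))
      groupAlgebra = GroupAlgebraConstruction.groupAlgebra R.commutativeRing (RF.nat (p ℕ.^ m))

      open BoxSums R.commutativeRing p h Q′ N system μ groupAlgebra d 1≤d

      -- A digit known modulo p^m is replaced by the Teichmüller element modulo p^N of the same
      -- class. The values of f change only by multiples of p^m, and all digits become members of
      -- the lifted set.
      digitTerm : Vec ℕ n × (ℕ → Elt h) → ℕ → PolyTerm n
      digitTerm (e , a) i = polyTerm i (τ (rep (a i))) e

      terms : List (PolyTerm n)
      terms = L.concatMap (λ t → L.map (digitTerm t) (L.upTo m)) f

      terms-bounded : All Bounded terms
      terms-bounded = All.tabulate λ {ϑ} i →
        let (t , j , l) = Em.∈-concatMap-elim (λ t → L.map (digitTerm t) (L.upTo m)) f i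
            (r , s , eq) = ∈-map⁻ (digitTerm t) l
        in ≡.subst Bounded (≡.sym eq) (ℕ.s≤s⁻¹ (∈-upTo⁻ s) , ∈-map⁺ τ (rep∈ (proj₂ t r)) , small t r (V.≡-dec ℕ._≟_ (proj₂ t r) S.zeroE) (All.lookup (degrees r (∈-upTo⁻ s)) j))
        where
        small : ∀ t r → Dec (proj₂ t r ≡ S.zeroE) → (proj₂ t r ≢ S.zeroE → V.sum (proj₁ t) ℕ.≤ d ℕ.* p ℕ.^ (h ℕ.* divN r h)) →
          (τ (rep (proj₂ t r)) R.≋ R.zeroE) ⊎ V.sum (proj₁ t) ℕ.≤ d ℕ.* p ℕ.^ (h ℕ.* divN r h)
        small t r (no ne) deg = inj₂ (deg ne)
        small t r (yes eq) _  = inj₁ (R.≋-trans (τ-cong (RF.≡-sym (rep≡ (proj₂ t r)))) (R.≋-trans (RF.reflexive (≡.cong τ eq)) τ-0))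

      Σ-reduce : ∀ {A : Set} (ys : List A) {F F′} → (∀ {y} → y ∈ ys → F y Rm.≋ F′ y) → RF.ΣL ys F Rm.≋ Fm.ΣL ys F′
      Σ-reduce []       eq = Fm.refl
      Σ-reduce (y ∷ ys) {F} {F′} eq = Rm.≋-trans (⊕-reduce (F y) (RF.ΣL ys F)) (Rm.⊕-cong (eq (here ≡.refl)) (Σ-reduce ys (λ i → eq (there i))))

      monomial≋ : ∀ {n} (e : Vec ℕ n) (X : Vec (Elt h) n) → S.monomial e (V.map τ̄ X) Rm.≋ (V.map τ X RF.^^ e)
      monomial≋ []      []      = Rm.≋-sym oneE-reduce
      monomial≋ (l ∷ e) (x ∷ X) = Rm.≋-trans (Rm.⊗-cong (Rm.≋-trans (≡⇒≋ (powE≡^ (τ̄ x) l)) (Rm.≋-trans (Fm.^-congˡ l (τ̄≋τ x)) (Rm.≋-sym (^-reduce (τ x) l)))) (monomial≋ e X))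
        (Rm.≋-sym (⊗-reduce (τ x RF.^ l) (V.map τ X RF.^^ e)))

      scale≋ : ∀ c v → Rm.scale c v Rm.≋ (Fm.nat c Rm.⊗ v)
      scale≋ c v = Rm.coords λ i → Rm.transₘ (Rm.lookup-scale c v i) (Rm.symₘ (Em.lookup-nat* c v i))

      sumE-map : ∀ {A : Set} (F : A → Elt h) ys → Rm.sumE (L.map F ys) Rm.≋ Fm.ΣL ys F
      sumE-map F ys = Rm.≋-trans (≡⇒≋ (sumE≡ΣL (L.map F ys))) (Fm.Σ-map F ys (λ x → x))

      digits≋ : ∀ e a (X : Vec (Elt h) n) → (∀ i → S.IsTeich q (a i)) →
        (S.coeffMod a Rm.⊗ S.monomial e (V.map τ̄ X)) Rm.≋ RF.ΣL (L.upTo m) (λ i → evalTerm (digitTerm (e , a) i) (V.map τ X))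
      digits≋ e a X ta = Rm.≋-trans (Rm.⊗-cong (Rm.≋-trans (sumE-map (λ i → Rm.scale (p ℕ.^ i) (a i)) (L.upTo m)) (Fm.Σ-cong (L.upTo m) (λ i → scale≋ (p ℕ.^ i) (a i)))) (Fm.refl {y}))
        (Rm.≋-trans (Rm.≋-sym (Fm.Σ-*ʳ (L.upTo m) y (λ i → Fm.nat (p ℕ.^ i) Rm.⊗ a i)))
          (Rm.≋-sym (Σ-reduce (L.upTo m) (λ {i} _ → Rm.≋-trans (⊗-reduce (RF.nat (p ℕ.^ i)) (τ (rep (a i)) R.⊗ Y)) (Rm.≋-trans
            (Rm.⊗-cong (nat-reduce (p ℕ.^ i)) (Rm.≋-trans (⊗-reduce (τ (rep (a i))) Y) (Rm.⊗-cong (τ-lifts (ta i)) (Rm.≋-sym (monomial≋ e X)))))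
            (Rm.≋-sym (Rm.⊗-assoc (Fm.nat (p ℕ.^ i)) (a i) y)))))))
        where
        y = S.monomial e (V.map τ̄ X)
        Y = V.map τ X RF.^^ e

      eval≋ : ∀ X → S.evalMod f (V.map τ̄ X) Rm.≋ evalPoly terms (V.map τ X)
      eval≋ X = Rm.≋-trans (sumE-map (λ t → S.coeffMod (proj₂ t) Rm.⊗ S.monomial (proj₁ t) (V.map τ̄ X)) f)
        (Rm.≋-sym (Rm.≋-trans (reduce (R.≋-trans (RF.Σ-concatMap (λ t → L.map (digitTerm t) (L.upTo m)) f at-X)
            (RF.Σ-cong f (λ t → RF.Σ-map (digitTerm t) (L.upTo m) at-X))))
          (Σ-reduce f (λ {t} i → Rm.≋-sym (digits≋ (proj₁ t) (proj₂ t) X (All.lookup teich i))))))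
        where
        at-X : PolyTerm n → Elt h
        at-X ϑ = evalTerm ϑ (V.map τ X)

      φ : Elt h → Elt h
      φ x = RF.indicator (x Em.≋? Rm.zeroE)

      isZero? : ∀ X → Dec (S.evalMod f X ≡ S.zeroE)
      isZero? X = V.≡-dec ℕ._≟_ (S.evalMod f X) S.zeroE

      box-sum : ∀ n (H : Vec (Elt h) n → Elt h) → RF.ΣL (S.box q n) H R.≋ RF.ΣBox (S.teichList q) n H
      box-sum zero    H = RF.+-identityʳ (H [])
      box-sum (suc n) H = R.≋-trans (RF.Σ-concatMap (λ x → L.map (x ∷_) (S.box q n)) (S.teichList q) H)
        (RF.Σ-cong (S.teichList q) (λ x → R.≋-trans (RF.Σ-map (x ∷_) (S.box q n) H) (box-sum n (λ X → H (x ∷ X)))))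

      count≋ : RF.nat (S.countV f) R.≋ RF.ΣBox (TeichmüllerSystem.ts system) n (λ X → φ (evalPoly terms X))
      count≋ = R.≋-trans (RF.count-filter isZero? (S.box q n)) (R.≋-trans (box-sum n H) (R.≋-trans (RF.ΣBox-↭ n H teichList↭) (R.≋-trans (RF.ΣBox-map τ̄ xs n H)
        (R.≋-trans (RF.ΣBox-cong xs n (λ X _ → RF.indicator-cong (isZero? (V.map τ̄ X)) (evalPoly terms (V.map τ X) Em.≋? Rm.zeroE)
            (λ z → Rm.≋-trans (Rm.≋-sym (eval≋ X)) (≡⇒≋ z))
            (λ z → Em.canonical-≡ (sumE-canonical (L.map (λ t → S.coeffMod (proj₂ t) Rm.⊗ S.monomial (proj₁ t) (V.map τ̄ X)) f)) Em.zeroE-canonical (Rm.≋-trans (eval≋ X) z))))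
          (R.≋-sym (RF.ΣBox-map τ xs n (λ X → φ (evalPoly terms X))))))))
        where
        H : Vec (Elt h) n → Elt h
        H X = RF.indicator (isZero? X)

      divisible : RF.nat (p ℕ.^ e) RF.∣ᵣ RF.ΣBox (TeichmüllerSystem.ts system) n (λ X → φ (evalPoly terms X))
      divisible = box-count terms terms-bounded φ
        (λ {x} {y} x≋y → RF.indicator-cong (x Em.≋? Rm.zeroE) (y Em.≋? Rm.zeroE) (Rm.≋-trans (Rm.≋-sym (reduce x≋y))) (Rm.≋-trans (reduce x≋y)))
        (λ x y → RF.indicator-cong ((x R.⊕ (RF.nat (p ℕ.^ m) R.⊗ y)) Em.≋? Rm.zeroE) (x Em.≋? Rm.zeroE)
          (Rm.≋-trans (Rm.≋-sym (multiple-vanishes x y))) (Rm.≋-trans (multiple-vanishes x y)))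

      -- The constant coordinate recovers an integer modulo p^N from its image in the ring.
      lookup-nat : ∀ c → lookup (RF.nat c) zero R.≈ₘ c
      lookup-nat c = R.transₘ (R.symₘ (R.at (RF.*-identityʳ (RF.nat c)) zero)) (R.transₘ (EN.lookup-nat* c R.oneE zero)
        (R.transₘ (R.*-congₘ {c} (R.eqₘ ≡.refl) (R.modN≈ 1)) (R.≡⇒≈ₘ (ℕ.*-identityʳ c))))

    p^e∣count : p ℕ.^ e ∣ S.countV f
    p^e∣count = m%n≡0⇒n∣m _ _ (begin
      S.countV f % p ℕ.^ e                        ≡⟨ m∣n⇒o%n%m≡o%m (p ℕ.^ e) (p ℕ.^ N) _ (p^-∣ {e} {N} (ℕ.m≤n+m e m)) ⟨
      S.countV f % p ℕ.^ N % p ℕ.^ e              ≡⟨ ≡.cong (_% p ℕ.^ e) (R.to% congruent) ⟩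
      (p ℕ.^ e ℕ.* lookup z zero) % p ℕ.^ N % p ℕ.^ e ≡⟨ m∣n⇒o%n%m≡o%m (p ℕ.^ e) (p ℕ.^ N) _ (p^-∣ {e} {N} (ℕ.m≤n+m e m)) ⟩
      (p ℕ.^ e ℕ.* lookup z zero) % p ℕ.^ e       ≡⟨ n∣m⇒m%n≡0 _ _ (m∣m*n (lookup z zero)) ⟩
      0                                           ∎)
      where
      open ≡.≡-Reasoning
      nz : ∀ i → NonZero (p ℕ.^ i)
      nz i = ℕ.>-nonZero (1≤p^ i)
      instance
        nz-e : NonZero (p ℕ.^ e)
        nz-e = nz e
        nz-N : NonZero (p ℕ.^ N)
        nz-N = nz N
      z = proj₁ divisible
      congruent : S.countV f R.≈ₘ p ℕ.^ e ℕ.* lookup z zero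
      congruent = R.transₘ (R.symₘ (lookup-nat (S.countV f))) (R.transₘ (R.at (R.≋-trans count≋ (proj₂ divisible)) zero) (EN.lookup-nat* (p ℕ.^ e) z zero))

open ZeroCounting

open import Defs
open import Data.Nat using (ℕ; _≤_; _<_; _*_; _^_)
open import Data.Nat.Divisibility using (_∣_)
open import Data.Nat.Primality using (Prime)
open import Data.Vec using (Vec)
open import Data.Nat using (suc; _∸_; >-nonZero; nonTrivial⇒n>1)
open import Data.Nat.Primality using (prime⇒nonTrivial)
import Data.Nat.Properties as ℕ
open import Data.Product using (_,_)
open import Relation.Binary.PropositionalEquality as ≡ using (_≡_)

theorem3p1 : (p h : ℕ) → Prime p → 1 ≤ h →
    (g : Vec ℕ h) → FieldModulus p g →
    (n m d : ℕ) → 1 ≤ n → 1 ≤ m → 1 ≤ d →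
    (f : TPoly n h) →
    Setup.WellFormed p h m g f →
    Setup.NonZeroPoly p h m g f →
    (∀ i → i < m → Setup.DegLe p h m g f i (d * p ^ (h * divN i h))) →
    (p ^ h) ^ bound p n m d ∣ Setup.countV p h m g f
theorem3p1 p (suc k) p-prime _ g isField n (suc μ) d _ _ 1≤d f (_ , teich) _ degrees =
  ≡.subst (_∣ Setup.countV p (suc k) (suc μ) g f) (≡.sym (ℕ.^-*-assoc p (suc k) (bound p n (suc μ) d)))
    -- The argument p^h ∸ 2 is Q′, so that Q = suc Q′ is q - 1 and visibly positive; q ≥ 2 makes the
    -- subtraction exact.
    (ZeroCount.p^e∣count p p-prime g isField (p ^ suc k ∸ 2) (≡.sym (ℕ.m+[n∸m]≡n 2≤q)) n μ d 1≤d f teich degrees)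
  where
  2≤p : 2 ≤ p
  2≤p = nonTrivial⇒n>1 p {{prime⇒nonTrivial p-prime}}
  2≤q : 2 ≤ p ^ suc k
  2≤q = ℕ.≤-trans 2≤p (ℕ.m≤m*n p (p ^ k) {{>-nonZero (ℕ.m^n>0 p {{>-nonZero (ℕ.<⇒≤ 2≤p)}} k)}})
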